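{- Given a graph $G$ and an obstacle enumeration $\mathcal Q$ in $G$, it is possible to find in linear time either an essential obstacle enumeration of some induced subgraph of $G$ or an induced subgraph of $G$ isomorphic to $C_4^*$, $K_{2,3}$, domino, $G_3$, $\overline{C_6}$, or $\overline{C_5+K_2}$. Moreover, if $G$ is a circular-arc graph, then given a circular-arc model of $G$ and an obstacle enumeration $\mathcal Q$ in $G$, an essential obstacle enumeration of some induced subgraph of $G$ can be found in $O(n)$ time.
   Context: All graphs are finite, undirected, without loops or multiple edges. A circular-arc graph is the intersection graph of a finite set of arcs on a circle (such a set is a circular-arc model of the graph). $n$ and $m$ are the numbers of vertices and edges of $G$; an algorithm taking a graph as input is linear-time if it runs in $O(n+m)$ time. When the input is a circular-arc model, $n$ is the number of arcs, and the $2n$ extremes of the arcs are assumed pairwise different and given in the order in which they occur in some traversal of the circle. $\overline N_G(v)$ denotes the set of vertices of $G$ different from $v$ and nonadjacent to $v$. An obstacle enumeration in a graph $G$ is a circular enumeration $\mathcal Q=v_1,\ldots,v_k$ of $k\ge 3$ pairwise different vertices such that $Q=\{v_1,\ldots,v_k\}$ is a clique of $G$, together with, for each $i\in\{1,\ldots,k\}$, a linear enumeration $\mathcal W_i$ (the witness enumeration of $v_iv_{i+1}$) of one or two vertices of $G$ such that (indices modulo $k$) either $(\mathcal O_1)$ $\mathcal W_i=w_i$ where $\overline N_G(w_i)\cap Q=\{v_i,v_{i+1}\}$; or $(\mathcal O_2)$ $\mathcal W_i=u_i,z_i$ where $\overline N_G(u_i)\cap Q=\{v_i\}$, $\overline N_G(z_i)\cap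 Q=\{v_{i+1}\}$, and $u_iz_i\in E(G)$. Witness enumerations of different edges may share vertices. The vertices occurring in $\mathcal W_1,\ldots,\mathcal W_k$ are the witnesses of $\mathcal Q$. $\mathcal Q$ is an obstacle enumeration of $G$ if every vertex of $G$ belongs to $Q$ or is a witness of $\mathcal Q$. An edge $y_1y_2$ of $G$ joining two witnesses is valid if either one of $\overline N_G(y_1)\cap Q$ and $\overline N_G(y_2)\cap Q$ is a subset of the other, or $y_1$ and $y_2$ occur together in some witness enumeration of $\mathcal Q$. An obstacle enumeration is essential if every edge joining two of its witnesses is valid. $H^*$ denotes the disjoint union $H+K_1$; $+$ is disjoint union; $\overline H$ is the complement of $H$. The domino is the graph on $a_1,a_2,b_1,b_2,c_1,c_2$ with edges exactly $a_1a_2,b_1b_2,c_1c_2,a_1b_1,a_2b_2,b_1c_1,b_2c_2$. $G_3$ is the graph obtained from the domino by adding the edge $a_1c_1$ (equivalently, $\overline{C_6}$ minus one edge of one of its triangles). -}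

module Defs where

open import Data.Bool.Base using (Bool; true; false; if_then_else_; _∧_)
open import Data.Fin.Base using (Fin; toℕ; splitAt; _↑ˡ_; _↑ʳ_; _<_; _≤_)
open import Data.Fin.Patterns using (0F; 1F; 2F; 3F; 4F; 5F)
open import Data.Fin.Properties using (_≟_; _<?_)
open import Data.List.Base as List
  using (List; []; _∷_; map; concat; length; filter; tabulate; allFin; cartesianProduct)
open import Data.List.Membership.Propositional using (_∈_)
import Data.List.Membership.DecPropositional as DecMembership
open import Data.List.Relation.Unary.Unique.Propositional using (Unique)
open import Data.Nat.Base as ℕ using (ℕ; zero; suc; _+_; _*_; _∸_; _≡ᵇ_; _<ᵇ_)
open import Data.Nat.DivMod using (_mod_)
open import Data.Product.Base using (Σ; ∃₂; ∃-syntax; _×_; _,_; proj₁; proj₂)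
open import Data.Product.Properties using (≡-dec)
open import Data.Sum.Base as Sum using (_⊎_)
open import Data.Sum.Relation.Binary.Pointwise as Pointwise using (Pointwise)
open import Function.Base using (_∘_; _on_)
open import Function.Bundles using (_⇔_; _↔_; _↣_; Inverse; Injection)
open import Function.Definitions using (Injective)
open import Level using (0ℓ)
open import Relation.Binary.Core using (Rel)
open import Relation.Binary.Definitions using (Symmetric; Irreflexive; Decidable)
open import Relation.Binary.PropositionalEquality using (_≡_; _≢_; refl; sym; ≢-sym)
open import Relation.Nullary.Decidable using (_×-dec_; _⊎-dec_; ¬?)
open import Relation.Nullary.Negation using (¬_)
open import Relation.Unary using (Pred; _∩_; _∪_; _⊆_; _≐_; ｛_｝)

private variable
  n h : ℕ

record Graph (n : ℕ) : Set₁ where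
  field
    Adj    : Rel (Fin n) 0ℓ
    adj?   : Decidable Adj
    symm   : Symmetric Adj
    irrefl : Irreflexive _≡_ Adj

open Graph public

edges : Graph n → List (Fin n × Fin n)
edges {n} G = filter (λ (u , v) → u <? v ×-dec adj? G u v)
                     (cartesianProduct (allFin n) (allFin n))

∣E_∣ : Graph n → ℕ
∣E G ∣ = length (edges G)

complement : Graph n → Graph n
complement G = record
  { Adj    = λ u v → u ≢ v × ¬ Adj G u v
  ; adj?   = λ u v → ¬? (u ≟ v) ×-dec ¬? (adj? G u v)
  ; symm   = λ (u≢v , ¬uv) → ≢-sym u≢v , (¬uv ∘ symm G)
  ; irrefl = λ u≡v (u≢v , _) → u≢v u≡v
  }

infixr 6 _+ᵍ_

_+ᵍ_ : ∀ {m n} → Graph m → Graph n → Graph (m + n)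
_+ᵍ_ {m} G H = record
  { Adj    = λ u v → Pointwise (Adj G) (Adj H) (splitAt m u) (splitAt m v)
  ; adj?   = λ u v → Pointwise.⊎-decidable (adj? G) (adj? H) (splitAt m u) (splitAt m v)
  ; symm   = Pointwise.⊎-symmetric (symm G) (symm H)
  ; irrefl = λ { {u} refl → Pointwise.⊎-irreflexive (irrefl G) (irrefl H)
                              (Pointwise.⊎-refl {R = _≡_} {S = _≡_} refl refl {splitAt m u}) }
  }

fromEdges : List (Fin n × Fin n) → Graph n
fromEdges {n} es = record
  { Adj    = λ u v → u ≢ v × ((u , v) ∈ es ⊎ (v , u) ∈ es)
  ; adj?   = λ u v → ¬? (u ≟ v) ×-dec (((u , v) ∈? es) ⊎-dec ((v , u) ∈? es))
  ; symm   = λ (u≢v , e) → ≢-sym u≢v , Sum.swap e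
  ; irrefl = λ u≡v (u≢v , _) → u≢v u≡v
  }
  where open DecMembership (≡-dec (_≟_ {n}) (_≟_ {n})) using (_∈?_)

-- Induced subgraphs are given by an injective listing of their vertices.

induced : (G : Graph n) → Fin h ↣ Fin n → Graph h
induced G S = record
  { Adj    = Adj G on to
  ; adj?   = λ u v → adj? G (to u) (to v)
  ; symm   = symm G
  ; irrefl = λ { refl → irrefl G refl }
  }
  where open Injection S using (to)

infix 4 _≅_

_≅_ : ∀ {m n} → Graph m → Graph n → Set
_≅_ {m} {n} G H = Σ (Fin m ↔ Fin n) λ f →
  ∀ u v → Adj G u v ⇔ Adj H (Inverse.to f u) (Inverse.to f v)

N̄ : Graph n → Fin n → Pred (Fin n) 0ℓ
N̄ G v = λ u → u ≢ v × ¬ Adj G v u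

next : ∀ {k} → Fin k → Fin k
next {suc k} i = suc (toℕ i) mod suc k

K : ∀ n → Graph n
K n = record
  { Adj    = _≢_
  ; adj?   = λ u v → ¬? (u ≟ v)
  ; symm   = ≢-sym
  ; irrefl = λ u≡v u≢v → u≢v u≡v
  }

-- The cycle on n vertices for n ≥ 3.
C : ∀ n → Graph n
C n = fromEdges (tabulate λ i → i , next i)

K⟨_,_⟩ : ∀ a b → Graph (a + b)
K⟨ a , b ⟩ = fromEdges (cartesianProduct (map (_↑ˡ b) (allFin a)) (map (a ↑ʳ_) (allFin b)))

infix 8 _*ᵍ

_*ᵍ : Graph n → Graph (n + 1)
H *ᵍ = H +ᵍ K 1

-- a₁, a₂, b₁, b₂, c₁, c₂ are the vertices 0, …, 5 in this order.
dominoEdges : List (Fin 6 × Fin 6)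
dominoEdges = (0F , 1F) ∷ (2F , 3F) ∷ (4F , 5F)
            ∷ (0F , 2F) ∷ (1F , 3F) ∷ (2F , 4F) ∷ (3F , 5F) ∷ []

domino G₃ : Graph 6
domino = fromEdges dominoEdges
G₃     = fromEdges ((0F , 4F) ∷ dominoEdges)

data WitnessEnum (V : Set) : Set where
  one : (w : V)   → WitnessEnum V
  two : (u z : V) → WitnessEnum V

first second : ∀ {V} → WitnessEnum V → V
first  (one w)   = w
first  (two u z) = u
second (one w)   = w
second (two u z) = z

size : ∀ {V} → WitnessEnum V → ℕ
size (one _)   = 1
size (two _ _) = 2

infix 4 _∈ᵂ_

_∈ᵂ_ : ∀ {V} → V → WitnessEnum V → Set
y ∈ᵂ one w   = y ≡ w
y ∈ᵂ two u z = y ≡ u ⊎ y ≡ z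

-- A circular enumeration is represented by any of its linear cuts.
record Enumeration (V : Set) : Set where
  field
    k       : ℕ
    vertex  : Fin k → V
    witness : Fin k → WitnessEnum V

  Q : Pred V 0ℓ
  Q x = ∃[ i ] x ≡ vertex i

  Witness : Pred V 0ℓ
  Witness y = ∃[ i ] y ∈ᵂ witness i

mapᵂ : ∀ {V V′} → (V → V′) → WitnessEnum V → WitnessEnum V′
mapᵂ f (one w)   = one (f w)
mapᵂ f (two u z) = two (f u) (f z)

mapᴱ : ∀ {V V′} → (V → V′) → Enumeration V → Enumeration V′
mapᴱ f 𝒬 = record { k = k ; vertex = f ∘ vertex ; witness = mapᵂ f ∘ witness }
  where open Enumeration 𝒬

module _ (G : Graph n) where

  IsWitnessEnum : Pred (Fin n) 0ℓ → (x y : Fin n) → WitnessEnum (Fin n) → Set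
  IsWitnessEnum Q x y (one w)   = N̄ G w ∩ Q ≐ ｛ x ｝ ∪ ｛ y ｝
  IsWitnessEnum Q x y (two u z) = (N̄ G u ∩ Q ≐ ｛ x ｝) × (N̄ G z ∩ Q ≐ ｛ y ｝) × Adj G u z

  module _ (𝒬 : Enumeration (Fin n)) where
    open Enumeration 𝒬

    record IsObstacleEnumIn : Set where
      field
        k≥3      : 3 ℕ.≤ k
        distinct : Injective _≡_ _≡_ vertex
        clique   : ∀ {x y} → Q x → Q y → x ≢ y → Adj G x y
        witnesses : ∀ i → IsWitnessEnum Q (vertex i) (vertex (next i)) (witness i)

    record IsObstacleEnumOf : Set where
      field
        obstacleIn : IsObstacleEnumIn
        spanning   : ∀ x → Q x ⊎ Witness x

    Valid : Rel (Fin n) 0ℓ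
    Valid y₁ y₂ = (N̄ G y₁ ∩ Q ⊆ N̄ G y₂ ∩ Q)
                ⊎ (N̄ G y₂ ∩ Q ⊆ N̄ G y₁ ∩ Q)
                ⊎ (∃[ i ] y₁ ∈ᵂ witness i × y₂ ∈ᵂ witness i)

    record IsEssentialObstacleEnumOf : Set where
      field
        obstacleOf : IsObstacleEnumOf
        essential  : ∀ {y₁ y₂} → Witness y₁ → Witness y₂ → Adj G y₁ y₂ → Valid y₁ y₂

data Side : Set where
  start end : Side

-- Only the cyclic order of the 2n pairwise different extremes matters, so the
-- circle is taken to be the cyclically ordered set Fin (2 * n) of their
-- positions: two arcs of a circle with pairwise different extremes intersect
-- if and only if some extreme lies in both (closed) arcs.  The arc v runs from
-- its start to its end in the direction of the traversal.
record ArcModel (n : ℕ) : Set where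
  field
    extreme : Fin (2 * n) ↔ (Fin n × Side)

  position : Fin n → Side → Fin (2 * n)
  position v σ = Inverse.from extreme (v , σ)

  Arc : Fin n → Pred (Fin (2 * n)) 0ℓ
  Arc v p = (s < e × (s ≤ p × p ≤ e)) ⊎ (e < s × (s ≤ p ⊎ p ≤ e))
    where
    s = position v start
    e = position v end

  Intersect : Rel (Fin n) 0ℓ
  Intersect u v = ∃[ p ] Arc u p × Arc v p

_IsModelOf_ : ArcModel n → Graph n → Set
M IsModelOf G = ∀ u v → Adj G u v ⇔ (u ≢ v × ArcModel.Intersect M u v)

-- Memory consists of arrays of words.  Array names are fixed in the program
-- text, hence a program uses a constant number of arrays.
Memory : Set
Memory = ℕ → ℕ → ℕ

data Expr : Set where
  lit     : ℕ → Expr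
  _[_]    : (array : ℕ) (index : Expr) → Expr
  _⊕_ _⊖_ : Expr → Expr → Expr

data Test : Set where
  _≺_ _≈_ : Expr → Expr → Test

data Program : Set where
  skip   : Program
  _[_]≔_ : (array : ℕ) (index value : Expr) → Program
  _⨾_    : Program → Program → Program
  cond   : Test → Program → Program → Program
  while  : Test → Program → Program

⟦_⟧ : Expr → Memory → ℕ
⟦ lit x ⟧   μ = x
⟦ a [ e ] ⟧ μ = μ a (⟦ e ⟧ μ)
⟦ d ⊕ e ⟧   μ = ⟦ d ⟧ μ + ⟦ e ⟧ μ
⟦ d ⊖ e ⟧   μ = ⟦ d ⟧ μ ∸ ⟦ e ⟧ μ

⟦_⟧ᵀ : Test → Memory → Bool
⟦ d ≺ e ⟧ᵀ μ = ⟦ d ⟧ μ <ᵇ ⟦ e ⟧ μ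
⟦ d ≈ e ⟧ᵀ μ = ⟦ d ⟧ μ ≡ᵇ ⟦ e ⟧ μ

_[_,_↦_] : Memory → ℕ → ℕ → ℕ → Memory
(μ [ a , i ↦ x ]) b j = if (a ≡ᵇ b) ∧ (i ≡ᵇ j) then x else μ b j

-- Run W p μ t μ′: started in μ, the program p halts in μ′ after t steps, with
-- all stored words and their addresses bounded by W.  Every assignment and
-- every test costs one step; the expressions in a program have constant size,
-- so this is the usual unit cost up to a factor depending on p only.  The
-- bound W prevents the packing of much data into a single huge number.
data Run (W : ℕ) : Program → Memory → ℕ → Memory → Set where
  skip    : ∀ {μ} → Run W skip μ 0 μ
  assign  : ∀ {a d e μ} → ⟦ d ⟧ μ ℕ.≤ W → ⟦ e ⟧ μ ℕ.≤ W →
            Run W (a [ d ]≔ e) μ 1 (μ [ a , ⟦ d ⟧ μ ↦ ⟦ e ⟧ μ ])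
  seq     : ∀ {p q μ μ′ μ″ s t} → Run W p μ s μ′ → Run W q μ′ t μ″ →
            Run W (p ⨾ q) μ (s + t) μ″
  ifTrue  : ∀ {b p q μ μ′ t} → ⟦ b ⟧ᵀ μ ≡ true → Run W p μ t μ′ →
            Run W (cond b p q) μ (suc t) μ′
  ifFalse : ∀ {b p q μ μ′ t} → ⟦ b ⟧ᵀ μ ≡ false → Run W q μ t μ′ →
            Run W (cond b p q) μ (suc t) μ′
  halt    : ∀ {b p μ} → ⟦ b ⟧ᵀ μ ≡ false → Run W (while b p) μ 1 μ
  loop    : ∀ {b p μ μ′ μ″ s t} → ⟦ b ⟧ᵀ μ ≡ true →
            Run W p μ s μ′ → Run W (while b p) μ′ t μ″ →
            Run W (while b p) μ (suc (s + t)) μ″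

_at_ : List ℕ → ℕ → ℕ
[]       at _     = 0
(x ∷ xs) at zero  = x
(x ∷ xs) at suc i = xs at i

-- The a-th list is the initial content of array a; all other cells are zero.
load : List (List ℕ) → Memory
load []         _       _ = 0
load (xs ∷ xss) zero    i = xs at i
load (xs ∷ xss) (suc a) i = load xss a i

-- Array a has the a-th list as its initial segment.
Holds : Memory → List (List ℕ) → Set
Holds μ xss = ∀ (a : Fin (length xss)) (i : Fin (length (List.lookup xss a))) →
              μ (toℕ a) (toℕ i) ≡ List.lookup (List.lookup xss a) i

Computes : Program → (input : List (List ℕ)) (bound : ℕ) → Pred Memory 0ℓ → Set
Computes p input bound Post =
  ∃₂ λ t μ → Run bound p (load input) t μ × t ℕ.≤ bound × Post μ

-- Neighbours may be listed in any order.
record AdjacencyLists (G : Graph n) : Set where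
  field
    neighbours : Fin n → List (Fin n)
    unique     : ∀ v → Unique (neighbours v)
    correct    : ∀ v u → u ∈ neighbours v ⇔ Adj G v u

-- The starting indices of the given lists in their concatenation when it is
-- stored from index acc on, followed by the index where it ends.
offsets : ∀ {A : Set} → ℕ → List (List A) → List ℕ
offsets acc []         = acc ∷ []
offsets acc (xs ∷ xss) = acc ∷ offsets (acc + length xs) xss

encodeGraph : {G : Graph n} → AdjacencyLists G → List (List ℕ)
encodeGraph {n} L = (n ∷ []) ∷ offsets 0 lists ∷ map toℕ (concat lists) ∷ []
  where lists = tabulate (AdjacencyLists.neighbours L)

encodeSide : Side → ℕ
encodeSide start = 0
encodeSide end   = 1

encodeModel : ArcModel n → List (List ℕ)
encodeModel {n} M = (n ∷ [])
                  ∷ tabulate (toℕ ∘ proj₁ ∘ to)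
                  ∷ tabulate (encodeSide ∘ proj₂ ∘ to)
                  ∷ []
  where open Inverse (ArcModel.extreme M) using (to)

encodeEnum : Enumeration (Fin n) → List (List ℕ)
encodeEnum 𝒬 = (k ∷ [])
             ∷ tabulate (toℕ ∘ vertex)
             ∷ tabulate (size ∘ witness)
             ∷ tabulate (toℕ ∘ first ∘ witness)
             ∷ tabulate (toℕ ∘ second ∘ witness)
             ∷ []
  where open Enumeration 𝒬

-- Array 0 of the output tells which of the two kinds of answer is given.

EssentialFound : Graph n → Pred Memory 0ℓ
EssentialFound {n} G μ =
  ∃[ h ] Σ (Fin h ↣ Fin n) λ S → Σ (Enumeration (Fin h)) λ 𝒬 →
    IsEssentialObstacleEnumOf (induced G S) 𝒬 ×
    Holds μ ((0 ∷ []) ∷ encodeEnum (mapᴱ (Injection.to S) 𝒬))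

InducedFound : ∀ {f} → Graph f → Graph n → Pred Memory 0ℓ
InducedFound {n} F G μ =
  ∃[ h ] Σ (Fin h ↣ Fin n) λ S →
    induced G S ≅ F ×
    Holds μ ((1 ∷ []) ∷ (h ∷ []) ∷ tabulate (toℕ ∘ Injection.to S) ∷ [])

{-# OPTIONS --safe #-}
module Submission where

-- If p and q are adjacent witnesses and the stretch of Q from the last
-- nonneighbour of p to the first nonneighbour of q has at least three vertices
-- but is not all of Q, then this stretch, closed by the witness enumeration
-- q, p, is an obstacle enumeration again.  Taking a shortest stretch (twice if
-- four vertices were left) confines the invalid edges to witnesses with close
-- nonneighbours.  A pass along Q that skips vertices then makes sure that they
-- join witnesses with one nonneighbour each, consecutive on Q, and a second
-- pass turns these edges into witness enumerations.  The cases k = 3 and k = 4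
-- are settled by decision trees, whose leaves are essential enumerations or
-- copies of the six graphs.
--
-- In a circular-arc model the edges between the witnesses may be too many to
-- be listed.  Let p and q be adjacent witnesses and c a position in both arcs.
-- The arcs of Q that avoid c, among them those of the nonneighbours of p and q,
-- are consecutive in the order of their starts.  If they are at least nine,
-- then three of the inner ones and their first witnesses, whose arcs contain c,
-- give an essential enumeration with k = 3.  Otherwise the nonneighbours of
-- adjacent witnesses are close in that order, so linearly many pairs suffice.
-- None of the six graphs is a circular-arc graph: the arcs of an induced
-- four-cycle cover the circle, and the arcs meeting two disjoint arcs both fall
-- into two classes of arcs with a common position.

open import Defs
open import Data.Bool.Base using (Bool; true; false; if_then_else_; _∧_; _∨_; not; T)
open import Data.Bool.Properties using (T-≡; T-∨)
open import Data.Empty using (⊥; ⊥-elim)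
open import Data.Fin.Base using (Fin; zero; suc; toℕ; fromℕ<)
open import Data.Fin.Patterns using (0F; 1F; 2F; 3F; 4F; 5F; 6F)
import Data.Fin.Properties as Fin
open import Data.Fin.Properties using (toℕ<n; toℕ-injective; toℕ-fromℕ<; fromℕ<-toℕ)
open import Data.List.Base as List using (List; []; _∷_; _++_; length)
open import Data.List.Base using (map; filter; tabulate; allFin; concat)
import Data.List.Properties as List
open import Data.List.Membership.Propositional using (_∈_)
open import Data.List.Membership.Propositional.Properties using (∈-allFin; ∈-filter⁺; ∈-filter⁻; ∈-lookup; ∈-++⁺ˡ; ∈-++⁺ʳ; ∈-map⁺; ∈-map⁻; ∈-cartesianProduct⁺; ∈-concat⁻′; ∈-tabulate⁻)
import Data.List.Relation.Unary.Any as Any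
open import Data.List.Relation.Unary.Any.Properties using (lookup-index)
open import Data.List.Relation.Unary.Unique.Propositional using (Unique; []; _∷_)
import Data.List.Relation.Unary.Unique.Propositional.Properties as Unique
import Data.List.Relation.Unary.AllPairs.Properties as AllPairs
import Data.List.Relation.Unary.All.Properties as AllP
open import Function.Construct.Identity using (↔-id)
open import Data.List.Relation.Unary.All as All using (All; []; _∷_)
open import Data.Nat.Base
open import Data.Nat.Properties
open import Data.Nat.DivMod using (_%_; m%n<n; m<n⇒m%n≡m; n%n≡0)
open import Data.Product.Base using (Σ; ∃; ∃₂; _×_; _,_; proj₁; proj₂; swap)
open import Data.Sum.Base as Sum using (_⊎_; inj₁; inj₂)
open import Data.Unit.Base using (⊤; tt)
open import Function.Base using (_∘_; id; case_of_)
open import Function.Bundles using (_⇔_; _↔_; _↣_; Inverse; Injection; Equivalence; mk⇔)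
open import Relation.Binary.Definitions using (tri<; tri≈; tri>)
open import Relation.Binary.PropositionalEquality hiding ([_])
open import Relation.Nullary using (¬_; Dec; yes; no; does)
open import Relation.Nullary.Decidable using (True; False; toWitness; toWitnessFalse; _×-dec_; _⊎-dec_; ¬?)

-- Weakest preconditions of loop-free programs and counting loops

-- Adjacency lists allow no test of adjacency in constant time. The passes are arranged so that a
-- witness whose last nonneighbour is vertex h of Q needs only two answers: whether it is adjacent
-- to the first witness of enumeration h + 1 and to the second witness of enumeration h. One scan of
-- the edges gives both answers for all witnesses. Only the decision trees scan the edges for every
-- single question.
--
-- Why a shortest stretch helps: in the linear order of the new enumeration, two adjacent witnesses
-- leave no vertex between their nonneighbours, unless these are the two ends of the stretch. Steps
-- that look two vertices ahead are therefore enough. Such a step may drop two vertices, so five are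
-- needed to keep three; this is why k = 3 and k = 4 stand apart. For k = 4 there is a further
-- obstacle: two adjacent witnesses may miss complementary pairs of vertices, and then neither
-- stretch between them has three vertices.
--
-- The combinatorial part speaks of functions on the natural numbers, later instantiated with the
-- arrays of the memory. No loop is nested in another, so linearly many rounds for each loop
-- suffice.

record Ok (W : ℕ) (Q : Memory → Set) (p : Program) (c : ℕ) (μ : Memory) : Set where
  constructor ok
  field
    {steps}  : ℕ
    {final}  : Memory
    run      : Run W p μ steps final
    steps≤   : steps ≤ c
    post     : Q final

infixr 5 _⍮_

_⍮_ : Program → Program → Program
p ⍮ q = p ⨾ q

slot : ℕ → Expr
slot i = 8 [ lit i ]

for_below_loop_ : ℕ → Expr → Program → Program
for c below N loop p = (8 [ lit c ]≔ lit 0) ⨾ while (slot c ≺ N) (p ⨾ (8 [ lit c ]≔ (slot c ⊕ lit 1)))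

-- Only meaningful for loop-free programs.
static : Program → ℕ
static skip           = 0
static (_ [ _ ]≔ _)   = 1
static (p ⨾ q)        = static p + static q
static (cond _ p q)   = suc (static p + static q)
static (while _ _)    = 0

-- Loop bodies are loop-free and a loop makes at most `M` rounds, so `price p * suc M` bounds the
-- running time. The 4 generously covers the test in every round and the final one.
price : Program → ℕ
price skip           = 0
price (_ [ _ ]≔ _)   = 1
price (p ⨾ q)        = price p + price q
price (cond _ p q)   = suc (price p + price q)
price (while _ p)    = 4 + static p

static≤price : ∀ p → static p ≤ price p
static≤price skip         = z≤n
static≤price (_ [ _ ]≔ _) = ≤-refl
static≤price (p ⨾ q)      = +-mono-≤ (static≤price p) (static≤price q)
static≤price (cond _ p q) = s≤s (+-mono-≤ (static≤price p) (static≤price q))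
static≤price (while _ _)  = z≤n

module Hoare (M : ℕ) (64≤M : 64 ≤ M) where

  Bounded : Memory → Set
  Bounded μ = ∀ a i → μ a i ≤ M

  -- X, together with what is not syntactically clear about the value of the
  -- expression being at most M.
  need : Expr → Memory → Set → Set
  need (lit x) μ X = if x ≤ᵇ 64 then X else ⊥
  need (_ [ _ ]) μ X = X
  need (d ⊕ e) μ X = (⟦ d ⟧ μ + ⟦ e ⟧ μ ≤ M) × X
  need (d ⊖ e) μ X = need d μ X

  -- The value of an expression is to be supplied: without this the memory
  -- after a sequence of assignments is a term of exponential size.
  bind : Expr → Memory → (ℕ → Set) → Set
  bind (lit x)   μ K = if x ≤ᵇ 64 then K x else ⊥
  bind (a [ e ]) μ K = Σ ℕ λ x → μ a (⟦ e ⟧ μ) ≡ x × K x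
  bind (d ⊕ e)   μ K = Σ ℕ λ x → ⟦ d ⟧ μ + ⟦ e ⟧ μ ≡ x × x ≤ M × K x
  bind (d ⊖ e)   μ K = Σ ℕ λ x → ⟦ d ⟧ μ ∸ ⟦ e ⟧ μ ≡ x × need d μ (K x)

  Holdsᵀ : Test → Memory → Set
  Holdsᵀ (d ≺ e) μ = ⟦ d ⟧ μ < ⟦ e ⟧ μ
  Holdsᵀ (d ≈ e) μ = ⟦ d ⟧ μ ≡ ⟦ e ⟧ μ

  Failsᵀ : Test → Memory → Set
  Failsᵀ (d ≺ e) μ = ⟦ e ⟧ μ ≤ ⟦ d ⟧ μ
  Failsᵀ (d ≈ e) μ = ⟦ d ⟧ μ ≢ ⟦ e ⟧ μ

  -- The precondition of `while` is absurd: loops are treated by `loops` alone, whose bodies go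
  -- through `wp`. Hence loops cannot be nested, which is what keeps all running times linear.
  wp : Program → (Memory → Set) → Memory → Set
  wp skip           Q μ = Q μ
  wp (a [ d ]≔ e)   Q μ = bind d μ λ i → bind e μ λ x → Q (μ [ a , i ↦ x ])
  wp (p ⨾ q)        Q μ = wp p (wp q Q) μ
  wp (cond b p q)   Q μ = (Holdsᵀ b μ → wp p Q μ) × (Failsᵀ b μ → wp q Q μ)
  wp (while _ _)    Q μ = ⊥

  need⇒ : ∀ e {μ X} → Bounded μ → need e μ X → ⟦ e ⟧ μ ≤ M × X
  need⇒ (lit x) B p with x ≤ᵇ 64 in eq
  ... | true = ≤-trans (≤ᵇ⇒≤ x 64 (subst T (sym eq) tt)) 64≤M , p
  need⇒ (a [ e ]) B p = B a _ , p
  need⇒ (d ⊕ e) B p = p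
  need⇒ (d ⊖ e) {μ} B p with need⇒ d B p
  ... | q , r = ≤-trans (m∸n≤m (⟦ d ⟧ μ) (⟦ e ⟧ μ)) q , r

  bind⇒ : ∀ e {μ K} → Bounded μ → bind e μ K → ⟦ e ⟧ μ ≤ M × K (⟦ e ⟧ μ)
  bind⇒ (lit x) B p with x ≤ᵇ 64 in eq
  ... | true = ≤-trans (≤ᵇ⇒≤ x 64 (subst T (sym eq) tt)) 64≤M , p
  bind⇒ (a [ e ]) B (x , refl , k) = B a _ , k
  bind⇒ (d ⊕ e) B (x , refl , le , k) = le , k
  bind⇒ (d ⊖ e) {μ} B (x , refl , p) with need⇒ d B p
  ... | q , r = ≤-trans (m∸n≤m (⟦ d ⟧ μ) (⟦ e ⟧ μ)) q , r

  private
    update-bounded : ∀ {μ} a i x → Bounded μ → x ≤ M → Bounded (μ [ a , i ↦ x ])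
    update-bounded a i x B x≤M b j with (a ≡ᵇ b) ∧ (i ≡ᵇ j)
    ... | true  = x≤M
    ... | false = B b j

  test : ∀ b μ → (⟦ b ⟧ᵀ μ ≡ true × Holdsᵀ b μ) ⊎ (⟦ b ⟧ᵀ μ ≡ false × Failsᵀ b μ)
  test (d ≺ e) μ with ⟦ d ⟧ μ <ᵇ ⟦ e ⟧ μ in eq
  ... | true  = inj₁ (refl , <ᵇ⇒< _ _ (subst T (sym eq) tt))
  ... | false = inj₂ (refl , ≮⇒≥ (λ l → subst T eq (<⇒<ᵇ l)))
  test (d ≈ e) μ with ⟦ d ⟧ μ ≡ᵇ ⟦ e ⟧ μ in eq
  ... | true  = inj₁ (refl , ≡ᵇ⇒≡ _ _ (subst T (sym eq) tt))
  ... | false = inj₂ (refl , λ l → subst T eq (≡⇒≡ᵇ _ _ l))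

  wp-sound : ∀ {W} → M ≤ W → ∀ p {Q μ} → Bounded μ → wp p Q μ →
             Ok W (λ μ′ → Bounded μ′ × Q μ′) p (static p) μ
  wp-sound M≤ skip B q = ok skip z≤n (B , q)
  wp-sound M≤ (a [ d ]≔ e) {μ = μ} B q with bind⇒ d B q
  ... | d≤ , q′ with bind⇒ e B q′
  ... | e≤ , q″ = ok (assign (≤-trans d≤ M≤) (≤-trans e≤ M≤)) ≤-refl (update-bounded a (⟦ d ⟧ μ) (⟦ e ⟧ μ) B e≤ , q″)
  wp-sound M≤ (p ⨾ r) B q with wp-sound M≤ p B q
  ... | ok run₁ s≤ (B′ , q′) with wp-sound M≤ r B′ q′
  ... | ok run₂ t≤ post = ok (seq run₁ run₂) (+-mono-≤ s≤ t≤) post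
  wp-sound M≤ (cond b p r) {μ = μ} B (q₁ , q₂) with test b μ
  ... | inj₁ (eq , h) with wp-sound M≤ p B (q₁ h)
  ...   | ok run t≤ post = ok (ifTrue eq run) (s≤s (≤-trans t≤ (m≤m+n _ _))) post
  wp-sound M≤ (cond b p r) {μ = μ} B (q₁ , q₂) | inj₂ (eq , h) with wp-sound M≤ r B (q₂ h)
  ...   | ok run t≤ post = ok (ifFalse eq run) (s≤s (≤-trans t≤ (m≤n+m _ _))) post

  module Triples (W : ℕ) (M≤W : M ≤ W) where

    ⟨_⟩_⟨_⟩ : (Memory → Set) → Program → (Memory → Set) → Set
    ⟨ P ⟩ p ⟨ Q ⟩ = ∀ μ → Bounded μ → P μ → Ok W (λ μ′ → Bounded μ′ × Q μ′) p (price p * suc M) μ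

    straight : ∀ {P Q} p → (∀ μ → Bounded μ → P μ → wp p Q μ) → ⟨ P ⟩ p ⟨ Q ⟩
    straight p f μ B h with wp-sound M≤W p B (f μ B h)
    ... | ok run t≤ post = ok run (≤-trans t≤ (≤-trans (static≤price p) (m≤m*n (price p) (suc M)))) post

    infixr 3 _▹_
    _▹_ : ∀ {P Q R p q} → ⟨ P ⟩ p ⟨ Q ⟩ → ⟨ Q ⟩ q ⟨ R ⟩ → ⟨ P ⟩ p ⍮ q ⟨ R ⟩
    _▹_ {p = p} {q} f g μ B h with f μ B h
    ... | ok run t≤ (B′ , h′) with g _ B′ h′
    ... | ok run′ t≤′ post = ok (seq run run′)
          (≤-trans (+-mono-≤ t≤ t≤′) (≤-reflexive (sym (*-distribʳ-+ (suc M) (price p) (price q))))) post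

    weaken : ∀ {P P′ Q Q′ p} → (∀ μ → P′ μ → P μ) → (∀ μ → Q μ → Q′ μ) → ⟨ P ⟩ p ⟨ Q ⟩ → ⟨ P′ ⟩ p ⟨ Q′ ⟩
    weaken f g t μ B h with t μ B (f μ h)
    ... | ok run t≤ (B′ , q) = ok run t≤ (B′ , g _ q)

    branch : ∀ {P Q p q} b → ⟨ (λ μ → P μ × Holdsᵀ b μ) ⟩ p ⟨ Q ⟩ →
             ⟨ (λ μ → P μ × Failsᵀ b μ) ⟩ q ⟨ Q ⟩ → ⟨ P ⟩ cond b p q ⟨ Q ⟩
    branch {p = p} {q} b f g μ B h with test b μ
    ... | inj₁ (eq , t) with f μ B (h , t)
    ...   | ok run t≤ post = ok (ifTrue eq run)
            (s≤s (≤-trans t≤ (≤-trans (*-monoˡ-≤ (suc M) (m≤m+n (price p) (price q))) (m≤n+m _ M)))) post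
    branch {p = p} {q} b f g μ B h | inj₂ (eq , t) with g μ B (h , t)
    ...   | ok run t≤ post = ok (ifFalse eq run)
            (s≤s (≤-trans t≤ (≤-trans (*-monoˡ-≤ (suc M) (m≤n+m (price q) (price p))) (m≤n+m _ M)))) post

    private
      iterations : ∀ (I : ℕ → Memory → Set) c N p N₀ → N₀ ≤ M →
        (∀ i μ → I i μ → ⟦ N ⟧ μ ≡ N₀) → c ≤ 64 →
        (∀ μ → Bounded μ → μ 8 c < N₀ → I (μ 8 c) μ →
           wp p (λ μ′ → μ′ 8 c ≡ μ 8 c × I (suc (μ 8 c)) (μ′ [ 8 , c ↦ suc (μ 8 c) ])) μ) →
        ∀ r μ → Bounded μ → μ 8 c + r ≡ N₀ → I (μ 8 c) μ →
        Ok W (λ μ′ → Bounded μ′ × I N₀ μ′) (while (slot c ≺ N) (p ⨾ (8 [ lit c ]≔ (slot c ⊕ lit 1))))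
           (suc (r * suc (suc (static p)))) μ
      iterations I c N p N₀ N₀≤M fix c≤ step zero μ B eq h with test (slot c ≺ N) μ
      ... | inj₁ (_ , lt) = ⊥-elim (<-irrefl (trans (sym (+-identityʳ _)) (trans eq (sym (fix _ μ h)))) lt)
      ... | inj₂ (t , _) = ok (halt t) ≤-refl (B , subst (λ x → I x μ) (trans (sym (+-identityʳ _)) eq) h)
      iterations I c N p N₀ N₀≤M fix c≤ step (suc r) μ B eq h with test (slot c ≺ N) μ
      ... | inj₂ (_ , ge) = ⊥-elim (<-irrefl refl (≤-trans (≤-trans (m≤m+n (suc (μ 8 c)) r)
                              (≤-reflexive (trans (sym (+-suc (μ 8 c) r)) eq)))
                              (≤-trans (≤-reflexive (sym (fix _ μ h))) ge)))
      ... | inj₁ (t , lt) with wp-sound M≤W p B (step μ B (≤-trans lt (≤-reflexive (fix _ μ h))) h)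
      ... | ok {final = μ′} run s≤ (B′ , same , h′) with suc≤ ← ≤-trans (≤-trans lt (≤-reflexive (fix _ μ h))) N₀≤M
          with iterations I c N p N₀ N₀≤M fix c≤ step r (μ′ [ 8 , c ↦ suc (μ 8 c) ])
               (update-bounded 8 c _ B′ suc≤)
               (trans (cong (_+ r) (at-c μ′ (suc (μ 8 c)))) (trans (sym (+-suc (μ 8 c) r)) eq))
               (subst (λ x → I x (μ′ [ 8 , c ↦ suc (μ 8 c) ])) (sym (at-c μ′ (suc (μ 8 c)))) h′)
        where
        at-c : ∀ μ x → (μ [ 8 , c ↦ x ]) 8 c ≡ x
        at-c μ x rewrite Equivalence.to T-≡ (≡⇒≡ᵇ c c refl) = refl
      ... | ok run′ t≤ post = ok
             (loop t (seq run (subst (λ x → Run W (8 [ lit c ]≔ (slot c ⊕ lit 1)) μ′ 1 (μ′ [ 8 , c ↦ x ]))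
                                 sucμ (assign (≤-trans (≤-trans c≤ 64≤M) M≤W)
                                              (≤-trans (≤-trans (≤-reflexive sucμ) suc≤) M≤W)))) run′)
             (s≤s (≤-trans (+-mono-≤ (+-monoˡ-≤ 1 s≤) t≤) (≤-reflexive arith))) post
        where
        sucμ : μ′ 8 c + 1 ≡ suc (μ 8 c)
        sucμ = trans (+-comm (μ′ 8 c) 1) (cong suc same)
        arith : static p + 1 + suc (r * suc (suc (static p))) ≡ suc r * suc (suc (static p))
        arith = trans (+-assoc (static p) 1 _) (trans (+-suc _ _) (cong suc (+-suc _ _)))

    After : (ℕ → Memory → Set) → ℕ → Memory → Memory → Set
    After I c μ μ′ = μ′ 8 c ≡ μ 8 c × I (suc (μ 8 c)) (μ′ [ 8 , c ↦ suc (μ 8 c) ])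

    -- `Inv i` holds before round `i`. By `fixed` the bound of the loop, which is evaluated again in
    -- every round, keeps the value `times`.
    record Counting (c : ℕ) (N : Expr) (p : Program) (Q : Memory → Set) (μ : Memory) : Set₁ where
      field
        times  : ℕ
        Inv    : ℕ → Memory → Set
        times≤ : Bounded μ → times ≤ M
        fixed  : ∀ i μ → Inv i μ → ⟦ N ⟧ μ ≡ times
        base   : Inv 0 (μ [ 8 , c ↦ 0 ])
        step   : ∀ μ → Bounded μ → μ 8 c < times → Inv (μ 8 c) μ →
                 wp p (After Inv c μ) μ
        exit   : ∀ μ → Inv times μ → Q μ

    loops : ∀ {P Q} c N p {_ : T (c ≤ᵇ 64)} → (∀ μ → P μ → Counting c N p Q μ) →
            ⟨ P ⟩ for c below N loop p ⟨ Q ⟩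
    loops c N p {c≤} f μ B h with Bz ← update-bounded {μ} 8 c 0 B z≤n
      with iterations Inv c N p times (times≤ B) fixed (≤ᵇ⇒≤ c 64 c≤) step times (μ [ 8 , c ↦ 0 ]) Bz
             (cong (_+ times) (at-c μ 0)) (subst (λ x → Inv x (μ [ 8 , c ↦ 0 ])) (sym (at-c μ 0)) base)
      where
      open Counting (f μ h)
      at-c : ∀ μ x → (μ [ 8 , c ↦ x ]) 8 c ≡ x
      at-c μ x rewrite Equivalence.to T-≡ (≡⇒≡ᵇ c c refl) = refl
    ... | ok run t≤ (B′ , h′) = ok (seq (assign (≤-trans (≤-trans (≤ᵇ⇒≤ c 64 c≤) 64≤M) M≤W) z≤n) run)
          (s≤s (≤-trans t≤ (≤-trans (s≤s (*-monoˡ-≤ (2 + static p) (Counting.times≤ (f μ h) B))) bound)))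
          (B′ , Counting.exit (f μ h) _ h′)
      where
      bound : suc (M * (2 + static p)) ≤ M + (4 + (static p + 1)) * suc M
      bound = ≤-trans (+-mono-≤ (s≤s (z≤n {M})) (≤-trans (≤-reflexive (*-comm M (2 + static p)))
                (*-monoʳ-≤ (2 + static p) (n≤1+n M))))
              (≤-trans (*-monoˡ-≤ (suc M) {3 + static p} {4 + (static p + 1)} (s≤s (s≤s (s≤s (≤-trans (m≤m+n (static p) 1) (n≤1+n _))))))
                (m≤n+m _ M))

-- Obstacle enumerations over the natural numbers

record Graphᴺ : Set₁ where
  field
    order : ℕ
    E     : ℕ → ℕ → Set
    E?    : ∀ x y → Dec (E x y)
    E-sym : ∀ {x y} → E x y → E y x
    E-irr : ∀ {x} → ¬ E x x
    E<    : ∀ {x y} → E x y → x < order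

-- The cyclic successor, given by a Boolean test so that it computes on numerals; the checks of the
-- decision trees rely on this.
nx : ℕ → ℕ → ℕ
nx k i = if suc i ≡ᵇ k then 0 else suc i

nx-suc : ∀ {k i} → suc i < k → nx k i ≡ suc i
nx-suc {k} {i} lt with suc i ≡ᵇ k in eq
... | false = refl
... | true  = ⊥-elim (<-irrefl (≡ᵇ⇒≡ _ _ (subst T (sym eq) tt)) lt)

nx-last : ∀ t → nx (suc t) t ≡ 0
nx-last t rewrite Equivalence.to T-≡ (≡⇒≡ᵇ t t refl) = refl

nx-cases : ∀ {k i} → i < k → (suc i < k × nx k i ≡ suc i) ⊎ (suc i ≡ k × nx k i ≡ 0)
nx-cases {k} {i} lt with m≤n⇒m<n∨m≡n lt
... | inj₁ p    = inj₁ (p , nx-suc p)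
... | inj₂ refl = inj₂ (refl , nx-last i)

nx<k : ∀ {k i} → i < k → nx k i < k
nx<k {k} lt with nx-cases {k} lt
... | inj₁ (p , e) = subst (_< k) (sym e) p
... | inj₂ (refl , e) = subst (_< k) (sym e) (s≤s z≤n)

nx≢ : ∀ {k i} → 2 ≤ k → i < k → nx k i ≢ i
nx≢ {k} 2≤k lt eq with nx-cases {k} lt
... | inj₁ (p , e) = 1+n≢n (trans (sym e) eq)
... | inj₂ (refl , e) with refl ← trans (sym e) eq = <-irrefl refl 2≤k

nx²≢ : ∀ {k i} → 3 ≤ k → i < k → nx k (nx k i) ≢ i
nx²≢ {k} {i} 3≤k lt eq with nx-cases {k} lt
... | inj₂ (refl , e) with refl ← trans (sym eq) (trans (cong (nx k) e) (nx-suc {k} {0} (≤-trans (s≤s (s≤s z≤n)) 3≤k))) = <-irrefl refl 3≤k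
... | inj₁ (p , e) with nx-cases {k} p
...   | inj₁ (q , e′) = <-irrefl (trans (sym eq) (trans (cong (nx k) e) e′)) (s≤s (n≤1+n i))
...   | inj₂ (refl , e′) with refl ← trans (sym eq) (trans (cong (nx k) e) e′) = <-irrefl refl 3≤k

nx-inj : ∀ {k i j} → i < k → j < k → nx k i ≡ nx k j → i ≡ j
nx-inj {k} i<k j<k eq with nx-cases {k} i<k | nx-cases {k} j<k
... | inj₁ (_ , e) | inj₁ (_ , e′) = suc-injective (trans (sym e) (trans eq e′))
... | inj₁ (_ , e) | inj₂ (_ , e′) with () ← trans (sym e) (trans eq e′)
... | inj₂ (_ , e) | inj₁ (_ , e′) with () ← trans (sym e) (trans eq e′)
... | inj₂ (refl , _) | inj₂ (e , _) = suc-injective (sym e)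

module Obstacles (Γ : Graphᴺ) where
  open Graphᴺ Γ public

  -- The vertices of Q nonadjacent to x are V l and V h.
  record Cl (k : ℕ) (V : ℕ → ℕ) (x l h : ℕ) : Set where
    constructor cl
    field
      x<  : x < order
      l<  : l < k
      h<  : h < k
      shape : h ≡ l ⊎ h ≡ nx k l
      out : ∀ j → j < k → x ≢ V j
      nl  : ¬ E x (V l)
      nh  : ¬ E x (V h)
      adj : ∀ j → j < k → j ≢ l → j ≢ h → E x (V j)

  data Wit (k : ℕ) (V : ℕ → ℕ) (i z f s : ℕ) : Set where
    single : z ≡ 1 → s ≡ f → Cl k V f i (nx k i) → Wit k V i z f s
    double : z ≡ 2 → Cl k V f i i → Cl k V s (nx k i) (nx k i) → E f s → Wit k V i z f s

  record Obs (k : ℕ) (V Z F S : ℕ → ℕ) : Set where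
    constructor obs
    field
      3≤k    : 3 ≤ k
      V<     : ∀ i → i < k → V i < order
      V-inj  : ∀ i j → i < k → j < k → V i ≡ V j → i ≡ j
      clique : ∀ i j → i < k → j < k → i ≢ j → E (V i) (V j)
      wit    : ∀ i → i < k → Wit k V i (Z i) (F i) (S i)

  record IsW (k : ℕ) (F S : ℕ → ℕ) (p : ℕ) : Set where
    constructor isW
    field
      {idx} : ℕ
      idx<  : idx < k
      here  : p ≡ F idx ⊎ p ≡ S idx

  Nested : ℕ → (ℕ → ℕ) → ℕ → ℕ → Set
  Nested k V p q = (∀ j → j < k → ¬ E p (V j) → ¬ E q (V j)) ⊎ (∀ j → j < k → ¬ E q (V j) → ¬ E p (V j))

  Together : ℕ → (F S : ℕ → ℕ) → ℕ → ℕ → Set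
  Together k F S p q = Σ ℕ λ i → i < k × (p ≡ F i ⊎ p ≡ S i) × (q ≡ F i ⊎ q ≡ S i)

  record Essential (k : ℕ) (V F S : ℕ → ℕ) : Set where
    constructor essential-by
    field valid : ∀ {p q} → IsW k F S p → IsW k F S q → E p q → Nested k V p q ⊎ Together k F S p q

  Neighbouring : ℕ → (ℕ → ℕ) → ℕ → ℕ → Set
  Neighbouring k V p q = Σ ℕ λ i → Cl k V p i i × Cl k V q (nx k i) (nx k i)

  -- Essential up to the invalid edges that the second pass can repair: those between witnesses with
  -- one nonneighbour each, consecutive on Q.
  record NoDbl (k : ℕ) (V F S : ℕ → ℕ) : Set where
    constructor no-double-by
    field bad : ∀ {p q} → IsW k F S p → IsW k F S q → E p q → Nested k V p q ⊎ Neighbouring k V p q ⊎ Neighbouring k V q p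

  module _ {k : ℕ} {V : ℕ → ℕ} where
    open Cl

    is-nonnbr : ∀ {x l h j} → Cl k V x l h → j < k → ¬ E x (V j) → j ≡ l ⊎ j ≡ h
    is-nonnbr {l = l} {h} {j} c j<k ¬e with j ≟ l | j ≟ h
    ... | yes p | _     = inj₁ p
    ... | no _  | yes p = inj₂ p
    ... | no p  | no q  = ⊥-elim (¬e (adj c j j<k p q))

    -- With only two vertices a pair of consecutive nonneighbours could be read in either order;
    -- from three on, `nx²≢` excludes this.
    Cl-unique : ∀ {x l h l′ h′} → 3 ≤ k → Cl k V x l h → Cl k V x l′ h′ → l ≡ l′ × h ≡ h′
    Cl-unique 3≤k c d with is-nonnbr c (l< d) (nl d) | is-nonnbr c (h< d) (nh d)
                         | is-nonnbr d (l< c) (nl c) | is-nonnbr d (h< c) (nh c)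
    ... | inj₁ refl | inj₁ refl | _ | inj₁ refl = refl , refl
    ... | inj₁ refl | inj₁ refl | _ | inj₂ refl = refl , refl
    ... | inj₁ refl | inj₂ refl | _ | _ = refl , refl
    ... | inj₂ refl | inj₂ refl | inj₁ refl | _ = refl , refl
    ... | inj₂ refl | inj₂ refl | inj₂ refl | _ = refl , refl
    ... | inj₂ refl | inj₁ refl | _ | _ with shape c | shape d
    ...   | inj₁ refl | _ = refl , refl
    ...   | inj₂ refl | inj₁ e = e , sym e
    ...   | inj₂ refl | inj₂ e = ⊥-elim (nx²≢ 3≤k (l< c) (sym e))

    nested-by : ∀ {p q l h l′ h′} → Cl k V p l h → Cl k V q l′ h′ →
                (l ≡ l′ ⊎ l ≡ h′) → (h ≡ l′ ⊎ h ≡ h′) → Nested k V p q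
    nested-by c d e e′ = inj₁ λ j j<k ¬e → go (is-nonnbr c j<k ¬e)
      where
      sub : ∀ {i j} → (i ≡ _ ⊎ i ≡ _) → j ≡ i → ¬ E _ (V j)
      sub (inj₁ refl) refl = nl d
      sub (inj₂ refl) refl = nh d
      go : ∀ {j} → (j ≡ _ ⊎ j ≡ _) → ¬ E _ (V j)
      go (inj₁ p) = sub e p
      go (inj₂ p) = sub e′ p

    nested-sym : ∀ {p q} → Nested k V p q → Nested k V q p
    nested-sym = Sum.swap

  -- The second pass: edges between witnesses of consecutive vertices become witness enumerations

  record Step₂ (pz a z f s nz g z′ f′ s′ : ℕ) : Set where
    field
      -- Here `a` is the second witness of the preceding enumeration and `g` the first witness of
      -- the following one. Where the sizes are 2, `a` and `f` miss only the first vertex of the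
      -- present pair and `s` and `g` only the second, so any edge from one side to the other can
      -- serve as the enumeration.
      kept⊎two : (z ≡ 1 × z′ ≡ 1 × f′ ≡ f × s′ ≡ s) ⊎
                 (z′ ≡ 2 × (pz ≡ 2 × f′ ≡ a ⊎ z ≡ 2 × f′ ≡ f) × (z ≡ 2 × s′ ≡ s ⊎ nz ≡ 2 × s′ ≡ g) × E f′ s′)
      -- The choice is such that the candidates still in play have no other edge across the pair.
      clear : ∀ {p q} → (pz ≡ 2 × p ≡ a ⊎ z′ ≡ 2 × p ≡ f′) → (z′ ≡ 2 × q ≡ s′ ⊎ nz ≡ 2 × q ≡ g) → E p q →
              z′ ≡ 2 × p ≡ f′ × q ≡ s′

  -- The pass closes up around the circle: step 0 has the old enumeration `t` before it, and step
  -- `t` has the new enumeration 0 after it.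
  module Pass₂ {t : ℕ} {V Z F S Z′ F′ S′ : ℕ → ℕ} (O : Obs (suc t) V Z F S)
    (first-step : Step₂ (Z t) (S t) (Z 0) (F 0) (S 0) (Z 1) (F 1) (Z′ 0) (F′ 0) (S′ 0))
    (middle-step : ∀ i → suc i < t → Step₂ (Z′ i) (S′ i) (Z (suc i)) (F (suc i)) (S (suc i))
                     (Z (suc (suc i))) (F (suc (suc i))) (Z′ (suc i)) (F′ (suc i)) (S′ (suc i)))
    (last-step : ∀ i → suc i ≡ t → Step₂ (Z′ i) (S′ i) (Z t) (F t) (S t) (Z′ 0) (F′ 0) (Z′ t) (F′ t) (S′ t)) where
    open Obs O
    open Step₂

    private
      k = suc t
      1<t : 1 < t
      1<t = s≤s⁻¹ 3≤k

      single-cl : ∀ i → i < k → Z i ≡ 2 → Cl k V (F i) i i × Cl k V (S i) (nx k i) (nx k i)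
      single-cl i i<k z with wit i i<k
      ... | single z′ _ _ with () ← trans (sym z) z′
      ... | double _ c d _ = c , d

      one-cl : ∀ i → i < k → Z i ≡ 1 → S i ≡ F i × Cl k V (F i) i (nx k i)
      one-cl i i<k z with wit i i<k
      ... | double z′ _ _ _ with () ← trans (sym z) z′
      ... | single _ e c = e , c

      WitOK : ℕ → Set
      WitOK i = Wit k V i (Z′ i) (F′ i) (S′ i) × IsW k F S (F′ i) × IsW k F S (S′ i)

      Good : ℕ → ℕ → Set
      Good i p = Cl k V p i i × IsW k F S p

      make : ∀ {i pz a nz g} → i < k → (pz ≡ 2 → Good i a) → (nz ≡ 2 → Good (nx k i) g) →
             Step₂ pz a (Z i) (F i) (S i) nz g (Z′ i) (F′ i) (S′ i) → WitOK i
      make {i} i<k ga gg st with kept⊎two st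
      ... | inj₁ (z1 , z′1 , ef , es) rewrite ef | es =
            single z′1 (proj₁ (one-cl i i<k z1)) (proj₂ (one-cl i i<k z1)) , isW i<k (inj₁ refl) , isW i<k (inj₂ refl)
      ... | inj₂ (z′2 , P , N , e) = double z′2 (proj₁ goodf) (proj₁ goods) e , proj₂ goodf , proj₂ goods
        where
        goodf : Good i (F′ i)
        goodf = Sum.[ (λ (pz2 , e) → subst (Good i) (sym e) (ga pz2))
                    , (λ (z2 , e) → subst (Good i) (sym e) (proj₁ (single-cl i i<k z2) , isW i<k (inj₁ refl))) ] P
        goods : Good (nx k i) (S′ i)
        goods = Sum.[ (λ (z2 , e) → subst (Good (nx k i)) (sym e) (proj₂ (single-cl i i<k z2) , isW i<k (inj₂ refl)))
                    , (λ (nz2 , e) → subst (Good (nx k i)) (sym e) (gg nz2)) ] N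

      second-good : ∀ {i} → WitOK i → Z′ i ≡ 2 → Good (nx k i) (S′ i)
      second-good (single z′ _ _ , _) z with () ← trans (sym z) z′
      second-good (double _ _ d _ , _ , w) z = d , w

      first-good : ∀ {i} → WitOK i → Z′ i ≡ 2 → Good i (F′ i)
      first-good (single z′ _ _ , _) z with () ← trans (sym z) z′
      first-good (double _ c _ _ , w , _) z = c , w

      orig-first : ∀ i → i < k → Z i ≡ 2 → Good i (F i)
      orig-first i i<k z = proj₁ (single-cl i i<k z) , isW i<k (inj₁ refl)

      nx-t : nx k t ≡ 0
      nx-t = nx-last t

      good : ∀ i → i < k → WitOK i
      good zero i<k = make i<k
        (λ z → subst (λ j → Good j (S t)) nx-t (proj₂ (single-cl t ≤-refl z) , isW ≤-refl (inj₂ refl)))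
        (λ z → subst (λ j → Good j (F 1)) (sym (nx-suc (s≤s (<⇒≤ 1<t)))) (orig-first 1 (s≤s (<⇒≤ 1<t)) z)) first-step
      good (suc i) i<k with good i (<⇒≤ i<k)
      ... | g with m≤n⇒m<n∨m≡n (s≤s⁻¹ i<k)
      ... | inj₁ lt = make i<k (λ z → subst (λ j → Good j (S′ i)) (nx-suc i<k) (second-good g z))
                        (λ z → subst (λ j → Good j (F (2 + i))) (sym (nx-suc (s≤s lt))) (orig-first (2 + i) (s≤s lt) z))
                        (middle-step i lt)
      ... | inj₂ refl = make i<k (λ z → subst (λ j → Good j (S′ i)) (nx-suc i<k) (second-good g z))
                        (λ z → subst (λ j → Good j (F′ 0)) (sym nx-t) (first-good (good 0 (s≤s z≤n)) z))
                        (last-step i refl)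

    result : Obs k V Z′ F′ S′
    result = obs 3≤k V< V-inj clique (λ i i<k → proj₁ (good i i<k))

    still : ∀ {p} → IsW k F′ S′ p → IsW k F S p
    still (isW i<k (inj₁ refl)) = proj₁ (proj₂ (good _ i<k))
    still (isW i<k (inj₂ refl)) = proj₂ (proj₂ (good _ i<k))

    private
      Firstly Secondly : ℕ → ℕ → Set
      Firstly i p = Z′ i ≡ 2 × p ≡ F′ i
      Secondly j p = Z′ j ≡ 2 × p ≡ S′ j

      place : ∀ {i p} → IsW k F′ S′ p → Cl k V p i i →
              Firstly i p ⊎ Σ ℕ λ j → j < k × nx k j ≡ i × Secondly j p
      place {i} (isW {j} j<k w) c with proj₁ (good j j<k) | w
      ... | single z e d | inj₁ refl = ⊥-elim (not-one d c)
        where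
        not-one : ∀ {x} → Cl k V x j (nx k j) → Cl k V x i i → ⊥
        not-one d c with refl , e ← Cl-unique 3≤k d c = nx≢ (<⇒≤ 3≤k) j<k e
      ... | single z e d | inj₂ refl with refl , e′ ← Cl-unique 3≤k (subst (λ x → Cl k V x j (nx k j)) (sym e) d) c
                                     = ⊥-elim (nx≢ (<⇒≤ 3≤k) j<k e′)
      ... | double z d _ _ | inj₁ refl with refl , _ ← Cl-unique 3≤k d c = inj₁ (z , refl)
      ... | double z _ d _ | inj₂ refl with e , _ ← Cl-unique 3≤k d c = inj₂ (j , j<k , e , z , refl)

      clear-at : ∀ {i p q pz a nz g} → i < k → Step₂ pz a (Z i) (F i) (S i) nz g (Z′ i) (F′ i) (S′ i) →
        (Firstly i p ⊎ pz ≡ 2 × p ≡ a) → (Secondly i q ⊎ nz ≡ 2 × q ≡ g) → E p q → Together k F′ S′ p q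
      clear-at {i} i<k st P N e with clear st (Sum.swap P) N e
      ... | _ , ep , eq = i , i<k , inj₁ ep , inj₂ eq

      prev-of : ∀ {i j} → j < k → nx k j ≡ suc i → j ≡ i
      prev-of j<k e with nx-cases j<k
      ... | inj₁ (_ , e′) = suc-injective (trans (sym e′) e)
      ... | inj₂ (_ , e′) with () ← trans (sym e′) e

      prev-of-0 : ∀ {j} → j < k → nx k j ≡ 0 → j ≡ t
      prev-of-0 j<k e with nx-cases j<k
      ... | inj₁ (_ , e′) with () ← trans (sym e′) e
      ... | inj₂ (e′ , _) = suc-injective e′

      -- The new first witness of `suc i` is taken from `S′ i` and `F (suc i)`, both already
      -- candidates in step `i`. So `clear` of step `i` remains informative about all witnesses that
      -- survive.
      next-N : ∀ {i q} → i < t → IsW k F′ S′ q → Cl k V q (suc i) (suc i) →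
               Secondly i q ⊎ (Z (suc i) ≡ 2 × q ≡ F (suc i))
      next-N {i} i<t w c with place w c
      ... | inj₂ (j , j<k , e , s) rewrite prev-of j<k e = inj₁ s
      ... | inj₁ (z , e) = go (m≤n⇒m<n∨m≡n i<t)
        where
        from : ∀ {nz g} → Step₂ (Z′ i) (S′ i) (Z (suc i)) (F (suc i)) (S (suc i)) nz g (Z′ (suc i)) (F′ (suc i)) (S′ (suc i)) →
               Secondly i _ ⊎ (Z (suc i) ≡ 2 × _ ≡ F (suc i))
        from st with kept⊎two st
        ... | inj₁ (_ , z′1 , _) with () ← trans (sym z) z′1
        ... | inj₂ (_ , inj₁ (pz , e′) , _) = inj₁ (pz , trans e e′)
        ... | inj₂ (_ , inj₂ (z2 , e′) , _) = inj₂ (z2 , trans e e′)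
        go : suc i < t ⊎ suc i ≡ t → _
        go (inj₁ lt) = from (middle-step i lt)
        go (inj₂ refl) = from (last-step i refl)

      together : ∀ {i p q} → i < k → IsW k F′ S′ p → IsW k F′ S′ q → Cl k V p i i → Cl k V q (nx k i) (nx k i) →
                 E p q → Together k F′ S′ p q
      together {zero} i<k wp wq cp cq e = clear-at i<k first-step P N e
        where
        last = pred t
        sl : suc last ≡ t
        sl = suc-pred t {{>-nonZero (<-trans (s≤s z≤n) 1<t)}}
        N : _
        N = next-N (<-trans (s≤s z≤n) 1<t) wq (subst (λ j → Cl k V _ j j) (nx-suc (s≤s (<⇒≤ 1<t))) cq)
        P : _
        P with place wp cp
        ... | inj₁ f = inj₁ f
        -- The new second witness of enumeration `t` is `S t` or `F′ 0`, and step 0 knew both.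
        ... | inj₂ (j , j<k , e′ , z , es) rewrite prev-of-0 j<k e′ with kept⊎two (last-step last sl)
        ...   | inj₁ (_ , z′1 , _) with () ← trans (sym z) z′1
        ...   | inj₂ (_ , _ , inj₁ (z2 , e″) , _) = inj₂ (z2 , trans es e″)
        ...   | inj₂ (_ , _ , inj₂ (z2 , e″) , _) = inj₁ (z2 , trans es e″)
      together {suc i} i<k wp wq cp cq e with m≤n⇒m<n∨m≡n (s≤s⁻¹ i<k)
      ... | inj₁ lt = clear-at i<k (middle-step i lt) P
                        (next-N lt wq (subst (λ j → Cl k V _ j j) (nx-suc (s≤s lt)) cq)) e
        where
        P : _
        P with place wp cp
        ... | inj₁ f = inj₁ f
        ... | inj₂ (j , j<k , e′ , s) rewrite prev-of j<k e′ = inj₂ s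
      ... | inj₂ refl = clear-at i<k (last-step i refl) P N e
        where
        P : _
        P with place wp cp
        ... | inj₁ f = inj₁ f
        ... | inj₂ (j , j<k , e′ , s) rewrite prev-of j<k e′ = inj₂ s
        N : _
        N with place wq (subst (λ j → Cl k V _ j j) nx-t cq)
        ... | inj₁ f = inj₂ f
        ... | inj₂ (j , j<k , e′ , s) rewrite prev-of-0 j<k e′ = inj₁ s

    essential : NoDbl k V F S → Essential k V F′ S′
    essential nd = essential-by (go nd)
     where
     go : NoDbl k V F S → ∀ {p q} → IsW k F′ S′ p → IsW k F′ S′ q → E p q → Nested k V p q ⊎ Together k F′ S′ p q
     go nd wp wq e with NoDbl.bad nd (still wp) (still wq) e
     ... | inj₁ n = inj₁ n
     ... | inj₂ (inj₁ (i , c , d)) = inj₂ (together (Cl.l< c) wp wq c d e)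
     ... | inj₂ (inj₂ (i , c , d)) with together (Cl.l< c) wq wp c d (E-sym e)
     ...   | j , j<k , hq , hp = inj₂ (j , j<k , hp , hq)

-- The first pass: removing vertices so that no bad edge involves a witness with two nonneighbours

module FirstPass (Γ : Graphᴺ) where
  open Obstacles Γ

  -- What a shortest stretch leaves behind. Only the linear order 0, ..., t counts; stretches that
  -- run across `t` are not restricted. The exception is realised by the two witnesses that close
  -- the enumeration.
  record Gap (t : ℕ) (V F S : ℕ → ℕ) : Set where
    constructor gap-by
    field apart : ∀ {p q lp hp lq hq} → IsW (suc t) F S p → IsW (suc t) F S q → Cl (suc t) V p lp hp → Cl (suc t) V q lq hq →
                  E p q → 2 + hp ≤ lq → hp ≡ 0 × lq ≡ t

  -- One step from the vertex i, reached with the witness a, to the vertex j.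
  data Step₁ (t : ℕ) (Z F S : ℕ → ℕ) (i a j z f s : ℕ) : Set where
    far  : z ≡ 2 → f ≡ F i → s ≡ F (2 + i) → Z i ≡ 1 → 2 + i ≤ t → E (F i) (F (2 + i)) →
           -- The witness `F (2 + i)` must miss just one kept vertex: if it misses both `2 + i` and
           -- `3 + i`, then `2 + i` is dropped as well.
           (Z (2 + i) ≡ 2 × j ≡ 2 + i ⊎ Z (2 + i) ≡ 1 × j ≡ 3 + i) → Step₁ t Z F S i a j z f s
    near : z ≡ 2 → f ≡ F i → s ≡ S (1 + i) → Z i ≡ 1 → (2 + i ≤ t → ¬ E (F i) (F (2 + i))) → 1 + i < t → E (F i) (S (1 + i)) →
           j ≡ 2 + i → Step₁ t Z F S i a j z f s
    wide : z ≡ 2 → f ≡ F i → s ≡ F (1 + i) → Z i ≡ 2 → Z (1 + i) ≡ 1 → E (F i) (F (1 + i)) → j ≡ 2 + i → Step₁ t Z F S i a j z f s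
    arr  : z ≡ 2 → f ≡ a → s ≡ F (1 + i) → Z (1 + i) ≡ 1 → E a (F (1 + i)) → j ≡ 2 + i → Step₁ t Z F S i a j z f s
    -- The refuted tests are recorded, because they limit how far the neighbours of the remaining
    -- witnesses can lie.
    keep : z ≡ Z i → f ≡ F i → s ≡ S i → (Z i ≡ 1 → 2 + i ≤ t → ¬ E (F i) (F (2 + i))) → (Z i ≡ 1 → 1 + i < t → ¬ E (F i) (S (1 + i))) →
           (Z i ≡ 2 → Z (1 + i) ≡ 1 → ¬ E (F i) (F (1 + i))) → (Z (1 + i) ≡ 1 → ¬ E a (F (1 + i))) → j ≡ 1 + i →
           Step₁ t Z F S i a j z f s

  -- The s-th kept vertex has old index `κ s`. The closing enumeration has two witnesses with one
  -- nonneighbour each and is taken over unchanged, so no step runs across `t`.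
  module Pass₁ {t r : ℕ} {V Z F S V′ Z′ F′ S′ κ : ℕ → ℕ} (O : Obs (suc t) V Z F S) (Zt : Z t ≡ 2) (4≤t : 4 ≤ t)
    (gap : Gap t V F S) (κ0 : κ 0 ≡ 0) (κr : κ r ≡ t)
    (first-step : 0 < r → Step₁ t Z F S 0 (S t) (κ 1) (Z′ 0) (F′ 0) (S′ 0))
    (later-step : ∀ s → suc s < r → Step₁ t Z F S (κ (suc s)) (S′ s) (κ (suc (suc s))) (Z′ (suc s)) (F′ (suc s)) (S′ (suc s)))
    (kept : ∀ s → s ≤ r → V′ s ≡ V (κ s))
    (lastZ : Z′ r ≡ 2) (lastF : F′ r ≡ F t) (lastS : S′ r ≡ S t) where
    open Obs O
    private
      k = suc t
      k′ = suc r

      a : ℕ → ℕ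
      a zero    = S t
      a (suc s) = S′ s

      step : ∀ s → s < r → Step₁ t Z F S (κ s) (a s) (κ (suc s)) (Z′ s) (F′ s) (S′ s)
      step zero    lt = subst (λ x → Step₁ t Z F S x (S t) (κ 1) (Z′ 0) (F′ 0) (S′ 0)) (sym κ0) (first-step lt)
      step (suc s) lt = later-step s lt

      κ-step : ∀ s → s < r → suc (κ s) ≤ κ (suc s) × κ (suc s) ≤ 3 + κ s
      κ-step s lt with κ (suc s) | step s lt
      ... | _ | far _ _ _ _ _ _ (inj₁ (_ , refl)) = n≤1+n _ , n≤1+n _
      ... | _ | far _ _ _ _ _ _ (inj₂ (_ , refl)) = ≤-trans (n≤1+n _) (n≤1+n _) , ≤-refl
      ... | _ | near _ _ _ _ _ _ _ refl = n≤1+n _ , n≤1+n _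
      ... | _ | wide _ _ _ _ _ _ refl = n≤1+n _ , n≤1+n _
      ... | _ | arr _ _ _ _ _ refl = n≤1+n _ , n≤1+n _
      ... | _ | keep _ _ _ _ _ _ _ refl = ≤-refl , ≤-trans (n≤1+n _) (n≤1+n _)

      κ-mono : ∀ {s u} → s < u → u ≤ r → κ s < κ u
      κ-mono {s} {suc u} s<u u≤r with m≤n⇒m<n∨m≡n (s≤s⁻¹ s<u)
      ... | inj₁ lt   = <-trans (κ-mono lt (<⇒≤ u≤r)) (proj₁ (κ-step u u≤r))
      ... | inj₂ refl = proj₁ (κ-step s u≤r)

      κ-mono≤ : ∀ {s u} → s ≤ u → u ≤ r → κ s ≤ κ u
      κ-mono≤ s≤u u≤r with m≤n⇒m<n∨m≡n s≤u
      ... | inj₁ lt   = <⇒≤ (κ-mono lt u≤r)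
      ... | inj₂ refl = ≤-refl

      κ≤t : ∀ {s} → s ≤ r → κ s ≤ t
      κ≤t s≤r = subst (κ _ ≤_) κr (κ-mono≤ s≤r ≤-refl)

      κ<t : ∀ {s} → s < r → κ s < t
      κ<t s<r = subst (κ _ <_) κr (κ-mono s<r ≤-refl)

      κ≤3* : ∀ u → u ≤ r → κ u ≤ u * 3
      κ≤3* zero    _   = ≤-reflexive κ0
      κ≤3* (suc u) u<r = ≤-trans (proj₂ (κ-step u u<r)) (+-monoʳ-≤ 3 (κ≤3* u (<⇒≤ u<r)))

      -- A step advances by at most three, so with `4 ≤ t` one step cannot reach the end, and at
      -- least three vertices are kept.
      2≤r : 2 ≤ r
      2≤r = ≮⇒≥ λ r<2 → <-irrefl refl (≤-trans 4≤t (≤-trans (≤-reflexive (sym κr))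
              (≤-trans (κ≤3* r ≤-refl) (*-monoˡ-≤ 3 (s≤s⁻¹ r<2)))))

      κ≤0 : ∀ s → s ≤ r → κ s ≤ 0 → s ≡ 0
      κ≤0 zero    _   _ = refl
      κ≤0 (suc s) s≤r e = ⊥-elim (n≮0 (<-≤-trans (κ-mono {s} ≤-refl s≤r) e))

      one-at : ∀ {i} → i < k → Z i ≡ 1 → S i ≡ F i × Cl k V (F i) i (nx k i)
      one-at i<k z with wit _ i<k
      ... | double z′ _ _ _ with () ← trans (sym z) z′
      ... | single _ e c = e , c

      two-at : ∀ {i} → i < k → Z i ≡ 2 → Cl k V (F i) i i × Cl k V (S i) (nx k i) (nx k i) × E (F i) (S i)
      two-at i<k z with wit _ i<k
      ... | single z′ _ _ with () ← trans (sym z) z′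
      ... | double _ c d e = c , d , e

      one<t : ∀ {i} → i ≤ t → Z i ≡ 1 → i < t
      one<t i≤t z with m≤n⇒m<n∨m≡n i≤t
      ... | inj₁ lt = lt
      ... | inj₂ refl with () ← trans (sym z) Zt

      Z12 : ∀ i → i < k → Z i ≡ 1 ⊎ Z i ≡ 2
      Z12 i i<k with wit i i<k
      ... | single z _ _ = inj₁ z
      ... | double z _ _ _ = inj₂ z

      one-cl : ∀ {i} → i ≤ t → Z i ≡ 1 → Cl k V (F i) i (suc i)
      one-cl {i} i≤t z = subst (Cl k V (F i) i) (nx-suc (s≤s (one<t i≤t z))) (proj₂ (one-at (s≤s i≤t) z))

      one-find : ∀ {q j l h} → j < k → Z j ≡ 1 → q ≡ F j → Cl k V q l h →
                 (h ≡ l ⊎ h ≡ suc l × q ≡ F l × Z l ≡ 1) × (q ≡ F l ⊎ (Σ ℕ λ l′ → suc l′ ≡ l × Z l′ ≡ 2 × q ≡ S l′) ⊎ l ≡ 0)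
      one-find j<k z refl c with refl , refl ← Cl-unique 3≤k (one-cl (s≤s⁻¹ j<k) z) c = inj₂ (refl , refl , z) , inj₁ refl

      -- Apart from S t, witnesses are found at their lower nonneighbour.
      find : ∀ {q l h} → IsW k F S q → Cl k V q l h →
             (h ≡ l ⊎ h ≡ suc l × q ≡ F l × Z l ≡ 1) × (q ≡ F l ⊎ (Σ ℕ λ l′ → suc l′ ≡ l × Z l′ ≡ 2 × q ≡ S l′) ⊎ l ≡ 0)
      find (isW {j} j<k w) c with wit j j<k | w
      ... | double z d _ _ | inj₁ refl with refl , refl ← Cl-unique 3≤k d c = inj₁ refl , inj₁ refl
      ... | double z _ d _ | inj₂ refl with refl , refl ← Cl-unique 3≤k d c with nx-cases j<k
      ...   | inj₁ (_ , e) = inj₁ refl , inj₂ (inj₁ (j , sym e , z , refl))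
      ...   | inj₂ (_ , e) = inj₁ refl , inj₂ (inj₂ e)
      find (isW {j} j<k w) c | single z e d | inj₁ q = one-find j<k z q c
      find (isW {j} j<k w) c | single z e d | inj₂ q = one-find j<k z (trans q e) c

      -- Used with consecutive kept vertices `i` and `j`: a neighbour of `p` that is located after
      -- `i` misses nothing beyond `j`, unless `Gap` makes it the other end of the enumeration.
      Reach : ℕ → ℕ → ℕ → ℕ → Set
      Reach p hp i j = ∀ {q lq hq} → IsW k F S q → Cl k V q lq hq → E p q → i < lq → hq ≤ j ⊎ (hp ≡ 0 × lq ≡ t)

      reach-single : ∀ {p l i j} → IsW k F S p → Cl k V p l i → suc i ≤ j →
                     (Z (suc i) ≡ 1 → E p (F (suc i)) → 2 + i ≤ j) → Reach p i i j
      reach-single wp cp i<j pass wq cq e i<lq with m≤n⇒m<n∨m≡n i<lq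
      ... | inj₁ lt = inj₂ (Gap.apart gap wp wq cp cq e lt)
      ... | inj₂ refl with proj₁ (find wq cq)
      ...   | inj₁ refl = inj₁ i<j
      ...   | inj₂ (refl , refl , z) = inj₁ (pass z e)

      reach-one : ∀ {i j} → i ≤ t → Z i ≡ 1 → suc i ≤ j →
                  (∀ {q} → E (F i) q → q ≡ F (suc i) → Z (suc i) ≡ 1 → 2 + i ≤ j) →
                  (∀ {q hq} → IsW k F S q → Cl k V q (2 + i) hq → E (F i) q → hq ≤ j) → Reach (F i) (suc i) i j
      reach-one i≤t z i<j pass pass′ wq cq e i<lq with m≤n⇒m<n∨m≡n i<lq
      ... | inj₂ refl with proj₁ (find wq cq)
      ...   | inj₁ refl = inj₁ i<j
      ...   | inj₂ (refl , e′ , z′) = inj₁ (pass e e′ z′)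
      reach-one i≤t z i<j pass pass′ wq cq e i<lq | inj₁ lt with m≤n⇒m<n∨m≡n lt
      ... | inj₂ refl = inj₁ (pass′ wq cq e)
      ... | inj₁ lt′ with () ← proj₁ (Gap.apart gap (isW (s≤s i≤t) (inj₁ refl)) wq (one-cl i≤t z) cq e lt′)

      V′-inj : ∀ {s u} → s ≤ r → u ≤ r → κ s ≡ κ u → s ≡ u
      V′-inj {s} {u} s≤r u≤r e with <-cmp s u
      ... | tri≈ _ p _ = p
      ... | tri< p _ _ = ⊥-elim (<-irrefl e (κ-mono p u≤r))
      ... | tri> _ _ p = ⊥-elim (<-irrefl (sym e) (κ-mono p s≤r))

      restrict : ∀ {p l h s s′} → Cl k V p l h → s ≤ r → s′ ≤ r → s′ ≡ s ⊎ s′ ≡ nx k′ s → (κ s ≡ l ⊎ κ s ≡ h) → (κ s′ ≡ l ⊎ κ s′ ≡ h) →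
                 (∀ u → u ≤ r → κ u ≡ l ⊎ κ u ≡ h → u ≡ s ⊎ u ≡ s′) → Cl k′ V′ p s s′
      restrict {p} {l} {h} c s≤r s′≤r sh e e′ only = cl (Cl.x< c) (s≤s s≤r) (s≤s s′≤r) sh
        (λ j j<k q → Cl.out c (κ j) (s≤s (κ≤t (s≤s⁻¹ j<k))) (trans q (kept j (s≤s⁻¹ j<k))))
        (non s≤r e) (non s′≤r e′)
        (λ j j<k j≢s j≢s′ → subst (E p) (sym (kept j (s≤s⁻¹ j<k)))
           (Cl.adj c (κ j) (s≤s (κ≤t (s≤s⁻¹ j<k)))
             (λ q → Sum.[ j≢s , j≢s′ ] (only j (s≤s⁻¹ j<k) (inj₁ q))) (λ q → Sum.[ j≢s , j≢s′ ] (only j (s≤s⁻¹ j<k) (inj₂ q)))))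
        where
        non : ∀ {u} → u ≤ r → κ u ≡ l ⊎ κ u ≡ h → ¬ E p (V′ u)
        non u≤r (inj₁ q) e = Cl.nl c (subst (E p) (trans (kept _ u≤r) (cong V q)) e)
        non u≤r (inj₂ q) e = Cl.nh c (subst (E p) (trans (kept _ u≤r) (cong V q)) e)

      l≤h : ∀ {p l h} → IsW k F S p → Cl k V p l h → l ≤ h × h ≤ suc l
      l≤h w c with proj₁ (find w c)
      ... | inj₁ refl = ≤-refl , n≤1+n _
      ... | inj₂ (refl , _) = n≤1+n _ , ≤-refl

      restrict-single : ∀ {p l h s} → IsW k F S p → Cl k V p l h → s ≤ r → (κ s ≡ l ⊎ κ s ≡ h) → (∀ u → u < s → κ u < l) →
                        (s < r → h < κ (suc s)) → Cl k′ V′ p s s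
      restrict-single {l = l} {h} {s} w c s≤r e lo hi = restrict c s≤r s≤r (inj₁ refl) e e λ u u≤r e′ → inj₁ (go u u≤r (bounds e′))
        where
        bounds : ∀ {u} → κ u ≡ l ⊎ κ u ≡ h → l ≤ κ u × κ u ≤ h
        bounds (inj₁ q) = ≤-reflexive (sym q) , ≤-trans (≤-reflexive q) (proj₁ (l≤h w c))
        bounds (inj₂ q) = ≤-trans (proj₁ (l≤h w c)) (≤-reflexive (sym q)) , ≤-reflexive q
        go : ∀ u → u ≤ r → l ≤ κ u × κ u ≤ h → u ≡ s
        go u u≤r (l≤ , ≤h) with <-cmp u s
        ... | tri≈ _ p _ = p
        ... | tri< p _ _ = ⊥-elim (<-irrefl refl (≤-trans (lo u p) l≤))
        ... | tri> _ _ p = ⊥-elim (<-irrefl refl (≤-trans (≤-trans (hi (≤-trans p u≤r)) (κ-mono≤ p u≤r)) ≤h))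

      -- A witness is located at the first kept vertex that it misses. In the second case of `final`
      -- it misses two kept vertices that are also consecutive on the old Q; then `h ≡ suc (κ s)`
      -- lets the `reach` of a witness at the place before exclude an edge to it.
      record At (s p : ℕ) : Set where
        constructor at
        field
          {l h}  : ℕ
          s≤r    : s ≤ r
          w      : IsW k F S p
          c      : Cl k V p l h
          below  : ∀ u → u < s → κ u < l
          meets  : κ s ≡ l ⊎ κ s ≡ h
          final  : Cl k′ V′ p s s ⊎ (Cl k′ V′ p s (suc s) × suc s ≤ r × h ≡ suc (κ s))
          reach  : s < r → Reach p h (κ s) (κ (suc s))

      -- A witness used for the arrival in κ s.
      record Arrival (s : ℕ) : Set where
        constructor arrival
        field
          {l}  : ℕ
          w    : IsW k F S (a s)
          c    : Cl k V (a s) l (κ s)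
          -- In the second case the preceding enumeration was kept and `a s` also misses the kept
          -- vertex before `κ s`. The test refuted there is the one by which `arr` would use `a s`,
          -- so `arr` does not occur.
          kind : (∀ u → u < s → κ u < l) ⊎
                 (Σ ℕ λ i → suc i ≡ κ s × (2 + i ≤ t → ¬ E (a s) (F (2 + i))))

      prev-below : ∀ {s l} → s < r → κ s < l → ∀ u → u < suc s → κ u < l
      prev-below s<r lt u u<s = ≤-<-trans (κ-mono≤ (s≤s⁻¹ u<s) (<⇒≤ s<r)) lt

      arrive : ∀ {s x l y} → s < r → S′ s ≡ x → κ (suc s) ≡ y → IsW k F S x → Cl k V x l y → κ s < l → Arrival (suc s)
      arrive s<r refl refl w c lt = arrival w c (inj₁ (prev-below s<r lt))

      second-cl : ∀ {i} → suc i < k → Z i ≡ 2 → Cl k V (S i) (suc i) (suc i)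
      second-cl lt z = subst (λ x → Cl k V _ x x) (nx-suc lt) (proj₁ (proj₂ (two-at (<⇒≤ lt) z)))

      arrivals : ∀ s → s ≤ r → Arrival s
      arrivals zero _ = arrival (isW ≤-refl (inj₂ refl))
        (subst (λ j → Cl k V (S t) j (κ 0)) κ0 (subst (Cl k V (S t) (κ 0)) refl
          (subst (λ j → Cl k V (S t) j j) (trans (nx-last t) (sym κ0)) (proj₁ (proj₂ (two-at ≤-refl Zt)))))) (inj₁ λ _ ())
      arrivals (suc s) s<r with step s s<r
      ... | far _ _ e′ z le e (inj₁ (z2 , j)) = arrive s<r e′ j (isW (s≤s le) (inj₁ refl)) (proj₁ (two-at (s≤s le) z2)) (n≤1+n _)
      ... | far _ _ e′ z le e (inj₂ (z1 , j)) = arrive s<r e′ j (isW (s≤s le) (inj₁ refl)) (one-cl le z1) (n≤1+n _)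
      ... | wide _ _ e′ z z1 e j = arrive s<r e′ j (isW (s≤s (κ<t s<r)) (inj₁ refl)) (one-cl (κ<t s<r) z1) ≤-refl
      ... | arr _ _ e′ z1 e j = arrive s<r e′ j (isW (s≤s (κ<t s<r)) (inj₁ refl)) (one-cl (κ<t s<r) z1) ≤-refl
      ... | near _ _ e′ z nf lt e j with Z12 (suc (κ s)) (s≤s (<⇒≤ lt))
      ...   | inj₁ z1 = arrive s<r (trans e′ (proj₁ (one-at (s≤s (<⇒≤ lt)) z1))) j (isW (s≤s (κ<t s<r)) (inj₁ refl)) (one-cl (<⇒≤ lt) z1) ≤-refl
      ...   | inj₂ z2 = arrive s<r e′ j (isW (s≤s (κ<t s<r)) (inj₂ refl)) (second-cl (s≤s lt) z2) (n≤1+n _)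
      arrivals (suc s) s<r | keep _ _ e′ nf nn nw na j with Z12 (κ s) (s≤s (<⇒≤ (κ<t s<r)))
      ...   | inj₂ z2 = arrive s<r e′ j (isW (s≤s (<⇒≤ (κ<t s<r))) (inj₂ refl)) (second-cl (s≤s (κ<t s<r)) z2) ≤-refl
      ...   | inj₁ z1 = arrival (subst (IsW k F S) (sym e′) (isW (s≤s (<⇒≤ (κ<t s<r))) (inj₂ refl)))
                          (subst₂ (λ x y → Cl k V x (κ s) y) (sym (trans e′ S≡F)) (sym j) (one-cl (<⇒≤ (κ<t s<r)) z1))
                          (inj₂ (κ s , sym j , λ le e → nf z1 le (subst (λ x → E x (F (2 + κ s))) (trans e′ S≡F) e)))
        where
        S≡F : S (κ s) ≡ F (κ s)
        S≡F = proj₁ (one-at (s≤s (<⇒≤ (κ<t s<r))) z1)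

      arrived : ∀ s → s ≤ r → (∀ l → Cl k V (a s) l (κ s) → ∀ u → u < s → κ u < l) → At s (a s)
      arrived s s≤r alone = at s≤r w c (alone _ c) (inj₂ refl)
        (inj₁ (restrict-single w c s≤r (inj₂ refl) (alone _ c) (λ lt → κ-mono ≤-refl lt)))
        (λ s<r → reach-single w c (κ-mono ≤-refl s<r) (pass s<r))
        where
        open Arrival (arrivals s s≤r)
        pass : s < r → Z (suc (κ s)) ≡ 1 → E (a s) (F (suc (κ s))) → 2 + κ s ≤ κ (suc s)
        pass s<r z e with step s s<r
        ... | far _ _ _ _ _ _ (inj₁ (_ , j)) = ≤-reflexive (sym j)
        ... | far _ _ _ _ _ _ (inj₂ (_ , j)) = ≤-trans (n≤1+n _) (≤-reflexive (sym j))
        ... | near _ _ _ _ _ _ _ j = ≤-reflexive (sym j)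
        ... | wide _ _ _ _ _ _ j = ≤-reflexive (sym j)
        ... | arr _ _ _ _ _ j = ≤-reflexive (sym j)
        ... | keep _ _ _ _ _ _ na _ = ⊥-elim (na z e)

      arrived′ : ∀ s → s ≤ r → (∀ i → suc i ≡ κ s → (2 + i ≤ t → ¬ E (a s) (F (2 + i))) → ⊥) → At s (a s)
      arrived′ s s≤r absurd with arrivals s s≤r
      ... | arrival w c (inj₂ (i , e , f)) = ⊥-elim (absurd i e f)
      ... | arrival w c (inj₁ lo) = arrived s s≤r (λ l c′ u u<s → subst (κ u <_) (proj₁ (Cl-unique 3≤k c c′)) (lo u u<s))

      before : ∀ {s} → s ≤ r → ∀ u → u < s → κ u < κ s
      before s≤r u u<s = κ-mono u<s s≤r

      data Shape (s : ℕ) : Set where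
        kept-one : Z′ s ≡ 1 → S′ s ≡ F′ s → At s (F′ s) → Cl k′ V′ (F′ s) s (nx k′ s) → Shape s
        pair     : Z′ s ≡ 2 → At s (F′ s) → Cl k′ V′ (F′ s) s s → At (nx k′ s) (S′ s) → Cl k′ V′ (S′ s) (nx k′ s) (nx k′ s) →
                   E (F′ s) (S′ s) → Shape s

      single-final : ∀ {s p} → At s p → (∀ {l h} → Cl k V p l h → h ≢ suc (κ s)) → Cl k′ V′ p s s
      single-final A absurd with At.final A
      ... | inj₁ c = c
      ... | inj₂ (_ , _ , e) = ⊥-elim (absurd (At.c A) e)

      arrival-final : ∀ s → s ≤ r → At s (a s) → Cl k′ V′ (a s) s s
      arrival-final s s≤r A = single-final A λ c e →
        1+n≢n (trans (sym e) (sym (proj₂ (Cl-unique 3≤k (Arrival.c (arrivals s s≤r)) c))))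

      first-one : ∀ s (s<r : s < r) → Z (κ s) ≡ 1 → 2 + κ s ≤ κ (suc s) →
                  (∀ {q hq} → IsW k F S q → Cl k V q (2 + κ s) hq → E (F (κ s)) q → hq ≤ κ (suc s)) →
                  At s (F (κ s)) × Cl k′ V′ (F (κ s)) s s
      first-one s s<r z le pass = at (<⇒≤ s<r) w c (before (<⇒≤ s<r)) (inj₁ refl) (inj₁ f)
        (λ _ → reach-one κ≤ z (≤-trans (n≤1+n _) le) (λ _ _ _ → le) pass) , f
        where
        κ≤ = <⇒≤ (κ<t s<r)
        w = isW (s≤s κ≤) (inj₁ refl)
        c = one-cl κ≤ z
        f = restrict-single w c (<⇒≤ s<r) (inj₁ refl) (before (<⇒≤ s<r)) (λ _ → le)

      first-two : ∀ s (s<r : s < r) → Z (κ s) ≡ 2 → (Z (suc (κ s)) ≡ 1 → E (F (κ s)) (F (suc (κ s))) → 2 + κ s ≤ κ (suc s)) →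
                  At s (F (κ s)) × Cl k′ V′ (F (κ s)) s s
      first-two s s<r z pass = at (<⇒≤ s<r) w c (before (<⇒≤ s<r)) (inj₁ refl) (inj₁ f)
        (λ _ → reach-single w c (κ-mono ≤-refl s<r) pass) , f
        where
        κ≤ = <⇒≤ (κ<t s<r)
        w = isW (s≤s κ≤) (inj₁ refl)
        c = proj₁ (two-at (s≤s κ≤) z)
        f = restrict-single w c (<⇒≤ s<r) (inj₁ refl) (before (<⇒≤ s<r)) (λ lt → κ-mono ≤-refl lt)

      arrive-two : ∀ s (s<r : s < r) {l} → Cl k V (S′ s) l (κ (suc s)) → κ s < l → At (suc s) (S′ s)
      arrive-two s s<r c lt = arrived (suc s) s<r λ l c′ →
        prev-below s<r (subst (κ s <_) (proj₁ (Cl-unique 3≤k c c′)) lt)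

      join : ∀ s → s < r → Z′ s ≡ 2 → ∀ {f} → F′ s ≡ f → At s f × Cl k′ V′ f s s → E f (S′ s) → At (suc s) (S′ s) → Shape s
      join s s<r z refl (A , c) e B = pair z A c
        (subst (λ j → At j (S′ s)) (sym nxs) B) (subst (λ j → Cl k′ V′ (S′ s) j j) (sym nxs) (arrival-final (suc s) s<r B)) e
        where nxs = nx-suc (s≤s s<r)

      shapes : ∀ s → s < r → Shape s
      shapes s s<r with step s s<r
      ... | far z f s′ z1 le e j = join s s<r z f (first-one s s<r z1 (2≤j j) pass) (subst (E (F (κ s))) (sym s′) e)
                                     (arrive-two s s<r (subst₂ (λ x y → Cl k V x (2 + κ s) y) (sym s′) refl (cls j)) (n≤1+n _))
        where
        2≤j : _ → 2 + κ s ≤ κ (suc s)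
        2≤j (inj₁ (_ , j)) = ≤-reflexive (sym j)
        2≤j (inj₂ (_ , j)) = ≤-trans (n≤1+n _) (≤-reflexive (sym j))
        cls : _ → Cl k V (F (2 + κ s)) (2 + κ s) (κ (suc s))
        cls (inj₁ (z2 , j)) = subst (Cl k V _ _) (sym j) (proj₁ (two-at (s≤s le) z2))
        cls (inj₂ (z1 , j)) = subst (Cl k V _ _) (sym j) (one-cl le z1)
        pass : ∀ {q hq} → IsW k F S q → Cl k V q (2 + κ s) hq → E (F (κ s)) q → hq ≤ κ (suc s)
        pass wq cq _ with proj₁ (find wq cq)
        ... | inj₁ refl = 2≤j j
        ... | inj₂ (refl , refl , _) = ≤-reflexive (proj₂ (Cl-unique 3≤k cq (cls j)))
      ... | near z f s′ z1 nf lt e j = join s s<r z f (first-one s s<r z1 (≤-reflexive (sym j)) pass) (subst (E (F (κ s))) (sym s′) e) there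
        where
        pass : ∀ {q hq} → IsW k F S q → Cl k V q (2 + κ s) hq → E (F (κ s)) q → hq ≤ κ (suc s)
        pass wq cq e with proj₁ (find wq cq)
        ... | inj₁ refl = ≤-reflexive (sym j)
        ... | inj₂ (_ , refl , _) = ⊥-elim (nf (s≤s⁻¹ (Cl.l< cq)) e)
        there : At (suc s) (S′ s)
        there with Z12 (suc (κ s)) (s≤s (<⇒≤ lt))
        ... | inj₁ z1′ = arrive-two s s<r (subst₂ (λ x y → Cl k V x (suc (κ s)) y)
                           (trans (sym (proj₁ (one-at (s≤s (<⇒≤ lt)) z1′))) (sym s′)) (sym j) (one-cl (<⇒≤ lt) z1′)) ≤-refl
        ... | inj₂ z2′ = arrive-two s s<r (subst₂ (λ x y → Cl k V x (2 + κ s) y) (sym s′) (sym j)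
                           (subst (λ x → Cl k V (S (suc (κ s))) x x) (nx-suc (s≤s lt)) (proj₁ (proj₂ (two-at (s≤s (<⇒≤ lt)) z2′))))) (n≤1+n _)
      ... | wide z f s′ z2 z1 e j = join s s<r z f (first-two s s<r z2 (λ _ _ → ≤-reflexive (sym j))) (subst (E (F (κ s))) (sym s′) e)
              (arrive-two s s<r (subst₂ (λ x y → Cl k V x (suc (κ s)) y) (sym s′) (sym j) (one-cl (κ<t s<r) z1)) ≤-refl)
      ... | arr z f s′ z1 e j = join s s<r z f (A , arrival-final s (<⇒≤ s<r) A) (subst (E (a s)) (sym s′) e)
              (arrive-two s s<r (subst₂ (λ x y → Cl k V x (suc (κ s)) y) (sym s′) (sym j) (one-cl (κ<t s<r) z1)) ≤-refl)
        where
        A : At s (a s)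
        A = arrived′ s (<⇒≤ s<r) λ i ei absurd → absurd (subst (_≤ t) (cong suc (sym ei)) (κ<t s<r)) (subst (λ x → E (a s) (F (suc x))) (sym ei) e)
      ... | keep z f s′ nf nn nw na j with Z12 (κ s) (s≤s (<⇒≤ (κ<t s<r)))
      ...   | inj₂ z2 = join s s<r (trans z z2) f (first-two s s<r z2 (λ z1 e → ⊥-elim (nw z2 z1 e)))
                          (subst (E (F (κ s))) (sym s′) (proj₂ (proj₂ (two-at κ< z2))))
                          (arrive-two s s<r (subst₂ (λ x y → Cl k V x (suc (κ s)) y) (sym s′) (sym j)
                            (subst (λ x → Cl k V (S (κ s)) x x) (nx-suc (s≤s (κ<t s<r))) (proj₁ (proj₂ (two-at κ< z2))))) ≤-refl)
        where
        κ< = s≤s (<⇒≤ (κ<t s<r))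
      ...   | inj₁ z1 = kept-one (trans z z1) (trans s′ (trans S≡F (sym f))) (subst (At s) (sym f) A)
                          (subst₂ (λ x y → Cl k′ V′ x s y) (sym f) (sym (nx-suc (s≤s s<r))) fin)
        where
        κ≤ = <⇒≤ (κ<t s<r)
        S≡F = proj₁ (one-at (s≤s κ≤) z1)
        w = isW (s≤s κ≤) (inj₁ refl)
        c = one-cl κ≤ z1
        fin : Cl k′ V′ (F (κ s)) s (suc s)
        fin = restrict c (<⇒≤ s<r) s<r (inj₂ (sym (nx-suc (s≤s s<r)))) (inj₁ refl) (inj₂ j)
          λ { u u≤r (inj₁ e) → inj₁ (V′-inj u≤r (<⇒≤ s<r) e) ; u u≤r (inj₂ e) → inj₂ (V′-inj u≤r s<r (trans e (sym j))) }
        pass : ∀ {q hq} → IsW k F S q → Cl k V q (2 + κ s) hq → E (F (κ s)) q → hq ≤ κ (suc s)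
        pass wq cq e with proj₂ (find wq cq)
        ... | inj₁ refl = ⊥-elim (nf z1 (s≤s⁻¹ (Cl.l< cq)) e)
        ... | inj₂ (inj₁ (_ , refl , _ , refl)) = ⊥-elim (nn z1 (s≤s⁻¹ (Cl.l< cq)) e)
        A : At s (F (κ s))
        A = at (<⇒≤ s<r) w c (before (<⇒≤ s<r)) (inj₁ refl) (inj₂ (fin , s<r , refl))
              (λ _ → reach-one κ≤ z1 (≤-reflexive (sym j))
                 (λ { e refl z1′ → ⊥-elim (nn z1 (one<t (κ<t s<r) z1′)
                        (subst (E _) (sym (proj₁ (one-at (s≤s (κ<t s<r)) z1′))) e)) }) pass)

      last-shape : Shape r
      last-shape = pair lastZ A (single-final A absurd)
        (subst₂ At (sym (nx-last r)) (sym lastS) B) (subst₂ (λ x j → Cl k′ V′ x j j) (sym lastS) (sym (nx-last r)) (arrival-final 0 z≤n B))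
        (subst₂ E (sym lastF) (sym lastS) (proj₂ (proj₂ (two-at ≤-refl Zt))))
        where
        B : At 0 (S t)
        B = arrived 0 z≤n (λ _ _ _ ())
        w = isW ≤-refl (inj₁ refl)
        c : Cl k V (F t) (κ r) (κ r)
        c = subst (λ x → Cl k V (F t) x x) (sym κr) (proj₁ (two-at ≤-refl Zt))
        A′ : At r (F t)
        A′ = at ≤-refl w c (before ≤-refl) (inj₁ refl)
               (inj₁ (restrict-single w c ≤-refl (inj₁ refl) (before ≤-refl) (λ lt → ⊥-elim (<-irrefl refl lt))))
               (λ lt → ⊥-elim (<-irrefl refl lt))
        A : At r (F′ r)
        A = subst (At r) (sym lastF) A′
        absurd : ∀ {l h} → Cl k V (F′ r) l h → h ≢ suc (κ r)
        absurd c′ e = 1+n≢n (trans (sym e) (sym (proj₂ (Cl-unique 3≤k (subst (λ x → Cl k V x _ _) (sym lastF) c) c′))))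

      shape : ∀ s → s < k′ → Shape s
      shape s s<k′ with m≤n⇒m<n∨m≡n (s≤s⁻¹ s<k′)
      ... | inj₁ lt   = shapes s lt
      ... | inj₂ refl = last-shape

      located : ∀ {p} → IsW k′ F′ S′ p → ∃ λ s → At s p
      located (isW {s} s<k′ w) with shape s s<k′ | w
      ... | kept-one _ e A _ | inj₁ refl = _ , A
      ... | kept-one _ e A _ | inj₂ refl = _ , subst (At s) (sym e) A
      ... | pair _ A _ _ _ _ | inj₁ refl = _ , A
      ... | pair _ _ _ B _ _ | inj₂ refl = _ , B

    still : ∀ {p} → IsW k′ F′ S′ p → IsW k F S p
    still w = At.w (proj₂ (located w))

    result : Obs k′ V′ Z′ F′ S′
    result = obs (s≤s 2≤r) (λ i i<k → subst (_< order) (sym (kept i (s≤s⁻¹ i<k))) (V< _ (s≤s (κ≤t (s≤s⁻¹ i<k)))))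
      (λ i j i<k j<k e → V′-inj (s≤s⁻¹ i<k) (s≤s⁻¹ j<k) (V-inj _ _ (s≤s (κ≤t (s≤s⁻¹ i<k))) (s≤s (κ≤t (s≤s⁻¹ j<k)))
         (trans (sym (kept i (s≤s⁻¹ i<k))) (trans e (kept j (s≤s⁻¹ j<k))))))
      (λ i j i<k j<k i≢j → subst₂ E (sym (kept i (s≤s⁻¹ i<k))) (sym (kept j (s≤s⁻¹ j<k)))
         (clique _ _ (s≤s (κ≤t (s≤s⁻¹ i<k))) (s≤s (κ≤t (s≤s⁻¹ j<k))) (i≢j ∘ V′-inj (s≤s⁻¹ i<k) (s≤s⁻¹ j<k))))
      λ i i<k → wit′ (shape i i<k)
      where
      wit′ : ∀ {i} → Shape i → Wit k′ V′ i (Z′ i) (F′ i) (S′ i)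
      wit′ (kept-one z e _ c) = single z e c
      wit′ (pair z _ c _ d e) = double z c d e

    private
      -- The reach of the earlier witness leaves for `u` only the next kept vertex, or, through the
      -- exception in `Gap`, the pair of the last and the first one.
      ordered : ∀ {s u p q} → s < u → At s p → At u q → E p q → Nested k′ V′ p q ⊎ Neighbouring k′ V′ p q ⊎ Neighbouring k′ V′ q p
      ordered {s} {u} s<u A B e with At.reach A (≤-trans s<u (At.s≤r B)) (At.w B) (At.c B) e (At.below B s s<u)
      ... | inj₁ hq≤ = fin (At.final A) (At.final B) u≡
        where
        κu≤h : κ u ≤ At.h B
        κu≤h with At.meets B
        ... | inj₁ m = ≤-trans (≤-reflexive m) (proj₁ (l≤h (At.w B) (At.c B)))
        ... | inj₂ m = ≤-reflexive m
        u≡ : u ≡ suc s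
        u≡ with m≤n⇒m<n∨m≡n s<u
        ... | inj₂ p = sym p
        ... | inj₁ lt = ⊥-elim (<-irrefl refl (≤-trans (κ-mono lt (At.s≤r B)) (≤-trans κu≤h hq≤)))
        nxs : nx k′ s ≡ suc s
        nxs = nx-suc (s≤s (≤-trans s<u (At.s≤r B)))
        fin : _ → _ → u ≡ suc s → _
        fin _ (inj₂ (_ , _ , h≡)) refl = ⊥-elim (<-irrefl refl (≤-trans (≤-reflexive (sym h≡)) hq≤))
        fin (inj₁ c) (inj₁ d) refl = inj₂ (inj₁ (s , c , subst (λ x → Cl k′ V′ _ x x) (sym nxs) d))
        fin (inj₂ (c , _)) (inj₁ d) refl = inj₁ (nested-sym (nested-by d c (inj₂ refl) (inj₂ refl)))
      ... | inj₂ (h≡0 , l≡t) = fin (At.final A) (At.final B) s≡0 u≡r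
        where
        s≡0 : s ≡ 0
        s≡0 = κ≤0 s (At.s≤r A) (Sum.[ (λ m → ≤-trans (≤-reflexive m) (≤-trans (proj₁ (l≤h (At.w A) (At.c A))) (≤-reflexive h≡0)))
                                     , (λ m → ≤-reflexive (trans m h≡0)) ] (At.meets A))
        t≤κu : t ≤ κ u
        t≤κu with At.meets B
        ... | inj₁ m = ≤-reflexive (sym (trans m l≡t))
        ... | inj₂ m = ≤-trans (≤-reflexive (sym l≡t)) (≤-trans (proj₁ (l≤h (At.w B) (At.c B))) (≤-reflexive (sym m)))
        u≡r : u ≡ r
        u≡r with m≤n⇒m<n∨m≡n (At.s≤r B)
        ... | inj₂ p = p
        ... | inj₁ lt = ⊥-elim (<-irrefl refl (<-≤-trans (κ<t lt) t≤κu))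
        fin : _ → _ → s ≡ 0 → u ≡ r → _
        fin (inj₂ (_ , _ , h≡)) _ refl refl with () ← trans (sym h≡0) h≡
        fin _ (inj₂ (_ , r<r , _)) refl refl = ⊥-elim (<-irrefl refl r<r)
        fin (inj₁ c) (inj₁ d) refl refl = inj₂ (inj₂ (r , d , subst (λ x → Cl k′ V′ _ x x) (sym (nx-last r)) c))

      same : ∀ {s p q} → At s p → At s q → Nested k′ V′ p q
      same A B with At.final A | At.final B
      ... | inj₁ c | inj₁ d = nested-by c d (inj₁ refl) (inj₁ refl)
      ... | inj₁ c | inj₂ (d , _) = nested-by c d (inj₁ refl) (inj₁ refl)
      ... | inj₂ (c , _) | inj₁ d = nested-sym (nested-by d c (inj₁ refl) (inj₁ refl))
      ... | inj₂ (c , _) | inj₂ (d , _) = nested-by c d (inj₁ refl) (inj₂ refl)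

    no-double : NoDbl k′ V′ F′ S′
    no-double = no-double-by go
     where
     go : ∀ {p q} → IsW k′ F′ S′ p → IsW k′ F′ S′ q → E p q → Nested k′ V′ p q ⊎ Neighbouring k′ V′ p q ⊎ Neighbouring k′ V′ q p
     go wp wq e with located wp | located wq
     ... | s , A | u , B with <-cmp s u
     ...   | tri< lt _ _ = ordered lt A B e
     ...   | tri≈ _ refl _ = inj₁ (same A B)
     ...   | tri> _ _ gt = Sum.map nested-sym Sum.swap (ordered gt B A (E-sym e))

-- Passing to the vertices between the nonneighbours of two adjacent witnesses

-- The distance from h to l and the vertex at distance j from h on the cycle 0, …, k - 1.
off : ℕ → ℕ → ℕ → ℕ
off k h l = if h <ᵇ suc l then l ∸ h else (l + k) ∸ h

ρ : ℕ → ℕ → ℕ → ℕ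
ρ k h j = if h + j <ᵇ k then h + j else (h + j) ∸ k

if-< : ∀ {m n} {x y : ℕ} → m < n → (if m <ᵇ n then x else y) ≡ x
if-< {m} {n} lt rewrite Equivalence.to T-≡ (<⇒<ᵇ lt) = refl

if-≥ : ∀ {m n} {x y : ℕ} → n ≤ m → (if m <ᵇ n then x else y) ≡ y
if-≥ {m} {n} le with m <ᵇ n in eq
... | false = refl
... | true  = ⊥-elim (<-irrefl refl (<-≤-trans (<ᵇ⇒< m n (subst T (sym eq) tt)) le))

off-≤ : ∀ {k h l} → h ≤ l → off k h l ≡ l ∸ h
off-≤ le = if-< (s≤s le)

off-> : ∀ {k h l} → l < h → off k h l ≡ (l + k) ∸ h
off-> lt = if-≥ lt

ρ-< : ∀ {k h j} → h + j < k → ρ k h j ≡ h + j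
ρ-< = if-<

ρ-≥ : ∀ {k h j} → k ≤ h + j → ρ k h j ≡ (h + j) ∸ k
ρ-≥ = if-≥

module _ {k h : ℕ} (h<k : h < k) where

  ρ<k : ∀ {j} → j ≤ k → ρ k h j < k
  ρ<k {j} j≤k with h + j <? k
  ... | yes p = subst (_< k) (sym (ρ-< {k} {h} p)) p
  ... | no p  = subst (_< k) (sym (ρ-≥ {k} {h} (≮⇒≥ p)))
        (<-≤-trans (∸-monoˡ-< (+-mono-<-≤ h<k j≤k) (≮⇒≥ p)) (≤-reflexive (m+n∸n≡m k k)))

  ρ-suc : ∀ {j} → j < k → nx k (ρ k h j) ≡ ρ k h (suc j)
  ρ-suc {j} j<k with h + j <? k
  ρ-suc {j} j<k | yes p rewrite ρ-< {k} {h} p with nx-cases p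
  ... | inj₁ (q , e) = trans e (trans (sym (+-suc h j)) (sym (ρ-< {k} {h} (subst (_< k) (sym (+-suc h j)) q))))
  ... | inj₂ (q , e) = trans e (sym (trans (ρ-≥ {k} {h} {suc j} (≤-reflexive (trans (sym q) (sym (+-suc h j)))))
                         (trans (cong (_∸ k) (trans (+-suc h j) q)) (n∸n≡0 k))))
  ρ-suc {j} j<k | no p rewrite ρ-≥ {k} {h} {j} (≮⇒≥ p) = trans (nx-suc (subst (_< k) e′ lt))
       (trans (sym e′) (sym (ρ-≥ {k} {h} (≤-trans (≮⇒≥ p) (+-monoʳ-≤ h (n≤1+n j))))))
    where
    e′ : h + suc j ∸ k ≡ suc (h + j ∸ k)
    e′ = trans (cong (_∸ k) (+-suc h j)) (+-∸-assoc 1 (≮⇒≥ p))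
    lt : h + suc j ∸ k < k
    lt = <-≤-trans (∸-monoˡ-< (+-mono-<-≤ h<k j<k) (≤-trans (≮⇒≥ p) (+-monoʳ-≤ h (n≤1+n j)))) (≤-reflexive (m+n∸n≡m k k))

  ρ-0 : ρ k h 0 ≡ h
  ρ-0 = trans (ρ-< {k} {h} {0} (subst (_< k) (sym (+-identityʳ h)) h<k)) (+-identityʳ h)

  ρ-k : ρ k h k ≡ h
  ρ-k = trans (ρ-≥ {k} {h} (m≤n+m k h)) (m+n∸n≡m h k)

  ρ-off : ∀ {l} → l < k → ρ k h (off k h l) ≡ l
  ρ-off {l} l<k with h ≤? l
  ... | yes p rewrite off-≤ {k} p = trans (ρ-< {k} {h} (subst (_< k) (sym (m+[n∸m]≡n p)) l<k)) (m+[n∸m]≡n p)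
  ... | no p rewrite off-> {k} (≰⇒> p) = trans (ρ-≥ {k} {h} (≤-trans (m≤n+m k l) (≤-reflexive (sym e)))) (trans (cong (_∸ k) e) (m+n∸n≡m l k))
    where
    e : h + (l + k ∸ h) ≡ l + k
    e = m+[n∸m]≡n (≤-trans (<⇒≤ h<k) (m≤n+m k l))

  off<k : ∀ {l} → l < k → off k h l < k
  off<k {l} l<k with h ≤? l
  ... | yes p = subst (_< k) (sym (off-≤ {k} p)) (≤-<-trans (m∸n≤m l h) l<k)
  ... | no p  = subst (_< k) (sym (off-> {k} (≰⇒> p)))
        (<-≤-trans (∸-monoˡ-< (+-monoˡ-< k (≰⇒> p)) (≤-trans (<⇒≤ h<k) (m≤n+m k l))) (≤-reflexive (m+n∸m≡n h k)))

  off-ρ : ∀ {i j} → i ≤ j → j < k → off k (ρ k h i) (ρ k h j) ≡ j ∸ i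
  off-ρ {i} {j} i≤j j<k with h + i <? k | h + j <? k
  ... | yes p | yes q rewrite ρ-< {k} {h} p | ρ-< {k} {h} q =
        trans (off-≤ {k} (+-monoʳ-≤ h i≤j)) ([m+n]∸[m+o]≡n∸o h j i)
  ... | yes p | no q rewrite ρ-< {k} {h} p | ρ-≥ {k} {h} {j} (≮⇒≥ q) =
        trans (off-> {k} {h + i} {(h + j) ∸ k} (<-≤-trans (<-≤-trans (∸-monoˡ-< (+-monoʳ-< h j<k) (≮⇒≥ q)) (≤-reflexive (m+n∸n≡m h k))) (m≤m+n h i)))
          (trans (cong (_∸ (h + i)) (m∸n+n≡m (≮⇒≥ q))) ([m+n]∸[m+o]≡n∸o h j i))
  ... | no p | no q rewrite ρ-≥ {k} {h} {i} (≮⇒≥ p) | ρ-≥ {k} {h} {j} (≮⇒≥ q) =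
        trans (off-≤ {k} (∸-monoˡ-≤ k (+-monoʳ-≤ h i≤j))) (trans (sub (≮⇒≥ p)) ([m+n]∸[m+o]≡n∸o h j i))
    where
    sub : ∀ {a b c} → c ≤ b → (a ∸ c) ∸ (b ∸ c) ≡ a ∸ b
    sub {a} {b} {c} c≤b = trans (∸-+-assoc a c (b ∸ c)) (cong (a ∸_) (m+[n∸m]≡n c≤b))
  ... | no p | yes q = ⊥-elim (p (≤-<-trans (+-monoʳ-≤ h i≤j) q))

off-refl : ∀ k h → off k h h ≡ 0
off-refl k h = trans (off-≤ {k} {h} ≤-refl) (n∸n≡0 h)

ρ-inj : ∀ {k h i j} → h < k → i < k → j < k → ρ k h i ≡ ρ k h j → i ≡ j
ρ-inj {k} {h} {i} {j} h<k i<k j<k e with ≤-total i j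
... | inj₁ le = ≤-antisym le (m∸n≡0⇒m≤n (trans (sym (off-ρ h<k le j<k)) (trans (cong (off k (ρ k h i)) (sym e)) (off-refl k (ρ k h i)))))
... | inj₂ le = ≤-antisym (m∸n≡0⇒m≤n (trans (sym (off-ρ h<k le i<k)) (trans (cong (off k (ρ k h j)) e) (off-refl k (ρ k h j))))) le

off-nx : ∀ {k h l} → h < k → l < k → h ≢ l → suc (off k (nx k h) l) ≡ off k h l
off-nx {k} {h} {l} h<k l<k h≢l with nx-cases h<k
... | inj₁ (p , e) rewrite e with <-cmp h l
...   | tri< lt _ _ = trans (cong suc (off-≤ {k} lt)) (trans (sym (+-∸-assoc 1 lt)) (sym (off-≤ {k} (<⇒≤ lt))))
...   | tri≈ _ q _ = ⊥-elim (h≢l q)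
...   | tri> _ _ gt = trans (cong suc (off-> {k} {suc h} {l} (≤-trans gt (n≤1+n h))))
                        (trans (sym (+-∸-assoc 1 (≤-trans (<⇒≤ p) (m≤n+m k l)))) (sym (off-> {k} {h} {l} gt)))
off-nx {k} {h} {l} h<k l<k h≢l | inj₂ (refl , e) rewrite e =
  sym (trans (off-> {suc h} {h} {l} (≤∧≢⇒< (s≤s⁻¹ l<k) (h≢l ∘ sym))) (trans (cong (_∸ h) (+-suc l h)) (m+n∸n≡m (suc l) h)))

off-nx-self : ∀ {k h} → h < k → suc (off k (nx k h) h) ≡ k
off-nx-self {k} {h} h<k with nx-cases h<k
... | inj₁ (p , e) rewrite e = trans (cong suc (off-> {k} {suc h} {h} ≤-refl)) (trans (sym (+-∸-assoc 1 (≤-trans (<⇒≤ p) (m≤n+m k h)))) (m+n∸m≡n h k))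
... | inj₂ (refl , e) rewrite e = refl

module Restriction (Γ : Graphᴺ) where
  open Obstacles Γ
  open FirstPass Γ using (Gap; gap-by)

  -- Every number of vertices from V hp to V lq that is at least 3, for
  -- adjacent witnesses p and q, is at least b.
  record Minimal (k : ℕ) (V F S : ℕ → ℕ) (b : ℕ) : Set where
    constructor minimal-by
    field
     least : ∀ {p q lp hp lq hq} → IsW k F S p → IsW k F S q → Cl k V p lp hp → Cl k V q lq hq → E p q →
                      3 ≤ suc (off k hp lq) → b ≤ suc (off k hp lq)

  module Shrink {k t : ℕ} {V Z F S V′ Z′ F′ S′ : ℕ → ℕ} (O : Obs k V Z F S) {x y lx hx ly hy : ℕ}
    (wx : IsW k F S x) (wy : IsW k F S y) (cx : Cl k V x lx hx) (cy : Cl k V y ly hy) (exy : E x y)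
    (t≡ : t ≡ off k hx ly) (2≤t : 2 ≤ t) (t<k : suc t < k) (minimal : Minimal k V F S (suc t))
    (V≡ : ∀ i → i ≤ t → V′ i ≡ V (ρ k hx i)) (Z≡ : ∀ i → i < t → Z′ i ≡ Z (ρ k hx i))
    (F≡ : ∀ i → i < t → F′ i ≡ F (ρ k hx i)) (S≡ : ∀ i → i < t → S′ i ≡ S (ρ k hx i))
    (Zt : Z′ t ≡ 2) (Ft : F′ t ≡ y) (St : S′ t ≡ x) where
    open Obs O

    private
      k′ = suc t
      h< = Cl.h< cx
      r : ℕ → ℕ
      r = ρ k hx

      r< : ∀ {i} → i ≤ t → r i < k
      r< i≤t = ρ<k h< (≤-trans i≤t (≤-trans (n≤1+n t) (<⇒≤ t<k)))

      r-inj : ∀ {i j} → i < k → j < k → r i ≡ r j → i ≡ j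
      r-inj = ρ-inj h<

      t<k₁ : t < k
      t<k₁ = <-trans ≤-refl t<k

      rt : r t ≡ ly
      rt = trans (cong r t≡) (ρ-off h< (Cl.l< cy))

      restrict : ∀ {p l h s s′} → Cl k V p l h → s ≤ t → s′ ≤ t → s′ ≡ s ⊎ s′ ≡ nx k′ s → (r s ≡ l ⊎ r s ≡ h) → (r s′ ≡ l ⊎ r s′ ≡ h) →
                 (∀ u → u ≤ t → r u ≡ l ⊎ r u ≡ h → u ≡ s ⊎ u ≡ s′) → Cl k′ V′ p s s′
      restrict {p} {l} {h} c s≤ s′≤ sh e e′ only = cl (Cl.x< c) (s≤s s≤) (s≤s s′≤) sh
        (λ j j<k q → Cl.out c (r j) (r< (s≤s⁻¹ j<k)) (trans q (V≡ j (s≤s⁻¹ j<k))))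
        (non s≤ e) (non s′≤ e′)
        (λ j j<k j≢s j≢s′ → subst (E p) (sym (V≡ j (s≤s⁻¹ j<k)))
           (Cl.adj c (r j) (r< (s≤s⁻¹ j<k))
             (λ q → Sum.[ j≢s , j≢s′ ] (only j (s≤s⁻¹ j<k) (inj₁ q))) (λ q → Sum.[ j≢s , j≢s′ ] (only j (s≤s⁻¹ j<k) (inj₂ q)))))
        where
        non : ∀ {u} → u ≤ t → r u ≡ l ⊎ r u ≡ h → ¬ E p (V′ u)
        non u≤t (inj₁ q) e = Cl.nl c (subst (E p) (trans (V≡ _ u≤t) (cong V q)) e)
        non u≤t (inj₂ q) e = Cl.nh c (subst (E p) (trans (V≡ _ u≤t) (cong V q)) e)

      lift< : ∀ {u} → u ≤ t → u < k
      lift< u≤t = ≤-<-trans u≤t t<k₁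

      single-at : ∀ {p s} → s ≤ t → Cl k V p (r s) (r s) → Cl k′ V′ p s s
      single-at s≤t c = restrict c s≤t s≤t (inj₁ refl) (inj₁ refl) (inj₁ refl)
        λ u u≤t e → inj₁ (r-inj (lift< u≤t) (lift< s≤t) (Sum.[ id , id ] e))

      -- If the other nonneighbour `lx` were some `r u` of the stretch, then `hx` would be both
      -- `r (suc u)` and `r 0`, impossible as `suc u < k`. So leaving out one vertex suffices for
      -- `x` to keep a single nonneighbour.
      cx′ : Cl k′ V′ x 0 0
      cx′ = restrict cx z≤n z≤n (inj₁ refl) (inj₂ (ρ-0 h<)) (inj₂ (ρ-0 h<)) λ u u≤t e → inj₁ (go u≤t (Cl.shape cx) e)
        where
        at-h : ∀ {u} → u ≤ t → r u ≡ hx → u ≡ 0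
        at-h u≤t e = r-inj (lift< u≤t) (≤-<-trans z≤n t<k) (trans e (sym (ρ-0 h<)))
        go : ∀ {u} → u ≤ t → hx ≡ lx ⊎ hx ≡ nx k lx → r u ≡ lx ⊎ r u ≡ hx → u ≡ 0
        go u≤t _ (inj₂ e) = at-h u≤t e
        go u≤t (inj₁ q) (inj₁ e) = at-h u≤t (trans e (sym q))
        go {u} u≤t (inj₂ q) (inj₁ e) with () ← r-inj (≤-<-trans (s≤s u≤t) t<k) (≤-<-trans z≤n t<k)
                         (trans (sym (ρ-suc h< (lift< u≤t))) (trans (cong (nx k) e) (trans (sym q) (sym (ρ-0 h<)))))

      cy′ : Cl k′ V′ y t t
      cy′ = restrict cy ≤-refl ≤-refl (inj₁ refl) (inj₁ rt) (inj₁ rt) λ u u≤t e → inj₁ (go u≤t (Cl.shape cy) e)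
        where
        at-l : ∀ {u} → u ≤ t → r u ≡ ly → u ≡ t
        at-l u≤t e = r-inj (lift< u≤t) t<k₁ (trans e (sym rt))
        go : ∀ {u} → u ≤ t → hy ≡ ly ⊎ hy ≡ nx k ly → r u ≡ ly ⊎ r u ≡ hy → u ≡ t
        go u≤t _ (inj₁ e) = at-l u≤t e
        go u≤t (inj₁ q) (inj₂ e) = at-l u≤t (trans e q)
        go u≤t (inj₂ q) (inj₂ e) = ⊥-elim (<-irrefl (r-inj (lift< u≤t) t<k (trans e (trans q (trans (cong (nx k) (sym rt)) (ρ-suc h< t<k₁))))) (s≤s u≤t))

      -- Only at place 0 may a witness have lost its lower nonneighbour, and only at place `t` its
      -- upper one. Everywhere else new and old classes correspond, so the minimality of the old
      -- enumeration can be applied to the new one.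
      record Old (p lp hp : ℕ) : Set where
        constructor old
        field
          {l h} : ℕ
          w  : IsW k F S p
          c  : Cl k V p l h
          lo : lp ≡ 0 ⊎ l ≡ r lp
          hi : hp ≡ t ⊎ h ≡ r hp

      data Shape (s : ℕ) : Set where
        one′ : Z′ s ≡ 1 → S′ s ≡ F′ s → Cl k′ V′ (F′ s) s (nx k′ s) → Old (F′ s) s (nx k′ s) → Shape s
        two′ : Z′ s ≡ 2 → Cl k′ V′ (F′ s) s s → Cl k′ V′ (S′ s) (nx k′ s) (nx k′ s) → E (F′ s) (S′ s) → Old (F′ s) s s → Old (S′ s) (nx k′ s) (nx k′ s) → Shape s

      shape : ∀ s → s < k′ → Shape s
      shape s s<k′ with m≤n⇒m<n∨m≡n (s≤s⁻¹ s<k′)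
      ... | inj₂ refl = two′ Zt (subst (λ v → Cl k′ V′ v t t) (sym Ft) cy′)
              (subst₂ (λ v j → Cl k′ V′ v j j) (sym St) (sym (nx-last t)) cx′) (subst₂ E (sym Ft) (sym St) (E-sym exy))
              (subst (λ v → Old v t t) (sym Ft) (old wy cy (inj₂ (sym rt)) (inj₁ refl)))
              (subst₂ (λ v j → Old v j j) (sym St) (sym (nx-last t)) (old wx cx (inj₁ refl) (inj₂ (sym (ρ-0 h<)))))
      ... | inj₁ s<t with wit (r s) (r< (<⇒≤ s<t))
      ...   | single z e c = one′ (trans (Z≡ s s<t) z) (trans (S≡ s s<t) (trans e (sym (F≡ s s<t))))
                (subst₂ (λ v j → Cl k′ V′ v s j) (sym (F≡ s s<t)) (sym nxs) cc)
                (subst₂ (λ v j → Old v s j) (sym (F≡ s s<t)) (sym nxs) (old (isW (r< (<⇒≤ s<t)) (inj₁ refl)) c (inj₂ refl) (inj₂ (ρ-suc h< (lift< (<⇒≤ s<t))))))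
        where
        nxs = nx-suc (s≤s s<t)
        rs = ρ-suc h< (lift< (<⇒≤ s<t))
        cc : Cl k′ V′ (F (r s)) s (suc s)
        cc = restrict c (<⇒≤ s<t) s<t (inj₂ (sym nxs)) (inj₁ refl) (inj₂ (sym rs))
          λ { u u≤t (inj₁ q) → inj₁ (r-inj (lift< u≤t) (lift< (<⇒≤ s<t)) q) ; u u≤t (inj₂ q) → inj₂ (r-inj (lift< u≤t) (lift< s<t) (trans q rs)) }
      ...   | double z c d e = two′ (trans (Z≡ s s<t) z) (subst (λ v → Cl k′ V′ v s s) (sym (F≡ s s<t)) (single-at (<⇒≤ s<t) c))
                (subst₂ (λ v j → Cl k′ V′ v j j) (sym (S≡ s s<t)) (sym nxs) (single-at s<t d′)) (subst₂ E (sym (F≡ s s<t)) (sym (S≡ s s<t)) e)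
                (subst (λ v → Old v s s) (sym (F≡ s s<t)) (old (isW (r< (<⇒≤ s<t)) (inj₁ refl)) c (inj₂ refl) (inj₂ refl)))
                (subst₂ (λ v j → Old v j j) (sym (S≡ s s<t)) (sym nxs) (old (isW (r< (<⇒≤ s<t)) (inj₂ refl)) d′ (inj₂ refl) (inj₂ refl)))
        where
        nxs = nx-suc (s≤s s<t)
        d′ : Cl k V (S (r s)) (r (suc s)) (r (suc s))
        d′ = subst (λ j → Cl k V (S (r s)) j j) (ρ-suc h< (lift< (<⇒≤ s<t))) d

    result : Obs k′ V′ Z′ F′ S′
    result = obs (s≤s 2≤t) (λ i i<k → subst (_< order) (sym (V≡ i (s≤s⁻¹ i<k))) (V< _ (r< (s≤s⁻¹ i<k))))
      (λ i j i<k j<k e → r-inj (lift< (s≤s⁻¹ i<k)) (lift< (s≤s⁻¹ j<k)) (V-inj _ _ (r< (s≤s⁻¹ i<k)) (r< (s≤s⁻¹ j<k))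
         (trans (sym (V≡ i (s≤s⁻¹ i<k))) (trans e (V≡ j (s≤s⁻¹ j<k))))))
      (λ i j i<k j<k i≢j → subst₂ E (sym (V≡ i (s≤s⁻¹ i<k))) (sym (V≡ j (s≤s⁻¹ j<k)))
         (clique _ _ (r< (s≤s⁻¹ i<k)) (r< (s≤s⁻¹ j<k)) (i≢j ∘ r-inj (lift< (s≤s⁻¹ i<k)) (lift< (s≤s⁻¹ j<k)))))
      λ i i<k → wit′ (shape i i<k)
      where
      wit′ : ∀ {i} → Shape i → Wit k′ V′ i (Z′ i) (F′ i) (S′ i)
      wit′ (one′ z e c _) = single z e c
      wit′ (two′ z c d e _ _) = double z c d e

    private
      old-of : ∀ {p lp hp} → IsW k′ F′ S′ p → Cl k′ V′ p lp hp → Old p lp hp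
      old-of {p} (isW {s} s<k′ w) c = go (shape s s<k′) w
        where
        tr : ∀ {v l h} → p ≡ v → Cl k′ V′ v l h → Old v l h → Old p _ _
        tr refl d o with refl , refl ← Cl-unique (s≤s 2≤t) d c = o
        go : Shape s → _ → _
        go (one′ _ e d o) (inj₁ q) = tr q d o
        go (one′ _ e d o) (inj₂ q) = tr (trans q e) d o
        go (two′ _ d _ _ o _) (inj₁ q) = tr q d o
        go (two′ _ _ d _ _ o) (inj₂ q) = tr q d o

    still : ∀ {p} → IsW k′ F′ S′ p → IsW k F S p
    still (isW {s} s<k′ w) with shape s s<k′ | w
    ... | one′ _ e _ o | inj₁ refl = Old.w o
    ... | one′ _ e _ o | inj₂ refl = subst (IsW k F S) (sym e) (Old.w o)
    ... | two′ _ _ _ _ o _ | inj₁ refl = Old.w o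
    ... | two′ _ _ _ _ _ o | inj₂ refl = Old.w o

    gap : Gap t V′ F′ S′
    gap = gap-by gap′
     where
     gap′ : ∀ {p q lp hp lq hq} → IsW k′ F′ S′ p → IsW k′ F′ S′ q → Cl k′ V′ p lp hp → Cl k′ V′ q lq hq → E p q → 2 + hp ≤ lq → hp ≡ 0 × lq ≡ t
     gap′ {lp = lp} {hp} {lq} {hq} wp wq cp cq e le = go (old-of wp cp) (old-of wq cq)
      where
      lq≤t = s≤s⁻¹ (Cl.l< cq)
      go : Old _ lp hp → Old _ lq hq → _
      go _ (old _ _ (inj₁ z) _) = ⊥-elim (n≮0 (≤-trans le (≤-reflexive z)))
      go (old _ _ _ (inj₁ z)) _ = ⊥-elim (<-irrefl refl (≤-trans (n≤1+n (suc t)) (≤-trans (≤-trans (≤-reflexive (cong (2 +_) (sym z))) le) lq≤t)))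
      go (old {l = l₁} w₁ c₁ _ (inj₂ eh)) (old {h = h₂} w₂ c₂ (inj₂ el) _)
        with o ← off-ρ h< {hp} {lq} (≤-trans (m≤n+m hp 2) le) (lift< lq≤t)
        -- Minimality yields `t ≤ lq ∸ hp`, and with `lq ≤ t` only the two ends remain.
        with b ← Minimal.least minimal w₁ w₂ (subst (Cl k V _ l₁) eh c₁) (subst (λ j → Cl k V _ j h₂) el c₂) e
                 (s≤s (≤-trans (m+n≤o⇒m≤o∸n 2 le) (≤-reflexive (sym o))))
        with b′ ← ≤-trans (s≤s⁻¹ b) (≤-reflexive o) =
          n≤0⇒n≡0 (+-cancelˡ-≤ t hp 0 (≤-trans (m≤n∸o⇒m+o≤n hp≤ b′) (≤-trans lq≤t (≤-reflexive (sym (+-identityʳ t))))))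
          , ≤-antisym lq≤t (≤-trans b′ (m∸n≤m lq hp))
        where
        hp≤ = ≤-trans (m≤n+m hp 2) le
        m≤n∸o⇒m+o≤n : ∀ {m n o} → o ≤ n → m ≤ n ∸ o → m + o ≤ n
        m≤n∸o⇒m+o≤n {m} {n} {o} o≤n p = ≤-trans (+-monoˡ-≤ o p) (≤-reflexive (m∸n+n≡m o≤n))

  -- For adjacent witnesses the stretch from the last nonneighbour of one to the first of the other
  -- has one, two or all `k` vertices, and this holds in both directions. Apart from harmless edges
  -- only complementary pairs of nonneighbours for `k ≡ 4` are left, which `opposite` excludes.
  module NoCandidate {k : ℕ} {V Z F S : ℕ → ℕ} (O : Obs k V Z F S) (4≤k : 4 ≤ k) (minimal : Minimal k V F S k)
    (opposite : ∀ {p q l} → k ≡ 4 → IsW k F S p → IsW k F S q → Cl k V p l (nx k l) →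
                Cl k V q (nx k (nx k l)) (nx k (nx k (nx k l))) → ¬ E p q) where
    open Obs O

    private
      short : ∀ {h l} → h < k → l < k → (3 ≤ suc (off k h l) → k ≤ suc (off k h l)) → l ≡ h ⊎ l ≡ nx k h ⊎ nx k l ≡ h
      short {h} {l} h<k l<k m with off k h l in eq
      ... | 0 = inj₁ (trans (sym (ρ-off h<k l<k)) (trans (cong (ρ k h) eq) (ρ-0 h<k)))
      ... | 1 = inj₂ (inj₁ (trans (sym (ρ-off h<k l<k)) (trans (cong (ρ k h) eq)
                  (trans (sym (ρ-suc h<k (≤-<-trans z≤n h<k))) (cong (nx k) (ρ-0 h<k))))))
      ... | suc (suc d) = inj₂ (inj₂ (trans (cong (nx k) (trans (sym (ρ-off h<k l<k)) (cong (ρ k h) eq)))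
                  (trans (ρ-suc h<k (subst (_< k) eq (off<k h<k l<k))) (trans (cong (ρ k h) (≤-antisym
                     (subst (_< k) eq (off<k h<k l<k)) (m (s≤s (s≤s (s≤s z≤n)))))) (ρ-k h<k)))))

      3≤k′ : 2 ≤ k
      3≤k′ = <⇒≤ 3≤k

      -- From the second successor of `j` around to `j` there are k - 1 vertices: at least three,
      -- but not all. From the third successor, in `not-back₃`, there are k - 2, whence the stronger
      -- `5 ≤ k`.
      not-back : ∀ {j} → j < k → ¬ (3 ≤ suc (off k (nx k (nx k j)) j) → k ≤ suc (off k (nx k (nx k j)) j))
      not-back {j} j<k m = <-irrefl refl (≤-trans (≤-reflexive o) (m (s≤s⁻¹ (≤-trans 4≤k (≤-reflexive (sym o))))))
        where
        o : suc (suc (off k (nx k (nx k j)) j)) ≡ k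
        o = trans (cong suc (off-nx (nx<k j<k) j<k (nx≢ 3≤k′ j<k))) (off-nx-self j<k)

      not-back₃ : ∀ {j} → j < k → 5 ≤ k → ¬ (3 ≤ suc (off k (nx k (nx k (nx k j))) j) → k ≤ suc (off k (nx k (nx k (nx k j))) j))
      not-back₃ {j} j<k 5≤k m = <-irrefl refl (≤-trans (≤-trans (n≤1+n _) (≤-reflexive o)) (m (s≤s⁻¹ (s≤s⁻¹ (≤-trans 5≤k (≤-reflexive (sym o)))))))
        where
        o : suc (suc (suc (off k (nx k (nx k (nx k j))) j))) ≡ k
        o = trans (cong (λ x → suc (suc x)) (off-nx (nx<k (nx<k j<k)) j<k (nx²≢ 3≤k j<k)))
              (trans (cong suc (off-nx (nx<k j<k) j<k (nx≢ 3≤k′ j<k))) (off-nx-self j<k))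

    no-double : NoDbl k V F S
    no-double = no-double-by bad
     where
     bad : ∀ {p q} → IsW k F S p → IsW k F S q → E p q → Nested k V p q ⊎ Neighbouring k V p q ⊎ Neighbouring k V q p
     bad {p} {q} wp wq e = go (class wp) (class wq)
      where
      class : ∀ {v} → IsW k F S v → ∃₂ λ l h → Cl k V v l h
      class (isW {i} i<k w) with wit i i<k | w
      ... | single _ _ c | inj₁ refl = _ , _ , c
      ... | single _ e c | inj₂ refl = _ , _ , subst (λ v → Cl k V v i (nx k i)) (sym e) c
      ... | double _ c _ _ | inj₁ refl = _ , _ , c
      ... | double _ _ c _ | inj₂ refl = _ , _ , c
      go : (∃₂ λ l h → Cl k V p l h) → (∃₂ λ l h → Cl k V q l h) → _
      go (lp , hp , cp) (lq , hq , cq) with short (Cl.h< cp) (Cl.l< cq) (Minimal.least minimal wp wq cp cq e) | Cl.shape cp | Cl.shape cq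
      ... | inj₁ refl | inj₁ refl | _ = inj₁ (nested-by cp cq (inj₁ refl) (inj₁ refl))
      ... | inj₁ refl | inj₂ refl | inj₁ refl = inj₁ (nested-sym (nested-by cq cp (inj₂ refl) (inj₂ refl)))
      ... | inj₁ refl | inj₂ refl | inj₂ refl = ⊥-elim (not-back (Cl.l< cp) (Minimal.least minimal wq wp cq cp (E-sym e)))
      ... | inj₂ (inj₁ refl) | inj₁ refl | inj₁ refl = inj₂ (inj₁ (lp , cp , cq))
      ... | inj₂ (inj₁ refl) | inj₁ refl | inj₂ refl = ⊥-elim (not-back (Cl.l< cp) (Minimal.least minimal wq wp cq cp (E-sym e)))
      ... | inj₂ (inj₁ refl) | inj₂ refl | inj₁ refl = ⊥-elim (not-back (Cl.l< cp) (Minimal.least minimal wq wp cq cp (E-sym e)))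
      ... | inj₂ (inj₁ refl) | inj₂ refl | inj₂ refl with m≤n⇒m<n∨m≡n 4≤k
      ...   | inj₁ 5≤k = ⊥-elim (not-back₃ (Cl.l< cp) 5≤k (Minimal.least minimal wq wp cq cp (E-sym e)))
      ...   | inj₂ 4≡k = ⊥-elim (opposite (sym 4≡k) wp wq cp cq e)
      go (lp , hp , cp) (lq , hq , cq) | inj₂ (inj₂ nxl) | inj₁ refl | inj₁ refl =
        inj₂ (inj₂ (lq , cq , subst (λ j → Cl k V p j j) (sym nxl) cp))
      go (lp , hp , cp) (lq , hq , cq) | inj₂ (inj₂ nxl) | inj₁ refl | inj₂ refl =
        inj₁ (nested-by cp cq (inj₂ (sym nxl)) (inj₂ (sym nxl)))
      go (lp , hp , cp) (lq , hq , cq) | inj₂ (inj₂ nxl) | inj₂ refl | s with refl ← nx-inj (Cl.l< cq) (Cl.l< cp) nxl | s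
      ... | inj₁ refl = inj₁ (nested-sym (nested-by cq cp (inj₁ refl) (inj₁ refl)))
      ... | inj₂ refl = inj₁ (nested-by cp cq (inj₁ refl) (inj₂ refl))

-- Decision trees for the small cases

allBelow anyBelow : ℕ → (ℕ → Bool) → Bool
allBelow zero    p = true
allBelow (suc n) p = p n ∧ allBelow n p
anyBelow zero    p = false
anyBelow (suc n) p = p n ∨ anyBelow n p

T-∧₁ : ∀ {a b} → T (a ∧ b) → T a × T b
T-∧₁ {true} {true} _ = tt , tt

T-∨₁ : ∀ {a b} → T (a ∨ b) → T a ⊎ T b
T-∨₁ {true} _ = inj₁ tt
T-∨₁ {false} t = inj₂ t

allBelow-sound : ∀ {n p i} → T (allBelow n p) → i < n → T (p i)
allBelow-sound {suc n} t i<n with m≤n⇒m<n∨m≡n (s≤s⁻¹ i<n)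
... | inj₁ lt   = allBelow-sound (proj₂ (T-∧₁ t)) lt
... | inj₂ refl = proj₁ (T-∧₁ t)

anyBelow-sound : ∀ {n p} → T (anyBelow n p) → Σ ℕ λ i → i < n × T (p i)
anyBelow-sound {suc n} t with T-∨₁ t
... | inj₁ u = n , ≤-refl , u
... | inj₂ u with anyBelow-sound u
...   | i , i<n , v = i , <-trans i<n ≤-refl , v

allFin′ : ∀ h → (Fin h → Bool) → Bool
allFin′ zero    p = true
allFin′ (suc h) p = p zero ∧ allFin′ h (p ∘ suc)

allFin′-sound : ∀ {h p} → T (allFin′ h p) → ∀ i → T (p i)
allFin′-sound {suc h} t zero    = proj₁ (T-∧₁ t)
allFin′-sound {suc h} t (suc i) = allFin′-sound (proj₂ (T-∧₁ t)) i

data Forbidden : Set where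
  isC₄* isK₂₃ isDomino isG₃ isC₆ᶜ isC₅K₂ᶜ : Forbidden

size-of : Forbidden → ℕ
size-of isC₄*    = 5
size-of isK₂₃    = 5
size-of isDomino = 6
size-of isG₃     = 6
size-of isC₆ᶜ    = 6
size-of isC₅K₂ᶜ  = 7

graph-of : (F : Forbidden) → Graph (size-of F)
graph-of isC₄*    = C 4 *ᵍ
graph-of isK₂₃    = K⟨ 2 , 3 ⟩
graph-of isDomino = domino
graph-of isG₃     = G₃
graph-of isC₆ᶜ    = complement (C 6)
graph-of isC₅K₂ᶜ  = complement (C 5 +ᵍ K 2)

-- A fact about two names: far also says that they denote different vertices.
data Relation : Set where
  adj non far : Relation

Facts : Set
Facts = List (ℕ × ℕ × Relation)

isAdj isNon isFar : Relation → Bool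
isAdj adj = true
isAdj _   = false
isNon adj = false
isNon _   = true
isFar far = true
isFar _   = false

has : (Relation → Bool) → Facts → ℕ → ℕ → Bool
has t [] a b = false
has t ((x , y , r) ∷ fs) a b = (t r ∧ (((x ≡ᵇ a) ∧ (y ≡ᵇ b)) ∨ ((x ≡ᵇ b) ∧ (y ≡ᵇ a)))) ∨ has t fs a b

-- Nonadjacent names may denote the same vertex. This is excluded by adjacency, by a `far` fact, or
-- by a third name adjacent to just one of the two.
distinct : ℕ → Facts → ℕ → ℕ → Bool
distinct N fs a b = has isAdj fs a b ∨ (has isFar fs a b ∨
  anyBelow N λ c → (has isAdj fs a c ∧ has isNon fs b c) ∨ (has isAdj fs b c ∧ has isNon fs a c))

allNon : Facts → List (ℕ × ℕ) → Bool
allNon fs [] = true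
allNon fs ((a , b) ∷ ps) = has isNon fs a b ∧ allNon fs ps

data Tree : Set where
  ask         : (a b : ℕ) (yes no : Tree) → Tree
  stop        : Tree
  forbidden   : Forbidden → List ℕ → Tree
  essential₃  : (qs zs fs ss : List ℕ) → Tree

module Names (N : ℕ) where

  -- A known neighbour, possibly outside the copy, proves that a named vertex is below `order`. Even
  -- the isolated vertex of C_4^* has such a neighbour among the names.
  nonisolatedᵇ : Facts → Forbidden → List ℕ → Bool
  nonisolatedᵇ fs F ns = allFin′ (size-of F) λ u → anyBelow N (has isAdj fs (ns at toℕ u))

  inducedᵇ : Facts → Forbidden → List ℕ → Bool
  inducedᵇ fs F ns = allFin′ (size-of F) λ u → allFin′ (size-of F) λ v →
    if toℕ u <ᵇ toℕ v
    then (if does (adj? (graph-of F) u v) then has isAdj fs (ns at toℕ u) (ns at toℕ v)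
          else has isNon fs (ns at toℕ u) (ns at toℕ v) ∧ distinct N fs (ns at toℕ u) (ns at toℕ v))
    else true

  forbiddenᵇ : Facts → Forbidden → List ℕ → Bool
  forbiddenᵇ fs F ns = nonisolatedᵇ fs F ns ∧ inducedᵇ fs F ns

  nonnbrᵇ : Facts → List ℕ → (x l h j : ℕ) → Bool
  nonnbrᵇ fs qs x l h j =
    if (j ≡ᵇ l) ∨ (j ≡ᵇ h) then has isNon fs x (qs at j) ∧ distinct N fs x (qs at j) else has isAdj fs x (qs at j)

  classᵇ : Facts → List ℕ → (x l h : ℕ) → Bool
  classᵇ fs qs x l h = allBelow 3 (nonnbrᵇ fs qs x l h)

  witnessᵇ : Facts → List ℕ → (i z f s : ℕ) → Bool
  witnessᵇ fs qs i z f s =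
    ((z ≡ᵇ 1) ∧ ((s ≡ᵇ f) ∧ classᵇ fs qs f i (nx 3 i))) ∨
    ((z ≡ᵇ 2) ∧ (classᵇ fs qs f i i ∧ (classᵇ fs qs s (nx 3 i) (nx 3 i) ∧ has isAdj fs f s)))

  nestedᵇ : Facts → List ℕ → (x y j : ℕ) → Bool
  nestedᵇ fa qs x y j = has isAdj fa x (qs at j) ∨ has isNon fa y (qs at j)

  bothᵇ : (fs ss : List ℕ) → (x y l : ℕ) → Bool
  bothᵇ fs ss x y l = ((x ≡ᵇ (fs at l)) ∨ (x ≡ᵇ (ss at l))) ∧ ((y ≡ᵇ (fs at l)) ∨ (y ≡ᵇ (ss at l)))

  valid₄ᵇ : Facts → (qs fs ss : List ℕ) → ℕ → ℕ → Bool
  validᵇ : Facts → (qs fs ss : List ℕ) → ℕ → ℕ → Bool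
  validᵇ fa qs fs ss x y = has isNon fa x y ∨ ((x ≡ᵇ y) ∨
    (allBelow 3 (nestedᵇ fa qs x y) ∨ (allBelow 3 (nestedᵇ fa qs y x) ∨ anyBelow 3 (bothᵇ fs ss x y))))

  valid₄ᵇ fa qs fs ss i j = validᵇ fa qs fs ss (fs at i) (fs at j) ∧ (validᵇ fa qs fs ss (fs at i) (ss at j) ∧
       (validᵇ fa qs fs ss (ss at i) (fs at j) ∧ validᵇ fa qs fs ss (ss at i) (ss at j)))

  witᵇ : Facts → (qs zs fs ss : List ℕ) → ℕ → Bool
  witᵇ fa qs zs fs ss i = witnessᵇ fa qs i (zs at i) (fs at i) (ss at i)

  essentialᵇ : Facts → (qs zs fs ss : List ℕ) → Bool
  essentialᵇ fa qs zs fs ss =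
    (has isAdj fa (qs at 0) (qs at 1) ∧ (has isAdj fa (qs at 1) (qs at 2) ∧ has isAdj fa (qs at 2) (qs at 0))) ∧
    (allBelow 3 (witᵇ fa qs zs fs ss) ∧ allBelow 3 (λ i → allBelow 3 (valid₄ᵇ fa qs fs ss i)))

  -- Names below q denote vertices of Q; only witnesses are asked about, and
  -- a tree may stop only where the given pairs are known to be nonadjacent.
  check : ℕ → List (ℕ × ℕ) → Facts → Tree → Bool
  check q ps fs (ask a b t u) = ((q ≤ᵇ a) ∧ (a <ᵇ N)) ∧ (((q ≤ᵇ b) ∧ (b <ᵇ N)) ∧
                                 (check q ps ((a , b , adj) ∷ fs) t ∧ check q ps ((a , b , non) ∷ fs) u))
  check q ps fs stop = allNon fs ps
  check q ps fs (forbidden F ns) = forbiddenᵇ fs F ns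
  check q ps fs (essential₃ qs zs ws ss) = essentialᵇ fs qs zs ws ss

module TreeSoundness (Γ : Graphᴺ) where
  open Obstacles Γ

  Holdsᶠ : (ℕ → ℕ) → ℕ × ℕ × Relation → Set
  Holdsᶠ v (a , b , adj) = E (v a) (v b)
  Holdsᶠ v (a , b , non) = ¬ E (v a) (v b)
  Holdsᶠ v (a , b , far) = ¬ E (v a) (v b) × v a ≢ v b

  ForbiddenAt : Forbidden → (ℕ → ℕ) → Set
  ForbiddenAt F v = (∀ (i : Fin (size-of F)) → v (toℕ i) < order) × ∀ (i j : Fin (size-of F)) →
    (E (v (toℕ i)) (v (toℕ j)) ⇔ Adj (graph-of F) i j) × (i ≢ j → v (toℕ i) ≢ v (toℕ j))

  module _ (v : ℕ → ℕ) where

    private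
      has-sound : ∀ {t} {P : ℕ → ℕ → Set} → (∀ {x y} → P x y → P y x) →
        (∀ {x y r} → T (t r) → Holdsᶠ v (x , y , r) → P (v x) (v y)) →
        ∀ {fs a b} → All (Holdsᶠ v) fs → T (has t fs a b) → P (v a) (v b)
      has-sound {t} {P} sy f {(x , y , r) ∷ fs} {a} {b} (h ∷ hs) p with T-∨₁ {t r ∧ _} p
      ... | inj₂ q = has-sound {t} {P} sy f hs q
      ... | inj₁ q with T-∧₁ {t r} q
      ...   | tr , e with T-∨₁ {(x ≡ᵇ a) ∧ (y ≡ᵇ b)} e
      ...     | inj₁ e′ with refl ← ≡ᵇ⇒≡ x a (proj₁ (T-∧₁ e′)) | refl ← ≡ᵇ⇒≡ y b (proj₂ (T-∧₁ {x ≡ᵇ a} e′)) = f tr h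
      ...     | inj₂ e′ with refl ← ≡ᵇ⇒≡ x b (proj₁ (T-∧₁ e′)) | refl ← ≡ᵇ⇒≡ y a (proj₂ (T-∧₁ {x ≡ᵇ b} e′)) = sy (f tr h)

    adj-sound : ∀ {fs a b} → All (Holdsᶠ v) fs → T (has isAdj fs a b) → E (v a) (v b)
    adj-sound = has-sound {isAdj} {E} E-sym λ { {r = adj} _ e → e }

    non-sound : ∀ {fs a b} → All (Holdsᶠ v) fs → T (has isNon fs a b) → ¬ E (v a) (v b)
    non-sound = has-sound {isNon} {λ x y → ¬ E x y} (λ f → f ∘ E-sym) λ { {r = non} _ e → e ; {r = far} _ e → proj₁ e }

    far-sound : ∀ {fs a b} → All (Holdsᶠ v) fs → T (has isFar fs a b) → v a ≢ v b
    far-sound = has-sound {isFar} {_≢_} (λ f → f ∘ sym) λ { {r = far} _ e → proj₂ e }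

    distinct-sound : ∀ {N fs a b} → All (Holdsᶠ v) fs → T (distinct N fs a b) → v a ≢ v b
    distinct-sound {N} {fs} {a} {b} hs p with T-∨₁ {has isAdj fs a b} p
    ... | inj₁ q = λ e → E-irr (subst (E (v a)) (sym e) (adj-sound hs q))
    ... | inj₂ q with T-∨₁ {has isFar fs a b} q
    ...   | inj₁ q′ = far-sound hs q′
    ...   | inj₂ q′ with anyBelow-sound {N} q′
    ...     | c , _ , q″ with T-∨₁ {has isAdj fs a c ∧ has isNon fs b c} q″
    ...       | inj₁ s = λ e → non-sound hs (proj₂ (T-∧₁ {has isAdj fs a c} s)) (subst (λ x → E x (v c)) e (adj-sound hs (proj₁ (T-∧₁ s))))
    ...       | inj₂ s = λ e → non-sound hs (proj₂ (T-∧₁ {has isAdj fs b c} s)) (subst (λ x → E x (v c)) (sym e) (adj-sound hs (proj₁ (T-∧₁ s))))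

    module _ {N : ℕ} {fa : Facts} (hs : All (Holdsᶠ v) fa) where
      open Names N

      forbidden-sound : ∀ F ns → T (forbiddenᵇ fa F ns) → ∀ w → (∀ (i : Fin (size-of F)) → w (toℕ i) ≡ v (ns at toℕ i)) → ForbiddenAt F w
      forbidden-sound F ns t w w≡ = (λ i → subst (_< order) (sym (w≡ i)) (bound i)) , pairs
        where
        tᵢ : T (inducedᵇ fa F ns)
        tᵢ = proj₂ (T-∧₁ {nonisolatedᵇ fa F ns} t)
        bound : ∀ i → v (ns at toℕ i) < order
        bound i with anyBelow-sound {N} {has isAdj fa (ns at toℕ i)} (allFin′-sound {p = λ u → anyBelow N (has isAdj fa (ns at toℕ u))} (proj₁ (T-∧₁ {nonisolatedᵇ fa F ns} t)) i)
        ... | c , _ , e = E< (adj-sound hs e)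
        below : ∀ i j → toℕ i < toℕ j → (E (v (ns at toℕ i)) (v (ns at toℕ j)) ⇔ Adj (graph-of F) i j) × v (ns at toℕ i) ≢ v (ns at toℕ j)
        below i j lt with toℕ i <ᵇ toℕ j in eq | adj? (graph-of F) i j | allFin′-sound (allFin′-sound tᵢ i) j
        ... | false | _ | _ = ⊥-elim (subst T eq (<⇒<ᵇ lt))
        ... | true | yes p | q = mk⇔ (λ _ → p) (λ _ → e) , λ ne → E-irr (subst (E _) (sym ne) e)
          where e = adj-sound hs q
        ... | true | no np | q = mk⇔ (λ e → ⊥-elim (non-sound hs (proj₁ (T-∧₁ q)) e)) (λ p → ⊥-elim (np p)) ,
                distinct-sound {N} {fa} {ns at toℕ i} {ns at toℕ j} hs (proj₂ (T-∧₁ {has isNon fa (ns at toℕ i) (ns at toℕ j)} {distinct N fa (ns at toℕ i) (ns at toℕ j)} q))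
        go : ∀ i j → _ → (E (v (ns at toℕ i)) (v (ns at toℕ j)) ⇔ Adj (graph-of F) i j) × (i ≢ j → v (ns at toℕ i) ≢ v (ns at toℕ j))
        go i j (tri< lt _ _) = proj₁ (below i j lt) , λ _ → proj₂ (below i j lt)
        go i j (tri> _ _ gt) = mk⇔ (symm (graph-of F) ∘ Equivalence.to (proj₁ (below j i gt)) ∘ E-sym)
                               (E-sym ∘ Equivalence.from (proj₁ (below j i gt)) ∘ symm (graph-of F)) , λ _ → proj₂ (below j i gt) ∘ sym
        go i j (tri≈ _ e _) with refl ← toℕ-injective e = mk⇔ (λ e → ⊥-elim (E-irr e)) (λ a → ⊥-elim (irrefl (graph-of F) refl a)) , λ ne → ⊥-elim (ne refl)
        pairs : ∀ i j → (E (w (toℕ i)) (w (toℕ j)) ⇔ Adj (graph-of F) i j) × (i ≢ j → w (toℕ i) ≢ w (toℕ j))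
        pairs i j rewrite w≡ i | w≡ j = go i j (<-cmp (toℕ i) (toℕ j))

      module _ {qs zs fs ss : List ℕ} {V Z F S : ℕ → ℕ} (V≡ : ∀ i → i < 3 → V i ≡ v (qs at i)) (Z≡ : ∀ i → i < 3 → Z i ≡ zs at i)
        (F≡ : ∀ i → i < 3 → F i ≡ v (fs at i)) (S≡ : ∀ i → i < 3 → S i ≡ v (ss at i)) (t : T (essentialᵇ fa qs zs fs ss)) where

        private
          on-three : ∀ {P : ℕ → Set} → P 0 → P 1 → P 2 → ∀ i → i < 3 → P i
          on-three p q r 0 _ = p
          on-three p q r 1 _ = q
          on-three p q r 2 _ = r
          on-three p q r (suc (suc (suc _))) (s≤s (s≤s (s≤s ())))

          cl-sound : ∀ x l h → l < 3 → h < 3 → h ≡ l ⊎ h ≡ nx 3 l → (Σ ℕ λ j → j < 3 × j ≢ l × j ≢ h) → T (classᵇ fa qs x l h) → Cl 3 V (v x) l h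
          cl-sound x l h l< h< sh (j , j< , j≢l , j≢h) c = cl (E< (adj₁ j j< j≢l j≢h)) l< h< sh out
              (non₁ l l< (inj₁ refl)) (non₁ h h< (inj₂ refl)) adj₁
            where
            case-j : ∀ j → j < 3 → ((j ≡ l ⊎ j ≡ h) × ¬ E (v x) (v (qs at j)) × v x ≢ v (qs at j)) ⊎ E (v x) (v (qs at j))
            case-j j j< with (j ≡ᵇ l) ∨ (j ≡ᵇ h) in eq | allBelow-sound {3} {nonnbrᵇ fa qs x l h} c j<
            ... | false | q = inj₂ (adj-sound hs q)
            ... | true  | q = inj₁ (Sum.map (≡ᵇ⇒≡ j l) (≡ᵇ⇒≡ j h) (T-∨₁ (subst T (sym eq) tt)) , non-sound hs (proj₁ (T-∧₁ q)) ,
                                distinct-sound {N} {fa} {x} {qs at j} hs (proj₂ (T-∧₁ {has isNon fa x (qs at j)} {distinct N fa x (qs at j)} q)))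
            adj₁ : ∀ j → j < 3 → j ≢ l → j ≢ h → E (v x) (V j)
            adj₁ j j< j≢l j≢h with case-j j j<
            ... | inj₁ (e , _) = ⊥-elim (Sum.[ j≢l , j≢h ] e)
            ... | inj₂ e = subst (E (v x)) (sym (V≡ j j<)) e
            out : ∀ j → j < 3 → v x ≢ V j
            out j j< e with case-j j j<
            ... | inj₁ (_ , _ , ne) = ne (trans e (V≡ j j<))
            ... | inj₂ e′ = E-irr (subst (E (v x)) (trans (sym (V≡ j j<)) (sym e)) e′)
            non₁ : ∀ j → j < 3 → j ≡ l ⊎ j ≡ h → ¬ E (v x) (V j)
            non₁ j j< e with (j ≡ᵇ l) ∨ (j ≡ᵇ h) in eq | allBelow-sound {3} {nonnbrᵇ fa qs x l h} c j<
            ... | true | q = λ e′ → non-sound hs (proj₁ (T-∧₁ q)) (subst (E (v x)) (V≡ j j<) e′)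
            ... | false | q = ⊥-elim (subst T eq (Equivalence.from T-∨′ (Sum.map (≡⇒≡ᵇ j l) (≡⇒≡ᵇ j h) e)))
              where
              T-∨′ : ∀ {a b} → T (a ∨ b) ⇔ (T a ⊎ T b)
              T-∨′ = T-∨

          Q : T (has isAdj fa (qs at 0) (qs at 1) ∧ (has isAdj fa (qs at 1) (qs at 2) ∧ has isAdj fa (qs at 2) (qs at 0)))
          Q = proj₁ (T-∧₁ {has isAdj fa (qs at 0) (qs at 1) ∧ (has isAdj fa (qs at 1) (qs at 2) ∧ has isAdj fa (qs at 2) (qs at 0))} t)
          e₀₁ = adj-sound {a = qs at 0} {qs at 1} hs (proj₁ (T-∧₁ Q))
          e₁₂ = adj-sound {a = qs at 1} {qs at 2} hs (proj₁ (T-∧₁ (proj₂ (T-∧₁ {has isAdj fa (qs at 0) (qs at 1)} Q))))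
          e₂₀ = adj-sound {a = qs at 2} {qs at 0} hs (proj₂ (T-∧₁ {has isAdj fa (qs at 1) (qs at 2)} (proj₂ (T-∧₁ {has isAdj fa (qs at 0) (qs at 1)} Q))))
          R = proj₂ (T-∧₁ {has isAdj fa (qs at 0) (qs at 1) ∧ (has isAdj fa (qs at 1) (qs at 2) ∧ has isAdj fa (qs at 2) (qs at 0))} t)

          clique₃ : ∀ i j → i < 3 → j < 3 → i ≢ j → E (V i) (V j)
          clique₃ i j i< j< i≢j rewrite V≡ i i< | V≡ j j< =
            on-three {λ i → i ≢ j → E (v (qs at i)) (v (qs at j))}
              (on-three {λ j → 0 ≢ j → E (v (qs at 0)) (v (qs at j))} (λ p → ⊥-elim (p refl)) (λ _ → e₀₁) (λ _ → E-sym e₂₀) j j<)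
              (on-three {λ j → 1 ≢ j → E (v (qs at 1)) (v (qs at j))} (λ _ → E-sym e₀₁) (λ p → ⊥-elim (p refl)) (λ _ → e₁₂) j j<)
              (on-three {λ j → 2 ≢ j → E (v (qs at 2)) (v (qs at j))} (λ _ → e₂₀) (λ _ → E-sym e₁₂) (λ p → ⊥-elim (p refl)) j j<)
              i i< i≢j

          third : ∀ i → i < 3 → (Σ ℕ λ j → j < 3 × j ≢ i × j ≢ nx 3 i)
          third = on-three (2 , s≤s (s≤s (s≤s z≤n)) , (λ ()) , λ ()) (0 , s≤s z≤n , (λ ()) , λ ()) (1 , s≤s (s≤s z≤n) , (λ ()) , λ ())

          wit₃ : ∀ i → i < 3 → Wit 3 V i (Z i) (F i) (S i)
          wit₃ i i< rewrite Z≡ i i< | F≡ i i< | S≡ i i< with T-∨₁ {((zs at i) ≡ᵇ 1) ∧ _} (allBelow-sound {3} {witᵇ fa qs zs fs ss} (proj₁ (T-∧₁ {allBelow 3 (witᵇ fa qs zs fs ss)} R)) i<)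
          ... | inj₁ p with T-∧₁ {(zs at i) ≡ᵇ 1} p
          ...   | z , q with T-∧₁ {(ss at i) ≡ᵇ (fs at i)} q
          ...     | s , c = single (≡ᵇ⇒≡ _ _ z) (cong v (≡ᵇ⇒≡ _ _ s)) (cl-sound (fs at i) i (nx 3 i) i< (nx<k i<) (inj₂ refl) (third i i<) c)
          wit₃ i i< | inj₂ p with T-∧₁ {(zs at i) ≡ᵇ 2} p
          ... | z , q with T-∧₁ {classᵇ fa qs (fs at i) i i} q
          ...   | c , q′ with T-∧₁ {classᵇ fa qs (ss at i) (nx 3 i) (nx 3 i)} q′
          ...     | d , e = double (≡ᵇ⇒≡ _ _ z)
                      (cl-sound (fs at i) i i i< i< (inj₁ refl) (proj₁ (third i i<) , proj₁ (proj₂ (third i i<)) , proj₁ (proj₂ (proj₂ (third i i<))) , proj₁ (proj₂ (proj₂ (third i i<)))) c)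
                      (cl-sound (ss at i) (nx 3 i) (nx 3 i) (nx<k i<) (nx<k i<) (inj₁ refl)
                        (proj₁ (third i i<) , proj₁ (proj₂ (third i i<)) , proj₂ (proj₂ (proj₂ (third i i<))) , proj₂ (proj₂ (proj₂ (third i i<)))) d)
                      (adj-sound hs e)

        obstacle₃ : Obs 3 V Z F S
        obstacle₃ = obs ≤-refl (λ i i< → E< (clique₃ i (nx 3 i) i< (nx<k i<) (λ e → nx≢ (s≤s (s≤s z≤n)) i< (sym e))))
          (λ i j i< j< e → case i ≟ j of λ { (yes p) → p ; (no p) → ⊥-elim (E-irr (subst (E (V i)) (sym e) (clique₃ i j i< j< p))) })
          clique₃ wit₃

        essential₃-sound : Essential 3 V F S
        essential₃-sound = essential-by sound
         where
         sound : ∀ {p q} → IsW 3 F S p → IsW 3 F S q → E p q → Nested 3 V p q ⊎ Together 3 F S p q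
         sound {p} {q} (isW {i} i< wp) (isW {j} j< wq) e = go wp wq
          where
          valid = allBelow-sound {3} {valid₄ᵇ fa qs fs ss i} (allBelow-sound {3} {λ i → allBelow 3 (valid₄ᵇ fa qs fs ss i)} (proj₂ (T-∧₁ {allBelow 3 (witᵇ fa qs zs fs ss)} R)) i<) j<
          v₁ = T-∧₁ {validᵇ fa qs fs ss (fs at i) (fs at j)} valid
          v₂ = T-∧₁ {validᵇ fa qs fs ss (fs at i) (ss at j)} (proj₂ v₁)
          v₃ = T-∧₁ {validᵇ fa qs fs ss (ss at i) (fs at j)} (proj₂ v₂)
          nested : ∀ {x y} → T (allBelow 3 (nestedᵇ fa qs x y)) →
                   ∀ j → j < 3 → ¬ E (v x) (V j) → ¬ E (v y) (V j)
          nested {x} {y} t j j< ne rewrite V≡ j j< with T-∨₁ {has isAdj fa x (qs at j)} (allBelow-sound {3} {nestedᵇ fa qs x y} t j<)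
          ... | inj₁ a = ⊥-elim (ne (adj-sound hs a))
          ... | inj₂ b = non-sound hs b
          place : ∀ {x l} → l < 3 → T ((x ≡ᵇ (fs at l)) ∨ (x ≡ᵇ (ss at l))) → v x ≡ F l ⊎ v x ≡ S l
          place {x} {l} l< t with T-∨₁ {x ≡ᵇ (fs at l)} t
          ... | inj₁ a = inj₁ (trans (cong v (≡ᵇ⇒≡ _ _ a)) (sym (F≡ l l<)))
          ... | inj₂ a = inj₂ (trans (cong v (≡ᵇ⇒≡ _ _ a)) (sym (S≡ l l<)))
          fin : ∀ {x y} → p ≡ v x → q ≡ v y → T (validᵇ fa qs fs ss x y) → Nested 3 V p q ⊎ Together 3 F S p q
          fin {x} {y} refl refl t with T-∨₁ {has isNon fa x y} t
          ... | inj₁ a = ⊥-elim (non-sound hs a e)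
          ... | inj₂ a with T-∨₁ {x ≡ᵇ y} a
          ...   | inj₁ b with refl ← ≡ᵇ⇒≡ x y b = ⊥-elim (E-irr e)
          ...   | inj₂ b with T-∨₁ {allBelow 3 (nestedᵇ fa qs x y)} b
          ...     | inj₁ c = inj₁ (inj₁ (nested {x} {y} c))
          ...     | inj₂ c with T-∨₁ {allBelow 3 (nestedᵇ fa qs y x)} c
          ...       | inj₁ d = inj₁ (inj₂ (nested {y} {x} d))
          ...       | inj₂ d with anyBelow-sound {3} {bothᵇ fs ss x y} d
          ...         | l , l< , m with T-∧₁ {(x ≡ᵇ (fs at l)) ∨ (x ≡ᵇ (ss at l))} m
          ...           | m₁ , m₂ = inj₂ (l , l< , place l< m₁ , place l< m₂)
          go : (p ≡ F i ⊎ p ≡ S i) → (q ≡ F j ⊎ q ≡ S j) → Nested 3 V p q ⊎ Together 3 F S p q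
          go (inj₁ a) (inj₁ b) = fin (trans a (F≡ i i<)) (trans b (F≡ j j<)) (proj₁ v₁)
          go (inj₁ a) (inj₂ b) = fin (trans a (F≡ i i<)) (trans b (S≡ j j<)) (proj₁ v₂)
          go (inj₂ a) (inj₁ b) = fin (trans a (S≡ i i<)) (trans b (F≡ j j<)) (proj₁ v₃)
          go (inj₂ a) (inj₂ b) = fin (trans a (S≡ i i<)) (trans b (S≡ j j<)) (proj₂ v₃)

-- The working memory: array 9 holds k, the number m of listed edges, the order n
-- and two flags, arrays 10 to 13 the enumeration, 18 and 19 the listed edges,
-- 20 to 22 the classes of the witnesses, 23 and 24 flags of the witnesses, 26
-- and 27 the first witness and the size of the next witness enumeration.

upd : (ℕ → ℕ) → ℕ → ℕ → ℕ → ℕ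
upd f i x j = if i ≡ᵇ j then x else f j

upd-elim : ∀ (P : ℕ → ℕ → Set) {f i x} → P i x → (∀ j → i ≢ j → P j (f j)) → ∀ j → P j (upd f i x j)
upd-elim P {f} {i} {x} p q j with i ≡ᵇ j in eq
... | true  with refl ← ≡ᵇ⇒≡ i j (subst T (sym eq) tt) = p
... | false = q j λ e → subst T eq (≡⇒≡ᵇ i j e)

upd-same : ∀ f i x → upd f i x i ≡ x
upd-same f i x rewrite Equivalence.to T-≡ (≡⇒≡ᵇ i i refl) = refl

upd-other : ∀ f {i j} x → i ≢ j → upd f i x j ≡ f j
upd-other f {i} {j} x ne with i ≡ᵇ j in eq
... | true  = ⊥-elim (ne (≡ᵇ⇒≡ i j (subst T (sym eq) tt)))
... | false = refl

upd-below : ∀ (P : ℕ → ℕ → Set) {f i x} → (∀ j → j < i → P j (f j)) → P i x → ∀ j → j < suc i → P j (upd f i x j)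
upd-below P {f} {i} {x} old new j j<i = upd-elim (λ j y → j < suc i → P j y) (λ _ → new)
  (λ j i≢j lt → old j (≤∧≢⇒< (s≤s⁻¹ lt) (i≢j ∘ sym))) j j<i

below : ∀ {i} {P : ℕ → Set} → (∀ j → j < i → P j) → P i → ∀ j → j < suc i → P j
below old new j j<i with m≤n⇒m<n∨m≡n (s≤s⁻¹ j<i)
... | inj₁ lt   = old j lt
... | inj₂ refl = new

-- Preparation: classes of the witnesses and answers to two adjacency questions for each

module Core (Γ : Graphᴺ) (Wt : ℕ → Set) (M : ℕ) (64≤M : 64 ≤ M) (W : ℕ) (M≤W : M ≤ W) where
  open Obstacles Γ
  open Hoare M 64≤M public
  open Triples W M≤W public

  -- Completeness is demanded on `Wt` only. For adjacency lists `Wt` is trivial; for circular-arc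
  -- models it consists of the given witnesses, since only edges between them are sought.
  record Edges (m : ℕ) (src tgt : ℕ → ℕ) : Set where
    field
      sound    : ∀ e → e < m → E (src e) (tgt e)
      complete : ∀ {x y} → Wt x → Wt y → E x y → Σ ℕ λ e → e < m × src e ≡ x × tgt e ≡ y

  record State (k m n : ℕ) (V Z F S src tgt : ℕ → ℕ) : Set where
    constructor state
    field
      obstacle : Obs k V Z F S
      original : ∀ {x} → IsW k F S x → Wt x
      listed   : Edges m src tgt
      n≡order  : n ≡ order

  St : Memory → Set
  St μ = State (μ 9 0) (μ 9 1) (μ 9 2) (μ 10) (μ 11) (μ 12) (μ 13) (μ 18) (μ 19)

  Marks : ℕ → (V F S lo hi mark : ℕ → ℕ) → Set
  Marks k V F S lo hi mark = ∀ x → x < order → mark x ≢ 0 → mark x ≡ 1 × Cl k V x (lo x) (hi x) × IsW k F S x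

  marks-step : ∀ {k V F S lo hi mark x l h} → Cl k V x l h → IsW k F S x → Marks k V F S lo hi mark →
               Marks k V F S (upd lo x l) (upd hi x h) (upd mark x 1)
  marks-step {x = x} c w m y y< ne with x ≡ᵇ y in eq
  ... | true  with refl ← ≡ᵇ⇒≡ x y (subst T (sym eq) tt) = refl , c , w
  ... | false = m y y< ne

  mark-keeps : ∀ {mark x y} → mark y ≢ 0 → upd mark x 1 y ≢ 0
  mark-keeps {mark} {x} {y} ne = upd-elim (λ j v → mark j ≢ 0 → v ≢ 0) {mark} {x} {1} (λ _ ()) (λ _ _ ne → ne) y ne

  mark-new : ∀ {mark x} → upd mark x 1 x ≢ 0
  mark-new {mark} {x} e with () ← trans (sym (upd-same mark x 1)) e

  Flag : ℕ → ℕ → ℕ → Set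
  Flag c x y = (c ≡ 1 × E x y) ⊎ (c ≡ 0 × ¬ E x y)

  Clear : ℕ → (f g h : ℕ → ℕ) → Set
  Clear n f g h = ∀ v → v < n → f v ≡ 0 × g v ≡ 0 × h v ≡ 0

  -- The preparation is repeated whenever the enumeration has changed, so the marks and flags of an
  -- earlier run have to be erased.
  clear : Program
  clear = for 10 below (9 [ lit 2 ]) loop
    (22 [ slot 10 ]≔ lit 0 ⍮ 23 [ slot 10 ]≔ lit 0 ⍮ 24 [ slot 10 ]≔ lit 0)

  Cleared : Memory → Set
  Cleared μ = St μ × Clear (μ 9 2) (μ 22) (μ 23) (μ 24)

  clear-triple : ⟨ St ⟩ clear ⟨ Cleared ⟩
  clear-triple = loops 10 (9 [ lit 2 ]) _ λ μ₀ r → record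
    { times  = μ₀ 9 2
    ; Inv    = λ i μ → St μ × μ 9 2 ≡ μ₀ 9 2 × Clear i (μ 22) (μ 23) (μ 24)
    ; times≤ = λ B → B 9 2
    ; fixed  = λ _ _ (_ , e , _) → e
    ; base   = r , refl , λ _ ()
    ; step   = λ μ _ lt (r , e , c) → μ 8 10 , refl , μ 8 10 , refl , μ 8 10 , refl , refl , r , e ,
        λ v v< → upd-below (λ _ x → x ≡ 0) (λ j j< → proj₁ (c j j<)) refl v v< ,
                 upd-below (λ _ x → x ≡ 0) (λ j j< → proj₁ (proj₂ (c j j<))) refl v v< ,
                 upd-below (λ _ x → x ≡ 0) (λ j j< → proj₂ (proj₂ (c j j<))) refl v v<
    ; exit   = λ μ (r , e , c) → r , subst (λ n → Clear n (μ 22) (μ 23) (μ 24)) (sym e) c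
    }

  Nexts : ℕ → ℕ → (Z F NF NZ : ℕ → ℕ) → Set
  Nexts k i Z F NF NZ = ∀ j → j < i → NF j ≡ F (nx k j) × NZ j ≡ Z (nx k j)

  next-slot : Program
  next-slot = cond ((slot 10 ⊕ lit 1) ≺ (9 [ lit 0 ])) (8 [ lit 2 ]≔ (slot 10 ⊕ lit 1)) (8 [ lit 2 ]≔ lit 0)

  next-slot-wp : ∀ Q {μ} → Bounded μ → μ 8 10 < μ 9 0 → Q (μ [ 8 , 2 ↦ nx (μ 9 0) (μ 8 10) ]) → wp next-slot Q μ
  next-slot-wp Q {μ} B lt q =
    (λ p → let e = trans (nx-suc {μ 9 0} (subst (_< μ 9 0) (+-comm (μ 8 10) 1) p)) (+-comm 1 (μ 8 10)) in
           nx (μ 9 0) (μ 8 10) , sym e , ≤-trans (≤-reflexive e) (≤-trans (<⇒≤ p) (B 9 0)) , q) ,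
    (λ p → subst (λ x → Q (μ [ 8 , 2 ↦ x ])) (last (nx-cases lt) p) q)
    where
    last : _ → μ 9 0 ≤ μ 8 10 + 1 → nx (μ 9 0) (μ 8 10) ≡ 0
    last (inj₁ (p , _)) le = ⊥-elim (<-irrefl refl (<-≤-trans p (≤-trans le (≤-reflexive (+-comm (μ 8 10) 1)))))
    last (inj₂ (_ , e)) _ = e

  classify-rest classify : Program
  classify-rest =
     8 [ lit 3 ]≔ (12 [ slot 10 ]) ⍮ 26 [ slot 10 ]≔ (12 [ slot 2 ]) ⍮ 27 [ slot 10 ]≔ (11 [ slot 2 ]) ⍮
     22 [ slot 3 ]≔ lit 1 ⍮ 20 [ slot 3 ]≔ slot 10 ⍮
     cond ((11 [ slot 10 ]) ≈ lit 1)
       (21 [ slot 3 ]≔ slot 2)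
       (21 [ slot 3 ]≔ slot 10 ⍮ 8 [ lit 3 ]≔ (13 [ slot 10 ]) ⍮ 22 [ slot 3 ]≔ lit 1 ⍮ 20 [ slot 3 ]≔ slot 2 ⍮ 21 [ slot 3 ]≔ slot 2)
  classify = for 10 below (9 [ lit 0 ]) loop (next-slot ⍮ classify-rest)

  Zero : ℕ → (C B : ℕ → ℕ) → Set
  Zero n C B = ∀ v → v < n → C v ≡ 0 × B v ≡ 0

  record Classes (k i : ℕ) (V Z F S lo hi mark NF NZ : ℕ → ℕ) : Set where
    constructor classes
    field
      marks  : Marks k V F S lo hi mark
      marked : ∀ j → j < i → mark (F j) ≢ 0 × mark (S j) ≢ 0
      nexts  : Nexts k i Z F NF NZ

  Classified : Memory → Set
  Classified μ = St μ × Zero (μ 9 2) (μ 23) (μ 24) × Classes (μ 9 0) (μ 9 0) (μ 10) (μ 11) (μ 12) (μ 13) (μ 20) (μ 21) (μ 22) (μ 26) (μ 27)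

  ClassifyInv : Memory → ℕ → Memory → Set
  ClassifyInv μ₀ i μ = μ 9 0 ≡ μ₀ 9 0 × St μ × Zero (μ 9 2) (μ 23) (μ 24) × Classes (μ 9 0) i (μ 10) (μ 11) (μ 12) (μ 13) (μ 20) (μ 21) (μ 22) (μ 26) (μ 27)

  classify-triple : ⟨ Cleared ⟩ classify ⟨ Classified ⟩
  classify-triple = loops 10 (9 [ lit 0 ]) _ λ μ₀ (r , c) → record
    { times  = μ₀ 9 0
    ; Inv    = ClassifyInv μ₀
    ; times≤ = λ B → B 9 0
    ; fixed  = λ _ _ (e , _) → e
    ; base   = refl , r , (λ v v< → proj₂ (c v v<)) , classes (λ x x< ne → ⊥-elim (ne (proj₁ (c x (≤-trans x< (≤-reflexive (sym (State.n≡order r)))))))) (λ _ ()) (λ _ ())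
    ; step   = λ μ B lt (e , s , zs , cs) → next-slot-wp (wp classify-rest (After (ClassifyInv μ₀) 10 μ)) B (subst (μ 8 10 <_) (sym e) lt) (body μ₀ μ e (subst (μ 8 10 <_) (sym e) lt) s zs cs)
    ; exit   = λ { μ (e , s , zs , cs) → s , zs , subst (λ i → Classes (μ 9 0) i (μ 10) (μ 11) (μ 12) (μ 13) (μ 20) (μ 21) (μ 22) (μ 26) (μ 27)) (sym e) cs }
    }
    where
    body : ∀ μ₀ μ → μ 9 0 ≡ μ₀ 9 0 → μ 8 10 < μ 9 0 → St μ → Zero (μ 9 2) (μ 23) (μ 24) → Classes (μ 9 0) (μ 8 10) (μ 10) (μ 11) (μ 12) (μ 13) (μ 20) (μ 21) (μ 22) (μ 26) (μ 27) →
           wp classify-rest (After (ClassifyInv μ₀) 10 μ) (μ [ 8 , 2 ↦ nx (μ 9 0) (μ 8 10) ])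
    body μ₀ μ e lt s zs (classes ms md ns) =
      F i , refl , i , refl , F (nx k i) , refl , i , refl , μ 11 (nx k i) , refl , F i , refl , F i , refl , i , refl ,
      (λ z1 → F i , refl , nx k i , refl , refl , e , s , zs , fin₁ z1 (Obs.wit (State.obstacle s) i lt)) ,
      (λ z≢1 → F i , refl , i , refl , S i , refl , S i , refl , S i , refl , nx k i , refl , S i , refl , nx k i , refl ,
               refl , e , s , zs , fin₂ z≢1 (Obs.wit (State.obstacle s) i lt))
      where
      i = μ 8 10
      k = μ 9 0
      F = μ 12
      S = μ 13
      nexts′ : Nexts k (suc i) (μ 11) F (upd (μ 26) i (F (nx k i))) (upd (μ 27) i (μ 11 (nx k i)))
      nexts′ j j< = upd-below (λ j x → x ≡ F (nx k j)) (λ j j< → proj₁ (ns j j<)) refl j j< ,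
                    upd-below (λ j x → x ≡ μ 11 (nx k j)) (λ j j< → proj₂ (ns j j<)) refl j j<
      fin₁ : μ 11 i ≡ 1 → Wit k (μ 10) i (μ 11 i) (F i) (S i) → Classes k (suc i) (μ 10) (μ 11) F S (upd (μ 20) (F i) i) (upd (μ 21) (F i) (nx k i)) (upd (μ 22) (F i) 1) (upd (μ 26) i (F (nx k i))) (upd (μ 27) i (μ 11 (nx k i)))
      fin₁ z1 (double z _ _ _) with () ← trans (sym z1) z
      fin₁ z1 (single _ e c) = classes (marks-step c (isW lt (inj₁ refl)) ms)
        (below (λ j j< → mark-keeps {μ 22} {F i} (proj₁ (md j j<)) , mark-keeps {μ 22} {F i} (proj₂ (md j j<)))
               (mark-new {μ 22} {F i} , subst (λ x → upd (μ 22) (F i) 1 x ≢ 0) (sym e) (mark-new {μ 22} {F i}))) nexts′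
      fin₂ : μ 11 i ≢ 1 → Wit k (μ 10) i (μ 11 i) (F i) (S i) → Classes k (suc i) (μ 10) (μ 11) F S (upd (upd (μ 20) (F i) i) (S i) (nx k i)) (upd (upd (μ 21) (F i) i) (S i) (nx k i)) (upd (upd (μ 22) (F i) 1) (S i) 1)
               (upd (μ 26) i (F (nx k i))) (upd (μ 27) i (μ 11 (nx k i)))
      fin₂ z≢1 (single z _ _) = ⊥-elim (z≢1 z)
      fin₂ z≢1 (double _ c d _) = classes (marks-step d (isW lt (inj₂ refl)) (marks-step c (isW lt (inj₁ refl)) ms))
        (below (λ j j< → keep₂ (proj₁ (md j j<)) , keep₂ (proj₂ (md j j<)))
               (mark-keeps {upd (μ 22) (F i) 1} {S i} (mark-new {μ 22} {F i}) , mark-new {upd (μ 22) (F i) 1} {S i})) nexts′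
        where
        keep₂ : ∀ {y} → μ 22 y ≢ 0 → upd (upd (μ 22) (F i) 1) (S i) 1 y ≢ 0
        keep₂ ne = mark-keeps {upd (μ 22) (F i) 1} {S i} (mark-keeps {μ 22} {F i} ne)

  -- With h the upper nonneighbour of a witness, array 23 records its adjacency to `F (nx k h)` and
  -- array 24 its adjacency to `S h`. Depending on whether the witness has one or two nonneighbours,
  -- these are the questions of both passes.
  flags : Program
  flags = for 10 below (9 [ lit 1 ]) loop
    cond ((22 [ 18 [ slot 10 ] ]) ≈ lit 1)
      (cond ((19 [ slot 10 ]) ≈ (26 [ 21 [ 18 [ slot 10 ] ] ])) (23 [ 18 [ slot 10 ] ]≔ lit 1) skip ⍮
       cond ((19 [ slot 10 ]) ≈ (13 [ 21 [ 18 [ slot 10 ] ] ])) (24 [ 18 [ slot 10 ] ]≔ lit 1) skip)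
      skip

  record Flags (e : ℕ) (src tgt hi mark T C : ℕ → ℕ) : Set where
    constructor mkflags
    field
      right : ∀ x → x < order → mark x ≢ 0 → C x ≡ 0 ⊎ C x ≡ 1 × E x (T (hi x))
      done  : ∀ e′ → e′ < e → mark (src e′) ≢ 0 → tgt e′ ≡ T (hi (src e′)) → C (src e′) ≡ 1

  flags-hit : ∀ {e src tgt hi mark T C} → E (src e) (tgt e) → tgt e ≡ T (hi (src e)) → Flags e src tgt hi mark T C →
              Flags (suc e) src tgt hi mark T (upd C (src e) 1)
  flags-hit {e} {src} {tgt} {hi} {mark} {T} {C} edge eq (mkflags r d) = mkflags
    (λ x x< mx → upd-elim (λ x c → x < order → mark x ≢ 0 → c ≡ 0 ⊎ c ≡ 1 × E x (T (hi x)))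
       (λ _ _ → inj₂ (refl , subst (E (src e)) eq edge)) (λ x _ → r x) x x< mx)
    (below (λ e′ e′< mx te → keep (d e′ e′< mx te)) (λ _ _ → upd-same C (src e) 1))
    where
    keep : ∀ {y} → C y ≡ 1 → upd C (src e) 1 y ≡ 1
    keep {y} c with src e ≡ᵇ y
    ... | true  = refl
    ... | false = c

  flags-miss : ∀ {e src tgt hi mark T C} → (mark (src e) ≢ 0 → tgt e ≢ T (hi (src e))) → Flags e src tgt hi mark T C →
               Flags (suc e) src tgt hi mark T C
  flags-miss ne (mkflags r d) = mkflags r (below d (λ mx te → ⊥-elim (ne mx te)))

  record Prepared (k m n : ℕ) (V Z F S src tgt lo hi mark C B NF NZ : ℕ → ℕ) : Set where
    field
      st      : State k m n V Z F S src tgt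
      marks   : Marks k V F S lo hi mark
      marked  : ∀ {x} → IsW k F S x → mark x ≡ 1
      nexts   : Nexts k k Z F NF NZ
      flag-f  : ∀ {x l h} → IsW k F S x → Cl k V x l h → Flag (C x) x (F (nx k h))
      flag-s  : ∀ {x l h} → IsW k F S x → Cl k V x l h → Flag (B x) x (S h)

    open State st public
    open Obs obstacle public using (3≤k)

    known : ∀ {x l h} → IsW k F S x → Cl k V x l h → lo x ≡ l × hi x ≡ h
    known {x} w c = Cl-unique 3≤k (proj₁ (proj₂ (marks x (Cl.x< c) (λ z → case trans (sym z) (marked w) of λ ())))) c

  Prep : Memory → Set
  Prep μ = Prepared (μ 9 0) (μ 9 1) (μ 9 2) (μ 10) (μ 11) (μ 12) (μ 13) (μ 18) (μ 19) (μ 20) (μ 21) (μ 22) (μ 23) (μ 24) (μ 26) (μ 27)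

  FlagsInv : Memory → ℕ → Memory → Set
  FlagsInv μ₀ e μ = μ 9 1 ≡ μ₀ 9 1 × St μ × Classes (μ 9 0) (μ 9 0) (μ 10) (μ 11) (μ 12) (μ 13) (μ 20) (μ 21) (μ 22) (μ 26) (μ 27) ×
                    Flags e (μ 18) (μ 19) (μ 21) (μ 22) (μ 26) (μ 23) × Flags e (μ 18) (μ 19) (μ 21) (μ 22) (μ 13) (μ 24)

  flags-triple : ⟨ Classified ⟩ flags ⟨ Prep ⟩
  flags-triple = loops 10 (9 [ lit 1 ]) _ λ μ₀ (r , z , c) → record
    { times  = μ₀ 9 1
    ; Inv    = FlagsInv μ₀
    ; times≤ = λ B → B 9 1
    ; fixed  = λ _ _ (e , _) → e
    ; base   = refl , r , c , initial r (λ v v< → proj₁ (z v v<)) , initial r (λ v v< → proj₂ (z v v<))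
    ; step   = λ μ B lt (e , s , c , f , g) →
                let edge = Edges.sound (State.listed s) (μ 8 10) (subst (μ 8 10 <_) (sym e) lt) in
                (λ _ → (λ h → x μ , refl , (λ h′ → x μ , refl , refl , e , s , c , flags-hit edge h f , flags-hit edge h′ g) ,
                               (λ h′ → refl , e , s , c , flags-hit edge h f , flags-miss (λ _ → h′) g)) ,
                        (λ h → (λ h′ → x μ , refl , refl , e , s , c , flags-miss (λ _ → h) f , flags-hit edge h′ g) ,
                               (λ h′ → refl , e , s , c , flags-miss (λ _ → h) f , flags-miss (λ _ → h′) g))) ,
                (λ h → refl , e , s , c , flags-miss (λ m → ⊥-elim (h (proj₁ (Classes.marks c _ (E< edge) m)))) f ,
                                          flags-miss (λ m → ⊥-elim (h (proj₁ (Classes.marks c _ (E< edge) m)))) g)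
    ; exit   = λ μ (e , s , c , f , g) → finish s c (subst (λ m → Flags m _ _ _ _ _ _) (sym e) f) (subst (λ m → Flags m _ _ _ _ _ _) (sym e) g)
    }
    where
    x : Memory → ℕ
    x μ = μ 18 (μ 8 10)

    initial : ∀ {k m n V Z F S src tgt hi mark T C} → State k m n V Z F S src tgt → (∀ v → v < n → C v ≡ 0) → Flags 0 src tgt hi mark T C
    initial s z = mkflags (λ x x< _ → inj₁ (z x (subst (x <_) (sym (State.n≡order s)) x<))) (λ _ ())

    finish : ∀ {k m n V Z F S src tgt lo hi mark NF NZ C B} → State k m n V Z F S src tgt → Classes k k V Z F S lo hi mark NF NZ →
             Flags m src tgt hi mark NF C → Flags m src tgt hi mark S B → Prepared k m n V Z F S src tgt lo hi mark C B NF NZ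
    finish {k} {m} {n} {V} {Z} {F} {S} {src} {tgt} {lo} {hi} {mark} {NF} {NZ} s c f g = record
      { st = s ; marks = marks ; marked = marked′ ; nexts = nexts
      ; flag-f = λ w cx → subst (Flag _ _) (proj₁ (nexts _ (Cl.h< cx))) (flag f w (cls w cx) (subst (IsW k F S) (sym (proj₁ (nexts _ (Cl.h< cx)))) (isW (nx<k (Cl.h< cx)) (inj₁ refl))))
      ; flag-s = λ w cx → flag g w (cls w cx) (isW (Cl.h< cx) (inj₂ refl)) }
      where
      open Classes c
      open State s
      ne : ∀ {x} → IsW k F S x → mark x ≢ 0
      ne (isW i<k (inj₁ refl)) = proj₁ (marked _ i<k)
      ne (isW i<k (inj₂ refl)) = proj₂ (marked _ i<k)
      x<order : ∀ {x} → IsW k F S x → x < order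
      x<order (isW {i} i<k p) with Obs.wit obstacle i i<k | p
      ... | single _ _ c | inj₁ refl = Cl.x< c
      ... | single _ e c | inj₂ refl = subst (_< order) (sym e) (Cl.x< c)
      ... | double _ c _ _ | inj₁ refl = Cl.x< c
      ... | double _ _ c _ | inj₂ refl = Cl.x< c
      marked′ : ∀ {x} → IsW k F S x → mark x ≡ 1
      marked′ w = proj₁ (marks _ (x<order w) (ne w))
      cls : ∀ {x l h} → IsW k F S x → Cl k V x l h → h ≡ hi x
      cls w cx = sym (proj₂ (Cl-unique (Obs.3≤k obstacle) (proj₁ (proj₂ (marks _ (x<order w) (ne w)))) cx))
      flag : ∀ {T C x h} → Flags m src tgt hi mark T C → IsW k F S x → h ≡ hi x → IsW k F S (T h) → Flag (C x) x (T h)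
      flag {T} {C} {x} (mkflags r d) w refl wt with r x (x<order w) (ne w) | E? x (T (hi x))
      ... | inj₂ q | _ = inj₁ q
      ... | inj₁ q | no np = inj₂ (q , np)
      ... | inj₁ q | yes p with Edges.complete listed (original w) (original wt) p
      ...   | e , e< , refl , te with () ← trans (sym q) (d e e< (ne w) te)

  prepare : Program
  prepare = clear ⍮ classify ⍮ flags

  prepare-triple : ⟨ St ⟩ prepare ⟨ Prep ⟩
  prepare-triple = clear-triple ▹ classify-triple ▹ flags-triple


-- Invariance under changes of the arrays from index k on

module Cong (Γ : Graphᴺ) where
  open Obstacles Γ
  open FirstPass Γ using (Gap; gap-by)

  Agree : ℕ → (f g : ℕ → ℕ) → Set
  Agree k f g = ∀ i → i < k → f i ≡ g i

  agree-sym : ∀ {k f g} → Agree k f g → Agree k g f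
  agree-sym a i i<k = sym (a i i<k)

  Cl-cong : ∀ {k V V′ x l h} → Agree k V V′ → Cl k V x l h → Cl k V′ x l h
  Cl-cong {x = x} a (cl x< l< h< sh out nl nh nbr) = cl x< l< h< sh (λ j j< e → out j j< (trans e (sym (a j j<))))
    (λ e → nl (subst (E x) (sym (a _ l<)) e)) (λ e → nh (subst (E x) (sym (a _ h<)) e)) (λ j j< p q → subst (E x) (a j j<) (nbr j j< p q))

  IsW-cong : ∀ {k F F′ S S′ x} → Agree k F F′ → Agree k S S′ → IsW k F S x → IsW k F′ S′ x
  IsW-cong a b (isW i<k w) = isW i<k (Sum.map (λ e → trans e (a _ i<k)) (λ e → trans e (b _ i<k)) w)

  Obs-cong : ∀ {k V V′ Z Z′ F F′ S S′} → Agree k V V′ → Agree k Z Z′ → Agree k F F′ → Agree k S S′ → Obs k V Z F S → Obs k V′ Z′ F′ S′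
  Obs-cong {k} v z f s (obs 3≤k V< inj cliq wit) = obs 3≤k (λ i i< → subst (_< order) (v i i<) (V< i i<))
    (λ i j i< j< e → inj i j i< j< (trans (v i i<) (trans e (sym (v j j<)))))
    (λ i j i< j< ne → subst₂ E (v i i<) (v j j<) (cliq i j i< j< ne))
    λ i i< → go i i< (wit i i<)
    where
    go : ∀ i → i < k → Wit k _ i _ _ _ → Wit k _ i _ _ _
    go i i< (single e e′ c) = single (trans (sym (z i i<)) e) (trans (sym (s i i<)) (trans e′ (f i i<))) (subst (λ x → Cl _ _ x _ _) (f i i<) (Cl-cong v c))
    go i i< (double e c d e′) = double (trans (sym (z i i<)) e) (subst (λ x → Cl _ _ x _ _) (f i i<) (Cl-cong v c))
      (subst (λ x → Cl _ _ x _ _) (s i i<) (Cl-cong v d)) (subst₂ E (f i i<) (s i i<) e′)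

  Gap-cong : ∀ {t V V′ F F′ S S′} → Agree (suc t) V V′ → Agree (suc t) F F′ → Agree (suc t) S S′ → Gap t V F S → Gap t V′ F′ S′
  Gap-cong v f s g = gap-by λ wp wq cp cq → Gap.apart g (IsW-cong (agree-sym f) (agree-sym s) wp) (IsW-cong (agree-sym f) (agree-sym s) wq)
                                   (Cl-cong (agree-sym v) cp) (Cl-cong (agree-sym v) cq)

  NoDbl-cong : ∀ {k V V′ F F′ S S′} → Agree k V V′ → Agree k F F′ → Agree k S S′ → NoDbl k V F S → NoDbl k V′ F′ S′
  NoDbl-cong {k} {V} {V′} v f s nd = no-double-by λ {p} {q} wp wq e → Sum.map nest (Sum.map nbr nbr) (NoDbl.bad nd (IsW-cong (agree-sym f) (agree-sym s) wp) (IsW-cong (agree-sym f) (agree-sym s) wq) e)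
    where
    nest : ∀ {p q} → Nested k V p q → Nested k V′ p q
    nest {p} {q} = Sum.map (λ h j j< ne e → h j j< (λ e → ne (subst (E p) (v j j<) e)) (subst (E q) (sym (v j j<)) e))
                           (λ h j j< ne e → h j j< (λ e → ne (subst (E q) (v j j<) e)) (subst (E p) (sym (v j j<)) e))
    nbr : ∀ {p q} → Neighbouring k V p q → Neighbouring k V′ p q
    nbr (i , c , d) = i , Cl-cong v c , Cl-cong v d

-- The program that passes to a shortest stretch

module Restricting (Γ : Graphᴺ) (Wt : ℕ → Set) (M : ℕ) (64≤M : 64 ≤ M) (W : ℕ) (M≤W : M ≤ W) where
  open Core Γ Wt M 64≤M W M≤W
  open Obstacles Γ
  open Restriction Γ
  open FirstPass Γ using (Gap; gap-by)
  open Cong Γ public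

  State-cong : ∀ {k m n V V′ Z Z′ F F′ S S′ src tgt} → Agree k V V′ → Agree k Z Z′ → Agree k F F′ → Agree k S S′ →
               State k m n V Z F S src tgt → State k m n V′ Z′ F′ S′ src tgt
  State-cong v z f s (state o w l e) = state (Obs-cong v z f s o) (λ x → w (IsW-cong (agree-sym f) (agree-sym s) x)) l e

  copy-back : Program
  copy-back = for 10 below (9 [ lit 0 ]) loop
    (10 [ slot 10 ]≔ (14 [ slot 10 ]) ⍮ 11 [ slot 10 ]≔ (15 [ slot 10 ]) ⍮ 12 [ slot 10 ]≔ (16 [ slot 10 ]) ⍮ 13 [ slot 10 ]≔ (17 [ slot 10 ]))

  -- Only the first `k` cells are copied and old values remain behind them, so `Φ` has to respect
  -- agreement below `k`.
  copy-back-triple : ∀ (Φ : (w : ℕ) (k m n : ℕ) (V Z F S src tgt : ℕ → ℕ) → Set) →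
    (∀ {w k m n V V′ Z Z′ F F′ S S′ src tgt} → Agree k V V′ → Agree k Z Z′ → Agree k F F′ → Agree k S S′ →
       Φ w k m n V Z F S src tgt → Φ w k m n V′ Z′ F′ S′ src tgt) →
    ⟨ (λ μ → Φ (μ 9 4) (μ 9 0) (μ 9 1) (μ 9 2) (μ 14) (μ 15) (μ 16) (μ 17) (μ 18) (μ 19)) ⟩ copy-back
    ⟨ (λ μ → Φ (μ 9 4) (μ 9 0) (μ 9 1) (μ 9 2) (μ 10) (μ 11) (μ 12) (μ 13) (μ 18) (μ 19)) ⟩
  copy-back-triple Φ resp = loops 10 (9 [ lit 0 ]) _ λ μ₀ φ → record
    { times  = μ₀ 9 0
    ; Inv    = λ i μ → μ 9 0 ≡ μ₀ 9 0 × Φ (μ 9 4) (μ 9 0) (μ 9 1) (μ 9 2) (μ 14) (μ 15) (μ 16) (μ 17) (μ 18) (μ 19) ×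
                 Agree i (μ 14) (μ 10) × Agree i (μ 15) (μ 11) × Agree i (μ 16) (μ 12) × Agree i (μ 17) (μ 13)
    ; times≤ = λ B → B 9 0
    ; fixed  = λ _ _ (e , _) → e
    ; base   = refl , φ , (λ _ ()) , (λ _ ()) , (λ _ ()) , (λ _ ())
    ; step   = λ μ B lt (e , φ , a , b , c , d) → let i = μ 8 10 in
        i , refl , μ 14 i , refl , i , refl , μ 15 i , refl , i , refl , μ 16 i , refl , i , refl , μ 17 i , refl , refl , e , φ ,
        upd-below (λ j x → μ 14 j ≡ x) a refl , upd-below (λ j x → μ 15 j ≡ x) b refl ,
        upd-below (λ j x → μ 16 j ≡ x) c refl , upd-below (λ j x → μ 17 j ≡ x) d refl
    ; exit   = λ μ (e , φ , a , b , c , d) → resp (subst (λ k → Agree k _ _) (sym e) a) (subst (λ k → Agree k _ _) (sym e) b)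
                 (subst (λ k → Agree k _ _) (sym e) c) (subst (λ k → Agree k _ _) (sym e) d) φ
    }

  -- The candidate with the fewest vertices is sought; slot 4 is their number.
  distance : Program
  distance = cond ((21 [ 18 [ slot 10 ] ]) ≺ ((20 [ 19 [ slot 10 ] ]) ⊕ lit 1))
               (8 [ lit 3 ]≔ ((20 [ 19 [ slot 10 ] ]) ⊖ (21 [ 18 [ slot 10 ] ])))
               (8 [ lit 3 ]≔ (((9 [ lit 0 ]) ⊖ (21 [ 18 [ slot 10 ] ])) ⊕ (20 [ 19 [ slot 10 ] ])))

  distance-wp : ∀ Q {μ} → Bounded μ → let h = μ 21 (μ 18 (μ 8 10)) ; l = μ 20 (μ 19 (μ 8 10)) in h < μ 9 0 → l < μ 9 0 →
                Q (μ [ 8 , 3 ↦ off (μ 9 0) h l ]) → wp distance Q μ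
  distance-wp Q {μ} B h<k l<k q =
    (λ p → off (μ 9 0) h l , sym (off-≤ {μ 9 0} (s≤s⁻¹ (≤-trans p (≤-reflexive (+-comm l 1))))) , q) ,
    (λ p → off (μ 9 0) h l , sym (eq (≤-trans (≤-reflexive (+-comm 1 l)) p)) , ≤-trans (<⇒≤ (off<k h<k l<k)) (B 9 0) , q)
    where
    h = μ 21 (μ 18 (μ 8 10))
    l = μ 20 (μ 19 (μ 8 10))
    eq : l < h → off (μ 9 0) h l ≡ (μ 9 0 ∸ h) + l
    eq lt = trans (off-> {μ 9 0} lt) (trans (+-∸-assoc l (<⇒≤ h<k)) (+-comm l _))

  search-rest search : Program
  search-rest = cond (lit 1 ≺ slot 3)
    (cond ((slot 3 ⊕ lit 1) ≺ slot 4) (8 [ lit 4 ]≔ (slot 3 ⊕ lit 1) ⍮ 8 [ lit 5 ]≔ (18 [ slot 10 ]) ⍮ 8 [ lit 6 ]≔ (19 [ slot 10 ])) skip) skip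
  search = 8 [ lit 4 ]≔ (9 [ lit 0 ]) ⍮ for 10 below (9 [ lit 1 ]) loop
    cond ((22 [ 18 [ slot 10 ] ]) ≈ lit 1) (cond ((22 [ 19 [ slot 10 ] ]) ≈ lit 1) (distance ⍮ search-rest) skip) skip

  -- The value `b ≡ k` stands for no candidate so far; nothing is then claimed about `x` and `y`.
  record Best (k e : ℕ) (src tgt lo hi mark : ℕ → ℕ) (b x y : ℕ) : Set where
    constructor best
    field
      found : b ≡ k ⊎ (mark x ≡ 1 × mark y ≡ 1 × E x y × b ≡ suc (off k (hi x) (lo y)) × 3 ≤ b × b < k)
      least : ∀ e′ → e′ < e → mark (src e′) ≡ 1 → mark (tgt e′) ≡ 1 → 3 ≤ suc (off k (hi (src e′)) (lo (tgt e′))) →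
              b ≤ suc (off k (hi (src e′)) (lo (tgt e′)))

  SearchInv : Memory → ℕ → Memory → Set
  SearchInv μ₀ e μ = μ 9 1 ≡ μ₀ 9 1 × μ 9 0 ≡ μ₀ 9 0 × Prep μ × Best (μ 9 0) e (μ 18) (μ 19) (μ 20) (μ 21) (μ 22) (μ 8 4) (μ 8 5) (μ 8 6)

  Searched : ℕ → Memory → Set
  Searched k₀ μ = μ 9 0 ≡ k₀ × Prep μ × Best (μ 9 0) (μ 9 1) (μ 18) (μ 19) (μ 20) (μ 21) (μ 22) (μ 8 4) (μ 8 5) (μ 8 6)

  search-triple : ∀ {k₀} → ⟨ (λ μ → μ 9 0 ≡ k₀ × Prep μ) ⟩ search ⟨ Searched k₀ ⟩
  search-triple {k₀} = straight {Q = λ μ → μ 8 4 ≡ μ 9 0 × μ 9 0 ≡ k₀ × Prep μ} _ (λ μ B (e , p) → μ 9 0 , refl , refl , e , p) ▹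
    loops 10 (9 [ lit 1 ]) _ λ μ₀ (e₀ , k≡ , p) → record
    { times  = μ₀ 9 1
    ; Inv    = SearchInv μ₀
    ; times≤ = λ B → B 9 1
    ; fixed  = λ _ _ (e , _) → e
    ; base   = refl , refl , p , best (inj₁ e₀) (λ _ ())
    ; step   = λ μ B lt (e , k , p , b) →
        (λ mx → (λ my → distance-wp (wp search-rest (After (SearchInv μ₀) 10 μ)) B (bounded-h μ p (subst (μ 8 10 <_) (sym e) lt) mx) (bounded-l μ p (subst (μ 8 10 <_) (sym e) lt) my)
                          (body μ₀ μ B (subst (μ 8 10 <_) (sym e) lt) e k p b mx my)) ,
                (λ my → refl , e , k , p , skip-to b (λ _ my′ _ → ⊥-elim (my my′)))) ,
        (λ mx → refl , e , k , p , skip-to b (λ mx′ _ _ → ⊥-elim (mx mx′)))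
    ; exit   = λ μ (e , k , p , b) → trans k k≡ , p , subst (λ m → Best (μ 9 0) m _ _ _ _ _ _ _ _) (sym e) b
    }
    where
    edge : ∀ μ → Prep μ → μ 8 10 < μ 9 1 → E (μ 18 (μ 8 10)) (μ 19 (μ 8 10))
    edge μ p lt = Edges.sound (Prepared.listed p) _ lt
    bounded-h : ∀ μ → Prep μ → μ 8 10 < μ 9 1 → μ 22 (μ 18 (μ 8 10)) ≡ 1 → μ 21 (μ 18 (μ 8 10)) < μ 9 0
    bounded-h μ p lt m = Cl.h< (proj₁ (proj₂ (Prepared.marks p _ (E< (edge μ p lt)) (λ z → case trans (sym z) m of λ ()))))
    bounded-l : ∀ μ → Prep μ → μ 8 10 < μ 9 1 → μ 22 (μ 19 (μ 8 10)) ≡ 1 → μ 20 (μ 19 (μ 8 10)) < μ 9 0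
    bounded-l μ p lt m = Cl.l< (proj₁ (proj₂ (Prepared.marks p _ (E< (E-sym (edge μ p lt))) (λ z → case trans (sym z) m of λ ()))))
    skip-to : ∀ {k e src tgt lo hi mark b x y} → Best k e src tgt lo hi mark b x y →
              (mark (src e) ≡ 1 → mark (tgt e) ≡ 1 → 3 ≤ suc (off k (hi (src e)) (lo (tgt e))) → b ≤ suc (off k (hi (src e)) (lo (tgt e)))) →
              Best k (suc e) src tgt lo hi mark b x y
    skip-to (best f l) new = best f (below l new)
    body : ∀ μ₀ μ → Bounded μ → μ 8 10 < μ 9 1 → μ 9 1 ≡ μ₀ 9 1 → μ 9 0 ≡ μ₀ 9 0 → Prep μ →
           Best (μ 9 0) (μ 8 10) (μ 18) (μ 19) (μ 20) (μ 21) (μ 22) (μ 8 4) (μ 8 5) (μ 8 6) →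
           μ 22 (μ 18 (μ 8 10)) ≡ 1 → μ 22 (μ 19 (μ 8 10)) ≡ 1 →
           wp search-rest (After (SearchInv μ₀) 10 μ) (μ [ 8 , 3 ↦ off (μ 9 0) (μ 21 (μ 18 (μ 8 10))) (μ 20 (μ 19 (μ 8 10))) ])
    body μ₀ μ B lt e k p b mx my =
      (λ 2≤ → (λ less → suc d , +-comm d 1 , ≤-trans (≤-reflexive (+-comm 1 d)) (≤-trans (<⇒≤ less) (B 8 4)) , μ 18 (μ 8 10) , refl , μ 19 (μ 8 10) , refl , refl , e , k , p ,
                 best (inj₂ (mx , my , edge μ p lt , refl , s≤s 2≤ , <-≤-trans (≤-trans (≤-reflexive (cong suc (+-comm 1 d))) less) (b≤k (Best.found b))))
                   (below (λ e′ e′< m m′ t → ≤-trans (≤-trans (≤-reflexive (+-comm 1 d)) (<⇒≤ less)) (Best.least b e′ e′< m m′ t)) (λ _ _ _ → ≤-refl))) ,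
              (λ ge → refl , e , k , p , skip-to b (λ _ _ _ → ≤-trans ge (≤-reflexive (+-comm d 1))))) ,
      (λ ≤1 → refl , e , k , p , skip-to b (λ _ _ t → ⊥-elim (<-irrefl refl (≤-trans t (s≤s ≤1)))))
      where
      d = off (μ 9 0) (μ 21 (μ 18 (μ 8 10))) (μ 20 (μ 19 (μ 8 10)))
      b≤k : ∀ {k b A B C D} → b ≡ k ⊎ (A × B × C × D × 3 ≤ b × b < k) → b ≤ k
      b≤k (inj₁ q) = ≤-reflexive q
      b≤k (inj₂ (_ , _ , _ , _ , _ , q)) = <⇒≤ q

  least-minimal : ∀ {k m n V Z F S src tgt lo hi mark C B NF NZ b x y} → Prepared k m n V Z F S src tgt lo hi mark C B NF NZ →
                  Best k m src tgt lo hi mark b x y → Minimal k V F S b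
  least-minimal {k} {V = V} {F = F} {S} {b = b₀} p b = minimal-by go
   where
   go : ∀ {x y lp hp lq hq} → IsW k F S x → IsW k F S y → Cl k V x lp hp → Cl k V y lq hq → E x y → 3 ≤ suc (off k hp lq) → b₀ ≤ suc (off k hp lq)
   go wp wq cp cq e 3≤ with Prepared.known p wp cp | Prepared.known p wq cq | Edges.complete (Prepared.listed p) (Prepared.original p wp) (Prepared.original p wq) e
   ... | _ , refl | refl , _ | e′ , e′< , refl , refl = Best.least b e′ e′< (Prepared.marked p wp) (Prepared.marked p wq) 3≤

  index : Program
  index = cond (((21 [ slot 5 ]) ⊕ slot 10) ≺ (9 [ lit 0 ])) (8 [ lit 3 ]≔ ((21 [ slot 5 ]) ⊕ slot 10))
                -- The inner difference is formed first: in the order (h + j) - k the stored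
                -- expression would contain a sum whose bound by `M` is not at hand.
                (8 [ lit 3 ]≔ ((21 [ slot 5 ]) ⊖ ((9 [ lit 0 ]) ⊖ slot 10)))

  index-wp : ∀ Q {μ} → Bounded μ → μ 8 10 ≤ μ 9 0 → Q (μ [ 8 , 3 ↦ ρ (μ 9 0) (μ 21 (μ 8 5)) (μ 8 10) ]) → wp index Q μ
  index-wp Q {μ} B j≤k q = (λ p → ρ (μ 9 0) h j , sym (ρ-< {μ 9 0} {h} p) , ≤-trans (≤-reflexive (ρ-< {μ 9 0} {h} p)) (≤-trans (<⇒≤ p) (B 9 0)) , q) ,
                         (λ p → ρ (μ 9 0) h j , sym (trans (ρ-≥ {μ 9 0} {h} p) eq) , q)
    where
    h = μ 21 (μ 8 5)
    j = μ 8 10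
    eq : (h + j) ∸ μ 9 0 ≡ h ∸ (μ 9 0 ∸ j)
    eq = trans (cong (h + j ∸_) (sym (m+[n∸m]≡n j≤k))) (trans (sym (∸-+-assoc (h + j) j _)) (cong (_∸ (μ 9 0 ∸ j)) (m+n∸n≡m h j)))

  extract-rest extract finish restrict : Program
  extract-rest = 14 [ slot 10 ]≔ (10 [ slot 3 ]) ⍮ 15 [ slot 10 ]≔ (11 [ slot 3 ]) ⍮ 16 [ slot 10 ]≔ (12 [ slot 3 ]) ⍮ 17 [ slot 10 ]≔ (13 [ slot 3 ])
  extract = for 10 below (slot 4) loop (index ⍮ extract-rest)
  finish = 15 [ slot 4 ⊖ lit 1 ]≔ lit 2 ⍮ 16 [ slot 4 ⊖ lit 1 ]≔ slot 6 ⍮ 17 [ slot 4 ⊖ lit 1 ]≔ slot 5 ⍮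
           9 [ lit 0 ]≔ slot 4 ⍮ 9 [ lit 4 ]≔ lit 1
  restrict = search ⍮ cond (slot 4 ≺ (9 [ lit 0 ])) (extract ⍮ finish ⍮ copy-back) (9 [ lit 4 ]≔ lit 0)

  Copied : ℕ → ℕ → (V Z F S V′ Z′ F′ S′ : ℕ → ℕ) → ℕ → Set
  Copied k h V Z F S V′ Z′ F′ S′ i = Agree i V′ (V ∘ ρ k h) × Agree i Z′ (Z ∘ ρ k h) × Agree i F′ (F ∘ ρ k h) × Agree i S′ (S ∘ ρ k h)

  ExtractInv : ℕ → ℕ → ℕ → Memory → Set
  ExtractInv k₀ b i μ = μ 8 4 ≡ b × μ 8 4 < μ 9 0 × Searched k₀ μ ×
    Copied (μ 9 0) (μ 21 (μ 8 5)) (μ 10) (μ 11) (μ 12) (μ 13) (μ 14) (μ 15) (μ 16) (μ 17) i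

  extract-triple : ∀ {k₀} → ⟨ (λ μ → Searched k₀ μ × μ 8 4 < μ 9 0) ⟩ extract ⟨ (λ μ → ExtractInv k₀ (μ 8 4) (μ 8 4) μ) ⟩
  extract-triple {k₀} = loops 10 (slot 4) _ λ μ₀ (s , lt) → record
    { times  = μ₀ 8 4
    ; Inv    = ExtractInv k₀ (μ₀ 8 4)
    ; times≤ = λ B → B 8 4
    ; fixed  = λ _ _ (e , _) → e
    ; base   = refl , lt , s , (λ _ ()) , (λ _ ()) , (λ _ ()) , (λ _ ())
    ; step   = λ μ B lt (e , b< , s , a , b , c , d) →
        index-wp (wp extract-rest (After (ExtractInv k₀ (μ₀ 8 4)) 10 μ)) B (<⇒≤ (<-trans lt (subst (_< μ 9 0) e b<)))
          (let i = μ 8 10 ; r = ρ (μ 9 0) (μ 21 (μ 8 5)) (μ 8 10) in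
           i , refl , μ 10 r , refl , i , refl , μ 11 r , refl , i , refl , μ 12 r , refl , i , refl , μ 13 r , refl ,
           refl , e , b< , s , upd-below (λ j x → x ≡ μ 10 (ρ (μ 9 0) (μ 21 (μ 8 5)) j)) a refl , upd-below (λ j x → x ≡ μ 11 (ρ (μ 9 0) (μ 21 (μ 8 5)) j)) b refl ,
           upd-below (λ j x → x ≡ μ 12 (ρ (μ 9 0) (μ 21 (μ 8 5)) j)) c refl , upd-below (λ j x → x ≡ μ 13 (ρ (μ 9 0) (μ 21 (μ 8 5)) j)) d refl)
    ; exit   = λ μ (e , b< , s , c) → refl , b< , s , subst (Copied (μ 9 0) (μ 21 (μ 8 5)) (μ 10) (μ 11) (μ 12) (μ 13) (μ 14) (μ 15) (μ 16) (μ 17)) (sym e) c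
    }

  -- k₀ is the number of vertices before the restriction.
  Restricted : ℕ → (w k m n : ℕ) (V Z F S src tgt : ℕ → ℕ) → Set
  Restricted k₀ w k m n V Z F S src tgt = State k m n V Z F S src tgt × w ≡ 1 × k < k₀ × Σ ℕ λ t → k ≡ suc t × Gap t V F S × Z t ≡ 2

  finish-triple : ∀ {k₀} → ⟨ (λ μ → ExtractInv k₀ (μ 8 4) (μ 8 4) μ) ⟩ finish
    ⟨ (λ μ → Restricted k₀ (μ 9 4) (μ 9 0) (μ 9 1) (μ 9 2) (μ 14) (μ 15) (μ 16) (μ 17) (μ 18) (μ 19)) ⟩
  finish-triple {k₀} = straight _ λ μ B (_ , b< , (k≡ , p , b) , c) →
    let l = μ 8 4 ∸ 1 in l , refl , l , refl , μ 8 6 , refl , l , refl , μ 8 5 , refl , μ 8 4 , refl ,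
    result μ b< k≡ p (Best.found b) (least-minimal p b) c
    where
    result : ∀ μ → μ 8 4 < μ 9 0 → μ 9 0 ≡ k₀ → Prep μ → _ → Minimal (μ 9 0) (μ 10) (μ 12) (μ 13) (μ 8 4) →
      Copied (μ 9 0) (μ 21 (μ 8 5)) (μ 10) (μ 11) (μ 12) (μ 13) (μ 14) (μ 15) (μ 16) (μ 17) (μ 8 4) →
      Restricted k₀ 1 (μ 8 4) (μ 9 1) (μ 9 2) (μ 14) (upd (μ 15) (μ 8 4 ∸ 1) 2) (upd (μ 16) (μ 8 4 ∸ 1) (μ 8 6)) (upd (μ 17) (μ 8 4 ∸ 1) (μ 8 5)) (μ 18) (μ 19)
    result μ b< k≡ p (inj₁ b≡k) _ _ = ⊥-elim (<-irrefl b≡k b<)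
    result μ b< k≡ p (inj₂ (mx , my , e , b≡ , 3≤b , _)) min (cv , cz , cf , cs) with μ 8 4 | b≡
    ... | .(suc (off (μ 9 0) (μ 21 (μ 8 5)) (μ 20 (μ 8 6)))) | refl =
        state Sh.result (λ w → original (Sh.still w)) listed n≡order , refl , subst (_ <_) k≡ b< , t , refl , Sh.gap , upd-same (μ 15) t 2
      where
      open Prepared p
      t = off (μ 9 0) (μ 21 (μ 8 5)) (μ 20 (μ 8 6))
      mx′ = proj₂ (marks _ (E< e) (λ z → case trans (sym z) mx of λ ()))
      my′ = proj₂ (marks _ (E< (E-sym e)) (λ z → case trans (sym z) my of λ ()))
      other : ∀ {f x} i → i < t → upd f t x i ≡ f i
      other {f} {x} i i<t = upd-other f x (λ q → <-irrefl (sym q) i<t)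
      module Sh = Shrink {V′ = μ 14} {upd (μ 15) t 2} {upd (μ 16) t (μ 8 6)} {upd (μ 17) t (μ 8 5)} obstacle
        (proj₂ mx′) (proj₂ my′) (proj₁ mx′) (proj₁ my′) e refl (s≤s⁻¹ 3≤b) b< min
        (λ i i≤t → cv i (s≤s i≤t))
        (λ i i<t → trans (other {μ 15} i i<t) (cz i (<-trans i<t ≤-refl)))
        (λ i i<t → trans (other {μ 16} i i<t) (cf i (<-trans i<t ≤-refl)))
        (λ i i<t → trans (other {μ 17} i i<t) (cs i (<-trans i<t ≤-refl)))
        (upd-same (μ 15) t 2) (upd-same (μ 16) t (μ 8 6)) (upd-same (μ 17) t (μ 8 5))

  Outcome : ℕ → Memory → Set
  Outcome k₀ μ = (St μ × μ 9 4 ≡ 0 × μ 9 0 ≡ k₀ × Minimal (μ 9 0) (μ 10) (μ 12) (μ 13) (μ 9 0)) ⊎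
                 Restricted k₀ (μ 9 4) (μ 9 0) (μ 9 1) (μ 9 2) (μ 10) (μ 11) (μ 12) (μ 13) (μ 18) (μ 19)

  restrict-triple : ∀ {k₀} → ⟨ (λ μ → μ 9 0 ≡ k₀ × Prep μ) ⟩ restrict ⟨ Outcome k₀ ⟩
  restrict-triple {k₀} = search-triple ▹ branch (slot 4 ≺ (9 [ lit 0 ]))
    (weaken (λ _ h → h) (λ _ → inj₂) (extract-triple ▹ finish-triple ▹
       copy-back-triple (Restricted k₀) λ { v z f s (st , w , k< , t , refl , g , zt) →
         State-cong v z f s st , w , k< , t , refl , Gap-cong v f s g , trans (sym (z t ≤-refl)) zt }))
    (straight _ λ μ B ((k≡ , p , b) , k≤b) → inj₁ (Prepared.st p , refl , k≡ , 
       subst (Minimal (μ 9 0) (μ 10) (μ 12) (μ 13)) (full (Best.found b) k≤b) (least-minimal p b)))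
    where
    full : ∀ {k b A B C D} → b ≡ k ⊎ (A × B × C × D × 3 ≤ b × b < k) → k ≤ b → b ≡ k
    full (inj₁ q) _ = q
    full (inj₂ (_ , _ , _ , _ , _ , lt)) le = ⊥-elim (<-irrefl refl (<-≤-trans lt le))

-- The program for the first pass

module FirstPassing (Γ : Graphᴺ) (Wt : ℕ → Set) (M : ℕ) (64≤M : 64 ≤ M) (W : ℕ) (M≤W : M ≤ W) where
  open Core Γ Wt M 64≤M W M≤W
  open Obstacles Γ
  open FirstPass Γ
  open Restricting Γ Wt M 64≤M W M≤W using (State-cong; copy-back; copy-back-triple; Restricted)
  open Cong Γ

  module _ {t : ℕ} {V Z F S : ℕ → ℕ} (O : Obs (suc t) V Z F S) (Zt : Z t ≡ 2) where
    open Obs O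

    one-at : ∀ {i} → i < suc t → Z i ≡ 1 → i < t × S i ≡ F i × Cl (suc t) V (F i) i (suc i)
    one-at i<k z with wit _ i<k
    ... | double z′ _ _ _ with () ← trans (sym z) z′
    one-at {i} i<k z | single _ e c with nx-cases i<k
    ... | inj₁ (p , q) = s≤s⁻¹ p , e , subst (Cl (suc t) V (F i) i) q c
    ... | inj₂ (refl , _) with () ← trans (sym z) Zt

    second-at : ∀ {i} → suc i < suc t → Σ ℕ λ l → Cl (suc t) V (S i) l (suc i)
    second-at i<t with wit _ (<⇒≤ i<t)
    ... | double _ _ c _ = _ , subst (λ j → Cl (suc t) V _ (nx (suc t) _) j) (nx-suc i<t) c
    ... | single _ e c = _ , subst₂ (λ x j → Cl (suc t) V x _ j) (sym e) (nx-suc i<t) c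

    first-two : ∀ {i} → i < suc t → Z i ≡ 2 → Cl (suc t) V (F i) i i
    first-two i<k z with wit _ i<k
    ... | double _ c _ _ = c
    ... | single z′ _ _ with () ← trans (sym z) z′

    step-bounds : ∀ {i a j z f s} → i < t → Step₁ t Z F S i a j z f s → suc i ≤ j × j ≤ t
    step-bounds i<t (far _ _ _ _ le _ (inj₁ (_ , refl))) = n≤1+n _ , le
    step-bounds i<t (far _ _ _ _ le _ (inj₂ (z , refl))) = ≤-trans (n≤1+n _) (n≤1+n _) , proj₁ (one-at (s≤s le) z)
    step-bounds i<t (near _ _ _ _ _ lt _ refl) = n≤1+n _ , lt
    step-bounds i<t (wide _ _ _ _ z _ refl) = n≤1+n _ , proj₁ (one-at (s≤s i<t) z)
    step-bounds i<t (arr _ _ _ z _ refl) = n≤1+n _ , proj₁ (one-at (s≤s i<t) z)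
    step-bounds i<t (keep _ _ _ _ _ _ _ refl) = ≤-refl , i<t

    step-class : ∀ {i a j z f s} → i < t → Step₁ t Z F S i a j z f s → IsW (suc t) F S s × Σ ℕ λ l → Cl (suc t) V s l j
    step-class i<t (far _ _ refl _ le _ (inj₁ (z , refl))) = isW (s≤s le) (inj₁ refl) , _ , first-two (s≤s le) z
    step-class i<t (far _ _ refl _ le _ (inj₂ (z , refl))) = isW (s≤s le) (inj₁ refl) , _ , proj₂ (proj₂ (one-at (s≤s le) z))
    step-class i<t (near _ _ refl _ _ lt _ refl) = isW (s≤s i<t) (inj₂ refl) , second-at (s≤s lt)
    step-class i<t (wide _ _ refl _ z _ refl) = isW (s≤s i<t) (inj₁ refl) , _ , proj₂ (proj₂ (one-at (s≤s i<t) z))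
    step-class i<t (arr _ _ refl z _ refl) = isW (s≤s i<t) (inj₁ refl) , _ , proj₂ (proj₂ (one-at (s≤s i<t) z))
    step-class i<t (keep _ _ refl _ _ _ _ refl) = isW (s≤s (<⇒≤ i<t)) (inj₂ refl) , second-at (s≤s i<t)

  leaf : Expr → Expr → Expr → Expr → Program
  leaf z f s j = 8 [ lit 24 ]≔ z ⍮ 8 [ lit 25 ]≔ f ⍮ 8 [ lit 26 ]≔ s ⍮ 8 [ lit 23 ]≔ j

  -- The tests follow the order of the constructors of `Step₁`, so a `keep` leaf is reached only
  -- after all applicable tests have failed. Slots 20, 21 and 22 hold the vertex i, the arrival
  -- witness a and the number of vertices kept before i; array 28 holds `κ` for the invariant.
  remain choose commit : Program
  remain = cond ((11 [ slot 20 ⊕ lit 1 ]) ≈ lit 1)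
      (cond ((23 [ slot 21 ]) ≈ lit 1) (leaf (lit 2) (slot 21) (12 [ slot 20 ⊕ lit 1 ]) (slot 20 ⊕ lit 2))
        (leaf (11 [ slot 20 ]) (12 [ slot 20 ]) (13 [ slot 20 ]) (slot 20 ⊕ lit 1)))
      (leaf (11 [ slot 20 ]) (12 [ slot 20 ]) (13 [ slot 20 ]) (slot 20 ⊕ lit 1))
  choose = cond ((11 [ slot 20 ]) ≈ lit 1)
    (cond ((slot 20 ⊕ lit 2) ≺ (9 [ lit 0 ]))
      (cond ((23 [ 12 [ slot 20 ] ]) ≈ lit 1)
        (cond ((11 [ slot 20 ⊕ lit 2 ]) ≈ lit 1) (leaf (lit 2) (12 [ slot 20 ]) (12 [ slot 20 ⊕ lit 2 ]) (slot 20 ⊕ lit 3))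
          (leaf (lit 2) (12 [ slot 20 ]) (12 [ slot 20 ⊕ lit 2 ]) (slot 20 ⊕ lit 2)))
        (cond ((24 [ 12 [ slot 20 ] ]) ≈ lit 1) (leaf (lit 2) (12 [ slot 20 ]) (13 [ slot 20 ⊕ lit 1 ]) (slot 20 ⊕ lit 2)) remain))
      remain)
    (cond ((11 [ slot 20 ⊕ lit 1 ]) ≈ lit 1)
      (cond ((23 [ 12 [ slot 20 ] ]) ≈ lit 1) (leaf (lit 2) (12 [ slot 20 ]) (12 [ slot 20 ⊕ lit 1 ]) (slot 20 ⊕ lit 2)) remain)
      remain)
  commit = 14 [ slot 22 ]≔ (10 [ slot 20 ]) ⍮ 15 [ slot 22 ]≔ slot 24 ⍮ 16 [ slot 22 ]≔ slot 25 ⍮ 17 [ slot 22 ]≔ slot 26 ⍮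
           8 [ lit 20 ]≔ slot 23 ⍮ 8 [ lit 21 ]≔ slot 26 ⍮ 8 [ lit 22 ]≔ (slot 22 ⊕ lit 1) ⍮ 28 [ slot 22 ]≔ slot 20

  Chosen : (Memory → Set) → ℕ → Memory → Set
  Chosen Q t μ = ∀ j z f s → Step₁ t (μ 11) (μ 12) (μ 13) (μ 8 20) (μ 8 21) j z f s →
                 Q ((((μ [ 8 , 24 ↦ z ]) [ 8 , 25 ↦ f ]) [ 8 , 26 ↦ s ]) [ 8 , 23 ↦ j ])

  flag-yes : ∀ {c x y} → Flag c x y → c ≡ 1 → E x y
  flag-yes (inj₁ (_ , e)) _ = e
  flag-yes (inj₂ (z , _)) o with () ← trans (sym z) o

  flag-no : ∀ {c x y} → Flag c x y → c ≢ 1 → ¬ E x y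
  flag-no (inj₁ (o , _)) n = ⊥-elim (n o)
  flag-no (inj₂ (_ , f)) _ = f

  PrepAt : ℕ → Memory → Set
  PrepAt k μ = Prepared k (μ 9 1) (μ 9 2) (μ 10) (μ 11) (μ 12) (μ 13) (μ 18) (μ 19) (μ 20) (μ 21) (μ 22) (μ 23) (μ 24) (μ 26) (μ 27)

  choose-wp : ∀ Q {t μ l} → suc t ≤ M → μ 9 0 ≡ suc t → PrepAt (suc t) μ → μ 11 t ≡ 2 → μ 8 20 < t →
              IsW (suc t) (μ 12) (μ 13) (μ 8 21) → Cl (suc t) (μ 10) (μ 8 21) l (μ 8 20) → Chosen Q t μ → wp choose Q μ
  choose-wp Q {t} {μ} k≤M k≡ p Zt i<t wa ca q =
    (λ z1 → (λ 2< → let le = s≤s⁻¹ (≤-trans (≤-reflexive (cong suc (+-comm 2 i))) (≤-trans 2< (≤-reflexive k≡))) in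
        (λ c → (λ z → F i , refl , F (2 + i) , cong F (+-comm i 2) , 3 + i , +-comm i 3 , i+3≤ le (trans (cong Z (+-comm 2 i)) z) ,
                      fin (far refl refl refl z1 le (flag-yes (fx z1 le) c) (inj₂ (trans (cong Z (+-comm 2 i)) z , refl)))) ,
               (λ z → F i , refl , F (2 + i) , cong F (+-comm i 2) , 2 + i , +-comm i 2 , i+2≤ ,
                      fin (far refl refl refl z1 le (flag-yes (fx z1 le) c) (inj₁ (not1 (s≤s le) (z ∘ trans (cong Z (+-comm i 2))) , refl))))) ,
        (λ c → (λ b → F i , refl , S (1 + i) , cong S (+-comm i 1) , 2 + i , +-comm i 2 , i+2≤ ,
                      fin (near refl refl refl z1 (λ le → flag-no (fx z1 le) c) le (flag-yes (sx z1) b) refl)) ,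
               (λ b → rest (λ _ le → flag-no (fx z1 le) c) (λ _ _ → flag-no (sx z1) b) (λ z2 → ⊥-elim (one≢two z1 z2))))) ,
      (λ ge → rest (λ _ → too-far ge) (λ _ → too-far ge) (λ z2 → ⊥-elim (one≢two z1 z2)))) ,
    (λ nz → let z2 = not1 (<-trans i<t ≤-refl) nz in
      (λ z → (λ c → F i , refl , F (1 + i) , cong F (+-comm i 1) , 2 + i , +-comm i 2 , i+2≤ ,
                    fin (wide refl refl refl z2 (trans (cong Z (+-comm 1 i)) z) (flag-yes (fw z2) c) refl)) ,
             (λ c → rest (λ z1 → ⊥-elim (one≢two z1 z2)) (λ z1 → ⊥-elim (one≢two z1 z2)) (λ _ _ → flag-no (fw z2) c))) ,
      (λ z → rest (λ z1 → ⊥-elim (one≢two z1 z2)) (λ z1 → ⊥-elim (one≢two z1 z2)) (λ _ z′ → ⊥-elim (z (trans (cong Z (+-comm i 1)) z′)))))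
    where
    open Prepared p
    i = μ 8 20
    a = μ 8 21
    V = μ 10
    Z = μ 11
    F = μ 12
    S = μ 13
    i+2≤ : 2 + i ≤ M
    i+2≤ = ≤-trans (s≤s i<t) k≤M
    i+1≤ : 1 + i ≤ M
    i+1≤ = ≤-trans i<t (≤-trans (n≤1+n t) k≤M)
    i+3≤ : 2 + i ≤ t → Z (2 + i) ≡ 1 → 3 + i ≤ M
    i+3≤ le z = ≤-trans (proj₁ (one-at obstacle Zt (s≤s le) z)) (≤-trans (n≤1+n t) k≤M)
    one≢two : ∀ {j} → Z j ≡ 1 → Z j ≡ 2 → ⊥
    one≢two z1 z2 with () ← trans (sym z1) z2
    not1 : ∀ {j} → j < suc t → Z j ≢ 1 → Z j ≡ 2
    not1 j< nz with Obs.wit obstacle _ j<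
    ... | single z _ _ = ⊥-elim (nz z)
    ... | double z _ _ _ = z
    too-far : ∀ {A : Set} → μ 9 0 ≤ i + 2 → 2 + i ≤ t → A
    too-far ge le = ⊥-elim (<-irrefl refl (≤-trans (s≤s le) (≤-trans (≤-reflexive (sym k≡)) (≤-trans ge (≤-reflexive (+-comm i 2))))))
    fin : ∀ {j z f s} → Step₁ t Z F S i a j z f s → Q _
    fin st = q _ _ _ _ st
    i<k : i < suc t
    i<k = <-trans i<t ≤-refl
    wi : IsW (suc t) F S (F i)
    wi = isW i<k (inj₁ refl)
    fx : Z i ≡ 1 → 2 + i ≤ t → Flag (μ 23 (F i)) (F i) (F (2 + i))
    fx z le = subst (λ j → Flag (μ 23 (F i)) (F i) (F j)) (nx-suc (s≤s le)) (flag-f wi (proj₂ (proj₂ (one-at obstacle Zt i<k z))))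
    sx : Z i ≡ 1 → Flag (μ 24 (F i)) (F i) (S (1 + i))
    sx z = flag-s wi (proj₂ (proj₂ (one-at obstacle Zt i<k z)))
    fw : Z i ≡ 2 → Flag (μ 23 (F i)) (F i) (F (1 + i))
    fw z = subst (λ j → Flag (μ 23 (F i)) (F i) (F j)) (nx-suc (s≤s i<t)) (flag-f wi (first-two obstacle Zt i<k z))
    fa : Flag (μ 23 a) a (F (1 + i))
    fa = subst (λ j → Flag (μ 23 a) a (F j)) (nx-suc (s≤s i<t)) (flag-f wa ca)
    rest : (Z i ≡ 1 → 2 + i ≤ t → ¬ E (F i) (F (2 + i))) → (Z i ≡ 1 → 1 + i < t → ¬ E (F i) (S (1 + i))) →
           (Z i ≡ 2 → Z (1 + i) ≡ 1 → ¬ E (F i) (F (1 + i))) → wp remain Q μ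
    rest nf nn nw =
      (λ z → (λ c → a , refl , F (1 + i) , cong F (+-comm i 1) , 2 + i , +-comm i 2 , i+2≤ ,
                    fin (arr refl refl refl (trans (cong Z (+-comm 1 i)) z) (flag-yes fa c) refl)) ,
             (λ c → Z i , refl , F i , refl , S i , refl , 1 + i , +-comm i 1 , i+1≤ , fin (keep refl refl refl nf nn nw (λ _ → flag-no fa c) refl))) ,
      (λ z → Z i , refl , F i , refl , S i , refl , 1 + i , +-comm i 1 , i+1≤ , fin (keep refl refl refl nf nn nw (λ z′ → ⊥-elim (z (trans (cong Z (+-comm i 1)) z′))) refl))

  -- The value in the preceding enumeration: already revised, except that before 0 there is the old
  -- enumeration `t`.
  arrives : ℕ → (S S′ : ℕ → ℕ) → ℕ → ℕ
  arrives t S S′ zero    = S t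
  arrives t S S′ (suc u) = S′ u

  record Chain (t c : ℕ) (V Z F S V′ Z′ F′ S′ κ : ℕ → ℕ) (i a s : ℕ) : Set where
    field
      -- Steps have different lengths, while the loop makes a fixed number of rounds. As `i` grows
      -- in every round until it is `t`, `suc t` rounds are enough, and the last ones may be idle.
      far-on  : c ≤ i ⊎ i ≡ t
      i≤t     : i ≤ t
      s≤i     : s ≤ i
      κ0      : κ 0 ≡ 0
      κs      : κ s ≡ i
      isw     : IsW (suc t) F S a
      cls     : Σ ℕ λ l → Cl (suc t) V a l i
      a≡      : arrives t S S′ s ≡ a
      kept    : ∀ u → u < s → V′ u ≡ V (κ u)
      steps   : ∀ u → u < s → Step₁ t Z F S (κ u) (arrives t S S′ u) (κ (suc u)) (Z′ u) (F′ u) (S′ u)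

  step-cong : ∀ {t Z F S i i′ a a′ j j′ z z′ f f′ s s′} → i ≡ i′ → a ≡ a′ → j ≡ j′ → z ≡ z′ → f ≡ f′ → s ≡ s′ →
              Step₁ t Z F S i a j z f s → Step₁ t Z F S i′ a′ j′ z′ f′ s′
  step-cong refl refl refl refl refl refl st = st

  chain-step : ∀ {t c V Z F S V′ Z′ F′ S′ κ i a s j z f w} → Obs (suc t) V Z F S → Z t ≡ 2 → i < t →
    Step₁ t Z F S i a j z f w → Chain t c V Z F S V′ Z′ F′ S′ κ i a s →
    Chain t (suc c) V Z F S (upd V′ s (V i)) (upd Z′ s z) (upd F′ s f) (upd S′ s w) (upd κ (suc s) j) j w (suc s)
  chain-step {t} {c} {V} {Z} {F} {S} {V′} {Z′} {F′} {S′} {κ} {i} {a} {s} {j} {z} {f} {w} O Zt i<t st ch = record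
    { far-on = on far-on
    ; i≤t = proj₂ bounds ; s≤i = ≤-trans (s≤s s≤i) (proj₁ bounds)
    ; κ0 = κ0 ; κs = upd-same κ (suc s) j
    ; isw = proj₁ (step-class O Zt i<t st) ; cls = proj₂ (step-class O Zt i<t st)
    ; a≡ = upd-same S′ s w
    ; kept = below (λ u u< → trans (old V′ u<) (trans (kept u u<) (cong V (sym (oldκ (<⇒≤ u<))))))
                   (trans (upd-same V′ s _) (cong V (trans (sym κs) (sym (oldκ ≤-refl)))))
    ; steps = below (λ u u< → step-cong (sym (oldκ (<⇒≤ u<))) (old-arr u u<) (sym (oldκ u<)) (sym (old Z′ u<)) (sym (old F′ u<)) (sym (old S′ u<)) (steps u u<))
                    (step-cong (trans (sym κs) (sym (oldκ ≤-refl))) (trans (sym a≡) (arr-s s refl)) (sym (upd-same κ (suc s) j)) (sym (upd-same Z′ s z)) (sym (upd-same F′ s f)) (sym (upd-same S′ s w)) st)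
    }
    where
    open Chain ch
    bounds = step-bounds O Zt i<t st
    on : c ≤ i ⊎ i ≡ t → suc c ≤ j ⊎ j ≡ t
    on (inj₁ le) = inj₁ (≤-trans (s≤s le) (proj₁ bounds))
    on (inj₂ e) = ⊥-elim (<-irrefl e i<t)
    old : ∀ g {u x} → u < s → upd g s x u ≡ g u
    old g {u} {x} u< = upd-other g x (λ e → <-irrefl (sym e) u<)
    oldκ : ∀ {u} → u ≤ s → upd κ (suc s) j u ≡ κ u
    oldκ u≤ = upd-other κ j (λ e → <-irrefl (sym e) (s≤s u≤))
    old-arr : ∀ u → u < s → arrives t S S′ u ≡ arrives t S (upd S′ s w) u
    old-arr zero _ = refl
    old-arr (suc u) u< = sym (old S′ (<⇒≤ u<))
    arr-s : ∀ s₁ → s₁ ≡ s → arrives t S S′ s₁ ≡ arrives t S (upd S′ s w) s₁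
    arr-s zero _ = refl
    arr-s (suc u) refl = sym (upd-other S′ w (λ e → <-irrefl (sym e) ≤-refl))

  Passing : ℕ → ℕ → Memory → Set
  Passing t c μ = μ 9 0 ≡ suc t × PrepAt (suc t) μ × Gap t (μ 10) (μ 12) (μ 13) × μ 11 t ≡ 2 × 4 ≤ t ×
    Chain t c (μ 10) (μ 11) (μ 12) (μ 13) (μ 14) (μ 15) (μ 16) (μ 17) (μ 28) (μ 8 20) (μ 8 21) (μ 8 22)

  Ready : Memory → Set
  Ready μ = Prep μ × Σ ℕ λ t → μ 9 0 ≡ suc t × Gap t (μ 10) (μ 12) (μ 13) × μ 11 t ≡ 2 × 4 ≤ t

  first-init first-loop first-end first-pass : Program
  first-init = 8 [ lit 20 ]≔ lit 0 ⍮ 8 [ lit 21 ]≔ (13 [ (9 [ lit 0 ]) ⊖ lit 1 ]) ⍮ 8 [ lit 22 ]≔ lit 0 ⍮ 28 [ lit 0 ]≔ lit 0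
  first-loop = for 10 below (9 [ lit 0 ]) loop cond ((slot 20 ⊕ lit 1) ≺ (9 [ lit 0 ])) (choose ⍮ commit) skip
  first-end = 14 [ slot 22 ]≔ (10 [ slot 20 ]) ⍮ 15 [ slot 22 ]≔ lit 2 ⍮ 16 [ slot 22 ]≔ (12 [ slot 20 ]) ⍮ 17 [ slot 22 ]≔ (13 [ slot 20 ]) ⍮
              9 [ lit 0 ]≔ (slot 22 ⊕ lit 1)
  first-pass = first-init ⍮ first-loop ⍮ first-end ⍮ copy-back

  first-init-triple : ⟨ Ready ⟩ first-init ⟨ (λ μ → Σ ℕ λ t → Passing t 0 μ) ⟩
  first-init-triple = straight _ λ μ B (p , t , k≡ , g , z , 4≤) → μ 13 (μ 9 0 ∸ 1) , refl , init μ p t k≡ g z 4≤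
    where
    init : ∀ μ → Prep μ → ∀ t → μ 9 0 ≡ suc t → Gap t (μ 10) (μ 12) (μ 13) → μ 11 t ≡ 2 → 4 ≤ t → _
    init μ p t k≡ g z 4≤ = t , k≡ , p′ , g , z , 4≤ , record
      { far-on = inj₁ z≤n ; i≤t = z≤n ; s≤i = z≤n ; κ0 = upd-same (μ 28) 0 0 ; κs = upd-same (μ 28) 0 0
      ; isw = isW ≤-refl (inj₂ e) ; cls = 0 , subst (λ x → Cl (suc t) (μ 10) x 0 0) (sym e) last-class
      ; a≡ = sym e ; kept = λ _ () ; steps = λ _ () }
      where
      p′ = subst (λ k → PrepAt k μ) k≡ p
      e : μ 13 (μ 9 0 ∸ 1) ≡ μ 13 t
      e = cong (λ k → μ 13 (k ∸ 1)) k≡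
      last-class : Cl (suc t) (μ 10) (μ 13 t) 0 0
      last-class with Obs.wit (Prepared.obstacle p′) t ≤-refl
      ... | single z′ _ _ with () ← trans (sym z) z′
      ... | double _ _ c _ = subst (λ j → Cl (suc t) (μ 10) (μ 13 t) j j) (nx-last t) c

  first-loop-triple : ⟨ (λ μ → Σ ℕ λ t → Passing t 0 μ) ⟩ first-loop ⟨ (λ μ → Σ ℕ λ t → Passing t (suc t) μ) ⟩
  first-loop-triple = loops 10 (9 [ lit 0 ]) _ λ μ₀ (t , p₀) → record
    { times  = suc t
    ; Inv    = Passing t
    ; times≤ = λ B → ≤-trans (≤-reflexive (sym (proj₁ p₀))) (B 9 0)
    ; fixed  = λ _ _ p → proj₁ p
    ; base   = p₀
    ; step   = λ μ B lt (k≡ , p , g , z , 4≤ , ch) →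
        (λ i+1< → let i<t = s≤s⁻¹ (≤-trans (≤-reflexive (cong suc (+-comm 1 (μ 8 20)))) (≤-trans i+1< (≤-reflexive k≡))) in
          choose-wp (wp commit (After (Passing t) 10 μ)) {μ = μ} (≤-trans (≤-reflexive (sym k≡)) (B 9 0)) k≡ p z i<t (Chain.isw ch) (proj₂ (Chain.cls ch))
            (λ j z′ f w st → let s = μ 8 22 ; i = μ 8 20 in
              s , refl , μ 10 i , refl , s , refl , z′ , refl , s , refl , f , refl , s , refl , w , refl , j , refl , w , refl ,
              suc s , +-comm s 1 , ≤-trans (s≤s (Chain.s≤i ch)) (≤-trans (≤-reflexive (+-comm 1 i)) (≤-trans (<⇒≤ i+1<) (B 9 0))) , suc s , refl , j , refl ,
              refl , k≡ , p , g , z , 4≤ , chain-step (Prepared.obstacle p) z i<t st ch)) ,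
        (λ ge → refl , k≡ , p , g , z , 4≤ , stay ch (≤-antisym (Chain.i≤t ch) (s≤s⁻¹ (≤-trans (≤-reflexive (sym k≡)) (≤-trans ge (≤-reflexive (+-comm (μ 8 20) 1)))))))
    ; exit   = λ μ p → t , p
    }
    where
    stay : ∀ {t c V Z F S V′ Z′ F′ S′ κ i a s} → Chain t c V Z F S V′ Z′ F′ S′ κ i a s → i ≡ t → Chain t (suc c) V Z F S V′ Z′ F′ S′ κ i a s
    stay ch e = record { Chain ch ; far-on = inj₂ e }

  Passed : (w k m n : ℕ) (V Z F S src tgt : ℕ → ℕ) → Set
  Passed w k m n V Z F S src tgt = State k m n V Z F S src tgt × NoDbl k V F S

  first-end-triple : ⟨ (λ μ → Σ ℕ λ t → Passing t (suc t) μ) ⟩ first-end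
    ⟨ (λ μ → Passed (μ 9 4) (μ 9 0) (μ 9 1) (μ 9 2) (μ 14) (μ 15) (μ 16) (μ 17) (μ 18) (μ 19)) ⟩
  first-end-triple = straight _ λ μ B (t , k≡ , p , g , z , 4≤ , ch) → let s = μ 8 22 ; i = μ 8 20 in
    s , refl , μ 10 i , refl , s , refl , s , refl , μ 12 i , refl , s , refl , μ 13 i , refl , suc s , +-comm s 1 ,
    ≤-trans (s≤s (≤-trans (Chain.s≤i ch) (Chain.i≤t ch))) (≤-trans (≤-reflexive (sym k≡)) (B 9 0)) ,
    result μ t p g z 4≤ ch
    where
    result : ∀ μ t → PrepAt (suc t) μ → Gap t (μ 10) (μ 12) (μ 13) → μ 11 t ≡ 2 → 4 ≤ t →
      Chain t (suc t) (μ 10) (μ 11) (μ 12) (μ 13) (μ 14) (μ 15) (μ 16) (μ 17) (μ 28) (μ 8 20) (μ 8 21) (μ 8 22) →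
      Passed (μ 9 4) (suc (μ 8 22)) (μ 9 1) (μ 9 2) (upd (μ 14) (μ 8 22) (μ 10 (μ 8 20))) (upd (μ 15) (μ 8 22) 2)
        (upd (μ 16) (μ 8 22) (μ 12 (μ 8 20))) (upd (μ 17) (μ 8 22) (μ 13 (μ 8 20))) (μ 18) (μ 19)
    result μ t p g z 4≤ ch = state Pa.result (λ w → original (Pa.still w)) listed n≡order , Pa.no-double
      where
      open Prepared p
      open Chain ch
      r = μ 8 22
      V′ = upd (μ 14) r (μ 10 (μ 8 20))
      Z′ = upd (μ 15) r 2
      F′ = upd (μ 16) r (μ 12 (μ 8 20))
      S′ = upd (μ 17) r (μ 13 (μ 8 20))
      i≡t : μ 8 20 ≡ t
      i≡t = Sum.[ (λ le → ⊥-elim (<-irrefl refl (≤-trans le i≤t))) , id ] far-on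
      old : ∀ g {u x} → u < r → upd g r x u ≡ g u
      old g {u} {x} u< = upd-other g x (λ e → <-irrefl (sym e) u<)
      taken : ∀ u → u < r → Step₁ t (μ 11) (μ 12) (μ 13) (μ 28 u) (arrives t (μ 13) S′ u) (μ 28 (suc u)) (Z′ u) (F′ u) (S′ u)
      taken u u< = step-cong refl (ar u u<) refl (sym (old (μ 15) u<)) (sym (old (μ 16) u<)) (sym (old (μ 17) u<)) (steps u u<)
        where
        ar : ∀ u → u < r → arrives t (μ 13) (μ 17) u ≡ arrives t (μ 13) S′ u
        ar zero _ = refl
        ar (suc u) u< = sym (old (μ 17) (<⇒≤ u<))
      keeps : ∀ u → u ≤ r → V′ u ≡ μ 10 (μ 28 u)
      keeps u u≤ with m≤n⇒m<n∨m≡n u≤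
      ... | inj₁ lt = trans (old (μ 14) lt) (kept u lt)
      ... | inj₂ refl = trans (upd-same (μ 14) r _) (cong (μ 10) (sym κs))
      module Pa = Pass₁ {V′ = V′} {Z′} {F′} {S′} {μ 28} obstacle z 4≤ g κ0 (trans κs i≡t)
        (λ 0<r → step-cong κ0 refl refl refl refl refl (taken 0 0<r)) (λ s s<r → taken (suc s) s<r) keeps
        (upd-same (μ 15) r 2) (trans (upd-same (μ 16) r _) (cong (μ 12) i≡t)) (trans (upd-same (μ 17) r _) (cong (μ 13) i≡t))

  first-pass-triple : ⟨ Ready ⟩ first-pass ⟨ (λ μ → St μ × NoDbl (μ 9 0) (μ 10) (μ 12) (μ 13)) ⟩
  first-pass-triple = first-init-triple ▹ first-loop-triple ▹ first-end-triple ▹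
    copy-back-triple Passed λ v z f s (st , nd) → State-cong v z f s st , NoDbl-cong v f s nd


-- A frame rule and the program for the second pass

untouched : ℕ → Program → Bool
untouched a skip           = true
untouched a (b [ _ ]≔ _)   = not (b ≡ᵇ a)
untouched a (p ⨾ q)        = untouched a p ∧ untouched a q
untouched a (cond _ p q)   = untouched a p ∧ untouched a q
untouched a (while _ p)    = untouched a p

-- The condition is syntactic, hence for a concrete program it is settled by evaluation and `tt`
-- proves it.
unchanged : ∀ {W p μ t μ′ a} → Run W p μ t μ′ → T (untouched a p) → ∀ i → μ′ a i ≡ μ a i
unchanged skip u i = refl
unchanged {a = a} (assign {b} x y) u i with b ≡ᵇ a
... | false = refl
unchanged {p = p ⨾ q} (seq r s) u i = trans (unchanged s (proj₂ (T-∧₁ {untouched _ p} u)) i) (unchanged r (proj₁ (T-∧₁ u)) i)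
unchanged {p = cond _ p q} (ifTrue _ r) u i = unchanged r (proj₁ (T-∧₁ u)) i
unchanged {p = cond _ p q} (ifFalse _ r) u i = unchanged r (proj₂ (T-∧₁ {untouched _ p} u)) i
unchanged (halt _) u i = refl
unchanged (loop _ r s) u i = trans (unchanged s u i) (unchanged r u i)

module SecondPassing (Γ : Graphᴺ) (Wt : ℕ → Set) (M : ℕ) (64≤M : 64 ≤ M) (W : ℕ) (M≤W : M ≤ W) where
  open Core Γ Wt M 64≤M W M≤W
  open Obstacles Γ
  open FirstPassing Γ Wt M 64≤M W M≤W using (flag-yes; flag-no; arrives; PrepAt)
  open Cong Γ

  framed : ∀ {P Q p} (Φ : Memory → Set) → (∀ μ μ′ → (∀ a → T (untouched a p) → ∀ i → μ′ a i ≡ μ a i) → Φ μ → Φ μ′) →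
           ⟨ P ⟩ p ⟨ Q ⟩ → ⟨ (λ μ → P μ × Φ μ) ⟩ p ⟨ (λ μ → Q μ × Φ μ) ⟩
  framed Φ resp t μ B (h , φ) with t μ B h
  ... | ok run t≤ (B′ , q) = ok run t≤ (B′ , q , resp μ _ (λ a u → unchanged run u) φ)

  Essential-cong : ∀ {k V V′ F F′ S S′} → Agree k V V′ → Agree k F F′ → Agree k S S′ → Essential k V F S → Essential k V′ F′ S′
  Essential-cong {k} {V} {V′} {F} {F′} {S} {S′} v f s es = essential-by λ {p} {q} wp wq e → Sum.map nest
      (λ (i , i<k , a , b) → i , i<k , tr i<k a , tr i<k b) (Essential.valid es (IsW-cong (agree-sym f) (agree-sym s) wp) (IsW-cong (agree-sym f) (agree-sym s) wq) e)
    where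
    tr : ∀ {i x} → i < k → x ≡ F i ⊎ x ≡ S i → x ≡ F′ i ⊎ x ≡ S′ i
    tr i<k = Sum.map (λ e → trans e (f _ i<k)) (λ e → trans e (s _ i<k))
    nest : ∀ {p q} → Nested k V p q → Nested k V′ p q
    nest {p} {q} = Sum.map (λ h j j< ne e → h j j< (λ e → ne (subst (E p) (v j j<) e)) (subst (E q) (sym (v j j<)) e))
                   (λ h j j< ne e → h j j< (λ e → ne (subst (E q) (v j j<) e)) (subst (E p) (sym (v j j<)) e))

  put : Expr → Expr → Expr → Program
  put z f s = 8 [ lit 24 ]≔ z ⍮ 8 [ lit 25 ]≔ f ⍮ 8 [ lit 26 ]≔ s

  keeping try-f try-b decide record-step : Program
  keeping = put (11 [ slot 10 ]) (12 [ slot 10 ]) (13 [ slot 10 ])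
  try-f = cond ((11 [ slot 10 ]) ≈ lit 2) (cond ((27 [ slot 10 ]) ≈ lit 2)
            (cond ((26 [ slot 10 ]) ≈ (13 [ slot 10 ]))
              (cond ((24 [ 12 [ slot 10 ] ]) ≈ lit 1) (put (lit 2) (12 [ slot 10 ]) (26 [ slot 10 ])) keeping)
              (cond ((23 [ 12 [ slot 10 ] ]) ≈ lit 1) (put (lit 2) (12 [ slot 10 ]) (26 [ slot 10 ])) keeping)) keeping) keeping
  try-b = cond ((11 [ slot 10 ]) ≈ lit 2) (cond ((24 [ slot 21 ]) ≈ lit 1) (put (lit 2) (slot 21) (13 [ slot 10 ])) try-f) try-f
  decide = cond (slot 27 ≈ lit 2) (cond ((27 [ slot 10 ]) ≈ lit 2)
            (cond ((26 [ slot 10 ]) ≈ (13 [ slot 10 ]))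
              (cond ((24 [ slot 21 ]) ≈ lit 1) (put (lit 2) (slot 21) (26 [ slot 10 ])) try-b)
              (cond ((23 [ slot 21 ]) ≈ lit 1) (put (lit 2) (slot 21) (26 [ slot 10 ])) try-b)) try-b) try-f
  record-step = 15 [ slot 10 ]≔ slot 24 ⍮ 16 [ slot 10 ]≔ slot 25 ⍮ 17 [ slot 10 ]≔ slot 26 ⍮
    8 [ lit 21 ]≔ slot 26 ⍮ 8 [ lit 27 ]≔ slot 24 ⍮
    cond (slot 10 ≈ lit 0) (26 [ (9 [ lit 0 ]) ⊖ lit 1 ]≔ slot 25 ⍮ 27 [ (9 [ lit 0 ]) ⊖ lit 1 ]≔ slot 24) skip

  -- In the last round the following enumeration is the new enumeration 0, whose first witness may
  -- be the old `S t`. This is the second possibility for `g`; the flag in array 24 then answers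
  -- instead of the one in array 23.
  decide-wp : ∀ Q {μ nf nz} → let i = μ 8 10 ; a = μ 8 21 ; g = μ 26 i in
    i < μ 9 0 → Prepared (μ 9 0) (μ 9 1) (μ 9 2) (μ 10) (μ 11) (μ 12) (μ 13) (μ 18) (μ 19) (μ 20) (μ 21) (μ 22) (μ 23) (μ 24) nf nz →
    (μ 8 27 ≡ 2 → IsW (μ 9 0) (μ 12) (μ 13) a × Cl (μ 9 0) (μ 10) a i i) → (μ 27 i ≡ 2 → g ≡ μ 12 (nx (μ 9 0) i) ⊎ g ≡ μ 13 i) →
    (∀ z f s → Step₂ (μ 8 27) a (μ 11 i) (μ 12 i) (μ 13 i) (μ 27 i) g z f s → Q (((μ [ 8 , 24 ↦ z ]) [ 8 , 25 ↦ f ]) [ 8 , 26 ↦ s ])) →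
    wp decide Q μ
  decide-wp Q {μ} i<k p ga gg q =
    (λ az → let w = proj₁ (ga az) ; c = proj₂ (ga az) in
      (λ gz → (λ g≡s → (λ y → take az gz (subst (E a) (sym g≡s) (flag-yes (flag-s w c) y))) ,
                       (λ n → at-b az w c (λ _ _ → subst (¬_ ∘ E a) (sym g≡s) (flag-no (flag-s w c) n)))) ,
              (λ g≢s → (λ y → take az gz (subst (E a) (sym (is-f gz g≢s)) (flag-yes (flag-f w c) y))) ,
                       (λ n → at-b az w c (λ _ _ → subst (¬_ ∘ E a) (sym (is-f gz g≢s)) (flag-no (flag-f w c) n))))) ,
      (λ gz → at-b az w c (λ _ z → ⊥-elim (gz z)))) ,
    (λ az → at-f (λ z → ⊥-elim (az z)) (λ z → ⊥-elim (az z)))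
    where
    open Prepared p
    i = μ 8 10
    a = μ 8 21
    zp = μ 8 27
    zi = μ 11 i
    f = μ 12 i
    s = μ 13 i
    gz = μ 27 i
    g = μ 26 i
    is-f : gz ≡ 2 → g ≢ s → g ≡ μ 12 (nx (μ 9 0) i)
    is-f z g≢s with gg z
    ... | inj₁ e = e
    ... | inj₂ e = ⊥-elim (g≢s e)
    take : zp ≡ 2 → gz ≡ 2 → E a g → wp (put (lit 2) (slot 21) (26 [ slot 10 ])) Q μ
    take z z′ e = a , refl , g , refl , q 2 a g record { kept⊎two = inj₂ (refl , inj₁ (z , refl) , inj₂ (z′ , refl) , e)
      ; clear = λ P N _ → refl , Sum.[ proj₂ , proj₂ ] P , Sum.[ proj₂ , proj₂ ] N }
    two-cl : zi ≡ 2 → Cl (μ 9 0) (μ 10) f i i × E f s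
    two-cl z with Obs.wit obstacle i i<k
    ... | single z′ _ _ with () ← trans (sym z) z′
    ... | double _ c _ e = c , e
    keeps : (zp ≡ 2 → gz ≡ 2 → ¬ E a g) → (zp ≡ 2 → zi ≡ 2 → ¬ E a s) → (zi ≡ 2 → gz ≡ 2 → ¬ E f g) → wp keeping Q μ
    keeps na nb nf with Obs.wit obstacle i i<k
    ... | single z s≡f _ = zi , refl , f , refl , s , refl , q zi f s record { kept⊎two = inj₁ (z , z , refl , refl)
          ; clear = λ { (inj₁ (za , refl)) (inj₂ (zg , refl)) e → ⊥-elim (na za zg e)
                      ; (inj₂ (z2 , _)) _ e → case trans (sym z2) z of λ ()
                      ; (inj₁ _) (inj₁ (z2 , _)) e → case trans (sym z2) z of λ () } }
    ... | double z _ _ e = zi , refl , f , refl , s , refl , q zi f s record { kept⊎two = inj₂ (z , inj₂ (z , refl) , inj₁ (z , refl) , e)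
          ; clear = λ { (inj₁ (za , refl)) (inj₁ (_ , refl)) e → ⊥-elim (nb za z e)
                      ; (inj₁ (za , refl)) (inj₂ (zg , refl)) e → ⊥-elim (na za zg e)
                      ; (inj₂ (_ , refl)) (inj₁ (_ , refl)) e → z , refl , refl
                      ; (inj₂ (_ , refl)) (inj₂ (zg , refl)) e → ⊥-elim (nf z zg e) } }
    three : (zp ≡ 2 → gz ≡ 2 → ¬ E a g) → zi ≡ 2 → gz ≡ 2 → E f g → wp (put (lit 2) (12 [ slot 10 ]) (26 [ slot 10 ])) Q μ
    three na z zg e = f , refl , g , refl , q 2 f g record { kept⊎two = inj₂ (refl , inj₂ (z , refl) , inj₂ (zg , refl) , e)
      ; clear = λ { (inj₁ (za , refl)) N e → ⊥-elim (na za zg (subst (E a) (Sum.[ proj₂ , proj₂ ] N) e))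
                  ; (inj₂ (_ , refl)) N e → refl , refl , Sum.[ proj₂ , proj₂ ] N } }
    at-f : (zp ≡ 2 → gz ≡ 2 → ¬ E a g) → (zp ≡ 2 → zi ≡ 2 → ¬ E a s) → wp try-f Q μ
    at-f na nb =
      (λ z → let w = isW i<k (inj₁ refl) ; c = proj₁ (two-cl z) in
        (λ zg → (λ g≡s → (λ y → three na z zg (subst (E f) (sym g≡s) (flag-yes (flag-s w c) y))) ,
                         (λ n → keeps na nb (λ _ _ → subst (¬_ ∘ E f) (sym g≡s) (flag-no (flag-s w c) n)))) ,
                (λ g≢s → (λ y → three na z zg (subst (E f) (sym (is-f zg g≢s)) (flag-yes (flag-f w c) y))) ,
                         (λ n → keeps na nb (λ _ _ → subst (¬_ ∘ E f) (sym (is-f zg g≢s)) (flag-no (flag-f w c) n))))) ,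
        (λ zg → keeps na nb (λ _ z → ⊥-elim (zg z)))) ,
      (λ z → keeps na nb (λ z′ → ⊥-elim (z z′)))
    at-b : zp ≡ 2 → IsW (μ 9 0) (μ 12) (μ 13) a → Cl (μ 9 0) (μ 10) a i i → (zp ≡ 2 → gz ≡ 2 → ¬ E a g) → wp try-b Q μ
    at-b az2 w c na =
      (λ z → (λ y → a , refl , s , refl , q 2 a s record { kept⊎two = inj₂ (refl , inj₁ (az2 , refl) , inj₁ (z , refl) , flag-yes (flag-s w c) y)
                ; clear = λ { P (inj₁ (_ , refl)) e → refl , Sum.[ proj₂ , proj₂ ] P , refl
                            ; P (inj₂ (zg , refl)) e → ⊥-elim (na (az2) zg (subst (λ x → E x g) (Sum.[ proj₂ , proj₂ ] P) e)) } }) ,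
             (λ n → at-f na (λ _ _ → flag-no (flag-s w c) n))) ,
      (λ z → at-f na (λ _ z′ → ⊥-elim (z z′)))

  record Second (t i : ℕ) (V Z F S Z′ F′ S′ NF NZ : ℕ → ℕ) (a az : ℕ) : Set where
    field
      nexts : ∀ j → j < t → NF j ≡ F (suc j) × NZ j ≡ Z (suc j)
      wrap  : i ≢ 0 → NF t ≡ F′ 0 × NZ t ≡ Z′ 0 × (Z′ 0 ≡ 2 → F′ 0 ≡ F 0 ⊎ F′ 0 ≡ S t)
      a≡    : arrives t S S′ i ≡ a
      az≡   : arrives t Z Z′ i ≡ az
      good  : i < suc t → az ≡ 2 → IsW (suc t) F S a × Cl (suc t) V a i i
      steps : ∀ j → j < i → Step₂ (arrives t Z Z′ j) (arrives t S S′ j) (Z j) (F j) (S j) (NZ j) (NF j) (Z′ j) (F′ j) (S′ j)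

  step₂-cong : ∀ {pz pz′ a a′ z f s nz nz′ g g′ x x′ y y′ w w′} → pz ≡ pz′ → a ≡ a′ → nz ≡ nz′ → g ≡ g′ → x ≡ x′ → y ≡ y′ → w ≡ w′ →
               Step₂ pz a z f s nz g x y w → Step₂ pz′ a′ z f s nz′ g′ x′ y′ w′
  step₂-cong refl refl refl refl refl refl refl st = st

  second-step : ∀ {t i V Z F S Z′ F′ S′ NF NZ NF′ NZ′ a az z f s} → Obs (suc t) V Z F S → i < suc t →
    Step₂ az a (Z i) (F i) (S i) (NZ i) (NF i) z f s → Second t i V Z F S Z′ F′ S′ NF NZ a az →
    (∀ j → j < t → NF′ j ≡ NF j × NZ′ j ≡ NZ j) → (i ≡ 0 → NF′ t ≡ f × NZ′ t ≡ z) → (i ≢ 0 → NF′ t ≡ NF t × NZ′ t ≡ NZ t) →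
    Second t (suc i) V Z F S (upd Z′ i z) (upd F′ i f) (upd S′ i s) NF′ NZ′ s z
  second-step {t} {i} {V} {Z} {F} {S} {Z′} {F′} {S′} {NF} {NZ} {NF′} {NZ′} {a} {az} {z} {f} {s} O i<k st sd same at0 later = record
    { nexts = λ j j<t → trans (proj₁ (same j j<t)) (proj₁ (nexts j j<t)) , trans (proj₂ (same j j<t)) (proj₂ (nexts j j<t))
    ; wrap = λ _ → wrap′ (i ≟ 0)
    ; a≡ = upd-same S′ i s ; az≡ = upd-same Z′ i z
    ; good = λ lt → good′ (s≤s⁻¹ lt)
    ; steps = below (λ j j< → step₂-cong (old-arr {Z} {Z′} j j<) (old-arr {S} {S′} j j<) (NZ≡ j (<-≤-trans j< (s≤s⁻¹ i<k))) (NF≡ j (<-≤-trans j< (s≤s⁻¹ i<k)))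
                        (sym (old Z′ j<)) (sym (old F′ j<)) (sym (old S′ j<)) (steps j j<))
                    (step₂-cong (trans (sym az≡) (arr-i {Z} {Z′} i refl)) (trans (sym a≡) (arr-i {S} {S′} i refl)) (NZi (m≤n⇒m<n∨m≡n (s≤s⁻¹ i<k))) (NFi (m≤n⇒m<n∨m≡n (s≤s⁻¹ i<k)))
                        (sym (upd-same Z′ i z)) (sym (upd-same F′ i f)) (sym (upd-same S′ i s)) st)
    }
    where
    open Second sd
    open Obs O
    t≢0 : t ≢ 0
    t≢0 refl with s≤s () ← 3≤k
    NF≡ : ∀ j → j < t → NF j ≡ NF′ j
    NF≡ j j<t = sym (proj₁ (same j j<t))
    NZ≡ : ∀ j → j < t → NZ j ≡ NZ′ j
    NZ≡ j j<t = sym (proj₂ (same j j<t))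
    NFi : i < t ⊎ i ≡ t → NF i ≡ NF′ i
    NFi (inj₁ lt) = NF≡ i lt
    NFi (inj₂ refl) = sym (proj₁ (later t≢0))
    NZi : i < t ⊎ i ≡ t → NZ i ≡ NZ′ i
    NZi (inj₁ lt) = NZ≡ i lt
    NZi (inj₂ refl) = sym (proj₂ (later t≢0))
    old : ∀ g {u x} → u < i → upd g i x u ≡ g u
    old g {u} {x} u< = upd-other g x (λ e → <-irrefl (sym e) u<)
    old-arr : ∀ {X X′ x} u → u < i → arrives t X X′ u ≡ arrives t X (upd X′ i x) u
    old-arr zero _ = refl
    old-arr {X′ = X′} (suc u) u< = sym (old X′ (<⇒≤ u<))
    arr-i : ∀ {X X′ x} u → u ≡ i → arrives t X X′ u ≡ arrives t X (upd X′ i x) u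
    arr-i zero _ = refl
    arr-i {X′ = X′} {x} (suc u) refl = sym (upd-other X′ x (λ e → <-irrefl (sym e) ≤-refl))
    wrap′ : Dec (i ≡ 0) → NF′ t ≡ upd F′ i f 0 × NZ′ t ≡ upd Z′ i z 0 × (upd Z′ i z 0 ≡ 2 → upd F′ i f 0 ≡ F 0 ⊎ upd F′ i f 0 ≡ S t)
    wrap′ (yes refl) = proj₁ (at0 refl) , proj₂ (at0 refl) , λ z2 → from (Step₂.kept⊎two st) z2
      where
      from : _ → z ≡ 2 → f ≡ F 0 ⊎ f ≡ S t
      from (inj₁ (_ , z1 , _)) z2 with () ← trans (sym z1) z2
      from (inj₂ (_ , inj₁ (_ , e) , _)) _ = inj₂ (trans e (sym a≡))
      from (inj₂ (_ , inj₂ (_ , e) , _)) _ = inj₁ e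
    wrap′ (no i≢0) = let (w₁ , w₂ , w₃) = wrap i≢0 ; (l₁ , l₂) = later i≢0 in
      trans l₁ (trans w₁ (sym (upd-other F′ f i≢0))) , trans l₂ (trans w₂ (sym (upd-other Z′ z i≢0))) ,
      λ z2 → subst (λ x → x ≡ F 0 ⊎ x ≡ S t) (sym (upd-other F′ f i≢0)) (w₃ (trans (sym (upd-other Z′ z i≢0)) z2))
    good′ : i < t → z ≡ 2 → IsW (suc t) F S s × Cl (suc t) V s (suc i) (suc i)
    good′ i<t z2 with Step₂.kept⊎two st
    ... | inj₁ (_ , z1 , _) with () ← trans (sym z1) z2
    ... | inj₂ (_ , _ , inj₁ (zi , refl) , _) with wit i i<k
    ...   | single z1 _ _ with () ← trans (sym zi) z1
    ...   | double _ _ c _ = isW i<k (inj₂ refl) , subst (λ j → Cl (suc t) V (S i) j j) (nx-suc (s≤s i<t)) c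
    good′ i<t z2 | inj₂ (_ , _ , inj₂ (nz , refl) , _) rewrite proj₁ (nexts i i<t) | proj₂ (nexts i i<t) with wit (suc i) (s≤s i<t)
    ... | single z1 _ _ with () ← trans (sym nz) z1
    ... | double _ c _ _ = isW (s≤s i<t) (inj₁ refl) , c

  -- `nf` and `nz` are the arrays 26 and 27 before the loop. Step 0 overwrites their entry `t` by
  -- the new enumeration 0, so `Prepared` is asserted for the earlier contents.
  Seconds : ℕ → (nf nz : ℕ → ℕ) → ℕ → Memory → Set
  Seconds t nf nz i μ = μ 9 0 ≡ suc t × Prepared (μ 9 0) (μ 9 1) (μ 9 2) (μ 10) (μ 11) (μ 12) (μ 13) (μ 18) (μ 19) (μ 20) (μ 21) (μ 22) (μ 23) (μ 24) nf nz ×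
    NoDbl (μ 9 0) (μ 10) (μ 12) (μ 13) × Second t i (μ 10) (μ 11) (μ 12) (μ 13) (μ 15) (μ 16) (μ 17) (μ 26) (μ 27) (μ 8 21) (μ 8 27)

  SecondReady Finished : Memory → Set
  SecondReady μ = Prep μ × NoDbl (μ 9 0) (μ 10) (μ 12) (μ 13)
  Finished μ = Obs (μ 9 0) (μ 10) (μ 15) (μ 16) (μ 17) × Essential (μ 9 0) (μ 10) (μ 16) (μ 17)

  second-init second-loop output second-pass : Program
  second-init = 8 [ lit 21 ]≔ (13 [ (9 [ lit 0 ]) ⊖ lit 1 ]) ⍮ 8 [ lit 27 ]≔ (11 [ (9 [ lit 0 ]) ⊖ lit 1 ])
  second-loop = for 10 below (9 [ lit 0 ]) loop (decide ⍮ record-step)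
  output = for 10 below (9 [ lit 0 ]) loop
      (2 [ slot 10 ]≔ (10 [ slot 10 ]) ⍮ 3 [ slot 10 ]≔ (15 [ slot 10 ]) ⍮ 4 [ slot 10 ]≔ (16 [ slot 10 ]) ⍮ 5 [ slot 10 ]≔ (17 [ slot 10 ])) ⍮
    1 [ lit 0 ]≔ (9 [ lit 0 ]) ⍮ 0 [ lit 0 ]≔ lit 0
  second-pass = prepare ⍮ second-init ⍮ second-loop ⍮ output

  obs-at : ∀ {k k′ V Z F S} → k ≡ k′ → Obs k V Z F S → Obs k′ V Z F S
  obs-at refl o = o

  dbl-at : ∀ {k k′ V F S} → k ≡ k′ → NoDbl k V F S → NoDbl k′ V F S
  dbl-at refl d = d

  second-init-triple : ⟨ SecondReady ⟩ second-init ⟨ (λ μ → Σ ℕ λ t → Seconds t (μ 26) (μ 27) 0 μ) ⟩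
  second-init-triple = straight _ λ μ B (p , nd) → μ 13 (μ 9 0 ∸ 1) , refl , μ 11 (μ 9 0 ∸ 1) , refl , init μ p nd (μ 9 0) refl (Prepared.3≤k p)
    where
    init : ∀ μ → Prep μ → NoDbl (μ 9 0) (μ 10) (μ 12) (μ 13) → ∀ k → μ 9 0 ≡ k → 3 ≤ μ 9 0 →
           Σ ℕ λ t → Seconds t (μ 26) (μ 27) 0 ((μ [ 8 , 21 ↦ μ 13 (μ 9 0 ∸ 1) ]) [ 8 , 27 ↦ μ 11 (μ 9 0 ∸ 1) ])
    init μ p nd 0 k≡ 3≤ = ⊥-elim (n≮0 (≤-trans 3≤ (≤-reflexive k≡)))
    init μ p nd (suc t) k≡ 3≤ = t , k≡ , p , nd , record
      { nexts = λ j j<t → let (u , v) = Prepared.nexts p j (subst (j <_) (sym k≡) (<-trans j<t ≤-refl)) in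
          trans u (cong (μ 12) (nx≡ j j<t)) , trans v (cong (μ 11) (nx≡ j j<t))
      ; wrap = λ ne → ⊥-elim (ne refl)
      ; a≡ = cong (λ k → μ 13 (k ∸ 1)) (sym k≡) ; az≡ = cong (λ k → μ 11 (k ∸ 1)) (sym k≡)
      ; good = λ _ → subst (λ k → μ 11 (k ∸ 1) ≡ 2 → IsW (suc t) (μ 12) (μ 13) (μ 13 (k ∸ 1)) × Cl (suc t) (μ 10) (μ 13 (k ∸ 1)) 0 0) (sym k≡) good
      ; steps = λ _ () }
      where
      nx≡ : ∀ j → j < t → nx (μ 9 0) j ≡ suc j
      nx≡ j j<t = trans (cong (λ k → nx k j) k≡) (nx-suc (s≤s j<t))
      O : Obs (suc t) (μ 10) (μ 11) (μ 12) (μ 13)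
      O = subst (λ k → Obs k (μ 10) (μ 11) (μ 12) (μ 13)) k≡ (Prepared.obstacle p)
      good : μ 11 t ≡ 2 → IsW (suc t) (μ 12) (μ 13) (μ 13 t) × Cl (suc t) (μ 10) (μ 13 t) 0 0
      good z with Obs.wit O t ≤-refl
      ... | single z1 _ _ with () ← trans (sym z) z1
      ... | double _ _ c _ = isW ≤-refl (inj₂ refl) , subst (λ j → Cl (suc t) (μ 10) (μ 13 t) j j) (nx-last t) c

  second-loop-triple : ⟨ (λ μ → Σ ℕ λ t → Seconds t (μ 26) (μ 27) 0 μ) ⟩ second-loop ⟨ Finished ⟩
  second-loop-triple = loops 10 (9 [ lit 0 ]) _ λ μ₀ (t , p₀) → record
    { times  = suc t
    ; Inv    = Seconds t (μ₀ 26) (μ₀ 27)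
    ; times≤ = λ B → ≤-trans (≤-reflexive (sym (proj₁ p₀))) (B 9 0)
    ; fixed  = λ _ _ p → proj₁ p
    ; base   = p₀
    ; step   = λ μ B lt (k≡ , p , nd , sd) → decide-wp (wp record-step (After (Seconds t (μ₀ 26) (μ₀ 27)) 10 μ)) {μ} (subst (μ 8 10 <_) (sym k≡) lt) p
        (λ z → subst (λ k → IsW k (μ 12) (μ 13) (μ 8 21) × Cl k (μ 10) (μ 8 21) (μ 8 10) (μ 8 10)) (sym k≡) (Second.good sd lt z))
        (subst (λ k → μ 27 (μ 8 10) ≡ 2 → μ 26 (μ 8 10) ≡ μ 12 (nx k (μ 8 10)) ⊎ μ 26 (μ 8 10) ≡ μ 13 (μ 8 10)) (sym k≡) (interpret (obs-at k≡ (Prepared.obstacle p)) lt sd))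
        (λ z f s st → let i = μ 8 10 ; l = μ 9 0 ∸ 1 in
                      i , refl , z , refl , i , refl , f , refl , i , refl , s , refl , s , refl , z , refl ,
                      (λ i≡0 → l , refl , f , refl , l , refl , z , refl , refl , k≡ , p , nd ,
                         subst (λ l → Second t (suc i) (μ 10) (μ 11) (μ 12) (μ 13) (upd (μ 15) i z) (upd (μ 16) i f) (upd (μ 17) i s) (upd (μ 26) l f) (upd (μ 27) l z) s z) (cong (_∸ 1) (sym k≡))
                         (at-zero μ k≡ (Prepared.obstacle p) lt st sd i≡0)) ,
                      (λ i≢0 → refl , k≡ , p , nd , second-step (obs-at k≡ (Prepared.obstacle p)) lt st sd (λ _ _ → refl , refl) (λ e → ⊥-elim (i≢0 e)) (λ _ → refl , refl)))
    ; exit   = λ μ (k≡ , p , nd , sd) → subst (λ k → Obs k (μ 10) (μ 15) (μ 16) (μ 17) × Essential k (μ 10) (μ 16) (μ 17)) (sym k≡)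
                 (done (obs-at k≡ (Prepared.obstacle p)) sd (dbl-at k≡ nd))
    }
    where
    interpret : ∀ {t i V Z F S Z′ F′ S′ NF NZ a az} → Obs (suc t) V Z F S → i < suc t → Second t i V Z F S Z′ F′ S′ NF NZ a az →
                NZ i ≡ 2 → NF i ≡ F (nx (suc t) i) ⊎ NF i ≡ S i
    interpret {t} {i} {F = F} O i<k sd z with m≤n⇒m<n∨m≡n (s≤s⁻¹ i<k)
    ... | inj₁ i<t = inj₁ (trans (proj₁ (Second.nexts sd _ i<t)) (cong F (sym (nx-suc (s≤s i<t)))))
    ... | inj₂ refl with Second.wrap sd (λ { refl → case Obs.3≤k O of λ { (s≤s ()) } })
    ...   | e , e′ , h with h (trans (sym e′) z)
    ...     | inj₁ q = inj₁ (trans e (trans q (cong F (sym (nx-last i)))))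
    ...     | inj₂ q = inj₂ (trans e q)
    at-zero : ∀ {t z f s} μ → μ 9 0 ≡ suc t → Obs (μ 9 0) (μ 10) (μ 11) (μ 12) (μ 13) → μ 8 10 < suc t →
            Step₂ (μ 8 27) (μ 8 21) (μ 11 (μ 8 10)) (μ 12 (μ 8 10)) (μ 13 (μ 8 10)) (μ 27 (μ 8 10)) (μ 26 (μ 8 10)) z f s →
            Second t (μ 8 10) (μ 10) (μ 11) (μ 12) (μ 13) (μ 15) (μ 16) (μ 17) (μ 26) (μ 27) (μ 8 21) (μ 8 27) → μ 8 10 ≡ 0 →
            Second t (suc (μ 8 10)) (μ 10) (μ 11) (μ 12) (μ 13) (upd (μ 15) (μ 8 10) z) (upd (μ 16) (μ 8 10) f) (upd (μ 17) (μ 8 10) s) (upd (μ 26) t f) (upd (μ 27) t z) s z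
    at-zero {t} {z} {f} μ k≡ O lt st sd i≡0 = second-step (obs-at k≡ O) lt st sd
      (λ j j<t → upd-other (μ 26) f (λ e → <-irrefl (sym e) j<t) , upd-other (μ 27) z (λ e → <-irrefl (sym e) j<t))
      (λ _ → upd-same (μ 26) t f , upd-same (μ 27) t z) (λ ne → ⊥-elim (ne i≡0))
    done : ∀ {t V Z F S Z′ F′ S′ NF NZ a az} → Obs (suc t) V Z F S → Second t (suc t) V Z F S Z′ F′ S′ NF NZ a az → NoDbl (suc t) V F S →
           Obs (suc t) V Z′ F′ S′ × Essential (suc t) V F′ S′
    done {t} {V} {Z} {F} {S} {Z′} {F′} {S′} O sd nd = Pa.result , Pa.essential nd
      where
      open Second sd
      1<t : 1 < t
      1<t = s≤s⁻¹ (Obs.3≤k O)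
      fi : ∀ t₁ → t₁ ≡ t → Step₂ (Z′ (pred t₁)) (S′ (pred t₁)) (Z t₁) (F t₁) (S t₁) (Z′ 0) (F′ 0) (Z′ t₁) (F′ t₁) (S′ t₁)
      fi zero refl with () ← 1<t
      fi (suc t₁) refl = step₂-cong refl refl (proj₁ (proj₂ (wrap λ ()))) (proj₁ (wrap λ ())) refl refl refl (steps (suc t₁) ≤-refl)
      last-step : ∀ i → suc i ≡ t → Step₂ (Z′ i) (S′ i) (Z t) (F t) (S t) (Z′ 0) (F′ 0) (Z′ t) (F′ t) (S′ t)
      last-step i refl = fi (suc i) refl
      module Pa = Pass₂ {Z′ = Z′} {F′} {S′} O
        (step₂-cong refl refl (proj₂ (nexts 0 (<-trans (s≤s z≤n) 1<t))) (proj₁ (nexts 0 (<-trans (s≤s z≤n) 1<t))) refl refl refl (steps 0 (s≤s z≤n)))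
        (λ i lt → step₂-cong refl refl (proj₂ (nexts (suc i) lt)) (proj₁ (nexts (suc i) lt)) refl refl refl (steps (suc i) (<-trans lt ≤-refl)))
        last-step

  Result : Memory → Set
  Result μ = μ 0 0 ≡ 0 × Obs (μ 1 0) (μ 2) (μ 3) (μ 4) (μ 5) × Essential (μ 1 0) (μ 2) (μ 4) (μ 5)

  output-triple : ⟨ Finished ⟩ output ⟨ Result ⟩
  output-triple = loops {Q = λ μ → Obs (μ 9 0) (μ 2) (μ 3) (μ 4) (μ 5) × Essential (μ 9 0) (μ 2) (μ 4) (μ 5)} 10 (9 [ lit 0 ]) _ (λ μ₀ f → record
    { times  = μ₀ 9 0
    ; Inv    = λ i μ → μ 9 0 ≡ μ₀ 9 0 × Finished μ × Agree i (μ 10) (μ 2) × Agree i (μ 15) (μ 3) × Agree i (μ 16) (μ 4) × Agree i (μ 17) (μ 5)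
    ; times≤ = λ B → B 9 0
    ; fixed  = λ _ _ (e , _) → e
    ; base   = refl , f , (λ _ ()) , (λ _ ()) , (λ _ ()) , (λ _ ())
    ; step   = λ μ B lt (e , φ , a , b , c , d) → let i = μ 8 10 in
        i , refl , μ 10 i , refl , i , refl , μ 15 i , refl , i , refl , μ 16 i , refl , i , refl , μ 17 i , refl , refl , e , φ ,
        upd-below (λ j x → μ 10 j ≡ x) a refl , upd-below (λ j x → μ 15 j ≡ x) b refl ,
        upd-below (λ j x → μ 16 j ≡ x) c refl , upd-below (λ j x → μ 17 j ≡ x) d refl
    ; exit   = λ μ (e , (o , es) , a , b , c , d) → let ag = λ {f} {g} → subst (λ k → Agree k f g) (sym e) in
                 Obs-cong (ag a) (ag b) (ag c) (ag d) o , Essential-cong (ag a) (ag c) (ag d) es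
    }) ▹ straight _ λ μ B h → μ 9 0 , refl , refl , h

  second-pass-triple : ⟨ (λ μ → St μ × NoDbl (μ 9 0) (μ 10) (μ 12) (μ 13)) ⟩ second-pass ⟨ Result ⟩
  second-pass-triple = framed (λ μ → NoDbl (μ 9 0) (μ 10) (μ 12) (μ 13))
    (λ μ μ′ same nd → subst (λ k → NoDbl k (μ′ 10) (μ′ 12) (μ′ 13)) (sym (same 9 tt 0))
      (NoDbl-cong (λ i _ → sym (same 10 tt i)) (λ i _ → sym (same 12 tt i)) (λ i _ → sym (same 13 tt i)) nd)) prepare-triple ▹
    second-init-triple ▹ second-loop-triple ▹ output-triple


-- The trees below were found by exhaustive search.  For k = 3 the names 0, 1, 2
-- denote three consecutive vertices of Q, 3 the witness of the first two, and
-- the other names the witnesses of the two following witness enumerations.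

tree₁₁ : Tree
tree₁₁ = ask 3 4
  (ask 3 5
   (ask 4 5
    (forbidden isC₆ᶜ (0 ∷ 3 ∷ 1 ∷ 4 ∷ 2 ∷ 5 ∷ []))
    (forbidden isG₃ (0 ∷ 4 ∷ 2 ∷ 3 ∷ 1 ∷ 5 ∷ [])))
   (ask 4 5
    (forbidden isG₃ (1 ∷ 5 ∷ 0 ∷ 4 ∷ 2 ∷ 3 ∷ []))
    (forbidden isC₄* (0 ∷ 2 ∷ 3 ∷ 4 ∷ 5 ∷ []))))
  (ask 3 5
   (ask 4 5
    (forbidden isG₃ (0 ∷ 4 ∷ 1 ∷ 5 ∷ 2 ∷ 3 ∷ []))
    (forbidden isC₄* (1 ∷ 2 ∷ 3 ∷ 5 ∷ 4 ∷ [])))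
   (stop))

tree₁₂ : Tree
tree₁₂ = ask 3 5
  (ask 3 6
   (ask 4 5
    (ask 4 6
     (essential₃ (1 ∷ 5 ∷ 6 ∷ []) (2 ∷ 2 ∷ 2 ∷ []) (3 ∷ 2 ∷ 0 ∷ []) (2 ∷ 0 ∷ 4 ∷ []))
     (essential₃ (1 ∷ 5 ∷ 6 ∷ []) (2 ∷ 2 ∷ 1 ∷ []) (3 ∷ 2 ∷ 4 ∷ []) (2 ∷ 0 ∷ 4 ∷ [])))
    (ask 3 4
     (forbidden isK₂₃ (0 ∷ 3 ∷ 2 ∷ 4 ∷ 5 ∷ []))
     (forbidden isC₄* (1 ∷ 2 ∷ 3 ∷ 5 ∷ 4 ∷ []))))
   (forbidden isK₂₃ (2 ∷ 5 ∷ 0 ∷ 3 ∷ 6 ∷ [])))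
  (ask 3 4
   (ask 3 6
    (ask 4 5
     (ask 4 6
      (essential₃ (1 ∷ 5 ∷ 6 ∷ []) (1 ∷ 2 ∷ 2 ∷ []) (3 ∷ 2 ∷ 0 ∷ []) (3 ∷ 0 ∷ 4 ∷ []))
      (forbidden isC₆ᶜ (0 ∷ 3 ∷ 5 ∷ 2 ∷ 4 ∷ 6 ∷ [])))
     (ask 4 6
      (forbidden isK₂₃ (0 ∷ 6 ∷ 2 ∷ 4 ∷ 5 ∷ []))
      (forbidden isG₃ (3 ∷ 4 ∷ 2 ∷ 0 ∷ 6 ∷ 5 ∷ []))))
    (ask 4 6
     (forbidden isK₂₃ (2 ∷ 4 ∷ 0 ∷ 3 ∷ 6 ∷ []))
     (ask 4 5
      (forbidden isG₃ (4 ∷ 3 ∷ 0 ∷ 2 ∷ 5 ∷ 6 ∷ []))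
      (forbidden isDomino (3 ∷ 4 ∷ 2 ∷ 0 ∷ 6 ∷ 5 ∷ [])))))
   (stop))

tree₂₁ : Tree
tree₂₁ = ask 3 5
  (ask 3 4
   (ask 5 6
    (ask 4 6
     (essential₃ (0 ∷ 4 ∷ 5 ∷ []) (2 ∷ 2 ∷ 2 ∷ []) (6 ∷ 1 ∷ 2 ∷ []) (1 ∷ 2 ∷ 3 ∷ []))
     (essential₃ (0 ∷ 4 ∷ 5 ∷ []) (1 ∷ 2 ∷ 2 ∷ []) (6 ∷ 1 ∷ 2 ∷ []) (6 ∷ 2 ∷ 3 ∷ [])))
    (ask 3 6
     (forbidden isK₂₃ (1 ∷ 3 ∷ 2 ∷ 5 ∷ 6 ∷ []))
     (forbidden isC₄* (0 ∷ 2 ∷ 3 ∷ 5 ∷ 6 ∷ []))))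
   (forbidden isK₂₃ (2 ∷ 5 ∷ 1 ∷ 3 ∷ 4 ∷ [])))
  (ask 3 6
   (ask 3 4
    (ask 4 6
     (ask 5 6
      (essential₃ (0 ∷ 4 ∷ 5 ∷ []) (2 ∷ 2 ∷ 1 ∷ []) (6 ∷ 1 ∷ 3 ∷ []) (1 ∷ 2 ∷ 3 ∷ []))
      (forbidden isK₂₃ (1 ∷ 4 ∷ 2 ∷ 5 ∷ 6 ∷ [])))
     (ask 5 6
      (forbidden isC₆ᶜ (1 ∷ 3 ∷ 5 ∷ 2 ∷ 6 ∷ 4 ∷ []))
      (forbidden isG₃ (3 ∷ 6 ∷ 2 ∷ 1 ∷ 4 ∷ 5 ∷ []))))
    (ask 4 6
     (forbidden isK₂₃ (2 ∷ 6 ∷ 1 ∷ 3 ∷ 4 ∷ []))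
     (ask 5 6
      (forbidden isG₃ (5 ∷ 4 ∷ 1 ∷ 2 ∷ 6 ∷ 3 ∷ []))
      (forbidden isDomino (3 ∷ 6 ∷ 2 ∷ 1 ∷ 4 ∷ 5 ∷ [])))))
   (stop))

tree₂₂ : Tree
tree₂₂ = ask 4 7
  (ask 4 6
   (essential₃ (0 ∷ 1 ∷ 2 ∷ []) (2 ∷ 2 ∷ 2 ∷ []) (7 ∷ 4 ∷ 6 ∷ []) (4 ∷ 6 ∷ 7 ∷ []))
   (ask 5 7
    (essential₃ (0 ∷ 1 ∷ 2 ∷ []) (2 ∷ 2 ∷ 2 ∷ []) (7 ∷ 4 ∷ 5 ∷ []) (4 ∷ 5 ∷ 7 ∷ []))
    (essential₃ (0 ∷ 1 ∷ 2 ∷ []) (2 ∷ 2 ∷ 2 ∷ []) (7 ∷ 4 ∷ 6 ∷ []) (4 ∷ 5 ∷ 7 ∷ []))))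
  (ask 3 5
   (ask 3 4
    (ask 5 7
     (ask 3 7
      (forbidden isC₅K₂ᶜ (0 ∷ 3 ∷ 1 ∷ 4 ∷ 7 ∷ 2 ∷ 5 ∷ []))
      (forbidden isK₂₃ (2 ∷ 5 ∷ 0 ∷ 3 ∷ 7 ∷ [])))
     (essential₃ (0 ∷ 2 ∷ 4 ∷ []) (2 ∷ 2 ∷ 1 ∷ []) (3 ∷ 5 ∷ 7 ∷ []) (5 ∷ 1 ∷ 7 ∷ [])))
    (forbidden isK₂₃ (2 ∷ 5 ∷ 1 ∷ 3 ∷ 4 ∷ [])))
   (ask 3 6
    (ask 3 7
     (ask 4 6
      (ask 3 4
       (forbidden isC₅K₂ᶜ (0 ∷ 3 ∷ 1 ∷ 4 ∷ 7 ∷ 2 ∷ 6 ∷ []))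
       (forbidden isK₂₃ (2 ∷ 6 ∷ 1 ∷ 3 ∷ 4 ∷ [])))
      (essential₃ (1 ∷ 2 ∷ 7 ∷ []) (2 ∷ 2 ∷ 1 ∷ []) (3 ∷ 6 ∷ 4 ∷ []) (6 ∷ 0 ∷ 4 ∷ [])))
     (forbidden isK₂₃ (2 ∷ 6 ∷ 0 ∷ 3 ∷ 7 ∷ [])))
    (stop)))

quad₁ : Tree
quad₁ = ask 3 4
  (forbidden isC₄* (0 ∷ 1 ∷ 3 ∷ 4 ∷ 5 ∷ []))
  (stop)

quad₂ : Tree
quad₂ = ask 3 4
  (ask 3 5
   (ask 4 6
    (forbidden isC₆ᶜ (0 ∷ 3 ∷ 6 ∷ 1 ∷ 4 ∷ 5 ∷ []))
    (forbidden isG₃ (3 ∷ 4 ∷ 1 ∷ 0 ∷ 5 ∷ 6 ∷ [])))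
   (ask 4 6
    (forbidden isG₃ (4 ∷ 3 ∷ 0 ∷ 1 ∷ 6 ∷ 5 ∷ []))
    (forbidden isDomino (3 ∷ 4 ∷ 1 ∷ 0 ∷ 5 ∷ 6 ∷ []))))
  (stop)

-- For k = 4 the names 2, 0 and 1 denote three consecutive vertices of Q, 3 and 4
-- the witnesses of the pairs preceding and following 0 and 1, and 5 and 6 theirs.

trio : Facts
trio = (1 , 0 , adj) ∷ (2 , 0 , adj) ∷ (2 , 1 , adj) ∷ []

wf : ℕ → (r s t : Relation) → Facts → Facts
wf w r s t fs = (w , 0 , r) ∷ (w , 1 , s) ∷ (w , 2 , t) ∷ fs

facts₁₁ facts₁₂ facts₂₁ facts₂₂ quads₁ quads₂ : Facts
facts₁₁ = wf 3 far far adj (wf 4 adj far far (wf 5 far adj far trio))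
facts₁₂ = (6 , 5 , adj) ∷ wf 3 far far adj (wf 4 adj far far (wf 5 adj adj far (wf 6 far adj adj trio)))
facts₂₁ = (5 , 4 , adj) ∷ wf 3 far far adj (wf 4 adj far adj (wf 5 adj adj far (wf 6 far adj far trio)))
facts₂₂ = (5 , 4 , adj) ∷ (7 , 6 , adj) ∷ wf 3 far far adj (wf 4 adj far adj (wf 5 adj adj far (wf 6 adj adj far (wf 7 far adj adj trio))))
quads₁ = (1 , 0 , adj) ∷ (3 , 0 , far) ∷ (3 , 1 , adj) ∷ (4 , 0 , adj) ∷ (4 , 1 , far) ∷ (5 , 0 , far) ∷ (5 , 1 , far) ∷ (5 , 3 , non) ∷ (5 , 4 , non) ∷ (5 , 2 , adj) ∷ []
quads₂ = (1 , 0 , adj) ∷ (3 , 0 , far) ∷ (3 , 1 , adj) ∷ (4 , 0 , adj) ∷ (4 , 1 , far) ∷ (5 , 0 , far) ∷ (5 , 1 , adj) ∷ (5 , 4 , non) ∷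
         (6 , 0 , adj) ∷ (6 , 1 , far) ∷ (6 , 3 , non) ∷ (6 , 5 , adj) ∷ []

-- Running the decision trees

module Trees (Γ : Graphᴺ) (Wt : ℕ → Set) (M : ℕ) (64≤M : 64 ≤ M) (W : ℕ) (M≤W : M ≤ W) where
  open Core Γ Wt M 64≤M W M≤W
  open Obstacles Γ
  open TreeSoundness Γ
  open SecondPassing Γ Wt M 64≤M W M≤W using (Result)

  Out : Memory → Set
  Out μ = Result μ ⊎ (Σ Forbidden λ F → μ 0 0 ≡ 1 × μ 1 0 ≡ size-of F × ForbiddenAt F (μ 2))

  -- Array 25 holds the named vertices, and 29 [ 0 ] tells whether an answer has been written.
  query : ℕ → ℕ → Program
  query a b = 8 [ lit 11 ]≔ lit 0 ⍮ for 10 below (9 [ lit 1 ]) loop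
    cond ((18 [ slot 10 ]) ≈ (25 [ lit a ])) (cond ((19 [ slot 10 ]) ≈ (25 [ lit b ])) (8 [ lit 11 ]≔ lit 1) skip) skip

  tree-program : Tree → Program
  tree-program (ask a b t u) = query a b ⍮ cond (slot 11 ≈ lit 1) (tree-program t) (tree-program u)
  tree-program stop = skip
  tree-program (forbidden F ns) =
    2 [ lit 0 ]≔ (25 [ lit (ns at 0) ]) ⍮ 2 [ lit 1 ]≔ (25 [ lit (ns at 1) ]) ⍮ 2 [ lit 2 ]≔ (25 [ lit (ns at 2) ]) ⍮
    2 [ lit 3 ]≔ (25 [ lit (ns at 3) ]) ⍮ 2 [ lit 4 ]≔ (25 [ lit (ns at 4) ]) ⍮ 2 [ lit 5 ]≔ (25 [ lit (ns at 5) ]) ⍮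
    2 [ lit 6 ]≔ (25 [ lit (ns at 6) ]) ⍮ 1 [ lit 0 ]≔ lit (size-of F) ⍮ 0 [ lit 0 ]≔ lit 1 ⍮ 29 [ lit 0 ]≔ lit 1
  tree-program (essential₃ qs zs fs ss) =
    2 [ lit 0 ]≔ (25 [ lit (qs at 0) ]) ⍮ 2 [ lit 1 ]≔ (25 [ lit (qs at 1) ]) ⍮ 2 [ lit 2 ]≔ (25 [ lit (qs at 2) ]) ⍮
    3 [ lit 0 ]≔ lit (zs at 0) ⍮ 3 [ lit 1 ]≔ lit (zs at 1) ⍮ 3 [ lit 2 ]≔ lit (zs at 2) ⍮
    4 [ lit 0 ]≔ (25 [ lit (fs at 0) ]) ⍮ 4 [ lit 1 ]≔ (25 [ lit (fs at 1) ]) ⍮ 4 [ lit 2 ]≔ (25 [ lit (fs at 2) ]) ⍮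
    5 [ lit 0 ]≔ (25 [ lit (ss at 0) ]) ⍮ 5 [ lit 1 ]≔ (25 [ lit (ss at 1) ]) ⍮ 5 [ lit 2 ]≔ (25 [ lit (ss at 2) ]) ⍮
    1 [ lit 0 ]≔ lit 3 ⍮ 0 [ lit 0 ]≔ lit 0 ⍮ 29 [ lit 0 ]≔ lit 1

  written : (v w : ℕ → ℕ) → List ℕ → ℕ → ℕ
  written v w ns = upd (upd (upd (upd (upd (upd (upd w 0 (v (ns at 0))) 1 (v (ns at 1))) 2 (v (ns at 2))) 3 (v (ns at 3))) 4 (v (ns at 4))) 5 (v (ns at 5))) 6 (v (ns at 6))

  NonAll : (ℕ → ℕ) → List (ℕ × ℕ) → Set
  NonAll v [] = ⊤
  NonAll v ((a , b) ∷ ps) = ¬ E (v a) (v b) × NonAll v ps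

  non-all : ∀ v {fs} ps → All (Holdsᶠ v) fs → T (allNon fs ps) → NonAll v ps
  non-all v [] hs t = tt
  non-all v {fs} ((a , b) ∷ ps) hs t with T-∧₁ {has isNon fs a b} t
  ... | p , q = non-sound v hs p , non-all v ps hs q

  -- `R` carries what is known about the rest of the memory through the tree. The questions write
  -- only to array 8, whence `stable`.
  module _ (N q : ℕ) (ps : List (ℕ × ℕ)) (R : Memory → Set) (stable : ∀ μ i x → R μ → R (μ [ 8 , i ↦ x ])) where
    open Names N

    Asked : (fs : Facts) → Memory → Set
    Asked fs μ = R μ × μ 29 0 ≡ 0 × Edges (μ 9 1) (μ 18) (μ 19) × All (Holdsᶠ (μ 25)) fs × (∀ a → q ≤ a → a < N → Wt (μ 25 a))

    Answered : Memory → Set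
    Answered μ = (μ 29 0 ≡ 1 × Out μ) ⊎ (μ 29 0 ≡ 0 × R μ × NonAll (μ 25) ps)

    query-triple : ∀ fs a b → q ≤ a → a < N → q ≤ b → b < N →
      ⟨ Asked fs ⟩ query a b ⟨ (λ μ → Asked fs μ × Flag (μ 8 11) (μ 25 a) (μ 25 b)) ⟩
    query-triple fs a b q≤a a<N q≤b b<N =
      straight {Q = λ μ → Asked fs μ × μ 8 11 ≡ 0} _ (λ μ B (r , h) → (stable μ 11 0 r , h) , refl) ▹ loops 10 (9 [ lit 1 ]) _ λ μ₀ ((r , h) , z) → record
      { times  = μ₀ 9 1
      ; Inv    = λ e μ → μ 9 1 ≡ μ₀ 9 1 × Asked fs μ × (μ 8 11 ≡ 0 ⊎ μ 8 11 ≡ 1 × E (μ 25 a) (μ 25 b)) ×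
                         (∀ e′ → e′ < e → μ 18 e′ ≡ μ 25 a → μ 19 e′ ≡ μ 25 b → μ 8 11 ≡ 1)
      ; times≤ = λ B → B 9 1
      ; fixed  = λ _ _ (e , _) → e
      ; base   = refl , (stable μ₀ 10 0 r , h) , inj₁ z , λ _ ()
      ; step   = λ μ B lt (e , (r , h@(_ , ed , _)) , s , d) →
          (λ x≡ → (λ y≡ → refl , e , (stable (μ [ 8 , 11 ↦ 1 ]) 10 (suc (μ 8 10)) (stable μ 11 1 r) , h) ,
                     inj₂ (refl , subst₂ E x≡ y≡ (Edges.sound ed (μ 8 10) (subst (μ 8 10 <_) (sym e) lt))) , below (λ e′ _ _ _ → refl) (λ _ _ → refl)) ,
                  (λ y≢ → refl , e , (stable μ 10 (suc (μ 8 10)) r , h) , s , below d (λ _ y≡ → ⊥-elim (y≢ y≡)))) ,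
          (λ x≢ → refl , e , (stable μ 10 (suc (μ 8 10)) r , h) , s , below d (λ x≡ _ → ⊥-elim (x≢ x≡)))
      ; exit   = λ μ (e , h@(_ , _ , ed , _ , w) , s , d) → h , flag μ (subst (λ m → Edges m (μ 18) (μ 19)) e ed) w s d
      }
      where
      flag : ∀ {m} μ → Edges m (μ 18) (μ 19) → (∀ a → q ≤ a → a < N → Wt (μ 25 a)) → (μ 8 11 ≡ 0 ⊎ μ 8 11 ≡ 1 × E (μ 25 a) (μ 25 b)) →
             (∀ e′ → e′ < m → μ 18 e′ ≡ μ 25 a → μ 19 e′ ≡ μ 25 b → μ 8 11 ≡ 1) → Flag (μ 8 11) (μ 25 a) (μ 25 b)
      flag μ ed w (inj₂ s) d = inj₁ s
      flag μ ed w (inj₁ z) d = inj₂ (z , λ e → let (e′ , e′< , p , p′) = Edges.complete ed (w a q≤a a<N) (w b q≤b b<N) e in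
                                          case trans (sym z) (d e′ e′< p p′) of λ ())

    -- Each answer extends the facts just as `check` does along the branch. The scans for different
    -- questions stand in sequence, so a fixed tree costs a fixed number of them.
    tree-triple : ∀ t fs → T (check q ps fs t) → ⟨ Asked fs ⟩ tree-program t ⟨ Answered ⟩
    tree-triple (ask a b t u) fs c with T-∧₁ {(q ≤ᵇ a) ∧ (a <ᵇ N)} c
    ... | ca , c′ with T-∧₁ {(q ≤ᵇ b) ∧ (b <ᵇ N)} c′
    ... | cb , c″ with T-∧₁ {check q ps ((a , b , adj) ∷ fs) t} c″ | T-∧₁ {q ≤ᵇ a} ca | T-∧₁ {q ≤ᵇ b} cb
    ... | ct , cu | a₁ , a₂ | b₁ , b₂ =
      query-triple fs a b (≤ᵇ⇒≤ q a a₁) (<ᵇ⇒< a N a₂) (≤ᵇ⇒≤ q b b₁) (<ᵇ⇒< b N b₂) ▹ branch (slot 11 ≈ lit 1)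
        (weaken (λ { μ (((r , z , ed , hs , w) , inj₁ (_ , e)) , _) → r , z , ed , e ∷ hs , w
                   ; μ ((_ , inj₂ (z , _)) , o) → case trans (sym z) o of λ () }) (λ _ p → p) (tree-triple t _ ct))
        (weaken (λ { μ (((r , z , ed , hs , w) , inj₂ (_ , e)) , _) → r , z , ed , e ∷ hs , w
                   ; μ ((_ , inj₁ (o , _)) , n) → ⊥-elim (n o) }) (λ _ p → p) (tree-triple u _ cu))
    tree-triple stop fs c = straight skip λ μ B (r , z , ed , hs , w) → inj₂ (z , r , non-all (μ 25) ps hs c)
    tree-triple (forbidden F ns) fs c = straight (tree-program (forbidden F ns)) λ μ B (r , z , ed , hs , w) → let v = μ 25 in
        v (ns at 0) , refl , v (ns at 1) , refl , v (ns at 2) , refl , v (ns at 3) , refl , v (ns at 4) , refl , v (ns at 5) , refl , v (ns at 6) , refl ,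
        small F (inj₁ (refl , inj₂ (F , refl , refl , forbidden-sound v {N} {fs} hs F ns c (written v (μ 2) ns) (named F {v} {μ 2}))))
      where
      small : ∀ F {X : Set} → X → (if size-of F ≤ᵇ 64 then X else ⊥)
      small isC₄* x = x
      small isK₂₃ x = x
      small isDomino x = x
      small isG₃ x = x
      small isC₆ᶜ x = x
      small isC₅K₂ᶜ x = x
      named : ∀ F {v w : ℕ → ℕ} (i : Fin (size-of F)) →
        written v w ns (toℕ i) ≡ v (ns at toℕ i)
      named F {v} {w} i = seven (toℕ i) (<-≤-trans (toℕ<n i) (size≤7 F))
        where
        size≤7 : ∀ F → size-of F ≤ 7
        size≤7 isC₄* = ≤ᵇ⇒≤ 5 7 tt
        size≤7 isK₂₃ = ≤ᵇ⇒≤ 5 7 tt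
        size≤7 isDomino = ≤ᵇ⇒≤ 6 7 tt
        size≤7 isG₃ = ≤ᵇ⇒≤ 6 7 tt
        size≤7 isC₆ᶜ = ≤ᵇ⇒≤ 6 7 tt
        size≤7 isC₅K₂ᶜ = ≤ᵇ⇒≤ 7 7 tt
        seven : ∀ i → i < 7 → written v w ns i ≡ v (ns at i)
        seven 0 _ = refl
        seven 1 _ = refl
        seven 2 _ = refl
        seven 3 _ = refl
        seven 4 _ = refl
        seven 5 _ = refl
        seven 6 _ = refl
        seven (suc (suc (suc (suc (suc (suc (suc _))))))) (s≤s (s≤s (s≤s (s≤s (s≤s (s≤s (s≤s ())))))))
    tree-triple (essential₃ qs zs fs′ ss) fs c = straight (tree-program (essential₃ qs zs fs′ ss)) λ μ B (r , z , ed , hs , w) → let v = μ 25 in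
        v (qs at 0) , refl , v (qs at 1) , refl , v (qs at 2) , refl ,
        small (size≤2 v hs 0 (s≤s z≤n)) (small (size≤2 v hs 1 (s≤s (s≤s z≤n))) (small (size≤2 v hs 2 (s≤s (s≤s (s≤s z≤n))))
        (v (fs′ at 0) , refl , v (fs′ at 1) , refl , v (fs′ at 2) , refl , v (ss at 0) , refl , v (ss at 1) , refl , v (ss at 2) , refl ,
         inj₁ (refl , inj₁ (refl , obstacle₃ v {N} {fs} hs {qs} {zs} {fs′} {ss} (three) (three) (three) (three) c , essential₃-sound v {N} {fs} hs {qs} {zs} {fs′} {ss} {Z = λ i → zs at i} (three) (λ _ _ → refl) (three) (three) c)))))
      where
      small : ∀ {x} {X : Set} → x ≤ 2 → X → (if x ≤ᵇ 64 then X else ⊥)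
      small {0} _ x = x
      small {1} _ x = x
      small {2} _ x = x
      small {suc (suc (suc _))} (s≤s (s≤s ()))
      -- `wp` demands literals of at most 64. The sizes in a leaf are variables here, but the
      -- successful check makes each of them 1 or 2.
      size≤2 : ∀ v → All (Holdsᶠ v) fs → ∀ i → i < 3 → (zs at i) ≤ 2
      size≤2 v hs i i<3 with Obs.wit (obstacle₃ v {N} {fs} hs {qs} {zs} {fs′} {ss} {λ i → v (qs at i)} {zs at_} {λ i → v (fs′ at i)} {λ i → v (ss at i)} (λ _ _ → refl) (λ _ _ → refl) (λ _ _ → refl) (λ _ _ → refl) c) i i<3
      ... | single z _ _ = ≤-trans (≤-reflexive z) (s≤s z≤n)
      ... | double z _ _ _ = ≤-reflexive z
      three : ∀ {g w : ℕ → ℕ} i → i < 3 → upd (upd (upd w 0 (g 0)) 1 (g 1)) 2 (g 2) i ≡ g i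
      three 0 _ = refl
      three 1 _ = refl
      three 2 _ = refl
      three (suc (suc (suc _))) (s≤s (s≤s (s≤s ())))


-- Enumerations with three vertices

nx³ : ∀ {i} → i < 3 → nx 3 (nx 3 (nx 3 i)) ≡ i
nx³ {0} _ = refl
nx³ {1} _ = refl
nx³ {2} _ = refl
nx³ {suc (suc (suc _))} (s≤s (s≤s (s≤s ())))

nx-reach : ∀ i j → i < 3 → j < 3 → j ≡ i ⊎ j ≡ nx 3 i ⊎ j ≡ nx 3 (nx 3 i)
nx-reach 0 0 _ _ = inj₁ refl
nx-reach 0 1 _ _ = inj₂ (inj₁ refl)
nx-reach 0 2 _ _ = inj₂ (inj₂ refl)
nx-reach 1 0 _ _ = inj₂ (inj₂ refl)
nx-reach 1 1 _ _ = inj₁ refl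
nx-reach 1 2 _ _ = inj₂ (inj₁ refl)
nx-reach 2 0 _ _ = inj₂ (inj₁ refl)
nx-reach 2 1 _ _ = inj₂ (inj₂ refl)
nx-reach 2 2 _ _ = inj₁ refl
nx-reach (suc (suc (suc _))) _ (s≤s (s≤s (s≤s ()))) _
nx-reach _ (suc (suc (suc _))) _ (s≤s (s≤s (s≤s ())))

module Triangle (Γ : Graphᴺ) {V Z F S : ℕ → ℕ} (O : Obstacles.Obs Γ 3 V Z F S) where
  open Obstacles Γ
  open Obs O

  data Place (q : ℕ) : Set where
    pair-at   : ∀ i → i < 3 → q ≡ F i → Z i ≡ 1 → S i ≡ F i → Cl 3 V q i (nx 3 i) → Place q
    single-at : ∀ a → Cl 3 V q a a → q ≡ F a ⊎ (Σ ℕ λ j → j < 3 × nx 3 j ≡ a × q ≡ S j) → Place q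

  place : ∀ {q} → IsW 3 F S q → Place q
  place (isW {i} i<3 w) with wit i i<3 | w
  ... | single z e c | inj₁ refl = pair-at i i<3 refl z e c
  ... | single z e c | inj₂ refl = pair-at i i<3 e z e (subst (λ x → Cl 3 V x i (nx 3 i)) (sym e) c)
  ... | double _ c _ _ | inj₁ refl = single-at i c (inj₁ refl)
  ... | double _ _ c _ | inj₂ refl = single-at (nx 3 i) c (inj₂ (i , i<3 , refl , refl))

  -- For k = 3, a witness of two nonneighbours has an edge that is not nested only with a witness
  -- that misses the third vertex. Such a witness is the second one of the next enumeration or the
  -- first one of the enumeration after that, so these two nonadjacencies are all that the trees
  -- must reach.
  module _ (clear : ∀ i → i < 3 → Z i ≡ 1 → ¬ E (F i) (S (nx 3 i)) × ¬ E (F i) (F (nx 3 (nx 3 i)))) where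

    private
      against : ∀ {q i p} → i < 3 → p ≡ F i → Z i ≡ 1 → Cl 3 V p i (nx 3 i) → Place q → E p q → Nested 3 V p q
      against {i = i} i<3 refl z c (pair-at j j<3 refl _ e d) pq with nx-reach i j i<3 j<3
      ... | inj₁ refl = nested-by c d (inj₁ refl) (inj₂ refl)
      ... | inj₂ (inj₁ refl) = ⊥-elim (proj₁ (clear i i<3 z) (subst (E (F i)) (sym e) pq))
      ... | inj₂ (inj₂ refl) = ⊥-elim (proj₂ (clear i i<3 z) pq)
      against {i = i} i<3 refl z c (single-at a d w) pq with nx-reach i a i<3 (Cl.l< d)
      ... | inj₁ refl = nested-sym (nested-by d c (inj₁ refl) (inj₁ refl))
      ... | inj₂ (inj₁ refl) = nested-sym (nested-by d c (inj₂ refl) (inj₂ refl))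
      ... | inj₂ (inj₂ refl) with w
      ...   | inj₁ refl = ⊥-elim (proj₂ (clear i i<3 z) pq)
      ...   | inj₂ (j , j<3 , e , refl) with refl ← nx-inj j<3 (nx<k i<3) e = ⊥-elim (proj₁ (clear i i<3 z) pq)

      both : ∀ {p q} → Place p → Place q → E p q → Nested 3 V p q ⊎ Neighbouring 3 V p q ⊎ Neighbouring 3 V q p
      both (pair-at i i<3 e z _ c) Q pq = inj₁ (against i<3 e z c Q pq)
      both P@(single-at _ _ _) (pair-at i i<3 e z _ c) pq = inj₁ (nested-sym (against i<3 e z c P (E-sym pq)))
      both (single-at a c _) (single-at b d _) pq with nx-reach a b (Cl.l< c) (Cl.l< d)
      ... | inj₁ refl = inj₁ (nested-by c d (inj₁ refl) (inj₁ refl))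
      ... | inj₂ (inj₁ refl) = inj₂ (inj₁ (a , c , d))
      ... | inj₂ (inj₂ refl) = inj₂ (inj₂ (nx 3 (nx 3 a) , d , subst (λ x → Cl 3 V _ x x) (sym (nx³ (Cl.l< c))) c))

    no-double : NoDbl 3 V F S
    no-double = no-double-by λ wp wq → both (place wp) (place wq)

from-start : ∀ {P : ℕ → Set} {q} → ∀ a → q ≤ a → a < q → P a
from-start a q≤a a<q = ⊥-elim (<-irrefl refl (≤-<-trans q≤a a<q))

extend : ∀ {P : ℕ → Set} {q N} → (∀ a → q ≤ a → a < N → P a) → P N → ∀ a → q ≤ a → a < suc N → P a
extend {P} {q} f p = λ a q≤a a<N → below {P = λ a → q ≤ a → P a} (λ a a<N q≤a → f a q≤a a<N) (λ _ → p) a a<N q≤a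

module Small (Γ : Graphᴺ) (Wt : ℕ → Set) (M : ℕ) (64≤M : 64 ≤ M) (W : ℕ) (M≤W : M ≤ W) where
  open Core Γ Wt M 64≤M W M≤W
  open Obstacles Γ
  open TreeSoundness Γ
  open Restriction Γ using (Minimal)
  open Trees Γ Wt M 64≤M W M≤W

  -- Assertions about the contents of arrays 9 to 13, 18 and 19 only: writing to other arrays
  -- preserves them by computation, so `stable` is the identity.
  Slices : Set₁
  Slices = (v9 V Z F S src tgt : ℕ → ℕ) → Set

  _of_ : Slices → Memory → Set
  Ψ of μ = Ψ (μ 9) (μ 10) (μ 11) (μ 12) (μ 13) (μ 18) (μ 19)

  Undecided : Slices → Memory → Set
  Undecided Ψ μ = (μ 29 0 ≡ 1 × Out μ) ⊎ (μ 29 0 ≡ 0 × Ψ of μ)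

  name : ℕ → Expr → Program
  name a e = 25 [ lit a ]≔ e

  triple-at : (i j l : ℕ) → Program
  triple-at i j l = cond ((11 [ lit i ]) ≈ lit 1) (cond ((11 [ lit j ]) ≈ lit 1)
      (cond ((11 [ lit l ]) ≈ lit 1)
        ((base ⍮ name 5 (12 [ lit l ])) ⍮ tree-program tree₁₁)
        ((base ⍮ name 5 (12 [ lit l ]) ⍮ name 6 (13 [ lit l ])) ⍮ tree-program tree₁₂))
      (cond ((11 [ lit l ]) ≈ lit 1)
        ((base ⍮ name 5 (13 [ lit j ]) ⍮ name 6 (12 [ lit l ])) ⍮ tree-program tree₂₁)
        ((base ⍮ name 5 (13 [ lit j ]) ⍮ name 6 (12 [ lit l ]) ⍮ name 7 (13 [ lit l ])) ⍮ tree-program tree₂₂))) skip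
    where
    base : Program
    base = name 0 (10 [ lit i ]) ⍮ name 1 (10 [ lit j ]) ⍮ name 2 (10 [ lit l ]) ⍮ name 3 (12 [ lit i ]) ⍮ name 4 (12 [ lit j ])

  ClearAt : (i j l : ℕ) → Slices
  ClearAt i j l _ V Z F S _ _ = Z i ≡ 1 → ¬ E (F i) (S j) × ¬ E (F i) (F l)

  module _ (Ψ : Slices) (get : ∀ {v9 V Z F S src tgt} → Ψ v9 V Z F S src tgt → State 3 (v9 1) (v9 2) V Z F S src tgt)
    (i j l : ℕ) (i< : i < 3) (j< : j < 3) (l< : l < 3) (ij : nx 3 i ≡ j) (jl : nx 3 j ≡ l) (li : nx 3 l ≡ i)
    (i≢j : i ≢ j) (j≢l : j ≢ l) (l≢i : l ≢ i) where

    private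
      module _ {v9 V Z F S src tgt : ℕ → ℕ} (ψ : Ψ v9 V Z F S src tgt) where
        st : State 3 (v9 1) (v9 2) V Z F S src tgt
        st = get ψ
        open State st
        open Obs obstacle

        one-at : ∀ {a b} → a < 3 → nx 3 a ≡ b → Z a ≡ 1 → Cl 3 V (F a) a b × S a ≡ F a
        one-at a< ab z with wit _ a<
        ... | double z′ _ _ _ = case trans (sym z) z′ of λ ()
        ... | single _ e c = subst (Cl 3 V (F _) _) ab c , e

        two-at : ∀ {a b} → a < 3 → nx 3 a ≡ b → Z a ≢ 1 → Cl 3 V (F a) a a × Cl 3 V (S a) b b × E (F a) (S a)
        two-at a< ab z with wit _ a<
        ... | single z′ _ _ = ⊥-elim (z z′)
        ... | double _ c d e = c , subst (λ x → Cl 3 V (S _) x x) ab d , e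

        fw : ∀ {a} → a < 3 → Wt (F a)
        fw a< = original (isW a< (inj₁ refl))
        sw : ∀ {a} → a < 3 → Wt (S a)
        sw a< = original (isW a< (inj₂ refl))

        trio-holds : ∀ {v} → v 0 ≡ V i → v 1 ≡ V j → v 2 ≡ V l → All (Holdsᶠ v) trio
        trio-holds a b c = subst₂ E (sym b) (sym a) (clique j i j< i< (i≢j ∘ sym)) ∷ subst₂ E (sym c) (sym a) (clique l i l< i< l≢i) ∷
          subst₂ E (sym c) (sym b) (clique l j l< j< (j≢l ∘ sym)) ∷ []

      farl : ∀ {V x a b} → Cl 3 V x a b → ¬ E x (V a) × x ≢ V a
      farl c = Cl.nl c , Cl.out c _ (Cl.l< c)
      farh : ∀ {V x a b} → Cl 3 V x a b → ¬ E x (V b) × x ≢ V b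
      farh c = Cl.nh c , Cl.out c _ (Cl.h< c)

      R : ℕ → ℕ → Memory → Set
      R a b μ = Ψ of μ × μ 25 3 ≡ μ 12 i × (μ 25 a ≡ μ 13 j) × μ 25 b ≡ μ 12 l

      done : ∀ {a b} μ → Answered 6 3 ((3 , a) ∷ (3 , b) ∷ []) (R a b) (λ _ _ _ r → r) μ →
             Undecided (λ v9 V Z F S src tgt → Ψ v9 V Z F S src tgt × ClearAt i j l v9 V Z F S src tgt) μ
      done μ (inj₁ o) = inj₁ o
      done μ (inj₂ (z , (ψ , e₁ , e₂ , e₃) , n₁ , n₂ , _)) = inj₂ (z , ψ , λ _ → (λ e → n₁ (subst₂ E (sym e₁) (sym e₂) e)) , λ e → n₂ (subst₂ E (sym e₁) (sym e₃) e))

    triple-at-triple : ⟨ (λ μ → μ 29 0 ≡ 0 × Ψ of μ) ⟩ triple-at i j l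
      ⟨ Undecided (λ v9 V Z F S src tgt → Ψ v9 V Z F S src tgt × ClearAt i j l v9 V Z F S src tgt) ⟩
    triple-at-triple = branch ((11 [ lit i ]) ≈ lit 1)
      (branch ((11 [ lit j ]) ≈ lit 1)
        (branch ((11 [ lit l ]) ≈ lit 1)
          (straight {Q = Asked 6 3 ((3 , 4) ∷ (3 , 5) ∷ []) (R 4 5) (λ _ _ _ r → r) facts₁₁} _ (λ { μ B ((((z , ψ) , zi) , zj) , zl) →
             let (ci , _) = one-at ψ i< ij zi ; (cj , ej) = one-at ψ j< jl zj ; (ck , _) = one-at ψ l< li zl in
             μ 10 i , refl , μ 10 j , refl , μ 10 l , refl , μ 12 i , refl , μ 12 j , refl , μ 12 l , refl ,
             (ψ , refl , sym ej , refl) , z , State.listed (st ψ) ,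
             farl ci ∷ farh ci ∷ Cl.adj ci l l< l≢i (j≢l ∘ sym) ∷
             Cl.adj cj i i< i≢j (l≢i ∘ sym) ∷ farl cj ∷ farh cj ∷
             farh ck ∷ Cl.adj ck j j< j≢l (i≢j ∘ sym) ∷ farl ck ∷ trio-holds ψ refl refl refl ,
             extend (extend (extend from-start (fw ψ i<)) (fw ψ j<)) (fw ψ l<) })
           ▹ weaken (λ _ h → h) done (tree-triple 6 3 ((3 , 4) ∷ (3 , 5) ∷ []) (R 4 5) (λ _ _ _ r → r) tree₁₁ facts₁₁ tt))
          (straight {Q = Asked 7 3 ((3 , 4) ∷ (3 , 5) ∷ []) (R 4 5) (λ _ _ _ r → r) facts₁₂} _ (λ { μ B ((((z , ψ) , zi) , zj) , zl) →
             let (ci , _) = one-at ψ i< ij zi ; (cj , ej) = one-at ψ j< jl zj ; (ck , dk , ek) = two-at ψ l< li zl in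
             μ 10 i , refl , μ 10 j , refl , μ 10 l , refl , μ 12 i , refl , μ 12 j , refl , μ 12 l , refl , μ 13 l , refl ,
             (ψ , refl , sym ej , refl) , z , State.listed (st ψ) ,
             E-sym ek ∷ farl ci ∷ farh ci ∷ Cl.adj ci l l< l≢i (j≢l ∘ sym) ∷
             Cl.adj cj i i< i≢j (l≢i ∘ sym) ∷ farl cj ∷ farh cj ∷
             Cl.adj ck i i< (l≢i ∘ sym) (l≢i ∘ sym) ∷ Cl.adj ck j j< j≢l j≢l ∷ farl ck ∷
             farl dk ∷ Cl.adj dk j j< (i≢j ∘ sym) (i≢j ∘ sym) ∷ Cl.adj dk l l< l≢i l≢i ∷ trio-holds ψ refl refl refl ,
             extend (extend (extend (extend from-start (fw ψ i<)) (fw ψ j<)) (fw ψ l<)) (sw ψ l<) })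
           ▹ weaken (λ _ h → h) done (tree-triple 7 3 ((3 , 4) ∷ (3 , 5) ∷ []) (R 4 5) (λ _ _ _ r → r) tree₁₂ facts₁₂ tt)))
        (branch ((11 [ lit l ]) ≈ lit 1)
          (straight {Q = Asked 7 3 ((3 , 5) ∷ (3 , 6) ∷ []) (R 5 6) (λ _ _ _ r → r) facts₂₁} _ (λ { μ B ((((z , ψ) , zi) , zj) , zl) →
             let (ci , _) = one-at ψ i< ij zi ; (cj , dj , ej) = two-at ψ j< jl zj ; (ck , _) = one-at ψ l< li zl in
             μ 10 i , refl , μ 10 j , refl , μ 10 l , refl , μ 12 i , refl , μ 12 j , refl , μ 13 j , refl , μ 12 l , refl ,
             (ψ , refl , refl , refl) , z , State.listed (st ψ) ,
             E-sym ej ∷ farl ci ∷ farh ci ∷ Cl.adj ci l l< l≢i (j≢l ∘ sym) ∷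
             Cl.adj cj i i< i≢j i≢j ∷ farl cj ∷ Cl.adj cj l l< (j≢l ∘ sym) (j≢l ∘ sym) ∷
             Cl.adj dj i i< (l≢i ∘ sym) (l≢i ∘ sym) ∷ Cl.adj dj j j< j≢l j≢l ∷ farl dj ∷
             farh ck ∷ Cl.adj ck j j< j≢l (i≢j ∘ sym) ∷ farl ck ∷ trio-holds ψ refl refl refl ,
             extend (extend (extend (extend from-start (fw ψ i<)) (fw ψ j<)) (sw ψ j<)) (fw ψ l<) })
           ▹ weaken (λ _ h → h) done (tree-triple 7 3 ((3 , 5) ∷ (3 , 6) ∷ []) (R 5 6) (λ _ _ _ r → r) tree₂₁ facts₂₁ tt))
          (straight {Q = Asked 8 3 ((3 , 5) ∷ (3 , 6) ∷ []) (R 5 6) (λ _ _ _ r → r) facts₂₂} _ (λ { μ B ((((z , ψ) , zi) , zj) , zl) →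
             let (ci , _) = one-at ψ i< ij zi ; (cj , dj , ej) = two-at ψ j< jl zj ; (ck , dk , ek) = two-at ψ l< li zl in
             μ 10 i , refl , μ 10 j , refl , μ 10 l , refl , μ 12 i , refl , μ 12 j , refl , μ 13 j , refl , μ 12 l , refl , μ 13 l , refl ,
             (ψ , refl , refl , refl) , z , State.listed (st ψ) ,
             E-sym ej ∷ E-sym ek ∷ farl ci ∷ farh ci ∷ Cl.adj ci l l< l≢i (j≢l ∘ sym) ∷
             Cl.adj cj i i< i≢j i≢j ∷ farl cj ∷ Cl.adj cj l l< (j≢l ∘ sym) (j≢l ∘ sym) ∷
             Cl.adj dj i i< (l≢i ∘ sym) (l≢i ∘ sym) ∷ Cl.adj dj j j< j≢l j≢l ∷ farl dj ∷
             Cl.adj ck i i< (l≢i ∘ sym) (l≢i ∘ sym) ∷ Cl.adj ck j j< j≢l j≢l ∷ farl ck ∷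
             farl dk ∷ Cl.adj dk j j< (i≢j ∘ sym) (i≢j ∘ sym) ∷ Cl.adj dk l l< l≢i l≢i ∷ trio-holds ψ refl refl refl ,
             extend (extend (extend (extend (extend from-start (fw ψ i<)) (fw ψ j<)) (sw ψ j<)) (fw ψ l<)) (sw ψ l<) })
           ▹ weaken (λ _ h → h) done (tree-triple 8 3 ((3 , 5) ∷ (3 , 6) ∷ []) (R 5 6) (λ _ _ _ r → r) tree₂₂ facts₂₂ tt))))
      (straight skip λ { μ B ((z , ψ) , zi) → inj₂ (z , ψ , λ z1 → ⊥-elim (zi z1)) })


-- Enumerations with four vertices, and the whole program on a list of edges

module Assembly (Γ : Graphᴺ) (Wt : ℕ → Set) (M : ℕ) (64≤M : 64 ≤ M) (W : ℕ) (M≤W : M ≤ W) where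
  open Core Γ Wt M 64≤M W M≤W
  open Obstacles Γ
  open TreeSoundness Γ
  open FirstPass Γ using (Gap)
  open Restriction Γ using (Minimal; module NoCandidate)
  open Restricting Γ Wt M 64≤M W M≤W using (restrict; restrict-triple; Outcome; Restricted)
  open Cong Γ
  open FirstPassing Γ Wt M 64≤M W M≤W using (first-pass; first-pass-triple)
  open SecondPassing Γ Wt M 64≤M W M≤W using (second-pass; second-pass-triple; framed; dbl-at)
  open Trees Γ Wt M 64≤M W M≤W
  open Small Γ Wt M 64≤M W M≤W

  quad-at : (i j l : ℕ) → Program
  quad-at i j l = cond ((11 [ lit i ]) ≈ lit 1) (cond ((11 [ lit l ]) ≈ lit 1) (cond ((11 [ lit j ]) ≈ lit 1)
      (base ⍮ tree-program quad₁) ((base ⍮ name 6 (13 [ lit j ])) ⍮ tree-program quad₂)) skip) skip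
    where
    base : Program
    base = name 0 (10 [ lit j ]) ⍮ name 1 (10 [ lit l ]) ⍮ name 2 (10 [ lit i ]) ⍮ name 3 (12 [ lit i ]) ⍮ name 4 (12 [ lit l ]) ⍮ name 5 (12 [ lit j ])

  OppositeAt : (i l : ℕ) → Slices
  OppositeAt i l _ V Z F S _ _ = Z i ≡ 1 → Z l ≡ 1 → ¬ E (F i) (F l)

  module _ (Ψ : Slices) (get : ∀ {v9 V Z F S src tgt} → Ψ v9 V Z F S src tgt → State 4 (v9 1) (v9 2) V Z F S src tgt × Minimal 4 V F S 4)
    (i j l m : ℕ) (i< : i < 4) (j< : j < 4) (l< : l < 4) (ij : nx 4 i ≡ j) (jl : nx 4 j ≡ l) (lm : nx 4 l ≡ m)
    (l≢i : l ≢ i) (i≢j : i ≢ j) (j≢l : j ≢ l) (j≢m : j ≢ m) (li : off 4 l i ≡ 2) (mj : off 4 m j ≡ 2) where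

    private
      module _ {v9 V Z F S src tgt : ℕ → ℕ} (ψ : Ψ v9 V Z F S src tgt) where
        st : State 4 (v9 1) (v9 2) V Z F S src tgt
        st = proj₁ (get ψ)
        open State st
        open Obs obstacle

        one-at : ∀ {a b} → a < 4 → nx 4 a ≡ b → Z a ≡ 1 → Cl 4 V (F a) a b
        one-at a< ab z with wit _ a<
        ... | double z′ _ _ _ = case trans (sym z) z′ of λ ()
        ... | single _ e c = subst (Cl 4 V (F _) _) ab c

        two-at : ∀ {a b} → a < 4 → nx 4 a ≡ b → Z a ≢ 1 → Cl 4 V (F a) a a × Cl 4 V (S a) b b × E (F a) (S a)
        two-at a< ab z with wit _ a<
        ... | single z′ _ _ = ⊥-elim (z z′)
        ... | double _ c d e = c , subst (λ x → Cl 4 V (S _) x x) ab d , e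

        fi : ∀ {a} → a < 4 → IsW 4 F S (F a)
        fi a< = isW a< (inj₁ refl)
        sj : IsW 4 F S (S j)
        sj = isW j< (inj₂ refl)

        edge : E (V l) (V j)
        edge = clique l j l< j< (j≢l ∘ sym)

        -- An edge would give a stretch of three of the four vertices, contrary to minimality. This
        -- is the origin of the `non` facts in `quads₁` and `quads₂`.
        short : ∀ {x y lx hx ly hy} → IsW 4 F S x → IsW 4 F S y → Cl 4 V x lx hx → Cl 4 V y ly hy → off 4 hx ly ≡ 2 → ¬ E x y
        short wx wy cx cy o e = <-irrefl refl (≤-trans (Minimal.least (proj₂ (get ψ)) wx wy cx cy e (≤-reflexive (cong suc (sym o)))) (≤-reflexive (cong suc o)))

        fw : ∀ {a} → a < 4 → Wt (F a)
        fw a< = original (fi a<)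

      farl : ∀ {V x a b} → Cl 4 V x a b → ¬ E x (V a) × x ≢ V a
      farl c = Cl.nl c , Cl.out c _ (Cl.l< c)
      farh : ∀ {V x a b} → Cl 4 V x a b → ¬ E x (V b) × x ≢ V b
      farh c = Cl.nh c , Cl.out c _ (Cl.h< c)

      R : Memory → Set
      R μ = Ψ of μ × μ 25 3 ≡ μ 12 i × μ 25 4 ≡ μ 12 l

      done : ∀ {N} μ → Answered N 3 ((3 , 4) ∷ []) R (λ _ _ _ r → r) μ →
             Undecided (λ v9 V Z F S src tgt → Ψ v9 V Z F S src tgt × OppositeAt i l v9 V Z F S src tgt) μ
      done μ (inj₁ o) = inj₁ o
      done μ (inj₂ (z , (ψ , e₁ , e₂) , n , _)) = inj₂ (z , ψ , λ _ _ e → n (subst₂ E (sym e₁) (sym e₂) e))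

    quad-at-triple : ⟨ (λ μ → μ 29 0 ≡ 0 × Ψ of μ) ⟩ quad-at i j l
      ⟨ Undecided (λ v9 V Z F S src tgt → Ψ v9 V Z F S src tgt × OppositeAt i l v9 V Z F S src tgt) ⟩
    quad-at-triple = branch ((11 [ lit i ]) ≈ lit 1)
      (branch ((11 [ lit l ]) ≈ lit 1)
        (branch ((11 [ lit j ]) ≈ lit 1)
          (straight {Q = Asked 6 3 ((3 , 4) ∷ []) R (λ _ _ _ r → r) quads₁} _ (λ { μ B ((((z , ψ) , zi) , zl) , zj) →
             let ci = one-at ψ i< ij zi ; cj = one-at ψ j< jl zj ; ck = one-at ψ l< lm zl in
             μ 10 j , refl , μ 10 l , refl , μ 10 i , refl , μ 12 i , refl , μ 12 l , refl , μ 12 j , refl ,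
             (ψ , refl , refl) , z , State.listed (st ψ) ,
             edge ψ ∷ farh ci ∷ Cl.adj ci l l< l≢i (j≢l ∘ sym) ∷ Cl.adj ck j j< j≢l j≢m ∷ farl ck ∷ farl cj ∷ farh cj ∷
             short ψ (fi ψ j<) (fi ψ i<) cj ci li ∷ (short ψ (fi ψ l<) (fi ψ j<) ck cj mj ∘ E-sym) ∷ Cl.adj cj i i< i≢j (l≢i ∘ sym) ∷ [] ,
             extend (extend (extend from-start (fw ψ i<)) (fw ψ l<)) (fw ψ j<) })
           ▹ weaken (λ _ h → h) (done {6}) (tree-triple 6 3 ((3 , 4) ∷ []) R (λ _ _ _ r → r) quad₁ quads₁ tt))
          (straight {Q = Asked 7 3 ((3 , 4) ∷ []) R (λ _ _ _ r → r) quads₂} _ (λ { μ B ((((z , ψ) , zi) , zl) , zj) →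
             let ci = one-at ψ i< ij zi ; (cj , dj , ej) = two-at ψ j< jl zj ; ck = one-at ψ l< lm zl in
             μ 10 j , refl , μ 10 l , refl , μ 10 i , refl , μ 12 i , refl , μ 12 l , refl , μ 12 j , refl , μ 13 j , refl ,
             (ψ , refl , refl) , z , State.listed (st ψ) ,
             edge ψ ∷ farh ci ∷ Cl.adj ci l l< l≢i (j≢l ∘ sym) ∷ Cl.adj ck j j< j≢l j≢m ∷ farl ck ∷
             farl cj ∷ Cl.adj cj l l< (j≢l ∘ sym) (j≢l ∘ sym) ∷ (short ψ (fi ψ l<) (fi ψ j<) ck cj mj ∘ E-sym) ∷
             Cl.adj dj j j< j≢l j≢l ∷ farl dj ∷ short ψ (sj ψ) (fi ψ i<) dj ci li ∷ E-sym ej ∷ [] ,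
             extend (extend (extend (extend from-start (fw ψ i<)) (fw ψ l<)) (fw ψ j<)) (State.original (st ψ) (sj ψ)) })
           ▹ weaken (λ _ h → h) (done {7}) (tree-triple 7 3 ((3 , 4) ∷ []) R (λ _ _ _ r → r) quad₂ quads₂ tt)))
        (straight skip λ { μ B (((z , ψ) , zi) , zl) → inj₂ (z , ψ , λ _ z1 → ⊥-elim (zl z1)) }))
      (straight skip λ { μ B ((z , ψ) , zi) → inj₂ (z , ψ , λ z1 → ⊥-elim (zi z1)) })

  Decided : Memory → Set
  Decided μ = (μ 29 0 ≡ 1 × Out μ) ⊎ (μ 29 0 ≡ 0 × St μ × NoDbl (μ 9 0) (μ 10) (μ 12) (μ 13))

  resume : ∀ Ψ Ψ′ {p} → ⟨ (λ μ → μ 29 0 ≡ 0 × Ψ of μ) ⟩ p ⟨ Undecided Ψ′ ⟩ →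
           ⟨ Undecided Ψ ⟩ cond ((29 [ lit 0 ]) ≈ lit 0) p skip ⟨ Undecided Ψ′ ⟩
  resume Ψ Ψ′ t = branch ((29 [ lit 0 ]) ≈ lit 0)
    (weaken (λ { μ (inj₁ (o , _) , z) → case trans (sym o) z of λ () ; μ (inj₂ h , _) → h }) (λ _ h → h) t)
    (straight skip λ { μ B (inj₁ h , _) → inj₁ h ; μ B (inj₂ (z , _) , nz) → ⊥-elim (nz z) })

  Ψ₃ Ψ₃′ Ψ₃″ Ψ₃‴ Ψ₄ Ψ₄′ Ψ₄″ : Slices
  Ψ₃ v9 V Z F S src tgt = v9 0 ≡ 3 × State (v9 0) (v9 1) (v9 2) V Z F S src tgt
  Ψ₃′ v9 V Z F S src tgt = Ψ₃ v9 V Z F S src tgt × ClearAt 0 1 2 v9 V Z F S src tgt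
  Ψ₃″ v9 V Z F S src tgt = Ψ₃′ v9 V Z F S src tgt × ClearAt 1 2 0 v9 V Z F S src tgt
  Ψ₃‴ v9 V Z F S src tgt = Ψ₃″ v9 V Z F S src tgt × ClearAt 2 0 1 v9 V Z F S src tgt
  Ψ₄ v9 V Z F S src tgt = v9 0 ≡ 4 × State (v9 0) (v9 1) (v9 2) V Z F S src tgt × Minimal (v9 0) V F S (v9 0)
  Ψ₄′ v9 V Z F S src tgt = Ψ₄ v9 V Z F S src tgt × OppositeAt 0 2 v9 V Z F S src tgt
  Ψ₄″ v9 V Z F S src tgt = Ψ₄′ v9 V Z F S src tgt × OppositeAt 1 3 v9 V Z F S src tgt

  state-at : ∀ {k k′ m n V Z F S src tgt} → k ≡ k′ → State k m n V Z F S src tgt → State k′ m n V Z F S src tgt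
  state-at refl s = s

  minimal-at : ∀ {k k′ V F S} → k ≡ k′ → Minimal k V F S k → Minimal k′ V F S k′
  minimal-at refl s = s

  triangle quadrangle : Program
  triangle = 29 [ lit 0 ]≔ lit 0 ⍮ triple-at 0 1 2 ⍮ cond ((29 [ lit 0 ]) ≈ lit 0) (triple-at 1 2 0) skip ⍮
             cond ((29 [ lit 0 ]) ≈ lit 0) (triple-at 2 0 1) skip
  quadrangle = 29 [ lit 0 ]≔ lit 0 ⍮ quad-at 0 1 2 ⍮ cond ((29 [ lit 0 ]) ≈ lit 0) (quad-at 1 2 3) skip

  triangle-triple : ⟨ (λ μ → Ψ₃ of μ) ⟩ triangle ⟨ Decided ⟩
  triangle-triple = straight {Q = λ μ → μ 29 0 ≡ 0 × Ψ₃ of μ} _ (λ μ B h → refl , h) ▹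
    triple-at-triple Ψ₃ (λ (e , s) → state-at e s) 0 1 2 (s≤s z≤n) (s≤s (s≤s z≤n)) (s≤s (s≤s (s≤s z≤n))) refl refl refl (λ ()) (λ ()) (λ ()) ▹
    resume Ψ₃′ Ψ₃″ (triple-at-triple Ψ₃′ (λ ((e , s) , _) → state-at e s) 1 2 0 (s≤s (s≤s z≤n)) (s≤s (s≤s (s≤s z≤n))) (s≤s z≤n) refl refl refl (λ ()) (λ ()) (λ ())) ▹
    weaken (λ _ h → h) decided
    (resume Ψ₃″ Ψ₃‴ (triple-at-triple Ψ₃″ (λ (((e , s) , _) , _) → state-at e s) 2 0 1 (s≤s (s≤s (s≤s z≤n))) (s≤s z≤n) (s≤s (s≤s z≤n)) refl refl refl (λ ()) (λ ()) (λ ())))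
    where
    decided : ∀ μ → Undecided Ψ₃‴ μ → Decided μ
    decided μ (inj₁ o) = inj₁ o
    decided μ (inj₂ (z , (((e , s) , c₀) , c₁) , c₂)) = inj₂ (z , s , dbl-at (sym e) (Triangle.no-double Γ (State.obstacle (state-at e s)) all-clear))
      where
      all-clear : ∀ i → i < 3 → μ 11 i ≡ 1 → ¬ E (μ 12 i) (μ 13 (nx 3 i)) × ¬ E (μ 12 i) (μ 12 (nx 3 (nx 3 i)))
      all-clear 0 _ = c₀
      all-clear 1 _ = c₁
      all-clear 2 _ = c₂
      all-clear (suc (suc (suc _))) (s≤s (s≤s (s≤s ())))

  pair-is-first : ∀ {k V Z F S p l} → Obs k V Z F S → IsW k F S p → Cl k V p l (nx k l) → p ≡ F l × Z l ≡ 1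
  pair-is-first O (isW i<k w) c with Obs.wit O _ i<k | w
  ... | single z _ d | inj₁ refl with refl , _ ← Cl-unique (Obs.3≤k O) d c = refl , z
  ... | single z e d | inj₂ refl with refl , _ ← Cl-unique (Obs.3≤k O) (subst (λ x → Cl _ _ x _ _) (sym e) d) c = e , z
  ... | double _ d _ _ | inj₁ refl with refl , e ← Cl-unique (Obs.3≤k O) d c = ⊥-elim (nx≢ (<⇒≤ (Obs.3≤k O)) (Cl.l< d) (sym e))
  ... | double _ _ d _ | inj₂ refl with refl , e ← Cl-unique (Obs.3≤k O) d c = ⊥-elim (nx≢ (<⇒≤ (Obs.3≤k O)) (Cl.l< d) (sym e))

  quadrangle-triple : ⟨ (λ μ → Ψ₄ of μ) ⟩ quadrangle ⟨ Decided ⟩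
  quadrangle-triple = straight {Q = λ μ → μ 29 0 ≡ 0 × Ψ₄ of μ} _ (λ μ B h → refl , h) ▹
    quad-at-triple Ψ₄ (λ (e , s , m) → state-at e s , minimal-at e m) 0 1 2 3 (s≤s z≤n) (s≤s (s≤s z≤n)) (s≤s (s≤s (s≤s z≤n))) refl refl refl (λ ()) (λ ()) (λ ()) (λ ()) refl refl ▹
    weaken (λ _ h → h) decided
    (resume Ψ₄′ Ψ₄″ (quad-at-triple Ψ₄′ (λ ((e , s , m) , _) → state-at e s , minimal-at e m) 1 2 3 0 (s≤s (s≤s z≤n)) (s≤s (s≤s (s≤s z≤n))) (s≤s (s≤s (s≤s (s≤s z≤n)))) refl refl refl (λ ()) (λ ()) (λ ()) (λ ()) refl refl))
    where
    decided : ∀ μ → Undecided Ψ₄″ μ → Decided μ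
    decided μ (inj₁ o) = inj₁ o
    decided μ (inj₂ (z , ((e , s , m) , c₀) , c₁)) = inj₂ (z , s , dbl-at (sym e)
        (NoCandidate.no-double O ≤-refl (minimal-at e m) λ {p} {q} {l} _ wp wq cp cq → opp l (Cl.l< cp) (pair-is-first O wp cp) (pair-is-first O wq cq)))
      where
      O = State.obstacle (state-at e s)
      opp : ∀ {p q} l → l < 4 → p ≡ μ 12 l × μ 11 l ≡ 1 → q ≡ μ 12 (nx 4 (nx 4 l)) × μ 11 (nx 4 (nx 4 l)) ≡ 1 → ¬ E p q
      opp 0 _ (refl , z) (refl , z′) = c₀ z z′
      opp 1 _ (refl , z) (refl , z′) = c₁ z z′
      opp 2 _ (refl , z) (refl , z′) = c₀ z′ z ∘ E-sym
      opp 3 _ (refl , z) (refl , z′) = c₁ z′ z ∘ E-sym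
      opp (suc (suc (suc (suc _)))) (s≤s (s≤s (s≤s (s≤s ()))))

  Chained : Memory → Set
  Chained μ = Σ ℕ λ t → μ 9 0 ≡ suc t × Gap t (μ 10) (μ 12) (μ 13) × μ 11 t ≡ 2

  -- Repeating the restriction when four vertices are left ends with three vertices or without a
  -- candidate. In the remaining case of `Sorted′` the gap property comes with at least five
  -- vertices, as the first pass requires.
  Sorted Sorted′ : Memory → Set
  Sorted μ = St μ × ((μ 9 4 ≡ 0 × Minimal (μ 9 0) (μ 10) (μ 12) (μ 13) (μ 9 0)) ⊎ (μ 9 4 ≡ 1 × Chained μ))
  Sorted′ μ = St μ × (μ 9 0 ≡ 3 ⊎ (μ 9 4 ≡ 0 × Minimal (μ 9 0) (μ 10) (μ 12) (μ 13) (μ 9 0)) ⊎ (μ 9 4 ≡ 1 × 5 ≤ μ 9 0 × Chained μ))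

  sort-first sort-again stage core : Program
  sort-first = prepare ⍮ restrict
  sort-again = cond ((9 [ lit 0 ]) ≈ lit 4) (cond ((9 [ lit 4 ]) ≈ lit 1) (prepare ⍮ restrict) skip) skip
  stage = cond ((9 [ lit 0 ]) ≈ lit 3) triangle
            (cond ((9 [ lit 4 ]) ≈ lit 1) (prepare ⍮ first-pass ⍮ 29 [ lit 0 ]≔ lit 0)
              (cond ((9 [ lit 0 ]) ≈ lit 4) quadrangle (29 [ lit 0 ]≔ lit 0)))
  core = sort-first ⍮ sort-again ⍮ stage ⍮ cond ((29 [ lit 0 ]) ≈ lit 0) second-pass skip

  sort-first-triple : ⟨ St ⟩ sort-first ⟨ Sorted ⟩
  sort-first-triple μ B s = (framed (λ μ′ → μ′ 9 0 ≡ μ 9 0) (λ μ₁ μ₂ same e → trans (same 9 tt 0) e) prepare-triple ▹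
    weaken (λ _ (p , e) → e , p) sorted (restrict-triple {μ 9 0})) μ B (s , refl)
    where
    sorted : ∀ {k₀} μ → Outcome k₀ μ → Sorted μ
    sorted μ (inj₁ (s , z , _ , m)) = s , inj₁ (z , m)
    sorted μ (inj₂ (s , o , _ , t , k≡ , g , z)) = s , inj₂ (o , t , k≡ , g , z)

  sort-again-triple : ⟨ Sorted ⟩ sort-again ⟨ Sorted′ ⟩
  sort-again-triple = branch ((9 [ lit 0 ]) ≈ lit 4)
    (branch ((9 [ lit 4 ]) ≈ lit 1)
      (weaken (λ { μ (((s , _) , k4) , _) → s , k4 }) (λ _ h → h)
        (framed (λ μ → μ 9 0 ≡ 4) (λ μ₁ μ₂ same e → trans (same 9 tt 0) e) prepare-triple ▹ weaken (λ _ (p , e) → e , p) again (restrict-triple {4})))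
      (straight skip λ { μ B (((s , inj₁ m) , _) , _) → s , inj₂ (inj₁ m) ; μ B (((s , inj₂ (o , _)) , _) , n) → ⊥-elim (n o) }))
    (straight skip λ { μ B ((s , inj₁ m) , _) → s , inj₂ (inj₁ m) ; μ B ((s , inj₂ (o , c)) , ne) → s , large μ s o c ne })
    where
    again : ∀ μ → Outcome 4 μ → Sorted′ μ
    again μ (inj₁ (s , z , _ , m)) = s , inj₂ (inj₁ (z , m))
    again μ (inj₂ (s , o , k< , _)) = s , inj₁ (≤-antisym (s≤s⁻¹ k<) (Obs.3≤k (State.obstacle s)))
    large : ∀ μ → St μ → μ 9 4 ≡ 1 → Chained μ → μ 9 0 ≢ 4 →
            μ 9 0 ≡ 3 ⊎ (μ 9 4 ≡ 0 × Minimal (μ 9 0) (μ 10) (μ 12) (μ 13) (μ 9 0)) ⊎ (μ 9 4 ≡ 1 × 5 ≤ μ 9 0 × Chained μ)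
    large μ s o c ne with m≤n⇒m<n∨m≡n (Obs.3≤k (State.obstacle s))
    ... | inj₂ e = inj₁ (sym e)
    ... | inj₁ lt = inj₂ (inj₂ (o , ≤∧≢⇒< lt (ne ∘ sym) , c))

  stage-triple : ⟨ Sorted′ ⟩ stage ⟨ Decided ⟩
  stage-triple = branch ((9 [ lit 0 ]) ≈ lit 3)
    (weaken (λ μ ((s , _) , e) → e , s) (λ _ h → h) triangle-triple)
    (branch ((9 [ lit 4 ]) ≈ lit 1)
      (weaken pre (λ _ h → h)
        (framed Ready′ keep prepare-triple ▹ weaken (λ μ (p , t , k≡ , g , z , 4≤) → p , t , k≡ , g , z , 4≤) (λ _ h → h) first-pass-triple ▹
          straight _ (λ μ B h → inj₂ (refl , h))))
      (branch ((9 [ lit 0 ]) ≈ lit 4)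
        (weaken (λ { μ ((((s , inj₁ e) , ne) , _) , _) → ⊥-elim (ne e)
                   ; μ ((((s , inj₂ (inj₁ (_ , m))) , _) , _) , e) → e , s , m
                   ; μ ((((s , inj₂ (inj₂ (o , _))) , _) , n) , _) → ⊥-elim (n o) }) (λ _ h → h) quadrangle-triple)
        (straight _ λ { μ B ((((s , inj₁ e) , ne) , _) , _) → ⊥-elim (ne e)
                      ; μ B ((((s , inj₂ (inj₂ (o , _))) , _) , n) , _) → ⊥-elim (n o)
                      ; μ B ((((s , inj₂ (inj₁ (_ , m))) , n3) , _) , n4) → inj₂ (refl , s ,
                          NoCandidate.no-double (State.obstacle s) (≤∧≢⇒< (Obs.3≤k (State.obstacle s)) (n3 ∘ sym)) m λ e → ⊥-elim (n4 e)) })))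
    where
    Ready′ : Memory → Set
    Ready′ μ = Σ ℕ λ t → μ 9 0 ≡ suc t × Gap t (μ 10) (μ 12) (μ 13) × μ 11 t ≡ 2 × 4 ≤ t
    keep : ∀ μ μ′ → (∀ a → T (untouched a prepare) → ∀ i → μ′ a i ≡ μ a i) → Ready′ μ → Ready′ μ′
    keep μ μ′ same (t , k≡ , g , z , 4≤) = t , trans (same 9 tt 0) k≡ ,
      Gap-cong (λ i _ → sym (same 10 tt i)) (λ i _ → sym (same 12 tt i)) (λ i _ → sym (same 13 tt i)) g , trans (same 11 tt t) z , 4≤
    pre : ∀ μ → (Sorted′ μ × μ 9 0 ≢ 3) × μ 9 4 ≡ 1 → St μ × Ready′ μ
    pre μ (((s , inj₁ e) , ne) , _) = ⊥-elim (ne e)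
    pre μ (((s , inj₂ (inj₁ (z , _))) , _) , o) = case trans (sym z) o of λ ()
    pre μ (((s , inj₂ (inj₂ (_ , 5≤ , t , k≡ , g , z))) , _) , o) = s , t , k≡ , g , z , s≤s⁻¹ (≤-trans 5≤ (≤-reflexive k≡))

  core-triple : ⟨ St ⟩ core ⟨ Out ⟩
  core-triple = sort-first-triple ▹ sort-again-triple ▹ stage-triple ▹ branch ((29 [ lit 0 ]) ≈ lit 0)
    (weaken (λ { μ (inj₁ (o , _) , z) → case trans (sym o) z of λ () ; μ (inj₂ (_ , h) , _) → h }) (λ _ → inj₁) second-pass-triple)
    (straight skip λ { μ B (inj₁ (_ , o) , _) → o ; μ B (inj₂ (z , _) , n) → ⊥-elim (n z) })


-- Translation between graphs on Fin n and on natural numbers below n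

toℕ-next : ∀ {k} (i : Fin k) → toℕ (next i) ≡ nx k (toℕ i)
toℕ-next {suc k} i with m≤n⇒m<n∨m≡n (toℕ<n i)
... | inj₁ lt = trans (toℕ-fromℕ< (m%n<n (suc (toℕ i)) (suc k))) (trans (m<n⇒m%n≡m lt) (sym (nx-suc lt)))
... | inj₂ e = trans (toℕ-fromℕ< (m%n<n (suc (toℕ i)) (suc k))) (trans (trans (cong (_% suc k) e) (n%n≡0 (suc k)))
                 (sym (trans (cong (nx (suc k)) (suc-injective e)) (nx-last k))))

graphᴺ : ∀ {n} → Graph n → Graphᴺ
graphᴺ {n} G = record
  { order = n
  ; E     = λ x y → Σ (Fin n) λ u → Σ (Fin n) λ v → toℕ u ≡ x × toℕ v ≡ y × Adj G u v
  ; E?    = dec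
  ; E-sym = λ (u , v , p , q , e) → v , u , q , p , symm G e
  ; E-irr = λ (u , v , p , q , e) → irrefl G (toℕ-injective (trans p (sym q))) e
  ; E<    = λ (u , v , p , q , e) → subst (_< n) p (toℕ<n u)
  }
  where
  dec : ∀ x y → Dec (Σ (Fin n) λ u → Σ (Fin n) λ v → toℕ u ≡ x × toℕ v ≡ y × Adj G u v)
  dec x y with x <? n | y <? n
  ... | no p | _ = no λ (u , _ , e , _) → p (subst (_< n) e (toℕ<n u))
  ... | _ | no p = no λ (_ , v , _ , e , _) → p (subst (_< n) e (toℕ<n v))
  ... | yes p | yes q with adj? G (fromℕ< p) (fromℕ< q)
  ...   | yes a = yes (fromℕ< p , fromℕ< q , toℕ-fromℕ< p , toℕ-fromℕ< q , a)
  ...   | no na = no λ (u , v , e , e′ , a) → na (subst₂ (Adj G) (toℕ-injective (trans e (sym (toℕ-fromℕ< p)))) (toℕ-injective (trans e′ (sym (toℕ-fromℕ< q)))) a)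

module Translation {n : ℕ} (G : Graph n) where
  open Obstacles (graphᴺ G)
  open Enumeration

  to-E : ∀ {u v} → Adj G u v → E (toℕ u) (toℕ v)
  to-E a = _ , _ , refl , refl , a

  from-E : ∀ {u v} → E (toℕ u) (toℕ v) → Adj G u v
  from-E (u , v , p , q , a) = subst₂ (Adj G) (toℕ-injective p) (toℕ-injective q) a

  data Stored {h : ℕ} (t : Fin h → ℕ) : WitnessEnum (Fin h) → (z f s : ℕ) → Set where
    one : ∀ {w z f s} → z ≡ 1 → t w ≡ f → t w ≡ s → Stored t (one w) z f s
    two : ∀ {u w z f s} → z ≡ 2 → t u ≡ f → t w ≡ s → Stored t (two u w) z f s

  module Import (𝒬 : Enumeration (Fin n)) (O : IsObstacleEnumIn G 𝒬) {V Z F S : ℕ → ℕ}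
    (V≡ : ∀ i → V (toℕ i) ≡ toℕ (vertex 𝒬 i)) (W≡ : ∀ i → Stored toℕ (witness 𝒬 i) (Z (toℕ i)) (F (toℕ i)) (S (toℕ i))) where
    open IsObstacleEnumIn O renaming (distinct to vertex-inj)

    private
      fin : ∀ {i} → i < k 𝒬 → Fin (k 𝒬)
      fin i< = fromℕ< i<

      V-fin : ∀ {i} (i< : i < k 𝒬) → V i ≡ toℕ (vertex 𝒬 (fin i<))
      V-fin i< = trans (cong V (sym (toℕ-fromℕ< i<))) (V≡ (fin i<))

      -- That a witness lies outside Q is not part of the definition. It follows because a member of
      -- the clique Q has no nonneighbour in Q, as `N̄` leaves out the vertex itself.
      class : ∀ {w : Fin n} (a b : Fin (k 𝒬)) → toℕ b ≡ toℕ a ⊎ toℕ b ≡ nx (k 𝒬) (toℕ a) →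
              (∀ {u} → (N̄ G w u × Q 𝒬 u) → vertex 𝒬 a ≡ u ⊎ vertex 𝒬 b ≡ u) → (∀ {u} → vertex 𝒬 a ≡ u ⊎ vertex 𝒬 b ≡ u → N̄ G w u × Q 𝒬 u) →
              Cl (k 𝒬) V (toℕ w) (toℕ a) (toℕ b)
      class {w} a b sh sub sup = cl (toℕ<n w) (toℕ<n a) (toℕ<n b) sh
        (λ j j< e → outside j j< e)
        (nonadj a (inj₁ refl)) (nonadj b (inj₂ refl))
        (λ j j< j≢a j≢b → subst (E (toℕ w)) (sym (V-fin j<)) (to-E (nbr (fin j<)
            (λ e → j≢a (trans (sym (toℕ-fromℕ< j<)) (cong toℕ (vertex-inj (sym e))))) (λ e → j≢b (trans (sym (toℕ-fromℕ< j<)) (cong toℕ (vertex-inj (sym e))))))))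
        where
        nonadj : ∀ c → vertex 𝒬 a ≡ vertex 𝒬 c ⊎ vertex 𝒬 b ≡ vertex 𝒬 c → ¬ E (toℕ w) (V (toℕ c))
        nonadj c e e′ = proj₂ (proj₁ (sup e)) (from-E (subst (E (toℕ w)) (V≡ c) e′))
        nbr : ∀ c → vertex 𝒬 a ≢ vertex 𝒬 c → vertex 𝒬 b ≢ vertex 𝒬 c → Adj G w (vertex 𝒬 c)
        nbr c p q with adj? G w (vertex 𝒬 c) | vertex 𝒬 c Fin.≟ w
        ... | yes e | _ = e
        ... | no ne | no ne′ = ⊥-elim (Sum.[ p , q ] (sub ((ne′ , ne) , c , refl)))
        ... | no ne | yes refl = ⊥-elim (proj₂ (proj₁ (sup (inj₁ refl))) (clique (c , refl) (a , refl) (p ∘ sym)))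
        outside : ∀ j → j < k 𝒬 → toℕ w ≢ V j
        outside j j< e with refl ← toℕ-injective (trans e (V-fin j<)) =
          case vertex 𝒬 (fin j<) Fin.≟ vertex 𝒬 a of λ
            { (yes q) → proj₁ (proj₁ (sup (inj₁ refl))) (sym q)
            ; (no q) → proj₂ (proj₁ (sup (inj₁ refl))) (clique (fin j< , refl) (a , refl) q) }

      wits : ∀ (i : Fin (k 𝒬)) → Wit (k 𝒬) V (toℕ i) (Z (toℕ i)) (F (toℕ i)) (S (toℕ i))
      wits i with witness 𝒬 i | W≡ i | witnesses i
      ... | one w | one z f s | (sub , sup) = single z (trans (sym s) f)
              (subst₂ (λ x j → Cl (k 𝒬) V x (toℕ i) j) f (toℕ-next i) (class {w} i (next i) (inj₂ (toℕ-next i)) sub sup))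
      ... | two u w | two z f s | ((sub , sup) , (sub′ , sup′) , e) = double z
              (subst (λ x → Cl (k 𝒬) V x (toℕ i) (toℕ i)) f (class {u} i i (inj₁ refl) (inj₁ ∘ sub) (λ e → sup (Sum.[ id , id ] e))))
              (subst₂ (λ x j → Cl (k 𝒬) V x j j) s (toℕ-next i) (class {w} (next i) (next i) (inj₁ refl) (inj₁ ∘ sub′) (λ e → sup′ (Sum.[ id , id ] e))))
              (subst₂ E f s (to-E e))

    obstacle : Obs (k 𝒬) V Z F S
    obstacle = obs k≥3 (λ i i< → subst (_< n) (sym (V-fin i<)) (toℕ<n _))
      (λ i j i< j< e → trans (sym (toℕ-fromℕ< i<)) (trans (cong toℕ (vertex-inj (toℕ-injective (trans (sym (V-fin i<)) (trans e (V-fin j<)))))) (toℕ-fromℕ< j<)))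
      (λ i j i< j< ne → subst₂ E (sym (V-fin i<)) (sym (V-fin j<)) (to-E (clique (fin i< , refl) (fin j< , refl)
         (λ e → ne (trans (sym (toℕ-fromℕ< i<)) (trans (cong toℕ (vertex-inj e)) (toℕ-fromℕ< j<)))))))
      λ i i< → subst (λ i → Wit (k 𝒬) V i (Z i) (F i) (S i)) (toℕ-fromℕ< i<) (wits (fin i<))

  module Export {h : ℕ} (H : Graph h) (t : Fin h → ℕ) (t-inj : ∀ {u v} → t u ≡ t v → u ≡ v)
    (adj⇔ : ∀ u v → Adj H u v ⇔ E (t u) (t v)) (𝒬 : Enumeration (Fin h)) {V Z F S : ℕ → ℕ}
    (O : Obs (k 𝒬) V Z F S) (es : Essential (k 𝒬) V F S)
    (V≡ : ∀ i → t (vertex 𝒬 i) ≡ V (toℕ i)) (W≡ : ∀ i → Stored t (witness 𝒬 i) (Z (toℕ i)) (F (toℕ i)) (S (toℕ i)))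
    (spans : ∀ x → (Σ ℕ λ i → i < k 𝒬 × t x ≡ V i) ⊎ IsW (k 𝒬) F S (t x)) where
    open Obs O

    private
      same : ∀ {i j : Fin (k 𝒬)} → toℕ i ≡ toℕ j → vertex 𝒬 i ≡ vertex 𝒬 j
      same e = cong (vertex 𝒬) (toℕ-injective e)

      class-sub : ∀ {w a b} → Cl (k 𝒬) V (t w) (toℕ a) (toℕ b) → ∀ {u} → N̄ H w u × Q 𝒬 u → vertex 𝒬 a ≡ u ⊎ vertex 𝒬 b ≡ u
      class-sub {w} c ((_ , ne) , j , refl) =
        Sum.map (λ e → sym (same e)) (λ e → sym (same e)) (is-nonnbr c (toℕ<n j) (λ e → ne (Equivalence.from (adj⇔ w _) (subst (E (t w)) (sym (V≡ j)) e))))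

      class-sup : ∀ {w a b} → Cl (k 𝒬) V (t w) (toℕ a) (toℕ b) → ∀ {u} → vertex 𝒬 a ≡ u ⊎ vertex 𝒬 b ≡ u → N̄ H w u × Q 𝒬 u
      class-sup {w} {a} {b} c (inj₁ refl) = ((λ e → Cl.out c (toℕ a) (toℕ<n a) (trans (cong t (sym e)) (V≡ a))) ,
        (λ e → Cl.nl c (subst (E (t w)) (V≡ a) (Equivalence.to (adj⇔ w _) e)))) , a , refl
      class-sup {w} {a} {b} c (inj₂ refl) = ((λ e → Cl.out c (toℕ b) (toℕ<n b) (trans (cong t (sym e)) (V≡ b))) ,
        (λ e → Cl.nh c (subst (E (t w)) (V≡ b) (Equivalence.to (adj⇔ w _) e)))) , b , refl

      wits : ∀ i → IsWitnessEnum H (Q 𝒬) (vertex 𝒬 i) (vertex 𝒬 (next i)) (witness 𝒬 i)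
      wits i with witness 𝒬 i | W≡ i | wit (toℕ i) (toℕ<n i)
      ... | one w | one z f s | double z′ _ _ _ = case trans (sym z) z′ of λ ()
      ... | two u w | two z f s | single z′ _ _ = case trans (sym z) z′ of λ ()
      ... | one w | one z f s | single _ _ c = class-sub c′ , class-sup c′
        where c′ = subst₂ (λ x j → Cl (k 𝒬) V x (toℕ i) j) (sym f) (sym (toℕ-next i)) c
      ... | two u w | two z f s | double _ c d e =
              ((λ p → Sum.[ id , id ] (class-sub c′ p)) , class-sup c′ ∘ inj₁) , ((λ p → Sum.[ id , id ] (class-sub d′ p)) , class-sup d′ ∘ inj₁) ,
              Equivalence.from (adj⇔ u w) (subst₂ E (sym f) (sym s) e)
        where
        c′ = subst (λ x → Cl (k 𝒬) V x (toℕ i) (toℕ i)) (sym f) c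
        d′ = subst₂ (λ x j → Cl (k 𝒬) V x j j) (sym s) (sym (toℕ-next i)) d

      in-witness : ∀ {y} i → t y ≡ F (toℕ i) ⊎ t y ≡ S (toℕ i) → y ∈ᵂ witness 𝒬 i
      in-witness i w with witness 𝒬 i | W≡ i | w
      ... | one x | one _ f s | inj₁ e = t-inj (trans e (sym f))
      ... | one x | one _ f s | inj₂ e = t-inj (trans e (sym s))
      ... | two x y | two _ f s | inj₁ e = inj₁ (t-inj (trans e (sym f)))
      ... | two x y | two _ f s | inj₂ e = inj₂ (t-inj (trans e (sym s)))

      from-witness : ∀ {y} i → y ∈ᵂ witness 𝒬 i → t y ≡ F (toℕ i) ⊎ t y ≡ S (toℕ i)
      from-witness i w with witness 𝒬 i | W≡ i
      from-witness i refl | one x | one _ f s = inj₁ f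
      from-witness i (inj₁ refl) | two x y | two _ f s = inj₁ f
      from-witness i (inj₂ refl) | two x y | two _ f s = inj₂ s

      finite : ∀ {i} (i< : i < k 𝒬) (P : ℕ → Set) → P i → P (toℕ (fromℕ< i<))
      finite i< P p = subst P (sym (toℕ-fromℕ< i<)) p

      nest : ∀ {y y′} → (∀ j → j < k 𝒬 → ¬ E (t y) (V j) → ¬ E (t y′) (V j)) → IsW (k 𝒬) F S (t y′) →
             ∀ {u} → N̄ H y u × Q 𝒬 u → N̄ H y′ u × Q 𝒬 u
      nest {y} {y′} f w′ ((_ , na) , j , refl) = ((λ e → not-V w′ (trans (cong t (sym e)) (V≡ j))) ,
        (λ e → f (toℕ j) (toℕ<n j) (λ e → na (Equivalence.from (adj⇔ y _) (subst (E (t y)) (sym (V≡ j)) e))) (subst (E (t y′)) (V≡ j) (Equivalence.to (adj⇔ y′ _) e)))) , j , refl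
        where
        not-V : ∀ {x} → IsW (k 𝒬) F S x → x ≢ V (toℕ j)
        not-V (isW i< p) with wit _ i< | p
        ... | single _ _ c | inj₁ refl = Cl.out c _ (toℕ<n j)
        ... | single _ e c | inj₂ refl = λ q → Cl.out c _ (toℕ<n j) (trans (sym e) q)
        ... | double _ c _ _ | inj₁ refl = Cl.out c _ (toℕ<n j)
        ... | double _ _ c _ | inj₂ refl = Cl.out c _ (toℕ<n j)

      witness-isW : ∀ {y} → Witness 𝒬 y → IsW (k 𝒬) F S (t y)
      witness-isW (i , w) = isW (toℕ<n i) (from-witness i w)

    result : IsEssentialObstacleEnumOf H 𝒬
    result = record
      { obstacleOf = record
        { obstacleIn = record
          { k≥3 = 3≤k
          ; distinct = λ {i} {j} e → toℕ-injective (V-inj _ _ (toℕ<n i) (toℕ<n j) (trans (sym (V≡ i)) (trans (cong t e) (V≡ j))))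
          ; clique = λ { (i , refl) (j , refl) ne → Equivalence.from (adj⇔ _ _) (subst₂ E (sym (V≡ i)) (sym (V≡ j))
              (clique _ _ (toℕ<n i) (toℕ<n j) (λ e → ne (same e)))) }
          ; witnesses = wits }
        ; spanning = λ x → Sum.map (λ (i , i< , e) → fromℕ< i< , t-inj (trans e (trans (cong V (sym (toℕ-fromℕ< i<))) (sym (V≡ _)))))
                                   (λ { (isW i< w) → fromℕ< i< , in-witness _ (finite i< (λ i → t x ≡ F i ⊎ t x ≡ S i) w) }) (spans x) }
      ; essential = λ {y₁} {y₂} w₁ w₂ e → ess (witness-isW w₁) (witness-isW w₂) (Essential.valid es (witness-isW w₁) (witness-isW w₂) (Equivalence.to (adj⇔ _ _) e))
      }
      where
      ess : ∀ {y₁ y₂} → IsW (k 𝒬) F S (t y₁) → IsW (k 𝒬) F S (t y₂) → Nested (k 𝒬) V (t y₁) (t y₂) ⊎ Together (k 𝒬) F S (t y₁) (t y₂) → Valid H 𝒬 y₁ y₂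
      ess w₁ w₂ (inj₁ (inj₁ f)) = inj₁ (nest f w₂)
      ess w₁ w₂ (inj₁ (inj₂ f)) = inj₂ (inj₁ (nest f w₁))
      ess {y₁} {y₂} w₁ w₂ (inj₂ (i , i< , a , b)) = inj₂ (inj₂ (fromℕ< i< ,
        in-witness _ (finite i< (λ i → t y₁ ≡ F i ⊎ t y₁ ≡ S i) a) , in-witness _ (finite i< (λ i → t y₂ ≡ F i ⊎ t y₂ ≡ S i) b)))


-- From the final memory to the answer

unique-lookup : ∀ {A : Set} {xs : List A} → Unique xs → ∀ i j → List.lookup xs i ≡ List.lookup xs j → i ≡ j
unique-lookup (x∉ ∷ u) zero    zero    e = refl
unique-lookup (x∉ ∷ u) zero    (suc j) e = ⊥-elim (All.lookup x∉ (∈-lookup j) e)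
unique-lookup (x∉ ∷ u) (suc i) zero    e = ⊥-elim (All.lookup x∉ (∈-lookup i) (sym e))
unique-lookup (x∉ ∷ u) (suc i) (suc j) e = cong suc (unique-lookup u i j e)

holds-tabulate : ∀ {m} (f : Fin m → ℕ) (g : ℕ → ℕ) → (∀ i → g (toℕ i) ≡ f i) →
                 ∀ (i : Fin (length (tabulate f))) → g (toℕ i) ≡ List.lookup (tabulate f) i
holds-tabulate {suc m} f g e zero    = e zero
holds-tabulate {suc m} f g e (suc i) = holds-tabulate (f ∘ suc) (g ∘ suc) (e ∘ suc) i

module Output {n : ℕ} (G : Graph n) where
  open Obstacles (graphᴺ G)
  open Translation G
  open TreeSoundness (graphᴺ G)
  open Enumeration

  module _ (μ : Memory) (flag : μ 0 0 ≡ 0) (O : Obs (μ 1 0) (μ 2) (μ 3) (μ 4) (μ 5)) (es : Essential (μ 1 0) (μ 2) (μ 4) (μ 5)) where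
    open Obs O
    private
      K₀ = μ 1 0

      -- Spanning is achieved by taking the subgraph induced by Q and its witnesses. The output
      -- names vertices of G, so the listing of the subgraph by filtering all vertices belongs to
      -- the proof and not to the program.
      Occurs : Fin n → Set
      Occurs x = (Σ ℕ λ i → i < K₀ × toℕ x ≡ μ 2 i) ⊎ (Σ ℕ λ i → i < K₀ × (toℕ x ≡ μ 4 i ⊎ toℕ x ≡ μ 5 i))

      occurs? : ∀ x → Dec (Occurs x)
      occurs? x = anyUpTo? (λ i → toℕ x ≟ μ 2 i) K₀ ⊎-dec anyUpTo? (λ i → (toℕ x ≟ μ 4 i) ⊎-dec (toℕ x ≟ μ 5 i)) K₀

      xs = filter occurs? (allFin n)
      h = length xs

      S : Fin h ↣ Fin n
      S = record { to = List.lookup xs ; cong = cong (List.lookup xs) ; injective = λ {i} {j} → unique-lookup (Unique.filter⁺ occurs? (Unique.allFin⁺ n)) i j }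

      index-of : ∀ {x} → x < order → (∀ (u : Fin n) → toℕ u ≡ x → Occurs u) → Σ (Fin h) λ i → toℕ (List.lookup xs i) ≡ x
      index-of {x} x< o = Any.index m , trans (cong toℕ (sym (lookup-index m))) (toℕ-fromℕ< x<)
        where
        m : fromℕ< x< ∈ xs
        m = ∈-filter⁺ occurs? (∈-allFin (fromℕ< x<)) (o (fromℕ< x<) (toℕ-fromℕ< x<))

      t : Fin h → ℕ
      t = toℕ ∘ List.lookup xs

      at-V : (i : Fin K₀) → Σ (Fin h) λ u → t u ≡ μ 2 (toℕ i)
      at-V i = index-of (V< _ (toℕ<n i)) (λ u e → inj₁ (toℕ i , toℕ<n i , e))

      at-F : (i : Fin K₀) → μ 4 (toℕ i) < order → Σ (Fin h) λ u → t u ≡ μ 4 (toℕ i)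
      at-F i lt = index-of lt (λ u e → inj₂ (toℕ i , toℕ<n i , inj₁ e))

      at-S : (i : Fin K₀) → μ 5 (toℕ i) < order → Σ (Fin h) λ u → t u ≡ μ 5 (toℕ i)
      at-S i lt = index-of lt (λ u e → inj₂ (toℕ i , toℕ<n i , inj₂ e))

      stored : (i : Fin K₀) → Σ (WitnessEnum (Fin h)) λ w → Stored t w (μ 3 (toℕ i)) (μ 4 (toℕ i)) (μ 5 (toℕ i))
      stored i with wit (toℕ i) (toℕ<n i)
      ... | single z e c = one (proj₁ (at-F i (Cl.x< c))) , one z (proj₂ (at-F i (Cl.x< c))) (trans (proj₂ (at-F i (Cl.x< c))) (sym e))
      ... | double z c d _ = two (proj₁ (at-F i (Cl.x< c))) (proj₁ (at-S i (Cl.x< d))) , two z (proj₂ (at-F i (Cl.x< c))) (proj₂ (at-S i (Cl.x< d)))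

      𝒬 : Enumeration (Fin h)
      𝒬 = record { k = K₀ ; vertex = proj₁ ∘ at-V ; witness = proj₁ ∘ stored }

      spans : ∀ x → (Σ ℕ λ i → i < K₀ × t x ≡ μ 2 i) ⊎ IsW K₀ (μ 4) (μ 5) (t x)
      spans x with proj₂ (∈-filter⁻ occurs? {xs = allFin n} (∈-lookup x))
      ... | inj₁ p = inj₁ p
      ... | inj₂ (i , i< , w) = inj₂ (isW i< w)

      at-size : ∀ {w z f s} → Stored t w z f s → z ≡ size (mapᵂ (List.lookup xs) w)
      at-size (one z _ _) = z
      at-size (two z _ _) = z
      at-first : ∀ {w z f s} → Stored t w z f s → f ≡ toℕ (first (mapᵂ (List.lookup xs) w))
      at-first (one _ f _) = sym f
      at-first (two _ f _) = sym f
      at-second : ∀ {w z f s} → Stored t w z f s → s ≡ toℕ (second (mapᵂ (List.lookup xs) w))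
      at-second (one _ _ s) = sym s
      at-second (two _ _ s) = sym s

      holds : Holds μ ((0 ∷ []) ∷ encodeEnum (mapᴱ (List.lookup xs) 𝒬))
      holds zero zero = flag
      holds (suc zero) zero = refl
      holds (suc (suc zero)) = holds-tabulate _ (μ 2) λ i → sym (proj₂ (at-V i))
      holds (suc (suc (suc zero))) = holds-tabulate _ (μ 3) λ i → at-size (proj₂ (stored i))
      holds (suc (suc (suc (suc zero)))) = holds-tabulate _ (μ 4) λ i → at-first (proj₂ (stored i))
      holds (suc (suc (suc (suc (suc zero))))) = holds-tabulate _ (μ 5) λ i → at-second (proj₂ (stored i))

    essential-found : EssentialFound G μ
    essential-found = h , S , 𝒬 ,
      Export.result (induced G S) t (λ e → Injection.injective S (toℕ-injective e)) (λ u v → mk⇔ to-E from-E) 𝒬 O es (proj₂ ∘ at-V) (proj₂ ∘ stored) spans , holds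

  forbidden-found : ∀ F μ → μ 0 0 ≡ 1 → μ 1 0 ≡ size-of F → ForbiddenAt F (μ 2) → InducedFound (graph-of F) G μ
  forbidden-found F μ flag len (bound , pairs) = size-of F , S , (↔-id _ , λ u v → mk⇔ (λ a → Equivalence.to (proj₁ (pairs u v)) (subst₂ E (toℕ-fromℕ< (bound u)) (toℕ-fromℕ< (bound v)) (to-E a)))
      (λ a → from-E (subst₂ E (sym (toℕ-fromℕ< (bound u))) (sym (toℕ-fromℕ< (bound v))) (Equivalence.from (proj₁ (pairs u v)) a)))) , holds
    where
    name : Fin (size-of F) → Fin n
    name i = fromℕ< (bound i)
    name-injective : ∀ {i j} → name i ≡ name j → i ≡ j
    name-injective {i} {j} e with i Fin.≟ j
    ... | yes p = p
    ... | no p  = ⊥-elim (proj₂ (pairs i j) p (trans (sym (toℕ-fromℕ< (bound i))) (trans (cong toℕ e) (toℕ-fromℕ< (bound j)))))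
    S : Fin (size-of F) ↣ Fin n
    S = record { to = name ; cong = cong name ; injective = name-injective }
    holds : Holds μ ((1 ∷ []) ∷ (size-of F ∷ []) ∷ tabulate (toℕ ∘ name) ∷ [])
    holds zero zero = flag
    holds (suc zero) zero = len
    holds (suc (suc zero)) = holds-tabulate _ (μ 2) λ i → sym (toℕ-fromℕ< (bound i))


-- Reading the adjacency lists

module Loading (Γ : Graphᴺ) (Wt : ℕ → Set) (M : ℕ) (64≤M : 64 ≤ M) (W : ℕ) (M≤W : M ≤ W) where
  open Core Γ Wt M 64≤M W M≤W
  open Obstacles Γ
  open Cong Γ

  take-input : Program
  take-input = (9 [ lit 0 ]≔ (3 [ lit 0 ]) ⍮ 9 [ lit 2 ]≔ (0 [ lit 0 ])) ⍮ for 10 below (9 [ lit 0 ]) loop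
    (10 [ slot 10 ]≔ (4 [ slot 10 ]) ⍮ 11 [ slot 10 ]≔ (5 [ slot 10 ]) ⍮ 12 [ slot 10 ]≔ (6 [ slot 10 ]) ⍮ 13 [ slot 10 ]≔ (7 [ slot 10 ]))

  module _ (Φ : (v0 v1 v2 : ℕ → ℕ) → Set) where

    Given Loaded : Memory → Set
    Given μ = μ 0 0 ≡ order × Obs (μ 3 0) (μ 4) (μ 5) (μ 6) (μ 7) × Φ (μ 0) (μ 1) (μ 2)
    Loaded μ = μ 9 2 ≡ order × Obs (μ 9 0) (μ 10) (μ 11) (μ 12) (μ 13) × Φ (μ 0) (μ 1) (μ 2)

    take-input-triple : ⟨ Given ⟩ take-input ⟨ Loaded ⟩
    take-input-triple = straight {Q = λ μ → μ 9 2 ≡ order × Obs (μ 9 0) (μ 4) (μ 5) (μ 6) (μ 7) × Φ (μ 0) (μ 1) (μ 2)} _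
        (λ μ B (n , o , φ) → μ 3 0 , refl , μ 0 0 , refl , n , o , φ) ▹
      loops 10 (9 [ lit 0 ]) _ (λ μ₀ (n , o , φ) → record
        { times  = μ₀ 9 0
        ; Inv    = λ i μ → μ 9 0 ≡ μ₀ 9 0 × (μ 9 2 ≡ order × Obs (μ 9 0) (μ 4) (μ 5) (μ 6) (μ 7) × Φ (μ 0) (μ 1) (μ 2)) ×
                     Agree i (μ 4) (μ 10) × Agree i (μ 5) (μ 11) × Agree i (μ 6) (μ 12) × Agree i (μ 7) (μ 13)
        ; times≤ = λ B → B 9 0
        ; fixed  = λ _ _ (e , _) → e
        ; base   = refl , (n , o , φ) , (λ _ ()) , (λ _ ()) , (λ _ ()) , (λ _ ())
        ; step   = λ μ B lt (e , φ , a , b , c , d) → let i = μ 8 10 in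
            i , refl , μ 4 i , refl , i , refl , μ 5 i , refl , i , refl , μ 6 i , refl , i , refl , μ 7 i , refl , refl , e , φ ,
            upd-below (λ j x → μ 4 j ≡ x) a refl , upd-below (λ j x → μ 5 j ≡ x) b refl ,
            upd-below (λ j x → μ 6 j ≡ x) c refl , upd-below (λ j x → μ 7 j ≡ x) d refl
        ; exit   = λ μ (e , (n , o , φ) , a , b , c , d) → let ag = λ {f} {g} → subst (λ k → Agree k f g) (sym e) in
            n , Obs-cong (ag a) (ag b) (ag c) (ag d) o , φ
        })

  record Rows (n : ℕ) (at-off nb : ℕ → ℕ) : Set where
    field
      bounded  : n + at-off n ≤ M
      zeroth   : at-off 0 ≡ 0
      rising   : ∀ v → v < n → at-off v ≤ at-off (suc v)
      in-row   : ∀ v e → v < n → at-off v ≤ e → e < at-off (suc v) → E v (nb e)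
      from-row : ∀ {x y} → E x y → Σ ℕ λ e → at-off x ≤ e × e < at-off (suc x) × nb e ≡ y

  -- One loop replaces two nested ones: each round either emits an edge of the current row or moves
  -- on to the next row. The number of rounds is thus n plus the total length of the rows, which is
  -- the content of `total` in `Listing`.
  list-edges : Program
  list-edges = (8 [ lit 20 ]≔ lit 0 ⍮ 8 [ lit 21 ]≔ lit 0) ⍮ (for 10 below ((9 [ lit 2 ]) ⊕ (1 [ 9 [ lit 2 ] ])) loop
    cond (slot 20 ≺ (9 [ lit 2 ])) (cond (slot 21 ≺ (1 [ slot 20 ⊕ lit 1 ]))
      (18 [ slot 21 ]≔ slot 20 ⍮ 19 [ slot 21 ]≔ (2 [ slot 21 ]) ⍮ 8 [ lit 21 ]≔ (slot 21 ⊕ lit 1))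
      (8 [ lit 20 ]≔ (slot 20 ⊕ lit 1))) skip) ⍮ 9 [ lit 1 ]≔ slot 21

  record Listing (n : ℕ) (at-off nb src tgt : ℕ → ℕ) (v e c : ℕ) : Set where
    field
      v≤n   : v ≤ n
      low   : at-off v ≤ e
      high  : v < n → e ≤ at-off (suc v)
      last  : v ≡ n → e ≤ at-off n
      total : v + e ≡ c
      past  : ∀ x e′ → x < v → at-off x ≤ e′ → e′ < at-off (suc x) → src e′ ≡ x × tgt e′ ≡ nb e′
      now   : ∀ e′ → e′ < e → at-off v ≤ e′ → src e′ ≡ v × tgt e′ ≡ nb e′
      good  : ∀ e′ → e′ < e → E (src e′) (tgt e′)

  module _ {n : ℕ} {at-off nb : ℕ → ℕ} (rows : Rows n at-off nb) where
    open Rows rows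

    rising≤ : ∀ {x v} → x ≤ v → v ≤ n → at-off x ≤ at-off v
    rising≤ {v = zero} z≤n _ = ≤-refl
    rising≤ {x} {suc v} x≤ v≤ with m≤n⇒m<n∨m≡n x≤
    ... | inj₁ lt = ≤-trans (rising≤ (s≤s⁻¹ lt) (<⇒≤ v≤)) (rising v v≤)
    ... | inj₂ refl = ≤-refl

    enter : ∀ {src tgt v e c} → v < n → e < at-off (suc v) → Listing n at-off nb src tgt v e c →
            Listing n at-off nb (upd src e v) (upd tgt e (nb e)) v (suc e) (suc c)
    enter {src} {tgt} {v} {e} v<n e< l = record
      { v≤n = v≤n ; low = m≤n⇒m≤1+n low ; high = λ _ → e< ; last = λ q → ⊥-elim (<-irrefl q v<n)
      ; total = trans (+-suc v e) (cong suc total)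
      ; past = λ x e′ x<v lo hi → let ne = λ q → <-irrefl (sym q) (<-≤-trans hi (≤-trans (rising≤ x<v v≤n) low)) ; (p , q) = past x e′ x<v lo hi in
          trans (upd-other src v ne) p , trans (upd-other tgt (nb e) ne) q
      ; now = λ e′ e′< lo → upd-below (λ j y → at-off v ≤ j → y ≡ v) (λ j j< lo → proj₁ (now j j< lo)) (λ _ → refl) e′ e′< lo ,
                            upd-below (λ j y → at-off v ≤ j → y ≡ nb j) (λ j j< lo → proj₂ (now j j< lo)) (λ _ → refl) e′ e′< lo
      ; good = below (λ e′ e′< → let ne = λ q → <-irrefl (sym q) e′< in subst₂ E (sym (upd-other src v ne)) (sym (upd-other tgt (nb e) ne)) (good e′ e′<))
                 (subst₂ E (sym (upd-same src e v)) (sym (upd-same tgt e (nb e))) (in-row v e v<n low e<)) }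
      where open Listing l

    advance : ∀ {src tgt v e c} → v < n → at-off (suc v) ≤ e → Listing n at-off nb src tgt v e c → Listing n at-off nb src tgt (suc v) e (suc c)
    advance {src} {tgt} {v} {e} v<n le l = record
      { v≤n = v<n ; low = le ; high = λ lt → ≤-trans (high v<n) (rising (suc v) lt)
      ; last = λ { refl → high v<n } ; total = cong suc total
      ; past = λ x e′ x< lo hi → go x e′ (m≤n⇒m<n∨m≡n (s≤s⁻¹ x<)) lo hi
      ; now = λ e′ e′< lo → ⊥-elim (<-irrefl refl (<-≤-trans (<-≤-trans e′< (high v<n)) lo))
      ; good = good }
      where
      open Listing l
      go : ∀ x e′ → x < v ⊎ x ≡ v → at-off x ≤ e′ → e′ < at-off (suc x) → src e′ ≡ x × tgt e′ ≡ nb e′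
      go x e′ (inj₁ lt) lo hi = past x e′ lt lo hi
      go x e′ (inj₂ refl) lo hi = now e′ (<-≤-trans hi le) lo

  Part₁ : (v0 v1 v2 : ℕ → ℕ) → Set
  Part₁ v0 v1 v2 = Rows order v1 v2

  list-edges-triple : (∀ {x} → Wt x) → ⟨ Loaded Part₁ ⟩ list-edges ⟨ St ⟩
  list-edges-triple wt = straight {Q = λ μ → Loaded Part₁ μ × μ 8 20 ≡ 0 × μ 8 21 ≡ 0} _ (λ μ B h → h , refl , refl) ▹
    (loops {Q = Listed order} 10 _ _ λ { μ₀ ((n≡ , o , rows) , v0 , e0) → record
      { times  = order + μ₀ 1 order
      ; Inv    = Inv (order + μ₀ 1 order)
      ; times≤ = λ B → Rows.bounded rows
      ; fixed  = λ { i μ ((n≡ , _) , t , _) → trans (cong (λ n → n + μ 1 n) n≡) t }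
      ; base   = (n≡ , o , rows) , refl , start₀ rows v0 e0
      ; step   = λ { μ B lt (L@(n≡ , o , rows) , t , l) →
          (λ v< → (λ e< → let v = μ 8 20 ; e = μ 8 21 in
                     e , refl , v , refl , e , refl , μ 2 e , refl , suc e , +-comm e 1 ,
                     e-bound rows (subst (v <_) n≡ v<) (subst (e <_) (cong (μ 1) (+-comm v 1)) e<) ,
                     refl , L , t , enter rows (subst (v <_) n≡ v<) (subst (e <_) (cong (μ 1) (+-comm v 1)) e<) l) ,
                  (λ e≥ → let v = μ 8 20 in suc v , +-comm v 1 , ≤-trans v< (B 9 2) , refl , L , t ,
                     advance rows (subst (v <_) n≡ v<) (subst (_≤ μ 8 21) (cong (μ 1) (+-comm v 1)) e≥) l)) ,
          (λ v≥ → ⊥-elim (<-irrefl refl (<-≤-trans lt (stuck rows t n≡ v≥ l)))) }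
      ; exit   = λ { μ (L@(n≡ , o , rows) , t , l) → L , ended rows t l }
      } }) ▹ straight _ λ { μ B ((n≡ , o , rows) , v≡ , l) → μ 8 21 , refl , state o (λ _ → wt) (edges-of rows (subst (λ v → Listing order (μ 1) (μ 2) (μ 18) (μ 19) v (μ 8 21) (order + μ 1 order)) v≡ l)) n≡ }
    where
    Listed : ℕ → Memory → Set
    Listed n μ = Loaded Part₁ μ × μ 8 20 ≡ n × Listing n (μ 1) (μ 2) (μ 18) (μ 19) (μ 8 20) (μ 8 21) (n + μ 1 n)
    Inv : ℕ → ℕ → Memory → Set
    Inv T c μ = Loaded Part₁ μ × order + μ 1 order ≡ T × Listing order (μ 1) (μ 2) (μ 18) (μ 19) (μ 8 20) (μ 8 21) c
    start₀ : ∀ {off′ nb src tgt v e} → Rows order off′ nb → v ≡ 0 → e ≡ 0 → Listing order off′ nb src tgt v e 0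
    start₀ rows refl refl = record
      { v≤n = z≤n ; low = ≤-reflexive (Rows.zeroth rows) ; high = λ _ → z≤n ; last = λ _ → z≤n ; total = refl
      ; past = λ _ _ () ; now = λ _ () ; good = λ _ () }
    e-bound : ∀ {off′ nb v e} → Rows order off′ nb → v < order → e < off′ (suc v) → suc e ≤ M
    e-bound {off′} rows v< e< = ≤-trans e< (≤-trans (rising≤ rows v< ≤-refl) (≤-trans (m≤n+m (off′ order) order) (Rows.bounded rows)))
    stuck : ∀ {off′ nb src tgt v e c T k} → Rows order off′ nb → order + off′ order ≡ T → k ≡ order → k ≤ v → Listing order off′ nb src tgt v e c → T ≤ c
    stuck rows refl refl v≥ l with refl ← ≤-antisym v≥ (Listing.v≤n l) = ≤-trans (+-monoʳ-≤ order (Listing.low l)) (≤-reflexive (Listing.total l))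
    ended : ∀ {off′ nb src tgt v e T} → Rows order off′ nb → order + off′ order ≡ T → Listing order off′ nb src tgt v e T →
            v ≡ order × Listing order off′ nb src tgt v e (order + off′ order)
    ended {off′} {v = v} {e} rows refl l with m≤n⇒m<n∨m≡n (Listing.v≤n l)
    ... | inj₂ q = q , l
    ... | inj₁ lt = ⊥-elim (<-irrefl (Listing.total l) (+-mono-<-≤ lt (≤-trans (Listing.high l lt) (rising≤ rows lt ≤-refl))))
    edges-of : ∀ {off′ nb src tgt e c} → Rows order off′ nb → Listing order off′ nb src tgt order e c → Edges e src tgt
    edges-of {e = e} rows l = record
      { sound = Listing.good l
      ; complete = λ _ _ a → let (e′ , lo , hi , q) = Rows.from-row rows a ; (p , p′) = Listing.past l _ e′ (E< a) lo hi in
          e′ , <-≤-trans hi (≤-trans (rising≤ rows (E< a) ≤-refl) (Listing.low l)) , p , trans p′ q }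


module _ {A : Set} where

  start-of : ∀ m → (Fin m → List A) → ℕ → ℕ
  start-of zero    f v       = 0
  start-of (suc m) f zero    = 0
  start-of (suc m) f (suc v) = length (f zero) + start-of m (f ∘ suc) v

  at-offsets : ∀ m (f : Fin m → List A) acc v → v ≤ m → (offsets acc (tabulate f) at v) ≡ acc + start-of m f v
  at-offsets zero    f acc zero    _ = sym (+-identityʳ acc)
  at-offsets (suc m) f acc zero    _ = sym (+-identityʳ acc)
  at-offsets (suc m) f acc (suc v) (s≤s v≤) = trans (at-offsets m (f ∘ suc) (acc + length (f zero)) v v≤) (+-assoc acc _ _)

  start-suc : ∀ m (f : Fin m → List A) (v : Fin m) → start-of m f (suc (toℕ v)) ≡ start-of m f (toℕ v) + length (f v)
  start-suc (suc zero)    f zero    = +-identityʳ _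
  start-suc (suc (suc m)) f zero    = +-identityʳ _
  start-suc (suc m)       f (suc v) = trans (cong (length (f zero) +_) (start-suc m (f ∘ suc) v)) (sym (+-assoc (length (f zero)) _ _))

  start-end : ∀ m (f : Fin m → List A) → start-of m f m ≡ length (concat (tabulate f))
  start-end zero    f = refl
  start-end (suc m) f = trans (cong (length (f zero) +_) (start-end m (f ∘ suc))) (sym (List.length-++ (f zero)))

at-++ʳ : ∀ xs ys j → ((xs ++ ys) at (length xs + j)) ≡ (ys at j)
at-++ʳ []       ys j = refl
at-++ʳ (x ∷ xs) ys j = at-++ʳ xs ys j

at-concat : ∀ {A : Set} (g : A → ℕ) m (f : Fin m → List A) (v : Fin m) (j : Fin (length (f v))) →
            (map g (concat (tabulate f)) at (start-of m f (toℕ v) + toℕ j)) ≡ g (List.lookup (f v) j)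
at-concat g (suc m) f zero j = trans (cong (_at toℕ j) (List.map-++ g (f zero) _)) (first-row (f zero) j)
  where
  first-row : ∀ xs {ys} (j : Fin (length xs)) → ((map g xs ++ ys) at toℕ j) ≡ g (List.lookup xs j)
  first-row (x ∷ xs) zero    = refl
  first-row (x ∷ xs) (suc j) = first-row xs j
at-concat g (suc m) f (suc v) j = trans (cong₂ _at_ (List.map-++ g (f zero) _) (+-assoc (length (f zero)) _ _))
  (trans (cong (λ l → (map g (f zero) ++ map g (concat (tabulate (f ∘ suc)))) at (l + (start-of m (f ∘ suc) (toℕ v) + toℕ j))) (sym (List.length-map g (f zero))))
    (trans (at-++ʳ (map g (f zero)) _ _) (at-concat g m (f ∘ suc) v j)))

unique-⊆ : ∀ {A : Set} {xs ys : List A} → Unique xs → (∀ {x} → x ∈ xs → x ∈ ys) → length xs ≤ length ys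
unique-⊆ {xs = xs} {ys} u sub = Fin.injective⇒≤ {f = λ i → Any.index (sub (∈-lookup {xs = xs} i))} λ {i} {j} e →
  unique-lookup u i j (trans (lookup-index (sub (∈-lookup i))) (trans (cong (List.lookup ys) e) (sym (lookup-index (sub (∈-lookup j))))))

module Adjacency {n : ℕ} (G : Graph n) (L : AdjacencyLists G) where
  open AdjacencyLists L
  open Graphᴺ (graphᴺ G) using (E)
  open Translation G using (to-E)

  total : ℕ
  total = length (concat (tabulate neighbours))

  private
    arcs : List (Fin n × Fin n)
    arcs = concat (tabulate λ v → map (v ,_) (neighbours v))

    arcs-length : ∀ m (f : Fin m → List (Fin n)) (g : Fin m → Fin n) →
                  length (concat (tabulate λ v → map (g v ,_) (f v))) ≡ length (concat (tabulate f))
    arcs-length zero    f g = refl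
    arcs-length (suc m) f g = trans (List.length-++ (map (g zero ,_) (f zero)))
      (trans (cong₂ _+_ (List.length-map (g zero ,_) (f zero)) (arcs-length m (f ∘ suc) (g ∘ suc))) (sym (List.length-++ (f zero))))

    arcs-unique : Unique arcs
    arcs-unique = Unique.concat⁺ (AllP.tabulate⁺ λ v → Unique.map⁺ (λ { refl → refl }) (unique v))
      (AllPairs.tabulate⁺ λ i≢j (p , q) → case (∈-map⁻ _ p , ∈-map⁻ _ q) of λ { ((_ , _ , refl) , (_ , _ , refl)) → i≢j refl })

    arc-adj : ∀ {u v} → (u , v) ∈ arcs → Adj G u v
    arc-adj m with ∈-concat⁻′ (tabulate λ v → map (v ,_) (neighbours v)) m
    ... | _ , p , q with ∈-tabulate⁻ q
    ... | x , refl with ∈-map⁻ (x ,_) p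
    ... | y , y∈ , refl = Equivalence.to (correct x y) y∈

    arc-edge : ∀ {e} → e ∈ arcs → e ∈ edges G ++ map swap (edges G)
    arc-edge {u , v} m with arc-adj m | Fin.<-cmp u v
    ... | a | tri< lt _ _ = ∈-++⁺ˡ (∈-filter⁺ _ (∈-cartesianProduct⁺ (∈-allFin u) (∈-allFin v)) (lt , a))
    ... | a | tri≈ _ e _ = ⊥-elim (irrefl G e a)
    ... | a | tri> _ _ gt = ∈-++⁺ʳ (edges G) (∈-map⁺ swap (∈-filter⁺ _ (∈-cartesianProduct⁺ (∈-allFin v) (∈-allFin u)) (gt , symm G a)))

  -- The entries of the lists are distinct ordered pairs, and each of them is an edge listed in
  -- increasing order or the reversal of one.
  total≤ : total ≤ ∣E G ∣ + ∣E G ∣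
  total≤ = ≤-trans (≤-reflexive (sym (arcs-length n neighbours id))) (≤-trans (unique-⊆ arcs-unique arc-edge)
    (≤-reflexive (trans (List.length-++ (edges G)) (cong (∣E G ∣ +_) (List.length-map swap (edges G))))))

  at-off at-nb : ℕ → ℕ
  at-off v = offsets 0 (tabulate neighbours) at v
  at-nb e = map toℕ (concat (tabulate neighbours)) at e

  off≡ : ∀ v → v ≤ n → at-off v ≡ start-of n neighbours v
  off≡ v v≤n = at-offsets n neighbours 0 v v≤n

  private
    fin : ∀ {v} → v < n → Fin n
    fin v<n = fromℕ< v<n

    off-suc : ∀ {v} (v<n : v < n) → at-off (suc v) ≡ at-off v + length (neighbours (fin v<n))
    off-suc {v} v<n = trans (off≡ (suc v) v<n) (trans (cong (start-of n neighbours ∘ suc) (sym (toℕ-fromℕ< v<n)))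
      (trans (start-suc n neighbours (fin v<n)) (cong (_+ length (neighbours (fin v<n))) (trans (cong (start-of n neighbours) (toℕ-fromℕ< v<n)) (sym (off≡ v (<⇒≤ v<n)))))))

    nb≡ : ∀ {v} (v<n : v < n) (j : Fin (length (neighbours (fin v<n)))) → at-nb (at-off v + toℕ j) ≡ toℕ (List.lookup (neighbours (fin v<n)) j)
    nb≡ {v} v<n j = trans (cong (λ s → at-nb (s + toℕ j)) (trans (off≡ v (<⇒≤ v<n)) (cong (start-of n neighbours) (sym (toℕ-fromℕ< v<n)))))
      (at-concat toℕ n neighbours (fin v<n) j)

  off-n : at-off n ≡ total
  off-n = trans (off≡ n ≤-refl) (start-end n neighbours)

  module Row (Wt : ℕ → Set) (M : ℕ) (64≤M : 64 ≤ M) (W : ℕ) (M≤W : M ≤ W) where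
    open Loading (graphᴺ G) Wt M 64≤M W M≤W

    rows : n + total ≤ M → Rows n at-off at-nb
    rows le = record
      { bounded = ≤-trans (≤-reflexive (cong (n +_) off-n)) le
      ; zeroth = trans (off≡ 0 z≤n) (start-0 n neighbours)
      ; rising = λ v v<n → ≤-trans (m≤m+n _ _) (≤-reflexive (sym (off-suc v<n)))
      ; in-row = λ v e v<n lo hi → row v e v<n lo hi
      ; from-row = λ { (u , v , refl , refl , a) → from u v a } }
      where
      start-0 : ∀ m (f : Fin m → List (Fin n)) → start-of m f 0 ≡ 0
      start-0 zero f = refl
      start-0 (suc m) f = refl
      row : ∀ v e → v < n → at-off v ≤ e → e < at-off (suc v) → E v (at-nb e)
      row v e v<n lo hi = subst₂ E (toℕ-fromℕ< v<n) (trans (sym (nb≡ v<n j)) (cong at-nb (trans (cong (at-off v +_) (toℕ-fromℕ< j<)) (m+[n∸m]≡n lo))))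
          (to-E (Equivalence.to (correct (fin v<n) _) (∈-lookup j)))
        where
        j< : e ∸ at-off v < length (neighbours (fin v<n))
        j< = <-≤-trans (∸-monoˡ-< (<-≤-trans hi (≤-reflexive (off-suc v<n))) lo) (≤-reflexive (m+n∸m≡n (at-off v) _))
        j = fromℕ< j<
      from : ∀ u v → Adj G u v → Σ ℕ λ e → at-off (toℕ u) ≤ e × e < at-off (suc (toℕ u)) × at-nb e ≡ toℕ v
      from u v a = at-off (toℕ u) + toℕ j , m≤m+n _ _ , <-≤-trans (+-monoʳ-< (at-off (toℕ u)) (toℕ<n j)) (≤-reflexive (sym (off-suc (toℕ<n u)))) ,
          trans (nb≡ (toℕ<n u) j) (cong toℕ (sym (lookup-index m)))
        where
        m : v ∈ neighbours (fin (toℕ<n u))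
        m = subst (λ x → v ∈ neighbours x) (sym (fromℕ<-toℕ u (toℕ<n u))) (Equivalence.from (correct u v) a)
        j = Any.index m

  offsets-bounded : ∀ {A : Set} (ls : List (List A)) acc {M} → acc + length (concat ls) ≤ M → All (_≤ M) (offsets acc ls)
  offsets-bounded [] acc le = ≤-trans (m≤m+n acc 0) le ∷ []
  offsets-bounded (l ∷ ls) acc le = ≤-trans (m≤m+n acc _) le ∷ offsets-bounded ls (acc + length l)
    (≤-trans (≤-reflexive (trans (+-assoc acc _ _) (cong (acc +_) (sym (List.length-++ l))))) le)

at-bounded : ∀ {M xs} → All (_≤ M) xs → ∀ i → (xs at i) ≤ M
at-bounded []       i       = z≤n
at-bounded (x ∷ xs) zero    = x
at-bounded (x ∷ xs) (suc i) = at-bounded xs i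

load-bounded : ∀ {M xss} → All (All (_≤ M)) xss → ∀ a i → load xss a i ≤ M
load-bounded []         a       i = z≤n
load-bounded (xs ∷ xss) zero    i = at-bounded xs i
load-bounded (xs ∷ xss) (suc a) i = load-bounded xss a i

at-tabulate : ∀ {m} (f : Fin m → ℕ) i → (tabulate f at toℕ i) ≡ f i
at-tabulate f zero    = refl
at-tabulate f (suc i) = at-tabulate (f ∘ suc) i

module EncodedEnum {n : ℕ} (G : Graph n) (𝒬 : Enumeration (Fin n)) (O : IsObstacleEnumIn G 𝒬) where
  open Enumeration 𝒬
  open IsObstacleEnumIn O using () renaming (distinct to vertex-injective)
  open Translation G

  k≤n : k ≤ n
  k≤n = Fin.injective⇒≤ vertex-injective

  bounded : ∀ {M} → n ≤ M → 2 ≤ M → All (All (_≤ M)) (encodeEnum 𝒬)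
  bounded n≤M 2≤M = (≤-trans k≤n n≤M ∷ []) ∷ AllP.tabulate⁺ (below-n ∘ vertex) ∷ AllP.tabulate⁺ (λ i → ≤-trans (size≤2 (witness i)) 2≤M) ∷
      AllP.tabulate⁺ (below-n ∘ first ∘ witness) ∷ AllP.tabulate⁺ (below-n ∘ second ∘ witness) ∷ []
    where
    below-n : ∀ v → toℕ v ≤ _
    below-n v = ≤-trans (<⇒≤ (toℕ<n v)) n≤M
    size≤2 : ∀ (w : WitnessEnum (Fin n)) → size w ≤ 2
    size≤2 (one _) = s≤s z≤n
    size≤2 (two _ _) = ≤-refl

  obstacle : Obstacles.Obs (graphᴺ G) k (λ i → tabulate (toℕ ∘ vertex) at i) (λ i → tabulate (size ∘ witness) at i)
             (λ i → tabulate (toℕ ∘ first ∘ witness) at i) (λ i → tabulate (toℕ ∘ second ∘ witness) at i)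
  obstacle = Import.obstacle 𝒬 O (at-tabulate (toℕ ∘ vertex)) stored
    where
    cast : ∀ {w z z′ f f′ s s′} → z ≡ z′ → f ≡ f′ → s ≡ s′ → Stored toℕ w z f s → Stored toℕ w z′ f′ s′
    cast refl refl refl st = st
    plain : ∀ w → Stored toℕ w (size w) (toℕ (first w)) (toℕ (second w))
    plain (one w) = one refl refl refl
    plain (two u w) = two refl refl refl
    stored : ∀ i → Stored toℕ (witness i) (tabulate (size ∘ witness) at toℕ i) (tabulate (toℕ ∘ first ∘ witness) at toℕ i) (tabulate (toℕ ∘ second ∘ witness) at toℕ i)
    stored i = cast (sym (at-tabulate (size ∘ witness) i)) (sym (at-tabulate (toℕ ∘ first ∘ witness) i)) (sym (at-tabulate (toℕ ∘ second ∘ witness) i)) (plain (witness i))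


-- Arcs of a circle with N positions

In : ℕ → ℕ → ℕ → Set
In s e q = (s < e × (s ≤ q × q ≤ e)) ⊎ (e < s × (s ≤ q ⊎ q ≤ e))

private
  -- A position q lies in the arc from s to e just if two of s ≤ q, q ≤ e, e < s hold. This form is
  -- symmetric under cyclic shifts of the three conditions and suits a change of the origin.
  Two : Set → Set → Set → Set
  Two A B C = (A × B) ⊎ (B × C) ⊎ (C × A)

  two-of : ∀ {s e q} → In s e q → Two (s ≤ q) (q ≤ e) (e < s)
  two-of (inj₁ (_ , a , b)) = inj₁ (a , b)
  two-of (inj₂ (c , inj₁ a)) = inj₂ (inj₂ (c , a))
  two-of (inj₂ (c , inj₂ b)) = inj₂ (inj₁ (b , c))

  of-two : ∀ {s e q} → s ≢ e → Two (s ≤ q) (q ≤ e) (e < s) → In s e q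
  of-two ne (inj₁ (a , b)) = inj₁ (≤∧≢⇒< (≤-trans a b) ne , a , b)
  of-two ne (inj₂ (inj₁ (b , c))) = inj₂ (c , inj₂ b)
  of-two ne (inj₂ (inj₂ (c , a))) = inj₂ (c , inj₁ a)

  map-two : ∀ {A B C A′ B′ C′ : Set} → (A → A′) → (B → B′) → (C → C′) → Two A B C → Two A′ B′ C′
  map-two f g h = Sum.map (λ (a , b) → f a , g b) (Sum.map (λ (b , c) → g b , h c) (λ (c , a) → h c , f a))

  other-two : ∀ {A B C : Set} → ¬ B → Two A B C → A × C
  other-two nb (inj₁ (_ , b)) = ⊥-elim (nb b)
  other-two nb (inj₂ (inj₁ (b , _))) = ⊥-elim (nb b)
  other-two nb (inj₂ (inj₂ (c , a))) = a , c

  turn : ∀ {A B C : Set} → Two A B C → Two B C A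
  turn (inj₁ x) = inj₂ (inj₂ x)
  turn (inj₂ (inj₁ x)) = inj₁ x
  turn (inj₂ (inj₂ x)) = inj₂ (inj₁ x)

module Rotation (N o : ℕ) (o≤N : o ≤ N) where

  d : ℕ → ℕ
  d = off N o

  private
    high : ∀ {x} → o ≤ x → d x ≡ x ∸ o
    high = off-≤ {N}
    low : ∀ {x} → x < o → d x ≡ x + (N ∸ o)
    low {x} lt = trans (off-> {N} lt) (+-∸-assoc x o≤N)

    record Same (x y : ℕ) : Set where
      constructor same
      field
        up   : x ≤ y → d x ≤ d y
        down : d x ≤ d y → x ≤ y
        up<   : x < y → d x < d y
        down< : d x < d y → x < y

    cross : ∀ {x y} → x < N → o ≤ x → y < o → d x < d y
    cross {x} {y} x<N o≤x y<o = subst₂ _<_ (sym (high o≤x)) (sym (low y<o)) (<-≤-trans (∸-monoˡ-< x<N o≤x) (m≤n+m (N ∸ o) y))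

    same-high : ∀ {x y} → o ≤ x → o ≤ y → Same x y
    same-high p q = same (λ le → subst₂ _≤_ (sym (high p)) (sym (high q)) (∸-monoˡ-≤ o le))
      (λ le → ≤-trans (≤-reflexive (sym (m∸n+n≡m p))) (≤-trans (+-monoˡ-≤ o (subst₂ _≤_ (high p) (high q) le)) (≤-reflexive (m∸n+n≡m q))))
      (λ lt → subst₂ _<_ (sym (high p)) (sym (high q)) (∸-monoˡ-< lt p))
      (λ lt → ≤-trans (≤-reflexive (cong suc (sym (m∸n+n≡m p)))) (≤-trans (+-monoˡ-< o (subst₂ _<_ (high p) (high q) lt)) (≤-reflexive (m∸n+n≡m q))))

    same-low : ∀ {x y} → x < o → y < o → Same x y
    same-low {x} {y} p q = same (λ le → subst₂ _≤_ (sym (low p)) (sym (low q)) (+-monoˡ-≤ (N ∸ o) le))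
      (λ le → +-cancelʳ-≤ (N ∸ o) x y (subst₂ _≤_ (low p) (low q) le))
      (λ lt → subst₂ _<_ (sym (low p)) (sym (low q)) (+-monoˡ-< (N ∸ o) lt))
      (λ lt → +-cancelʳ-< (N ∸ o) x y (subst₂ _<_ (low p) (low q) lt))

  d-injective : ∀ {x y} → x < N → y < N → d x ≡ d y → x ≡ y
  d-injective {x} {y} x< y< e with o ≤? x | o ≤? y
  ... | yes p | yes q = ≤-antisym (Same.down (same-high p q) (≤-reflexive e)) (Same.down (same-high q p) (≤-reflexive (sym e)))
  ... | no p  | no q  = ≤-antisym (Same.down (same-low (≰⇒> p) (≰⇒> q)) (≤-reflexive e)) (Same.down (same-low (≰⇒> q) (≰⇒> p)) (≤-reflexive (sym e)))
  ... | yes p | no q  = ⊥-elim (<-irrefl e (cross x< p (≰⇒> q)))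
  ... | no p  | yes q = ⊥-elim (<-irrefl (sym e) (cross y< q (≰⇒> p)))

  private
    -- Of the three pairs of positions either none or two are separated by o.
    rotate : ∀ {s e q} → s < N → e < N → q < N →
             (Two (s ≤ q) (q ≤ e) (e < s) → Two (d s ≤ d q) (d q ≤ d e) (d e < d s)) ×
             (Two (d s ≤ d q) (d q ≤ d e) (d e < d s) → Two (s ≤ q) (q ≤ e) (e < s))
    rotate {s} {e} {q} s< e< q< with o ≤? s | o ≤? q | o ≤? e
    ... | yes a | yes b | yes c = map-two (Same.up (same-high a b)) (Same.up (same-high b c)) (Same.up< (same-high c a)) , map-two (Same.down (same-high a b)) (Same.down (same-high b c)) (Same.down< (same-high c a))
    ... | no a  | no b  | no c  = let a′ = ≰⇒> a ; b′ = ≰⇒> b ; c′ = ≰⇒> c in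
          map-two (Same.up (same-low a′ b′)) (Same.up (same-low b′ c′)) (Same.up< (same-low c′ a′)) , map-two (Same.down (same-low a′ b′)) (Same.down (same-low b′ c′)) (Same.down< (same-low c′ a′))
    ... | yes a | yes b | no c  = (λ t → inj₁ (Same.up (same-high a b) (proj₁ (other-two (<⇒≱ (<-≤-trans (≰⇒> c) b)) t)) , <⇒≤ (cross q< b (≰⇒> c)))) ,
          (λ t → inj₂ (inj₂ (<-≤-trans (≰⇒> c) a , Same.down (same-high a b) (proj₂ (other-two (<⇒≯ (cross s< a (≰⇒> c))) (turn t))))))
    ... | no a  | no b  | yes c = (λ t → inj₂ (inj₂ (cross e< c (≰⇒> a) , Same.up (same-low (≰⇒> a) (≰⇒> b)) (proj₂ (other-two (<⇒≯ (<-≤-trans (≰⇒> a) c)) (turn t)))))) ,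
          (λ t → inj₁ (Same.down (same-low (≰⇒> a) (≰⇒> b)) (proj₁ (other-two (<⇒≱ (cross e< c (≰⇒> b))) t)) , <⇒≤ (<-≤-trans (≰⇒> b) c)))
    ... | yes a | no b  | no c  = (λ t → inj₁ (<⇒≤ (cross s< a (≰⇒> b)) , Same.up (same-low (≰⇒> b) (≰⇒> c)) (proj₂ (other-two (<⇒≱ (<-≤-trans (≰⇒> b) a)) (turn (turn t)))))) ,
          (λ t → inj₂ (inj₁ (Same.down (same-low (≰⇒> b) (≰⇒> c)) (proj₁ (other-two (<⇒≯ (cross s< a (≰⇒> c))) (turn t))) , <-≤-trans (≰⇒> c) a)))
    ... | no a  | yes b | yes c = (λ t → inj₂ (inj₁ (Same.up (same-high b c) (proj₁ (other-two (<⇒≯ (<-≤-trans (≰⇒> a) c)) (turn t))) , cross e< c (≰⇒> a)))) ,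
          (λ t → inj₁ (<⇒≤ (<-≤-trans (≰⇒> a) b) , Same.down (same-high b c) (proj₂ (other-two (<⇒≱ (cross q< b (≰⇒> a))) (turn (turn t))))))
    ... | yes a | no b  | yes c = (λ t → inj₂ (inj₂ (Same.up< (same-high c a) (proj₁ (other-two (<⇒≱ (<-≤-trans (≰⇒> b) a)) (turn (turn t)))) , <⇒≤ (cross s< a (≰⇒> b))))) ,
          (λ t → inj₂ (inj₁ (<⇒≤ (<-≤-trans (≰⇒> b) c) , Same.down< (same-high c a) (proj₂ (other-two (<⇒≱ (cross e< c (≰⇒> b))) t)))))
    ... | no a  | yes b | no c  = (λ t → inj₂ (inj₁ (<⇒≤ (cross q< b (≰⇒> c)) , Same.up< (same-low (≰⇒> c) (≰⇒> a)) (proj₂ (other-two (<⇒≱ (<-≤-trans (≰⇒> c) b)) t))))) ,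
          (λ t → inj₂ (inj₂ (Same.down< (same-low (≰⇒> c) (≰⇒> a)) (proj₁ (other-two (<⇒≱ (cross q< b (≰⇒> a))) (turn (turn t)))) , <⇒≤ (<-≤-trans (≰⇒> a) b))))

  module _ {s e q : ℕ} (s< : s < N) (e< : e < N) (q< : q < N) (s≢e : s ≢ e) where

    rotated : In s e q → In (d s) (d e) (d q)
    rotated = of-two (s≢e ∘ d-injective s< e<) ∘ proj₁ (rotate s< e< q<) ∘ two-of

    unrotated : In (d s) (d e) (d q) → In s e q
    unrotated = of-two s≢e ∘ proj₂ (rotate s< e< q<) ∘ two-of

  d-self : d o ≡ 0
  d-self = off-refl N o


record Arcs (Γ : Graphᴺ) : Set₁ where
  open Graphᴺ Γ
  field
    N   : ℕ
    s e : ℕ → ℕ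
    s<  : ∀ {x} → x < order → s x < N
    e<  : ∀ {x} → x < order → e x < N
    s≢e : ∀ {x} → x < order → s x ≢ e x

  _∋_ : ℕ → ℕ → Set
  x ∋ p = In (s x) (e x) p

  Meets : ℕ → ℕ → Set
  Meets x y = Σ ℕ λ p → p < N × x ∋ p × y ∋ p

  field
    meets    : ∀ {x y} → E x y → Meets x y
    adjacent : ∀ {x y} → x < order → y < order → x ≢ y → Meets x y → E x y

module ArcLemmas {Γ : Graphᴺ} (A : Arcs Γ) where
  open Graphᴺ Γ
  open Arcs A

  has-start : ∀ {x} → x < order → x ∋ s x
  has-start {x} x< with <-cmp (s x) (e x)
  ... | tri< lt _ _ = inj₁ (lt , ≤-refl , <⇒≤ lt)
  ... | tri≈ _ q _ = ⊥-elim (s≢e x< q)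
  ... | tri> _ _ gt = inj₂ (gt , inj₁ ≤-refl)

  -- Distances from `c` straighten the circle: `c` becomes 0, and an arc that avoids `c` becomes an
  -- ordinary interval.
  module Cut (c : ℕ) (c<N : c < N) where
    open Rotation N c (<⇒≤ c<N) public

    turned : ∀ {x q} → x < order → q < N → x ∋ q → In (d (s x)) (d (e x)) (d q)
    turned x< q< = rotated (s< x<) (e< x<) q< (s≢e x<)

    unturned : ∀ {x q} → x < order → q < N → In (d (s x)) (d (e x)) (d q) → x ∋ q
    unturned x< q< = unrotated (s< x<) (e< x<) q< (s≢e x<)

    ds≢de : ∀ {x} → x < order → d (s x) ≢ d (e x)
    ds≢de x< = s≢e x< ∘ d-injective (s< x<) (e< x<)

    flat : ∀ {x} → x < order → ¬ x ∋ c → 0 < d (s x) × d (s x) < d (e x)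
    flat {x} x< n with <-cmp (d (s x)) (d (e x))
    ... | tri≈ _ q _ = ⊥-elim (ds≢de x< q)
    ... | tri> _ _ gt = ⊥-elim (n (unturned x< c<N (inj₂ (gt , inj₂ (≤-trans (≤-reflexive d-self) z≤n)))))
    ... | tri< lt _ _ with d (s x) in eq
    ...   | suc _ = s≤s z≤n , lt
    ...   | zero = ⊥-elim (n (unturned x< c<N (inj₁ (subst (_< d (e x)) (sym eq) lt , ≤-reflexive (trans eq (sym d-self)) , ≤-trans (≤-reflexive d-self) z≤n))))

    inside : ∀ {x q} → x < order → ¬ x ∋ c → q < N → x ∋ q → d (s x) ≤ d q × d q ≤ d (e x)
    inside x< n q< m with turned x< q< m
    ... | inj₁ (_ , b) = b
    ... | inj₂ (gt , _) = ⊥-elim (<-asym gt (proj₂ (flat x< n)))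

    between : ∀ {x q} → x < order → ¬ x ∋ c → q < N → d (s x) ≤ d q → d q ≤ d (e x) → x ∋ q
    between x< n q< a b = unturned x< q< (inj₁ (proj₂ (flat x< n) , a , b))

  module _ {x y : ℕ} (x< : x < order) (y< : y < order) (m : Meets x y) where
    private
      open Cut (s x) (s< x<)
      p<N = proj₁ (proj₂ m)
      len : In 0 (d (e x)) (d (proj₁ m))
      len = subst (λ z → In z (d (e x)) (d (proj₁ m))) d-self (turned x< p<N (proj₁ (proj₂ (proj₂ m))))
      ≤len : ∀ {q} → In 0 (d (e x)) q → q ≤ d (e x)
      ≤len (inj₁ (_ , _ , b)) = b
      0<len : 0 < d (e x)
      0<len with d (e x) in eq
      ... | suc _ = s≤s z≤n
      ... | zero = ⊥-elim (ds≢de x< (trans d-self (sym eq)))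
      in-x : ∀ {q} → q < N → d q ≤ d (e x) → x ∋ q
      in-x q< le = unturned x< q< (inj₁ (subst (_< d (e x)) (sym d-self) 0<len , ≤-trans (≤-reflexive d-self) z≤n , le))

    -- Measured from `s x`, the arc of x is an initial interval. If the end of y lies outside of it,
    -- then y, having a position inside, must run over the end of x.
    ends : x ∋ e y ⊎ y ∋ e x
    ends with d (e y) ≤? d (e x) | turned y< p<N (proj₂ (proj₂ (proj₂ m)))
    ... | yes le | _ = inj₁ (in-x (e< y<) le)
    ... | no gt | inj₁ (lt , a , _) = inj₂ (unturned y< (e< x<) (inj₁ (lt , ≤-trans a (≤len len) , <⇒≤ (≰⇒> gt))))
    ... | no gt | inj₂ (w , _) = inj₂ (unturned y< (e< x<) (inj₂ (w , inj₂ (<⇒≤ (≰⇒> gt)))))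

    starts : x ∋ s y ⊎ y ∋ s x
    starts with turned y< p<N (proj₂ (proj₂ (proj₂ m)))
    ... | inj₁ (_ , a , _) = inj₁ (in-x (s< y<) (≤-trans a (≤len len)))
    ... | inj₂ (w , _) = inj₂ (unturned y< (s< x<) (inj₂ (w , inj₂ (≤-trans (≤-reflexive d-self) z≤n))))

  -- If x contained neither end, then by `ends` both a and c would contain the end of x, although
  -- they are disjoint.
  colour : ∀ {x a c} → x < order → a < order → c < order → ¬ Meets a c → Meets x a → Meets x c → x ∋ e a ⊎ x ∋ e c
  colour {x} x< a< c< n ma mc with ends x< a< ma | ends x< c< mc
  ... | inj₁ p | _ = inj₁ p
  ... | inj₂ _ | inj₁ p = inj₂ p
  ... | inj₂ p | inj₂ q = ⊥-elim (n (e x , e< x< , p , q))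

  module _ {a b c d′ p : ℕ} (a< : a < order) (b< : b < order) (c< : c < order) (d< : d′ < order) (p< : p < N)
    (na : ¬ a ∋ p) (nb : ¬ b ∋ p) (nc : ¬ c ∋ p) (nd : ¬ d′ ∋ p) where
    open Cut p p<

    -- The arcs of an induced cycle with four vertices cover the circle.
    cover : Meets a b → Meets b c → Meets c d′ → Meets d′ a → ¬ Meets a c → Meets b d′
    cover (q₁ , q₁< , qa , qb) (q₂ , q₂< , rb , rc) (q₃ , q₃< , tc , td) (q₄ , q₄< , ud , ua) ac with d (s c) ≤? d (e a) | d (s a) ≤? d (e c)
    ... | no gt | _ = e a , e< a< , between b< nb (e< a<) (≤-trans (proj₁ (inside b< nb q₁< qb)) (proj₂ (inside a< na q₁< qa)))
                                      (≤-trans (<⇒≤ (≰⇒> gt)) (≤-trans (proj₁ (inside c< nc q₂< rc)) (proj₂ (inside b< nb q₂< rb)))) ,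
                                    between d< nd (e< a<) (≤-trans (proj₁ (inside d< nd q₄< ud)) (proj₂ (inside a< na q₄< ua)))
                                      (≤-trans (<⇒≤ (≰⇒> gt)) (≤-trans (proj₁ (inside c< nc q₃< tc)) (proj₂ (inside d< nd q₃< td))))
    ... | yes _ | no gt = e c , e< c< , between b< nb (e< c<) (≤-trans (proj₁ (inside b< nb q₂< rb)) (proj₂ (inside c< nc q₂< rc)))
                                      (≤-trans (<⇒≤ (≰⇒> gt)) (≤-trans (proj₁ (inside a< na q₁< qa)) (proj₂ (inside b< nb q₁< qb)))) ,
                                    between d< nd (e< c<) (≤-trans (proj₁ (inside d< nd q₃< td)) (proj₂ (inside c< nc q₃< tc)))
                                      (≤-trans (<⇒≤ (≰⇒> gt)) (≤-trans (proj₁ (inside a< na q₄< ua)) (proj₂ (inside d< nd q₄< ud))))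
    ... | yes le | yes le′ with ≤-total (d (s a)) (d (s c))
    ...   | inj₁ q = ⊥-elim (ac (s c , s< c< , between a< na (s< c<) q le , has-start c<))
    ...   | inj₂ q = ⊥-elim (ac (s a , s< a< , has-start a< , between c< nc (s< a<) q le′))

-- The six graphs are not circular-arc graphs

module NotCircularArc {Γ : Graphᴺ} (A : Arcs Γ) where
  open Graphᴺ Γ
  open Arcs A
  open ArcLemmas A
  open TreeSoundness Γ using (ForbiddenAt)

  module _ (F : Forbidden) (v : ℕ → ℕ) (f : ForbiddenAt F v) where
    private
      w : Fin (size-of F) → ℕ
      w i = v (toℕ i)

      w< : ∀ i → w i < order
      w< = proj₁ f

    module _ (a b c d x y : Fin (size-of F)) where
      private
        G = graph-of F
        miss? : ∀ z → Dec (¬ (Adj G z x ⊎ z ≡ x) ⊎ ¬ (Adj G z y ⊎ z ≡ y))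
        miss? z = ¬? (adj? G z x ⊎-dec z Fin.≟ x) ⊎-dec ¬? (adj? G z y ⊎-dec z Fin.≟ y)

        off-cycle : Dec _
        off-cycle = ¬? (adj? G a c ⊎-dec a Fin.≟ c) ×-dec ¬? (adj? G b d ⊎-dec b Fin.≟ d) ×-dec
                    (adj? G x y ⊎-dec x Fin.≟ y) ×-dec miss? a ×-dec miss? b ×-dec miss? c ×-dec miss? d ×-dec
                    adj? G a b ×-dec adj? G b c ×-dec adj? G c d ×-dec adj? G d a

        meet : ∀ {i j} → Adj G i j → Meets (w i) (w j)
        meet {i} {j} t = meets (Equivalence.from (proj₁ (proj₂ f i j)) t)

        disjoint : ∀ {i j} → ¬ (Adj G i j ⊎ i ≡ j) → ¬ Meets (w i) (w j)
        disjoint {i} {j} n m = n (inj₁ (Equivalence.to (proj₁ (proj₂ f i j)) (adjacent (w< i) (w< j) (proj₂ (proj₂ f i j) (n ∘ inj₂)) m)))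

        common : Adj G x y ⊎ x ≡ y → Meets (w x) (w y)
        common (inj₁ t) = meet t
        common (inj₂ refl) = s (w x) , s< (w< x) , has-start (w< x) , has-start (w< x)

      -- By cover an arc of the induced cycle a b c d contains a common position of x and y.
      no-cycle : True off-cycle → ⊥
      no-cycle t with toWitness t
      ... | ac , bd , xy , na , nb , nc , nd , ab , bc , cd , da with common xy
      ... | p , p< , px , py = disjoint bd (cover (w< a) (w< b) (w< c) (w< d) p< (miss na) (miss nb) (miss nc) (miss nd)
              (meet ab) (meet bc) (meet cd) (meet da) (disjoint ac))
        where
        miss : ∀ {z} → ¬ (Adj G z x ⊎ z ≡ x) ⊎ ¬ (Adj G z y ⊎ z ≡ y) → ¬ w z ∋ p
        miss (inj₁ n) m = disjoint n (p , p< , m , px)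
        miss (inj₂ n) m = disjoint n (p , p< , m , py)

    -- The arcs meeting both of the disjoint arcs a and c are coloured by the end that they contain.
    module _ (a c : Fin (size-of F)) where
      private
        G = graph-of F

      Colour : Bool → Fin (size-of F) → Set
      Colour true  i = w i ∋ e (w a)
      Colour false i = w i ∋ e (w c)

      coloured : False (adj? G a c ⊎-dec a Fin.≟ c) → ∀ i {_ : True (adj? G i a ×-dec adj? G i c)} → Σ Bool λ x → Colour x i
      coloured n i {t} with toWitness t
      ... | ia , ic with colour (w< i) (w< a) (w< c)
            (λ m → toWitnessFalse n (inj₁ (Equivalence.to (proj₁ (proj₂ f a c)) (adjacent (w< a) (w< c) (proj₂ (proj₂ f a c) (toWitnessFalse n ∘ inj₂)) m))))
            (meets (Equivalence.from (proj₁ (proj₂ f i a)) ia)) (meets (Equivalence.from (proj₁ (proj₂ f i c)) ic))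
      ...   | inj₁ p = true , p
      ...   | inj₂ p = false , p

      differ : ∀ i j {_ : False (adj? G i j ⊎-dec i Fin.≟ j)} ((x , _) : Σ Bool λ x → Colour x i) ((y , _) : Σ Bool λ x → Colour x j) → x ≢ y
      differ i j {t} (x , p) (y , q) refl = toWitnessFalse t (inj₁ (Equivalence.to (proj₁ (proj₂ f i j))
          (adjacent (w< i) (w< j) (proj₂ (proj₂ f i j) (toWitnessFalse t ∘ inj₂)) (common x p q))))
        where
        common : ∀ x → Colour x i → Colour x j → Meets (w i) (w j)
        common true  p q = e (w a) , e< (w< a) , p , q
        common false p q = e (w c) , e< (w< c) , p , q

  private
    two-colours : ∀ (x y z : Bool) → x ≢ y → y ≢ z → x ≡ z
    two-colours true  true  _     n _ = ⊥-elim (n refl)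
    two-colours false false _     n _ = ⊥-elim (n refl)
    two-colours true  false true  _ _ = refl
    two-colours true  false false _ n = ⊥-elim (n refl)
    two-colours false true  false _ _ = refl
    two-colours false true  true  _ n = ⊥-elim (n refl)

  not-circular-arc : ∀ F v → ¬ ForbiddenAt F v
  not-circular-arc isC₄*    v f = no-cycle isC₄* v f 0F 1F 2F 3F 4F 4F tt
  not-circular-arc isDomino v f = no-cycle isDomino v f 2F 3F 5F 4F 0F 1F tt
  not-circular-arc isG₃     v f = no-cycle isG₃ v f 0F 1F 3F 2F 4F 5F tt
  not-circular-arc isC₆ᶜ    v f = no-cycle isC₆ᶜ v f 0F 2F 5F 3F 4F 1F tt
  -- The three vertices of the larger side are pairwise nonadjacent but share two colours.
  not-circular-arc isK₂₃ v f = differ′ 2F 4F (col 2F) (col 4F) (two-colours _ _ _ (differ′ 2F 3F (col 2F) (col 3F)) (differ′ 3F 4F (col 3F) (col 4F)))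
    where
    col = coloured isK₂₃ v f 0F 1F tt
    differ′ = differ isK₂₃ v f 0F 1F
  -- Vertices consecutive on the complemented five-cycle are nonadjacent, so the colours would
  -- properly colour an odd cycle with two colours.
  not-circular-arc isC₅K₂ᶜ v f = differ′ 4F 0F (col 4F) (col 0F) (sym (trans
      (two-colours _ _ _ (differ′ 0F 1F (col 0F) (col 1F)) (differ′ 1F 2F (col 1F) (col 2F)))
      (two-colours _ _ _ (differ′ 2F 3F (col 2F) (col 3F)) (differ′ 3F 4F (col 3F) (col 4F)))))
    where
    col = coloured isC₅K₂ᶜ v f 5F 6F tt
    differ′ = differ isC₅K₂ᶜ v f 5F 6F

-- Many arcs of Q that avoid a common position of two witnesses

module Ranks {Γ : Graphᴺ} (A : Arcs Γ) (k : ℕ) (V F : ℕ → ℕ) where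
  open Graphᴺ Γ
  open Arcs A

  -- Since `F i` misses `V i` and Q is a clique, the six vertices induce the octahedron K_{2,2,2}.
  -- With the enumerations `F a`, `F b`, then `F b`, `F c`, then `F c`, `F a`, it is essential,
  -- because any two of the three witnesses occur together.
  record Octahedron (a b c : ℕ) : Set where
    constructor octahedron
    field
      ffᵃᵇ : E (F a) (F b)
      ffᵃᶜ : E (F a) (F c)
      ffᵇᶜ : E (F b) (F c)
      fvᵃᵇ : E (F a) (V b)
      fvᵃᶜ : E (F a) (V c)
      fvᵇᵃ : E (F b) (V a)
      fvᵇᶜ : E (F b) (V c)
      fvᶜᵃ : E (F c) (V a)
      fvᶜᵇ : E (F c) (V b)

  -- The vertices of Q in the order of the starts of their arcs, listed twice.
  record Ranking (K : ℕ) (ord : ℕ → ℕ) : Set where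
    field
      ord<   : ∀ r → ord r < k
      rising : ∀ {r r′} → r < r′ → r′ < K → s (V (ord r)) < s (V (ord r′))
      onto   : ∀ i → i < k → Σ ℕ λ r → r < K × ord r ≡ i
      again  : ∀ r → r < K → ord (K + r) ≡ ord r

module NearlyComplete {Γ : Graphᴺ} (A : Arcs Γ) {k : ℕ} {V Z F S : ℕ → ℕ} (O : Obstacles.Obs Γ k V Z F S) where
  open Obstacles Γ
  open Arcs A
  open ArcLemmas A
  open Obs O
  open Ranks A k V F public

  module _ {i : ℕ} (i< : i < k) where

    F< : F i < order
    F< with wit i i<
    ... | single _ _ c   = Cl.x< c
    ... | double _ c _ _ = Cl.x< c

    F-far : ¬ E (F i) (V i) × F i ≢ V i
    F-far with wit i i<
    ... | single _ _ c   = Cl.nl c , Cl.out c i i<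
    ... | double _ c _ _ = Cl.nl c , Cl.out c i i<

    F-adj : ∀ {j} → j < k → j ≢ i → j ≢ nx k i → E (F i) (V j)
    F-adj j< p q with wit i i<
    ... | single _ _ c   = Cl.adj c _ j< p q
    ... | double _ c _ _ = Cl.adj c _ j< p p

    S-far : ¬ E (S i) (V (nx k i)) × S i ≢ V (nx k i)
    S-far with wit i i<
    ... | single _ e c   = subst (λ x → ¬ E x (V (nx k i)) × x ≢ V (nx k i)) (sym e) (Cl.nh c , Cl.out c _ (Cl.h< c))
    ... | double _ _ c _ = Cl.nl c , Cl.out c _ (Cl.l< c)

    S< : S i < order
    S< with wit i i<
    ... | single _ e c   = subst (_< order) (sym e) (Cl.x< c)
    ... | double _ _ c _ = Cl.x< c

    S-adj : ∀ {j} → j < k → j ≢ i → j ≢ nx k i → E (S i) (V j)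
    S-adj j< p q with wit i i<
    ... | single _ e c   = subst (λ x → E x (V _)) (sym e) (Cl.adj c _ j< p q)
    ... | double _ _ c _ = Cl.adj c _ j< q q

  private
    -- Besides `V x` the witness `F x` can miss only the successor of `V x`. For that one, the
    -- second witness of the preceding enumeration serves.
    separated : ∀ {x m} → x < k → m < k → x ≢ m → Σ ℕ λ w → w < order × (¬ E w (V x) × w ≢ V x) × E w (V m)
    separated {x} {m} x< m< x≢m with m ≟ nx k x
    ... | no n = F x , F< x< , F-far x< , F-adj x< m< (x≢m ∘ sym) n
    ... | yes refl = S y , S< y< , subst (λ j → ¬ E (S y) (V j) × S y ≢ V j) y→x (S-far y<) ,
          S-adj y< (nx<k x<) (λ e → nx²≢ 3≤k y< (trans (cong (nx k) y→x) e)) (λ e → nx≢ (<⇒≤ 3≤k) x< (trans e y→x))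
      where
      1≤k = ≤-trans (s≤s z≤n) 3≤k
      y = ρ k x (k ∸ 1)
      y< : y < k
      y< = ρ<k x< (m∸n≤m k 1)
      y→x : nx k y ≡ x
      y→x = trans (ρ-suc x< (≤-reflexive (m+[n∸m]≡n 1≤k))) (trans (cong (ρ k x) (m+[n∸m]≡n 1≤k)) (ρ-k x<))

    -- The separating witness meets `V m` in a position outside `V x`. So the arcs of Q form a
    -- proper family, where starts and ends come in the same order.
    proper : ∀ {x m} → x < k → m < k → x ≢ m → ¬ (∀ {q} → q < N → V m ∋ q → V x ∋ q)
    proper x< m< ne sub with separated x< m< ne
    ... | w , w< , (n , w≢) , a with meets a
    ... | q , q< , p , p′ = n (adjacent w< (V< _ x<) w≢ (q , q< , p , sub q< p′))

  module At (c : ℕ) (c<N : c < N) where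
    open Cut c c<N

    ds de : ℕ → ℕ
    ds m = d (s (V m))
    de m = d (e (V m))

    Avoids : ℕ → Set
    Avoids m = m < k × ¬ V m ∋ c

    -- Measured from `c`, an arc through `c` that starts before `V m′` covers everything from its
    -- start on, and hence would contain `V m′`, contrary to `proper`.
    convex : ∀ {m x m′} → Avoids m → x < k → Avoids m′ → ds m < ds x → ds x < ds m′ → Avoids x
    convex {m} {x} {m′} _ x< (m′< , nm′) lt lt′ = x< , λ x∋c → case turned (V< x x<) c<N x∋c of λ
      { (inj₁ (_ , le , _)) → <-irrefl refl (<-≤-trans lt (≤-trans le (≤-trans (≤-reflexive d-self) z≤n)))
      ; (inj₂ (gt , _)) → proper x< m′< (λ e → <-irrefl (cong ds e) lt′) λ q< q∈ →
          unturned (V< x x<) q< (inj₂ (gt , inj₁ (≤-trans (<⇒≤ lt′) (proj₁ (inside (V< _ m′<) nm′ q< q∈))))) }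

    ends-rise : ∀ {m m′} → Avoids m → Avoids m′ → ds m < ds m′ → de m < de m′
    ends-rise {m} {m′} (m< , nm) (m′< , nm′) lt with de m <? de m′
    ... | yes p = p
    ... | no p  = ⊥-elim (proper m< m′< (λ e → <-irrefl (cong ds e) lt) λ q< q∈ → let (a , b) = inside (V< _ m′<) nm′ q< q∈ in
            between (V< _ m<) nm q< (≤-trans (<⇒≤ lt) a) (≤-trans b (≮⇒≥ p)))

    private
      before : ∀ {m q} → Avoids m → q < N → ¬ V m ∋ q → d q ≤ de m → d q < ds m
      before (m< , nm) q< n le = ≰⇒> λ ge → n (between (V< _ m<) nm q< ge le)

      after : ∀ {m q} → Avoids m → q < N → ¬ V m ∋ q → ds m ≤ d q → de m < d q
      after (m< , nm) q< n ge = ≰⇒> λ le → n (between (V< _ m<) nm q< ge le)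

    ∋? : ∀ x q → Dec (x ∋ q)
    ∋? x q = (s x <? e x ×-dec s x ≤? q ×-dec q ≤? e x) ⊎-dec (e x <? s x ×-dec (s x ≤? q ⊎-dec q ≤? e x))

    module _ {b m m′ : ℕ} (Sb : Avoids b) (Sm : Avoids m) (Sm′ : Avoids m′) (lt : ds m < ds b) (lt′ : ds b < ds m′) where

      -- If `F b` avoided `c`, it would be an interval meeting arcs on both sides of `V b`. It would
      -- then contain the start of `V b`, although it misses `V b`.
      surrounded : E (F b) (V m) → E (F b) (V m′) → F b ∋ c
      surrounded a a′ with ∋? (F b) c | meets a | meets a′
      ... | yes p | _ | _ = p
      ... | no n | q , q< , p , r | q′ , q′< , p′ , r′ =
            ⊥-elim (proj₁ F-far′ (adjacent (F< b<) (V< b b<) (proj₂ F-far′) (s (V b) , s< (V< b b<) ,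
              between (F< b<) n (s< (V< b b<)) (≤-trans (proj₁ (inside (F< b<) n q< p)) (<⇒≤ (before Sb q< (misses q< p)
                  (≤-trans (proj₂ (inside (V< _ (proj₁ Sm)) (proj₂ Sm) q< r)) (<⇒≤ (ends-rise Sm Sb lt))))))
                (≤-trans (≤-trans (<⇒≤ lt′) (proj₁ (inside (V< _ (proj₁ Sm′)) (proj₂ Sm′) q′< r′))) (proj₂ (inside (F< b<) n q′< p′))) ,
              has-start (V< b b<))))
        where
        b< = proj₁ Sb
        F-far′ = F-far b<
        misses : ∀ {q} → q < N → F b ∋ q → ¬ V b ∋ q
        misses q< p p′ = proj₁ F-far′ (adjacent (F< b<) (V< b b<) (proj₂ F-far′) (_ , q< , p , p′))

    -- Besides `V b` at most one vertex of Q is missed by `F b`. Of two arcs on each side of `V b`,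
    -- at least one on each side is thus available for `surrounded`.
    interior : ∀ {b m₁ m₂ m₃ m₄} → Avoids b → Avoids m₁ → Avoids m₂ → Avoids m₃ → Avoids m₄ →
               ds m₁ < ds m₂ → ds m₂ < ds b → ds b < ds m₃ → ds m₃ < ds m₄ → F b ∋ c
    interior {b} {m₁} {m₂} {m₃} {m₄} Sb S₁ S₂ S₃ S₄ l₁ l₂ l₃ l₄ with m₁ ≟ nx k b | m₃ ≟ nx k b
    ... | no p | no q = surrounded Sb S₁ S₃ (<-trans l₁ l₂) l₃ (near S₁ (<⇒≢ (<-trans l₁ l₂)) p) (near S₃ (>⇒≢ l₃) q)
      where
      near : ∀ {m} → Avoids m → ds m ≢ ds b → m ≢ nx k b → E (F b) (V m)
      near Sm ne = F-adj (proj₁ Sb) (proj₁ Sm) (ne ∘ cong ds)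
    ... | yes p | no q = surrounded Sb S₂ S₃ l₂ l₃ (F-adj (proj₁ Sb) (proj₁ S₂) (<⇒≢ l₂ ∘ cong ds) (λ e → <⇒≢ l₁ (cong ds (trans p (sym e)))))
                           (F-adj (proj₁ Sb) (proj₁ S₃) (>⇒≢ l₃ ∘ cong ds) q)
    ... | _ | yes q = surrounded Sb S₁ S₄ (<-trans l₁ l₂) (<-trans l₃ l₄)
                           (F-adj (proj₁ Sb) (proj₁ S₁) (<⇒≢ (<-trans l₁ l₂) ∘ cong ds) (λ e → <⇒≢ (<-trans l₁ (<-trans l₂ l₃)) (cong ds (trans e (sym q)))))
                           (F-adj (proj₁ Sb) (proj₁ S₄) (>⇒≢ (<-trans l₃ l₄) ∘ cong ds) (λ e → >⇒≢ l₄ (cong ds (trans e (sym q)))))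

    -- Together the arcs of a and b contain that of m, so F a cannot miss both.
    beyond : ∀ {a m b} → Avoids a → Avoids m → Avoids b → (ds a < ds m × ds m < ds b) ⊎ (ds b < ds m × ds m < ds a) → E (F a) (V b)
    beyond {a} {m} {b} Sa@(a< , na) Sm@(m< , nm) Sb@(b< , nb) l with b ≟ nx k a
    ... | no p = F-adj a< b< (λ e → apart l (cong ds e)) p
      where
      apart : (ds a < ds m × ds m < ds b) ⊎ (ds b < ds m × ds m < ds a) → ds b ≢ ds a
      apart (inj₁ (p , q)) = >⇒≢ (<-trans p q)
      apart (inj₂ (p , q)) = <⇒≢ (<-trans p q)
    ... | yes refl with wit a a<
    ...   | double _ f _ _ = Cl.adj f _ b< (nx≢ (<⇒≤ 3≤k) a<) (nx≢ (<⇒≤ 3≤k) a<)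
    ...   | single _ _ f with meets (Cl.adj f m m< (m≢a l) (m≢b l)) | meets (clique a b a< b< (nx≢ (<⇒≤ 3≤k) a< ∘ sym))
      where
      m≢a : (ds a < ds m × ds m < ds b) ⊎ (ds b < ds m × ds m < ds a) → m ≢ a
      m≢a (inj₁ (p , _)) e = >⇒≢ p (cong ds e)
      m≢a (inj₂ (_ , p)) e = <⇒≢ p (cong ds e)
      m≢b : (ds a < ds m × ds m < ds b) ⊎ (ds b < ds m × ds m < ds a) → m ≢ b
      m≢b (inj₁ (_ , p)) e = <⇒≢ p (cong ds e)
      m≢b (inj₂ (p , _)) e = >⇒≢ p (cong ds e)
    ...     | q , q< , p , r | z , z< , y , y′ = ⊥-elim (contra l)
      where
      q∉a : ¬ V a ∋ q
      q∉a q∈ = Cl.nl f (adjacent (Cl.x< f) (V< a a<) (Cl.out f a a<) (q , q< , p , q∈))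
      q∉b : ¬ V b ∋ q
      q∉b q∈ = Cl.nh f (adjacent (Cl.x< f) (V< b b<) (Cl.out f b b<) (q , q< , p , q∈))
      qm = inside (V< m m<) nm q< r
      za = inside (V< a a<) na z< y
      zb = inside (V< b b<) nb z< y′
      contra : (ds a < ds m × ds m < ds b) ⊎ (ds b < ds m × ds m < ds a) → ⊥
      contra (inj₁ (l₁ , l₂)) = <-irrefl refl (<-≤-trans (<-trans (after Sa q< q∉a (≤-trans (<⇒≤ l₁) (proj₁ qm)))
        (before Sb q< q∉b (≤-trans (proj₂ qm) (<⇒≤ (ends-rise Sm Sb l₂))))) (≤-trans (proj₁ zb) (proj₂ za)))
      contra (inj₂ (l₁ , l₂)) = <-irrefl refl (<-≤-trans (<-trans (after Sb q< q∉b (≤-trans (<⇒≤ l₁) (proj₁ qm)))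
        (before Sa q< q∉a (≤-trans (proj₂ qm) (<⇒≤ (ends-rise Sm Sa l₂))))) (≤-trans (proj₁ za) (proj₂ zb)))

  module _ {K : ℕ} {ord : ℕ → ℕ} (ranking : Ranking K ord) where
    open Ranking ranking

    private
      st : ℕ → ℕ
      st r = s (V (ord r))

      st< : ∀ r → st r < N
      st< r = s< (V< _ (ord< r))

      -- The second copy of the list is moved on by a full turn, so the starts rise along both
      -- copies. The positions from `c` to `c + N` then correspond to consecutive ranks, even if
      -- they pass the origin.
      t : ℕ → ℕ
      t r = st r + (if r <ᵇ K then 0 else N)

      t-first : ∀ {r} → r < K → t r ≡ st r
      t-first {r} lt = trans (cong (st r +_) (if-< lt)) (+-identityʳ _)

      t-second : ∀ {r} → K ≤ r → t r ≡ st r + N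
      t-second {r} le = cong (st r +_) (if-≥ le)

      st-again : ∀ {r} → K ≤ r → r < K + K → r ∸ K < K × st r ≡ st (r ∸ K)
      st-again {r} le lt = r< , cong (s ∘ V) (trans (cong ord (sym (m+[n∸m]≡n le))) (again (r ∸ K) r<))
        where
        r< = <-≤-trans (∸-monoˡ-< lt le) (≤-reflexive (m+n∸n≡m K K))

      t-rising : ∀ {r r′} → r < r′ → r′ < K + K → t r < t r′
      t-rising {r} {r′} lt lt′ with r <? K | r′ <? K
      ... | yes p | yes q = subst₂ _<_ (sym (t-first p)) (sym (t-first q)) (rising lt q)
      ... | yes p | no q  = subst₂ _<_ (sym (t-first p)) (sym (t-second (≮⇒≥ q))) (<-≤-trans (st< r) (m≤n+m N _))
      ... | no p  | yes q = ⊥-elim (p (<-trans lt q))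
      ... | no p  | no q  = let (_ , e) = st-again (≮⇒≥ p) (<-trans lt lt′) ; (l , e′) = st-again (≮⇒≥ q) lt′ in
            subst₂ _<_ (sym (t-second (≮⇒≥ p))) (sym (t-second (≮⇒≥ q)))
              (+-monoˡ-< N (subst₂ _<_ (sym e) (sym e′) (rising (∸-monoˡ-< lt (≮⇒≥ p)) l)))

    module _ (c : ℕ) (c<N : c < N) where
      open Cut c c<N
      open At c c<N

      -- Cutting at c, exactly one of the two occurrences counts.
      record Counts (r : ℕ) : Set where
        constructor counts
        field
          r<   : r < K + K
          from : c ≤ t r
          to   : t r < c + N

      counting : ∀ {i} → i < k → Σ ℕ λ r → Counts r × ord r ≡ i
      counting i< with onto _ i<
      ... | r , r< , e with c ≤? st r
      ...   | yes p = r , counts (≤-trans r< (m≤m+n K K)) (subst (c ≤_) (sym (t-first r<)) p)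
                  (subst (_< c + N) (sym (t-first r<)) (<-≤-trans (st< r) (m≤n+m N c))) , e
      ...   | no p = K + r , counts (+-monoʳ-< K r<) (subst (c ≤_) (sym t≡) (≤-trans (<⇒≤ c<N) (m≤n+m N _))) (subst (_< c + N) (sym t≡) (+-monoˡ-< N (≰⇒> p))) , trans (again r r<) e
        where
        t≡ : t (K + r) ≡ st r + N
        t≡ = trans (t-second (m≤m+n K r)) (cong (λ i → s (V i) + N) (again r r<))

      ds≡ : ∀ {r} → Counts r → ds (ord r) ≡ t r ∸ c
      ds≡ {r} (counts r< from to) with r <? K
      ... | yes p = trans (off-≤ {N} (≤-trans from (≤-reflexive (t-first p)))) (cong (_∸ c) (sym (t-first p)))
      ... | no p = trans (off-> {N} (+-cancelʳ-< N _ _ (≤-<-trans (≤-reflexive (sym (t-second (≮⇒≥ p)))) to))) (cong (_∸ c) (sym (t-second (≮⇒≥ p))))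

      counts-between : ∀ {R r R′} → Counts R → Counts R′ → R ≤ r → r ≤ R′ → Counts r
      counts-between {R} {r} {R′} (counts _ from _) (counts R′< _ to) a b = counts r< (≤-trans from (t-mono a r<)) (≤-<-trans (t-mono b R′<) to)
        where
        r< = ≤-<-trans b R′<
        t-mono : ∀ {x y} → x ≤ y → y < K + K → t x ≤ t y
        t-mono le lt with m≤n⇒m<n∨m≡n le
        ... | inj₁ l    = <⇒≤ (t-rising l lt)
        ... | inj₂ refl = ≤-refl

      ds-rising : ∀ {r r′} → Counts r → Counts r′ → r < r′ → ds (ord r) < ds (ord r′)
      ds-rising cr cr′ lt = subst₂ _<_ (sym (ds≡ cr)) (sym (ds≡ cr′)) (∸-monoˡ-< (t-rising lt (Counts.r< cr′)) (Counts.from cr))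

      -- Why nine arcs: among the ranks 0 to 8 counted from `R`, each of 2, 4 and 6 has two arcs
      -- before and two after it, as `interior` demands, and 3 and 5 lie between them for `beyond`.
      module _ {R R′ : ℕ} (CR : Counts R) (CR′ : Counts R′) (SR : Avoids (ord R)) (SR′ : Avoids (ord R′)) (far : 8 + R ≤ R′) where

        private
          C′ : ∀ i {_ : T (i ≤ᵇ 8)} → Counts (i + R)
          C′ i {le} = counts-between CR CR′ (m≤n+m R i) (≤-trans (+-monoˡ-≤ R (≤ᵇ⇒≤ i 8 le)) far)

          rise : ∀ i j {a : T (i ≤ᵇ 8)} {b : T (j ≤ᵇ 8)} {_ : T (i <ᵇ j)} → ds (ord (i + R)) < ds (ord (j + R))
          rise i j {a} {b} {lt} = ds-rising (C′ i {a}) (C′ j {b}) (+-monoˡ-< R (<ᵇ⇒< i j lt))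

          avoid : ∀ i {_ : T (i ≤ᵇ 8)} → Avoids (ord (i + R))
          avoid zero = SR
          avoid (suc i) {le} with m≤n⇒m<n∨m≡n (≤-trans (+-monoˡ-≤ R (≤ᵇ⇒≤ (suc i) 8 le)) far)
          ... | inj₂ e = subst (Avoids ∘ ord) (sym e) SR′
          ... | inj₁ lt = convex SR (ord< _) SR′ (ds-rising CR (C′ (suc i) {le}) (s≤s (m≤n+m R i))) (ds-rising (C′ (suc i) {le}) CR′ lt)

          at-cut : ∀ i {x : T (i ≤ᵇ 8)} {y : T (1 + i ≤ᵇ 8)} {z : T (2 + i ≤ᵇ 8)} {u : T (3 + i ≤ᵇ 8)} {v : T (4 + i ≤ᵇ 8)} {p : T (i <ᵇ 1 + i)} → F (ord (2 + i + R)) ∋ c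
          at-cut i {x} {y} {z} {u} {v} {p} = interior (avoid (2 + i) {z}) (avoid i {x}) (avoid (1 + i) {y}) (avoid (3 + i) {u}) (avoid (4 + i) {v})
            (rise i (1 + i) {x} {y} {p}) (rise (1 + i) (2 + i) {y} {z} {p}) (rise (2 + i) (3 + i) {z} {u} {p}) (rise (3 + i) (4 + i) {u} {v} {p})

          both : ∀ {a b} → a < k → b < k → F a ∋ c → F b ∋ c → E (F a) (V b) → E (F a) (F b)
          both a< b< p q e = adjacent (F< a<) (F< b<) (λ x → proj₁ (F-far b<) (subst (λ y → E y (V _)) x e)) (c , c<N , p , q)

        octahedral : Octahedron (ord (2 + R)) (ord (4 + R)) (ord (6 + R))
        octahedral = octahedron
            (both (ord< _) (ord< _) (at-cut 0) (at-cut 2) ab) (both (ord< _) (ord< _) (at-cut 0) (at-cut 4) ac) (both (ord< _) (ord< _) (at-cut 2) (at-cut 4) bc)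
            ab ac (beyond (avoid 4) (avoid 3) (avoid 2) (inj₂ (rise 2 3 , rise 3 4))) bc
            (beyond (avoid 6) (avoid 3) (avoid 2) (inj₂ (rise 2 3 , rise 3 6))) (beyond (avoid 6) (avoid 5) (avoid 4) (inj₂ (rise 4 5 , rise 5 6)))
          where
          ab = beyond (avoid 2) (avoid 3) (avoid 4) (inj₁ (rise 2 3 , rise 3 4))
          ac = beyond (avoid 2) (avoid 3) (avoid 6) (inj₁ (rise 2 3 , rise 3 6))
          bc = beyond (avoid 4) (avoid 5) (avoid 6) (inj₁ (rise 4 5 , rise 5 6))

    -- A common position `c` of `p` and `q` is avoided by `V a` and `V b`. Both therefore have a
    -- rank in the turn that begins at `c`, and ranks differing by 8 or more would give an
    -- octahedron.
    near : (∀ r → r < K + K → ¬ Octahedron (ord r) (ord (2 + r)) (ord (4 + r))) →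
           ∀ {p q a b} → E p q → a < k → b < k → ¬ E p (V a) × p ≢ V a → ¬ E q (V b) × q ≢ V b →
           Σ ℕ λ r → Σ ℕ λ r′ → (r < K + K × ord r ≡ a) × (r′ < K + K × ord r′ ≡ b) × r ≤ 7 + r′ × r′ ≤ 7 + r
    near none {p} {q} pq a< b< (na , p≢) (nb , q≢) with meets pq
    ... | c , c< , p∋ , q∋ with counting c c< a< | counting c c< b<
    ... | r , Cr , refl | r′ , Cr′ , refl = r , r′ , (Counts.r< Cr , refl) , (Counts.r< Cr′ , refl) ,
          close Cr′ Cr Sb Sa , close Cr Cr′ Sa Sb
      where
      open At c c<
      Sa : Avoids (ord r)
      Sa = a< , λ m → na (adjacent (E< pq) (V< _ a<) p≢ (c , c< , p∋ , m))
      Sb : Avoids (ord r′)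
      Sb = b< , λ m → nb (adjacent (E< (E-sym pq)) (V< _ b<) q≢ (c , c< , q∋ , m))
      close : ∀ {R R′} → Counts c c< R → Counts c c< R′ → Avoids (ord R) → Avoids (ord R′) → R′ ≤ 7 + R
      close {R} {R′} CR CR′ SR SR′ with R′ ≤? 7 + R
      ... | yes le = le
      ... | no gt = ⊥-elim (none (2 + R) (<-trans (≤-trans (s≤s (+-monoˡ-≤ R (s≤s (s≤s z≤n)))) (≰⇒> gt)) (Counts.r< CR′)) (octahedral c c< CR CR′ SR SR′ (≰⇒> gt)))

-- Finding the edges between the witnesses in the order of the arcs.  Array 31
-- holds the starts of the arcs, 32 their ends, 34 the vertices of Q in the
-- order of their starts, twice, and 33 for each of them the first witness
-- nonadjacent to it and the second one.

inside : Expr → Expr → Program → Program → Program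
inside x y hit miss = cond ((31 [ x ]) ≺ (32 [ x ]))
  (cond ((31 [ y ]) ≺ (31 [ x ])) miss (cond ((32 [ x ]) ≺ (31 [ y ])) miss hit))
  (cond ((31 [ y ]) ≺ (31 [ x ])) (cond ((32 [ x ]) ≺ (31 [ y ])) miss hit) hit)

-- Two arcs meet just if one contains the start of the other, so adjacency in a model takes constant
-- time, unlike in adjacency lists.
touched : Expr → Expr → Program
touched x y = 8 [ lit 32 ]≔ lit 0 ⍮ cond (x ≈ y) skip
  (inside x y (8 [ lit 32 ]≔ lit 1) (inside y x (8 [ lit 32 ]≔ lit 1) skip))

all-pairs : List (Fin 6 × Fin 6) → Program → Program
all-pairs []             hit = hit
all-pairs ((i , j) ∷ ps) hit = touched (25 [ lit (toℕ i) ]) (25 [ lit (toℕ j) ]) ⍮ cond (slot 32 ≈ lit 1) (all-pairs ps hit) skip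

-- Near the end of the list the indices run past it, into cells that contain 0. This is still the
-- index of a vertex of Q, so an octahedron found there is genuine as well.
name-all : Program
name-all = 25 [ lit 0 ]≔ (10 [ 34 [ slot 10 ] ]) ⍮ 25 [ lit 1 ]≔ (10 [ 34 [ lit 2 ⊕ slot 10 ] ]) ⍮ 25 [ lit 2 ]≔ (10 [ 34 [ lit 4 ⊕ slot 10 ] ]) ⍮
           25 [ lit 3 ]≔ (12 [ 34 [ slot 10 ] ]) ⍮ 25 [ lit 4 ]≔ (12 [ 34 [ lit 2 ⊕ slot 10 ] ]) ⍮ 25 [ lit 5 ]≔ (12 [ 34 [ lit 4 ⊕ slot 10 ] ])

octahedron-pairs : List (Fin 6 × Fin 6)
octahedron-pairs = (3F , 4F) ∷ (3F , 5F) ∷ (4F , 5F) ∷ (3F , 1F) ∷ (3F , 2F) ∷ (4F , 0F) ∷ (4F , 2F) ∷ (5F , 0F) ∷ (5F , 1F) ∷ []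

-- Slot 38 holds one more than the rank of an octahedron, so that 0 can say that none has been
-- found.
seek : List (Fin 6 × Fin 6) → Program
seek ps = 8 [ lit 38 ]≔ lit 0 ⍮ for 10 below (9 [ lit 6 ]) loop (name-all ⍮ all-pairs ps (8 [ lit 38 ]≔ (slot 10 ⊕ lit 1)))

add-if-touched : Program
add-if-touched = cond (slot 32 ≈ lit 1)
  (18 [ 9 [ lit 1 ] ]≔ slot 30 ⍮ 19 [ 9 [ lit 1 ] ]≔ slot 31 ⍮ 9 [ lit 1 ]≔ ((9 [ lit 1 ]) ⊕ lit 1) ⍮
   18 [ 9 [ lit 1 ] ]≔ slot 31 ⍮ 19 [ 9 [ lit 1 ] ]≔ slot 30 ⍮ 9 [ lit 1 ]≔ ((9 [ lit 1 ]) ⊕ lit 1)) skip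

pairs-at : Program → ℕ → Program
pairs-at p δ = for 10 below (9 [ lit 7 ]) loop
  (8 [ lit 30 ]≔ (33 [ slot 10 ]) ⍮ 8 [ lit 31 ]≔ (33 [ slot 10 ⊕ lit δ ]) ⍮ p ⍮ add-if-touched)

-- The pairs of seats are grouped by their distance. A fixed number of loops in sequence thereby
-- replaces a nested loop.
pairs-within : ℕ → Program
pairs-within zero    = 9 [ lit 1 ]≔ lit 0
pairs-within (suc δ) = pairs-within δ ⍮ pairs-at (touched (slot 30) (slot 31)) δ

module Touching {Γ : Graphᴺ} (A : Arcs Γ) (M : ℕ) (64≤M : 64 ≤ M) where
  open Graphᴺ Γ
  open Arcs A
  open ArcLemmas A
  open Hoare M 64≤M

  inside-wp : ∀ Q x y hit miss {μ a b} → ⟦ x ⟧ μ ≡ a → ⟦ y ⟧ μ ≡ b → μ 31 a ≢ μ 32 a → (In (μ 31 a) (μ 32 a) (μ 31 b) → wp hit Q μ) →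
              (¬ In (μ 31 a) (μ 32 a) (μ 31 b) → wp miss Q μ) → wp (inside x y hit miss) Q μ
  inside-wp Q x y hit miss refl refl ne h m =
    (λ s<e → (λ q<s → m λ { (inj₁ (_ , s≤q , _)) → <⇒≱ q<s s≤q ; (inj₂ (e<s , _)) → <-asym s<e e<s }) ,
             (λ s≤q → (λ e<q → m λ { (inj₁ (_ , _ , q≤e)) → <⇒≱ e<q q≤e ; (inj₂ (e<s , _)) → <-asym s<e e<s }) ,
                      (λ q≤e → h (inj₁ (s<e , s≤q , q≤e))))) ,
    (λ e≤s → let e<s = ≤∧≢⇒< e≤s (ne ∘ sym) in
             (λ q<s → (λ e<q → m λ { (inj₁ (s<e , _)) → <-asym s<e e<s ; (inj₂ (_ , inj₁ s≤q)) → <⇒≱ q<s s≤q ; (inj₂ (_ , inj₂ q≤e)) → <⇒≱ e<q q≤e }) ,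
                      (λ q≤e → h (inj₂ (e<s , inj₂ q≤e)))) ,
             (λ s≤q → h (inj₂ (e<s , inj₁ s≤q))))

  Timed : (st en : ℕ → ℕ) → Set
  Timed st en = ∀ v → v < order → st v ≡ s v × en v ≡ e v

  touched-wp : ∀ Q {μ} x y {a b} → ⟦ x ⟧ (μ [ 8 , 32 ↦ 0 ]) ≡ a → ⟦ y ⟧ (μ [ 8 , 32 ↦ 0 ]) ≡ b → a < order → b < order → Timed (μ 31) (μ 32) →
               (E a b → Q (μ [ 8 , 32 ↦ 0 ] [ 8 , 32 ↦ 1 ])) → (¬ E a b → Q (μ [ 8 , 32 ↦ 0 ])) → wp (touched x y) Q μ
  touched-wp Q {μ} x y {a} {b} xa yb a< b< timed hit miss =
    (λ e → miss (λ ab → E-irr (subst (E _) (sym (trans (sym xa) (trans e yb))) ab))) ,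
    (λ ne → let a≢b = λ e → ne (trans xa (trans e (sym yb))) in
      inside-wp Q x y (8 [ lit 32 ]≔ lit 1) (inside y x (8 [ lit 32 ]≔ lit 1) skip) xa yb (differ a<)
        (λ i → hit (adjacent a< b< a≢b (s b , s< b< , at a< b< i , has-start b<)))
        (λ ni → inside-wp Q y x (8 [ lit 32 ]≔ lit 1) skip yb xa (differ b<)
          (λ i → hit (adjacent a< b< a≢b (s a , s< a< , has-start a< , at b< a< i)))
          (λ ni′ → miss λ ab → case starts a< b< (meets ab) of λ { (inj₁ p) → ni (to a< b< p) ; (inj₂ p) → ni′ (to b< a< p) })))
    where
    differ : ∀ {v} → v < order → μ 31 v ≢ μ 32 v
    differ v< q = s≢e v< (trans (sym (proj₁ (timed _ v<))) (trans q (proj₂ (timed _ v<))))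
    at : ∀ {u v} → u < order → v < order → In (μ 31 u) (μ 32 u) (μ 31 v) → u ∋ s v
    at u< v< = subst id (cong₂ (λ (a , b) c → In a b c) (cong₂ _,_ (proj₁ (timed _ u<)) (proj₂ (timed _ u<))) (proj₁ (timed _ v<)))
    to : ∀ {u v} → u < order → v < order → u ∋ s v → In (μ 31 u) (μ 32 u) (μ 31 v)
    to u< v< = subst id (sym (cong₂ (λ (a , b) c → In a b c) (cong₂ _,_ (proj₁ (timed _ u<)) (proj₂ (timed _ u<))) (proj₁ (timed _ v<))))

  AllAdjacent : (ℕ → ℕ) → List (Fin 6 × Fin 6) → Set
  AllAdjacent v = All (λ (i , j) → E (v (toℕ i)) (v (toℕ j)))

  all-pairs-wp : ∀ (J Q : Memory → Set) → (∀ μ x → J μ → J (μ [ 8 , 32 ↦ x ])) → (∀ μ → J μ → Timed (μ 31) (μ 32) × ∀ (i : Fin 6) → μ 25 (toℕ i) < order) →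
                 ∀ ps hit μ → J μ → (∀ μ → J μ → AllAdjacent (μ 25) ps → wp hit Q μ) → (∀ μ → J μ → ¬ AllAdjacent (μ 25) ps → Q μ) → wp (all-pairs ps hit) Q μ
  all-pairs-wp J Q stable facts [] hit μ j h m = h μ j []
  all-pairs-wp J Q stable facts ((a , b) ∷ ps) hit μ j h m =
    touched-wp (wp (cond (slot 32 ≈ lit 1) (all-pairs ps hit) skip) Q) (25 [ lit (toℕ a) ]) (25 [ lit (toℕ b) ]) refl refl
      (proj₂ (facts μ j) a) (proj₂ (facts μ j) b) (proj₁ (facts μ j))
      (λ ab → (λ _ → all-pairs-wp (λ μ → J μ × E (μ 25 (toℕ a)) (μ 25 (toℕ b))) Q (λ μ x (j , e) → stable μ x j , e) (λ μ (j , _) → facts μ j)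
                 ps hit (μ [ 8 , 32 ↦ 0 ] [ 8 , 32 ↦ 1 ]) (stable _ 1 (stable μ 0 j) , ab) (λ μ (j , e) es → h μ j (e ∷ es)) (λ μ (j , _) n → m μ j λ { (_ ∷ es) → n es })) ,
              (λ n → ⊥-elim (n refl)))
      (λ n → (λ ()) , (λ _ → m (μ [ 8 , 32 ↦ 0 ]) (stable μ 0 j) λ { (e ∷ _) → n e }))

module Listing₂ {Γ : Graphᴺ} (A : Arcs Γ) (Wt : ℕ → Set) (M : ℕ) (64≤M : 64 ≤ M) (W : ℕ) (M≤W : M ≤ W) (room : 128 * Arcs.N A ≤ M) where
  open Core Γ Wt M 64≤M W M≤W
  open Obstacles Γ
  open Arcs A
  open Touching A M 64≤M

  record Front (k n K K₂ L : ℕ) (V Z F S st en X ord : ℕ → ℕ) : Set where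
    field
      obstacle : Obs k V Z F S
      n≡       : n ≡ order
      original : ∀ {x} → IsW k F S x → Wt x
      only     : ∀ {x} → Wt x → IsW k F S x
      timed    : Timed st en
      ranking  : Ranks.Ranking A k V F K ord
      K≤N      : K ≤ N
      K₂≡      : K₂ ≡ K + K
      L≡       : L ≡ K₂ + K₂
      X<       : ∀ i → X i < order
      X-first  : ∀ r → r < K₂ → X (r + r) ≡ F (ord r)
      X-second : ∀ r j → r < K₂ → j < k → nx k j ≡ ord r → X (suc (r + r)) ≡ S j

  Fr : Memory → Set
  Fr μ = Front (μ 9 0) (μ 9 2) (μ 9 5) (μ 9 6) (μ 9 7) (μ 10) (μ 11) (μ 12) (μ 13) (μ 31) (μ 32) (μ 33) (μ 34)

  Octahedral : (k : ℕ) (V F ord : ℕ → ℕ) → ℕ → Set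
  Octahedral k V F ord r = Ranks.Octahedron A k V F (ord r) (ord (2 + r)) (ord (4 + r))

  Status : (k found i : ℕ) (V F ord : ℕ → ℕ) → Set
  Status k found i V F ord = (found ≡ 0 × ∀ r → r < i → ¬ Octahedral k V F ord r) ⊎ (Σ ℕ λ r → found ≡ suc r × Octahedral k V F ord r)

  record Named (i : ℕ) (names V F ord : ℕ → ℕ) : Set where
    constructor named
    field
      name₀ : names 0 ≡ V (ord i)
      name₁ : names 1 ≡ V (ord (2 + i))
      name₂ : names 2 ≡ V (ord (4 + i))
      name₃ : names 3 ≡ F (ord i)
      name₄ : names 4 ≡ F (ord (2 + i))
      name₅ : names 5 ≡ F (ord (4 + i))

  module _ {k i : ℕ} {names V F ord : ℕ → ℕ} where

    octahedron⇒ : Named i names V F ord → AllAdjacent names octahedron-pairs → Octahedral k V F ord i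
    octahedron⇒ (named a b c f g h) (p₁ ∷ p₂ ∷ p₃ ∷ p₄ ∷ p₅ ∷ p₆ ∷ p₇ ∷ p₈ ∷ p₉ ∷ []) = Ranks.octahedron
      (subst₂ E f g p₁) (subst₂ E f h p₂) (subst₂ E g h p₃) (subst₂ E f b p₄) (subst₂ E f c p₅) (subst₂ E g a p₆) (subst₂ E g c p₇) (subst₂ E h a p₈) (subst₂ E h b p₉)

    octahedron⇐ : Named i names V F ord → Octahedral k V F ord i → AllAdjacent names octahedron-pairs
    octahedron⇐ (named a b c f g h) (Ranks.octahedron p₁ p₂ p₃ p₄ p₅ p₆ p₇ p₈ p₉) =
      subst₂ E (sym f) (sym g) p₁ ∷ subst₂ E (sym f) (sym h) p₂ ∷ subst₂ E (sym g) (sym h) p₃ ∷ subst₂ E (sym f) (sym b) p₄ ∷ subst₂ E (sym f) (sym c) p₅ ∷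
      subst₂ E (sym g) (sym a) p₆ ∷ subst₂ E (sym g) (sym c) p₇ ∷ subst₂ E (sym h) (sym a) p₈ ∷ subst₂ E (sym h) (sym b) p₉ ∷ []

  named< : ∀ {k n K K₂ L V Z F S st en X ord i names} → Front k n K K₂ L V Z F S st en X ord → Named i names V F ord → ∀ (j : Fin 6) → names (toℕ j) < order
  named< {V = V} {F = F} {ord = ord} fr (named a b c f g h) = λ where
      0F → at-V a ; 1F → at-V b ; 2F → at-V c ; 3F → at-F f ; 4F → at-F g ; 5F → at-F h
    where
    open Front fr
    at-V : ∀ {x r} → x ≡ V (ord r) → x < order
    at-V refl = Obs.V< obstacle _ (Ranks.Ranking.ord< ranking _)
    at-F : ∀ {x r} → x ≡ F (ord r) → x < order
    at-F refl = NearlyComplete.F< A obstacle (Ranks.Ranking.ord< ranking _)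

  Sought : Memory → Set
  Sought μ = Fr μ × Status (μ 9 0) (μ 8 38) (μ 9 6) (μ 10) (μ 12) (μ 34)

  private
    SeekInv : ℕ → ℕ → Memory → Set
    SeekInv T i μ = μ 9 6 ≡ T × Fr μ × Status (μ 9 0) (μ 8 38) i (μ 10) (μ 12) (μ 34)

    Trial : ℕ → ℕ → Memory → Set
    Trial T i μ = μ 8 10 ≡ i × SeekInv T i μ × Named i (μ 25) (μ 10) (μ 12) (μ 34)

    next-status : ∀ {k found i V F ord} → ¬ Octahedral k V F ord i → Status k found i V F ord → Status k found (suc i) V F ord
    next-status n (inj₁ (z , none)) = inj₁ (z , below none n)
    next-status n (inj₂ p) = inj₂ p

  -- The pairs are kept general: their tests would be unfolded otherwise.
  seek-triple : ∀ ps → (∀ {k i names V F ord} → Named i names V F ord → (AllAdjacent names ps → Octahedral k V F ord i) × (Octahedral k V F ord i → AllAdjacent names ps)) →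
                ⟨ Fr ⟩ seek ps ⟨ Sought ⟩
  seek-triple ps sound = straight {Q = λ μ → Fr μ × μ 8 38 ≡ 0} _ (λ μ B h → h , refl) ▹ loops 10 (9 [ lit 6 ]) _ λ μ₀ (h , z) → record
    { times  = μ₀ 9 6
    ; Inv    = SeekInv (μ₀ 9 6)
    ; times≤ = λ B → B 9 6
    ; fixed  = λ _ _ (e , _) → e
    ; base   = refl , h , inj₁ (z , λ _ ())
    ; step   = λ μ B lt (e , h , st) → let i = μ 8 10 ; V = μ 10 ; F = μ 12 ; ord = μ 34 ; lt′ = subst (μ 8 10 <_) (sym e) lt in
        V (ord i) , refl , V (ord (2 + i)) , refl , V (ord (4 + i)) , refl , F (ord i) , refl , F (ord (2 + i)) , refl , F (ord (4 + i)) , refl ,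
        all-pairs-wp (Trial (μ₀ 9 6) i) (After (SeekInv (μ₀ 9 6)) 10 μ) (λ _ _ j → j) (λ _ (_ , (_ , h , _) , nm) → Front.timed h , named< h nm)
          ps (8 [ lit 38 ]≔ (slot 10 ⊕ lit 1)) _ (refl , (e , h , st) , named refl refl refl refl refl refl)
          (λ μ′ (c , (e , h , st) , nm) es → suc i , trans (cong (_+ 1) c) (+-comm i 1) , ≤-trans lt′ (B 9 6) , c , e , h , inj₂ (i , refl , proj₁ (sound nm) es))
          (λ μ′ (c , (e , h , st) , nm) n → c , e , h , next-status (n ∘ proj₂ (sound nm)) st)
    ; exit   = λ μ (e , h , st) → h , subst (λ i → Status (μ 9 0) (μ 8 38) i (μ 10) (μ 12) (μ 34)) (sym e) st
    }

  seek-octahedron-triple : ⟨ Fr ⟩ seek octahedron-pairs ⟨ Sought ⟩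
  seek-octahedron-triple = seek-triple octahedron-pairs λ nm → octahedron⇒ nm , octahedron⇐ nm

  FN : Memory → Set
  FN μ = Fr μ × ∀ r → r < μ 9 6 → ¬ Octahedral (μ 9 0) (μ 10) (μ 12) (μ 34) r

  Has : (m : ℕ) (src tgt : ℕ → ℕ) → ℕ → ℕ → Set
  Has m src tgt x y = Σ ℕ λ e → e < m × src e ≡ x × tgt e ≡ y

  record Pairs (δ r L m : ℕ) (src tgt X : ℕ → ℕ) : Set where
    constructor pairs
    field
      count : m ≤ (δ * L + r) + (δ * L + r)
      sound : ∀ e → e < m → E (src e) (tgt e)
      done  : ∀ δ′ P → δ′ < δ → P < L → E (X P) (X (P + δ′)) → Has m src tgt (X P) (X (P + δ′)) × Has m src tgt (X (P + δ′)) (X P)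
      now   : ∀ P → P < r → E (X P) (X (P + δ)) → Has m src tgt (X P) (X (P + δ)) × Has m src tgt (X (P + δ)) (X P)

  private
    has-old : ∀ {m src tgt x y a b} → Has m src tgt a b → Has (suc m) (upd src m x) (upd tgt m y) a b
    has-old {m} {src} {tgt} {x} {y} (e , e< , p , q) = e , m<n⇒m<1+n e< , trans (upd-other src x (>⇒≢ e<)) p , trans (upd-other tgt y (>⇒≢ e<)) q

    has-new : ∀ {m src tgt x y} → Has (suc m) (upd src m x) (upd tgt m y) x y
    has-new {m} {src} {tgt} {x} {y} = m , n<1+n m , upd-same src m x , upd-same tgt m y

    sound-new : ∀ {m src tgt x y} → E x y → (∀ e → e < m → E (src e) (tgt e)) → ∀ e → e < suc m → E (upd src m x e) (upd tgt m y e)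
    sound-new {m} {src} {tgt} {x} {y} xy old = below (λ e e< → subst₂ E (sym (upd-other src x (>⇒≢ e<))) (sym (upd-other tgt y (>⇒≢ e<))) (old e e<))
      (subst₂ E (sym (upd-same src m x)) (sym (upd-same tgt m y)) xy)

    twice-suc : ∀ a → suc (suc (a + a)) ≡ suc a + suc a
    twice-suc a = cong suc (sym (+-suc a a))

    next-count : ∀ {a r m} → m ≤ (a + r) + (a + r) → suc (suc m) ≤ (a + suc r) + (a + suc r)
    next-count {a} {r} c = ≤-trans (s≤s (s≤s c)) (≤-reflexive (trans (twice-suc (a + r)) (cong (λ a → a + a) (sym (+-suc a r)))))

    add-pair : ∀ {δ r L m src tgt X} → E (X r) (X (r + δ)) → Pairs δ r L m src tgt X →
               Pairs δ (suc r) L (suc (suc m)) (upd (upd src m (X r)) (suc m) (X (r + δ))) (upd (upd tgt m (X (r + δ))) (suc m) (X r)) X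
    add-pair {δ} {r} {L} xy (pairs c s d n) = pairs
      (next-count {δ * L} c)
      (sound-new (E-sym xy) (sound-new xy s))
      (λ δ′ P l l′ e → let (a , b) = d δ′ P l l′ e in has-old (has-old a) , has-old (has-old b))
      (below (λ P l e → let (a , b) = n P l e in has-old (has-old a) , has-old (has-old b)) (λ _ → has-old has-new , has-new))

    skip-pair : ∀ {δ r L m src tgt X} → ¬ E (X r) (X (r + δ)) → Pairs δ r L m src tgt X → Pairs δ (suc r) L m src tgt X
    skip-pair {δ} {r} {L} xy (pairs c s d n) = pairs (≤-trans c (+-mono-≤ le le)) s d (below n (⊥-elim ∘ xy))
      where
      le : δ * L + r ≤ δ * L + suc r
      le = +-monoʳ-≤ (δ * L) (n≤1+n r)

    next-pairs : ∀ {δ L m src tgt X} → Pairs δ L L m src tgt X → Pairs (suc δ) 0 L m src tgt X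
    next-pairs {δ} {L} (pairs c s d n) = pairs
      (≤-trans c (≤-reflexive (cong (λ a → a + a) (trans (+-comm (δ * L) L) (sym (+-identityʳ _))))))
      s (λ δ′ P l l′ → older (m≤n⇒m<n∨m≡n (s≤s⁻¹ l)) P l′) (λ _ ())
      where
      older : ∀ {δ′} → δ′ < δ ⊎ δ′ ≡ δ → ∀ P → P < L → _
      older (inj₁ l) P = d _ P l
      older (inj₂ refl) P = n P

  -- Sixteen distances, at most 4 N seats and two directions per pair: this is the 128 N in `room`.
  list-room : ∀ {k n K K₂ L V Z F S st en X ord δ r} → Front k n K K₂ L V Z F S st en X ord → δ < 16 → r < L → (δ * L + suc r) + (δ * L + suc r) ≤ M
  list-room {K = K} {L = L} {δ = δ} {r} fr δ< r< = ≤-trans (+-mono-≤ part part) (≤-trans (≤-reflexive (sym (*-distribʳ-+ L 16 16)))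
      (≤-trans (≤-reflexive (cong (32 *_) (trans (Front.L≡ fr) (cong (λ a → a + a) (Front.K₂≡ fr)))))
        (≤-trans (*-monoʳ-≤ 32 four) (≤-trans (≤-reflexive (sym (*-assoc 32 4 N))) room))))
    where
    part : δ * L + suc r ≤ 16 * L
    part = ≤-trans (+-monoʳ-≤ (δ * L) r<) (≤-trans (≤-reflexive (+-comm (δ * L) L)) (*-monoˡ-≤ L δ<))
    four : (K + K) + (K + K) ≤ 4 * N
    four = ≤-trans (+-mono-≤ (+-mono-≤ (Front.K≤N fr) (Front.K≤N fr)) (+-mono-≤ (Front.K≤N fr) (Front.K≤N fr)))
      (≤-reflexive (trans (+-assoc N N (N + N)) (cong (λ a → N + (N + (N + a))) (sym (+-identityʳ N)))))

  private
    PairInv : ℕ → ℕ → ℕ → Memory → Set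
    PairInv T δ i μ = μ 9 7 ≡ T × FN μ × Pairs δ i (μ 9 7) (μ 9 1) (μ 18) (μ 19) (μ 33)

  Paired : ℕ → Memory → Set
  Paired δ μ = FN μ × Pairs δ 0 (μ 9 7) (μ 9 1) (μ 18) (μ 19) (μ 33)

  pairs-at-triple : ∀ p δ → δ < 16 → (∀ Q {μ} → μ 8 30 < order → μ 8 31 < order → Timed (μ 31) (μ 32) →
                      (E (μ 8 30) (μ 8 31) → Q (μ [ 8 , 32 ↦ 0 ] [ 8 , 32 ↦ 1 ])) → (¬ E (μ 8 30) (μ 8 31) → Q (μ [ 8 , 32 ↦ 0 ])) → wp p Q μ) →
                    ⟨ Paired δ ⟩ pairs-at p δ ⟨ Paired (suc δ) ⟩
  pairs-at-triple p δ δ< test-wp = loops 10 (9 [ lit 7 ]) _ λ μ₀ (h , ps) → record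
    { times  = μ₀ 9 7
    ; Inv    = PairInv (μ₀ 9 7) δ
    ; times≤ = λ B → B 9 7
    ; fixed  = λ _ _ (e , _) → e
    ; base   = refl , h , ps
    ; step   = λ μ B lt (e , h , p) → let i = μ 8 10 ; X = μ 33 ; x = X i ; y = X (i + δ) ; m = μ 9 1
                                          i< = subst (i <_) (sym e) lt ; le = ≤-trans (next-count {δ * μ 9 7} (Pairs.count p)) (list-room (proj₁ h) δ< i<) in
        x , refl , y , refl , test-wp (wp add-if-touched (After (PairInv (μ₀ 9 7) δ) 10 μ)) {μ [ 8 , 30 ↦ x ] [ 8 , 31 ↦ y ]} (Front.X< (proj₁ h) _) (Front.X< (proj₁ h) _) (Front.timed (proj₁ h))
          (λ xy → (λ _ → m , refl , x , refl , m , refl , y , refl , suc m , +-comm m 1 , ≤-trans (n≤1+n _) le ,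
                         suc m , refl , y , refl , suc m , refl , x , refl , suc (suc m) , +-comm (suc m) 1 , le , refl , e , h , add-pair xy p) ,
                  (λ n → ⊥-elim (n refl)))
          (λ nxy → (λ ()) , (λ _ → refl , e , h , skip-pair nxy p))
    ; exit   = λ μ (e , h , p) → h , next-pairs (subst (λ i → Pairs δ i (μ 9 7) (μ 9 1) (μ 18) (μ 19) (μ 33)) (sym e) p)
    }

  pairs-within-triple : ∀ δ → δ ≤ 16 → ⟨ FN ⟩ pairs-within δ ⟨ Paired δ ⟩
  pairs-within-triple zero _ = straight _ λ μ B h → h , pairs z≤n (λ _ ()) (λ _ _ ()) (λ _ ())
  pairs-within-triple (suc δ) δ< = pairs-within-triple δ (<⇒≤ δ<) ▹
    pairs-at-triple (touched (slot 30) (slot 31)) δ δ< λ Q {μ} → touched-wp Q {μ} (slot 30) (slot 31) refl refl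

  module _ {k n K K₂ L : ℕ} {V Z F S st en X ord : ℕ → ℕ} (fr : Front k n K K₂ L V Z F S st en X ord) where
    open Front fr

    private
      shift : ∀ r → (7 + r) + (7 + r) ≡ 14 + (r + r)
      shift r = cong (7 +_) (+-comm r (7 + r))

      record Place (p a : ℕ) : Set where
        field
          a<   : a < k
          miss : ¬ E p (V a) × p ≢ V a
          seat : ∀ r → r < K₂ → ord r ≡ a → Σ ℕ λ P → X P ≡ p × r + r ≤ P × P ≤ suc (r + r)

      place : ∀ {p} → IsW k F S p → Σ ℕ (Place p)
      place (isW {j} j< (inj₁ refl)) = j , record { a< = j< ; miss = NearlyComplete.F-far A obstacle j<
        ; seat = λ { r r< refl → r + r , X-first r r< , ≤-refl , n≤1+n _ } }
      place (isW {j} j< (inj₂ refl)) = nx k j , record { a< = nx<k j< ; miss = NearlyComplete.S-far A obstacle j<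
        ; seat = λ r r< e → suc (r + r) , X-second r j r< j< (sym e) , n≤1+n _ , ≤-refl }

      seat<L : ∀ {r P} → r < K₂ → P ≤ suc (r + r) → P < L
      seat<L {r} r< le = ≤-trans (s≤s le) (≤-trans (≤-reflexive (twice-suc r)) (≤-trans (+-mono-≤ r< r<) (≤-reflexive (sym L≡))))

      close : ∀ {r r′ P Q} → r ≤ 7 + r′ → P ≤ suc (r + r) → r′ + r′ ≤ Q → P ≤ 15 + Q
      close {r} {r′} le p q = ≤-trans p (s≤s (≤-trans (+-mono-≤ le le) (≤-trans (≤-reflexive (shift r′)) (+-monoʳ-≤ 14 q))))

    -- By `near` the ranks of the nonneighbours differ by at most 7. With two seats for each rank
    -- the witnesses are at most 2 · 7 + 1 = 15 seats apart, hence the sixteen distances from 0 to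
    -- 15.
    edges-listed : (∀ r → r < K₂ → ¬ Octahedral k V F ord r) → ∀ {m src tgt} → Pairs 16 0 L m src tgt X → Edges m src tgt
    edges-listed none {m} {src} {tgt} ps = record { sound = Pairs.sound ps ; complete = complete }
      where
      within : ∀ {P Q} → P < L → P ≤ Q → Q ≤ 15 + P → E (X P) (X Q) → Has m src tgt (X P) (X Q) × Has m src tgt (X Q) (X P)
      within {P} {Q} P< le le′ = subst (λ Q → E (X P) (X Q) → Has m src tgt (X P) (X Q) × Has m src tgt (X Q) (X P)) (m+[n∸m]≡n le)
        (Pairs.done ps (Q ∸ P) P (s≤s (≤-trans (∸-monoˡ-≤ P le′) (≤-reflexive (m+n∸n≡m 15 P)))) P<)
      complete : ∀ {x y} → Wt x → Wt y → E x y → Has m src tgt x y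
      complete wx wy xy with place (only wx) | place (only wy)
      ... | a , pa | b , pb with NearlyComplete.near A obstacle ranking (λ r r< → none r (subst (r <_) (sym K₂≡) r<)) xy (Place.a< pa) (Place.a< pb) (Place.miss pa) (Place.miss pb)
      ... | r , r′ , (r< , e) , (r′< , e′) , le , le′ with Place.seat pa r (subst (r <_) (sym K₂≡) r<) e | Place.seat pb r′ (subst (r′ <_) (sym K₂≡) r′<) e′
      ... | P , refl , lo , hi | Q , refl , lo′ , hi′ with ≤-total P Q
      ...   | inj₁ P≤Q = proj₁ (within (seat<L (subst (r <_) (sym K₂≡) r<) hi) P≤Q (close le′ hi′ lo) xy)
      ...   | inj₂ Q≤P = proj₂ (within (seat<L (subst (r′ <_) (sym K₂≡) r′<) hi′) Q≤P (close le hi lo′) (E-sym xy))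

  all-listed : ∀ μ → FN μ × Pairs 16 0 (μ 9 7) (μ 9 1) (μ 18) (μ 19) (μ 33) → St μ
  all-listed μ ((fr , none) , ps) = state (Front.obstacle fr) (Front.original fr) (edges-listed fr none ps) (Front.n≡ fr)

-- Sorting the vertices of Q by the starts of their arcs: array 35 holds 1 + i
-- for the vertex V i of Q, array 30 the second witness preceding it.

mark-step sweep-step sweep repeat fill : Program
mark-step = 30 [ slot 2 ]≔ (13 [ slot 10 ]) ⍮ 35 [ 10 [ slot 10 ] ]≔ (slot 10 ⊕ lit 1)
sweep-step = cond ((2 [ slot 10 ]) ≈ lit 0)
  (31 [ 1 [ slot 10 ] ]≔ slot 10 ⍮ cond ((35 [ 1 [ slot 10 ] ]) ≈ lit 0) skip
     (34 [ 9 [ lit 5 ] ]≔ ((35 [ 1 [ slot 10 ] ]) ⊖ lit 1) ⍮ 9 [ lit 5 ]≔ ((9 [ lit 5 ]) ⊕ lit 1)))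
  (32 [ 1 [ slot 10 ] ]≔ slot 10)
sweep = 9 [ lit 5 ]≔ lit 0 ⍮ for 10 below ((9 [ lit 2 ]) ⊕ (9 [ lit 2 ])) loop sweep-step
repeat = for 10 below (9 [ lit 5 ]) loop (34 [ (9 [ lit 5 ]) ⊕ slot 10 ]≔ (34 [ slot 10 ]))
fill = 9 [ lit 6 ]≔ ((9 [ lit 5 ]) ⊕ (9 [ lit 5 ])) ⍮ (for 10 below (9 [ lit 6 ]) loop
  (33 [ slot 10 ⊕ slot 10 ]≔ (12 [ 34 [ slot 10 ] ]) ⍮ 33 [ (slot 10 ⊕ slot 10) ⊕ lit 1 ]≔ (30 [ 34 [ slot 10 ] ]))) ⍮
  9 [ lit 7 ]≔ ((9 [ lit 6 ]) ⊕ (9 [ lit 6 ]))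

record Positions {Γ : Graphᴺ} (A : Arcs Γ) (vx sd : ℕ → ℕ) : Set where
  open Graphᴺ Γ
  open Arcs A
  field
    at-start : ∀ {v} → v < order → vx (s v) ≡ v × sd (s v) ≡ 0
    at-end   : ∀ {v} → v < order → vx (e v) ≡ v × sd (e v) ≢ 0
    start-at : ∀ {c} → c < N → sd c ≡ 0 → s (vx c) ≡ c
    end-at   : ∀ {c} → c < N → sd c ≢ 0 → e (vx c) ≡ c

module Sweeping {Γ : Graphᴺ} (A : Arcs Γ) (Wt : ℕ → Set) (M : ℕ) (64≤M : 64 ≤ M) (W : ℕ) (M≤W : M ≤ W) (room : 128 * Arcs.N A ≤ M)
  (N≡ : Arcs.N A ≡ Graphᴺ.order Γ + Graphᴺ.order Γ) where
  open Core Γ Wt M 64≤M W M≤W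
  open Obstacles Γ
  open Arcs A
  open Touching A M 64≤M using (Timed)
  open Listing₂ A Wt M 64≤M W M≤W room using (Front; Fr)

  private
    upd< : ∀ f i x {b} → x < b → (∀ j → f j < b) → ∀ j → upd f i x j < b
    upd< f i x {b} new old = upd-elim (λ _ y → y < b) {f} {i} {x} new (λ j _ → old j)

    multiple≤M : ∀ {x} a {_ : T (a ≤ᵇ 128)} → x ≤ a * N → x ≤ M
    multiple≤M a {t} le = ≤-trans le (≤-trans (*-monoˡ-≤ N (≤ᵇ⇒≤ a 128 t)) room)

    four : ∀ {K} → K ≤ N → (K + K) + (K + K) ≤ 4 * N
    four {K} le = ≤-trans (+-mono-≤ (+-mono-≤ le le) (+-mono-≤ le le))
      (≤-reflexive (trans (+-assoc N N (N + N)) (cong (λ a → N + (N + (N + a))) (sym (+-identityʳ N)))))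

  record Base (k n : ℕ) (V Z F S vx sd : ℕ → ℕ) : Set where
    field
      obstacle  : Obs k V Z F S
      n≡        : n ≡ order
      original  : ∀ {x} → IsW k F S x → Wt x
      only      : ∀ {x} → Wt x → IsW k F S x
      positions : Positions A vx sd

  record Tagged (i k : ℕ) (V S SP mark : ℕ → ℕ) : Set where
    field
      prev  : ∀ j → j < i → SP (nx k j) ≡ S j
      SP<   : ∀ x → SP x < order
      marks : ∀ v → (mark v ≡ 0 × ∀ j → j < i → V j ≢ v) ⊎ (Σ ℕ λ j → j < i × mark v ≡ suc j × V j ≡ v)

  record Timing (c : ℕ) (st en : ℕ → ℕ) : Set where
    field
      started : ∀ v → v < order → s v < c → st v ≡ s v
      ended   : ∀ v → v < order → e v < c → en v ≡ e v

  record Sorted (c K k : ℕ) (V ord : ℕ → ℕ) : Set where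
    field
      K≤c    : K ≤ c
      ord<   : ∀ r → ord r < k
      swept  : ∀ {r} → r < K → s (V (ord r)) < c
      rising : ∀ {r r′} → r < r′ → r′ < K → s (V (ord r)) < s (V (ord r′))
      onto   : ∀ i → i < k → s (V i) < c → Σ ℕ λ r → r < K × ord r ≡ i

  -- Initial zeros matter: in array 35 a zero says that a vertex is not in Q, and in arrays 30, 33
  -- and 34 it makes every cell a legitimate vertex or index, even where nothing has been written.
  Started Marked Swept Doubled : Memory → Set
  Bs : Memory → Set
  Bs μ = Base (μ 9 0) (μ 9 2) (μ 10) (μ 11) (μ 12) (μ 13) (μ 1) (μ 2)
  Started μ = Bs μ × (∀ i → μ 33 i ≡ 0) × (∀ i → μ 34 i ≡ 0) × (∀ i → μ 30 i ≡ 0) × (∀ i → μ 35 i ≡ 0)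
  Marked μ = Bs μ × (∀ i → μ 33 i ≡ 0) × (∀ i → μ 34 i ≡ 0) × Tagged (μ 9 0) (μ 9 0) (μ 10) (μ 13) (μ 30) (μ 35)

  order>0 : ∀ {k V Z F S} → Obs k V Z F S → 0 < order
  order>0 O = ≤-trans (s≤s z≤n) (Obs.V< O 0 (≤-trans (s≤s z≤n) (Obs.3≤k O)))

  private
    prepare-next : ∀ {i k V Z F S SP mark} → Obs k V Z F S → i < k → Tagged i k V S SP mark →
                   Tagged (suc i) k V S (upd SP (nx k i) (S i)) (upd mark (V i) (suc i))
    prepare-next {i} {k} {V} {Z} {F} {S} {SP} {mark} O i< p = record
      { prev = below (λ j j< → trans (upd-other SP (S i) (λ q → <-irrefl (nx-inj (<-trans j< i<) i< (sym q)) j<)) (prev j j<)) (upd-same SP (nx k i) (S i))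
      ; SP< = upd< SP (nx k i) (S i) (NearlyComplete.S< A O i<) SP<
      ; marks = upd-elim (λ v y → (y ≡ 0 × ∀ j → j < suc i → V j ≢ v) ⊎ (Σ ℕ λ j → j < suc i × y ≡ suc j × V j ≡ v))
          (inj₂ (i , n<1+n i , refl , refl)) (λ v ne → Sum.map (λ (z , none) → z , below none ne) (λ (j , j< , q) → j , m<n⇒m<1+n j< , q) (marks v)) }
      where open Tagged p

    MarkInv : ℕ → ℕ → Memory → Set
    MarkInv T i μ = μ 9 0 ≡ T × Bs μ × (∀ i → μ 33 i ≡ 0) × (∀ i → μ 34 i ≡ 0) × Tagged i (μ 9 0) (μ 10) (μ 13) (μ 30) (μ 35)

  marking : Program
  marking = for 10 below (9 [ lit 0 ]) loop (next-slot ⍮ mark-step)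

  marking-triple : ⟨ Started ⟩ marking ⟨ Marked ⟩
  marking-triple = loops 10 (9 [ lit 0 ]) _ λ μ₀ (b , z , z′ , z″ , z‴) → record
    { times  = μ₀ 9 0
    ; Inv    = MarkInv (μ₀ 9 0)
    ; times≤ = λ B → B 9 0
    ; fixed  = λ _ _ (e , _) → e
    ; base   = refl , b , z , z′ , record { prev = λ _ () ; SP< = λ x → ≤-<-trans (≤-reflexive (z″ x)) (order>0 (Base.obstacle b)) ; marks = λ v → inj₁ (z‴ v , λ _ ()) }
    ; step   = λ μ B lt (e , b , z , z′ , p) → let i = μ 8 10 ; i< = subst (i <_) (sym e) lt in
        next-slot-wp (wp mark-step (After (MarkInv (μ₀ 9 0)) 10 μ)) B i<
          (nx (μ 9 0) i , refl , μ 13 i , refl , μ 10 i , refl , suc i , +-comm i 1 , ≤-trans i< (B 9 0) ,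
           refl , e , b , z , z′ , prepare-next (Base.obstacle b) i< p)
    ; exit   = λ μ (e , b , z , z′ , p) → b , z , z′ , subst (λ i → Tagged i (μ 9 0) (μ 10) (μ 13) (μ 30) (μ 35)) (sym e) p
    }

  module _ {vx sd : ℕ → ℕ} (P : Positions A vx sd) {c : ℕ} (c< : c < N) where
    open Positions P

    private
      earlier : ∀ {x} → x ≢ c → x < suc c → x < c
      earlier ne lt = ≤∧≢⇒< (s≤s⁻¹ lt) ne

      not-start : sd c ≢ 0 → ∀ {v} → v < order → s v ≢ c
      not-start ne v< refl = ne (proj₂ (at-start v<))

    time-start : ∀ {st en} → sd c ≡ 0 → Timing c st en → Timing (suc c) (upd st (vx c) c) en
    time-start {st} {en} z t = record
      { started = upd-elim (λ v y → v < order → s v < suc c → y ≡ s v) (λ _ _ → sym (start-at c< z))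
          (λ v ne v< lt → Timing.started t v v< (earlier (λ q → ne (trans (cong vx (sym q)) (proj₁ (at-start v<)))) lt))
      ; ended = λ v v< lt → Timing.ended t v v< (earlier (λ { refl → proj₂ (at-end v<) z }) lt) }

    time-end : ∀ {st en} → sd c ≢ 0 → Timing c st en → Timing (suc c) st (upd en (vx c) c)
    time-end {st} {en} nz t = record
      { started = λ v v< lt → Timing.started t v v< (earlier (not-start nz v<) lt)
      ; ended = upd-elim (λ v y → v < order → e v < suc c → y ≡ e v) (λ _ _ → sym (end-at c< nz))
          (λ v ne v< lt → Timing.ended t v v< (earlier (λ q → ne (trans (cong vx (sym q)) (proj₁ (at-end v<)))) lt)) }

    module _ {k K : ℕ} {V Z F S ord : ℕ → ℕ} (O : Obs k V Z F S) where

      sort-skip : (∀ i → i < k → s (V i) ≢ c) → Sorted c K k V ord → Sorted (suc c) K k V ord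
      sort-skip none so = record { K≤c = m≤n⇒m≤1+n K≤c ; ord< = ord< ; swept = λ l → m<n⇒m<1+n (swept l) ; rising = rising
        ; onto = λ i i< lt → onto i i< (earlier (none i i<) lt) }
        where open Sorted so

      sort-end : sd c ≢ 0 → Sorted c K k V ord → Sorted (suc c) K k V ord
      sort-end nz = sort-skip λ i i< → not-start nz (Obs.V< O i i<)

      module _ {SP mark : ℕ → ℕ} (p : Tagged k k V S SP mark) where

        sort-other : mark (vx c) ≡ 0 → Sorted c K k V ord → Sorted (suc c) K k V ord
        sort-other z = sort-skip λ i i< q → case Tagged.marks p (vx c) of λ
          { (inj₁ (_ , none)) → none i i< (trans (sym (proj₁ (at-start (Obs.V< O i i<)))) (cong vx q))
          ; (inj₂ (_ , _ , m , _)) → case trans (sym z) m of λ () }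

        sort-add : sd c ≡ 0 → mark (vx c) ≢ 0 → Sorted c K k V ord → Sorted (suc c) (suc K) k V (upd ord K (mark (vx c) ∸ 1))
        sort-add z nz so with mark (vx c) | Tagged.marks p (vx c)
        ... | _ | inj₁ (m , _) = ⊥-elim (nz m)
        ... | _ | inj₂ (j , j< , refl , Vj) = record
          { K≤c = s≤s K≤c
          ; ord< = upd< ord K j j< ord<
          ; swept = λ {r} → upd-below (λ _ y → s (V y) < suc c) (λ r l → m<n⇒m<1+n (swept l)) (≤-reflexive (cong suc sV)) r
          ; rising = λ {r} {r′} l l′ → subst (λ y → s (V y) < s (V (upd ord K j r′))) (sym (upd-other ord j (>⇒≢ (<-≤-trans l (s≤s⁻¹ l′)))))
              (upd-below (λ r′ y → r < r′ → s (V (ord r)) < s (V y)) (λ r′ l′ l → rising l l′) (λ l → <-≤-trans (swept l) (≤-reflexive (sym sV))) r′ l′ l)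
          ; onto = λ i i< lt → found i i< (m≤n⇒m<n∨m≡n (s≤s⁻¹ lt)) }
          where
          open Sorted so
          sV : s (V j) ≡ c
          sV = trans (cong s Vj) (start-at c< z)
          found : ∀ i → i < k → s (V i) < c ⊎ s (V i) ≡ c → Σ ℕ λ r → r < suc K × upd ord K j r ≡ i
          found i i< (inj₁ lt) = let (r , r< , q) = onto i i< lt in r , m<n⇒m<1+n r< , trans (upd-other ord j (>⇒≢ r<)) q
          found i i< (inj₂ q) = K , n<1+n K , trans (upd-same ord K j) (Obs.V-inj O j i j< i< (trans Vj (trans (cong vx (sym q)) (proj₁ (at-start (Obs.V< O i i<))))))

  Swept μ = Bs μ × (∀ i → μ 33 i ≡ 0) × Tagged (μ 9 0) (μ 9 0) (μ 10) (μ 13) (μ 30) (μ 35) × Timing N (μ 31) (μ 32) × Sorted N (μ 9 5) (μ 9 0) (μ 10) (μ 34)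

  private
    SweepInv : ℕ → Memory → Set
    SweepInv c μ = Bs μ × (∀ i → μ 33 i ≡ 0) × Tagged (μ 9 0) (μ 9 0) (μ 10) (μ 13) (μ 30) (μ 35) × Timing c (μ 31) (μ 32) × Sorted c (μ 9 5) (μ 9 0) (μ 10) (μ 34)

  -- The model lists the extremes in the order of the circle, so the starts of the arcs of Q are met
  -- in increasing order and appending them sorts Q in linear time.
  sweep-triple : ⟨ Marked ⟩ sweep ⟨ Swept ⟩
  sweep-triple = straight {Q = λ μ → Marked μ × μ 9 5 ≡ 0} _ (λ μ B h → h , refl) ▹ loops 10 ((9 [ lit 2 ]) ⊕ (9 [ lit 2 ])) _ λ { μ₀ ((b , z , z′ , p) , k0) → record
    { times  = N
    ; Inv    = SweepInv
    ; times≤ = λ B → multiple≤M 1 (≤-reflexive (sym (+-identityʳ N)))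
    ; fixed  = λ _ _ (b , _) → trans (cong (λ a → a + a) (Base.n≡ b)) (sym N≡)
    ; base   = b , z , p , record { started = λ _ _ () ; ended = λ _ _ () } ,
        record { K≤c = ≤-reflexive k0 ; ord< = λ r → ≤-<-trans (≤-reflexive (z′ r)) (≤-trans (s≤s z≤n) (Obs.3≤k (Base.obstacle b)))
               ; swept = λ l → case subst (_ <_) k0 l of λ () ; rising = λ _ l → case subst (_ <_) k0 l of λ () ; onto = λ _ _ () }
    ; step   = λ μ B lt (b , z , p , t , so) → let c = μ 8 10 ; v = μ 1 c ; P = Base.positions b ; O = Base.obstacle b in
        (λ sd0 → v , refl , c , refl ,
           (λ m0 → refl , b , z , p , time-start P lt sd0 t , sort-other P lt O p m0 so) ,
           (λ m≢0 → μ 9 5 , refl , μ 35 v ∸ 1 , refl , suc (μ 9 5) , +-comm (μ 9 5) 1 ,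
                    multiple≤M 1 (≤-trans (≤-trans (s≤s (Sorted.K≤c so)) lt) (≤-reflexive (sym (+-identityʳ N)))) ,
                    refl , b , z , p , time-start P lt sd0 t , sort-add P lt O p sd0 m≢0 so)) ,
        (λ sd≢0 → v , refl , c , refl , refl , b , z , p , time-end P lt sd≢0 t , sort-end P lt O sd≢0 so)
    ; exit   = λ μ h → h
    } }

  Doubled μ = Swept μ × ∀ r → r < μ 9 5 → μ 34 (μ 9 5 + r) ≡ μ 34 r

  private
    DoubleInv : ℕ → ℕ → Memory → Set
    DoubleInv T i μ = μ 9 5 ≡ T × Swept μ × ∀ r → r < i → μ 34 (μ 9 5 + r) ≡ μ 34 r

    sort-beyond : ∀ {c K k V ord j x} → K ≤ j → x < k → Sorted c K k V ord → Sorted c K k V (upd ord j x)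
    sort-beyond {c} {K} {k} {V} {ord} {j} {x} K≤j x< so = record { K≤c = K≤c ; ord< = upd< ord j x x< ord<
      ; swept = λ l → subst (λ y → s (V y) < c) (same l) (swept l) ; rising = λ l l′ → subst₂ (λ y z → s (V y) < s (V z)) (same (<-trans l l′)) (same l′) (rising l l′)
      ; onto = λ i i< lt → let (r , r< , q) = onto i i< lt in r , r< , trans (sym (same r<)) q }
      where
      open Sorted so
      same : ∀ {r} → r < K → ord r ≡ upd ord j x r
      same l = sym (upd-other ord x (>⇒≢ (<-≤-trans l K≤j)))

    repeat-next : ∀ {K ord i} → i < K → (∀ r → r < i → ord (K + r) ≡ ord r) → ∀ r → r < suc i → upd ord (K + i) (ord i) (K + r) ≡ upd ord (K + i) (ord i) r
    repeat-next {K} {ord} {i} i< h = below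
        (λ r r< → trans (upd-other ord (ord i) (>⇒≢ (+-monoʳ-< K r<))) (trans (h r r<) (sym (upd-other ord (ord i) (>⇒≢ (<-≤-trans (<-trans r< i<) (m≤m+n K i)))))))
        (trans (upd-same ord (K + i) (ord i)) (sym (upd-other ord (ord i) (>⇒≢ (<-≤-trans i< (m≤m+n K i))))))

  repeat-triple : ⟨ Swept ⟩ repeat ⟨ Doubled ⟩
  repeat-triple = loops 10 (9 [ lit 5 ]) _ λ { μ₀ h → record
    { times  = μ₀ 9 5
    ; Inv    = DoubleInv (μ₀ 9 5)
    ; times≤ = λ B → B 9 5
    ; fixed  = λ _ _ (e , _) → e
    ; base   = refl , h , λ _ ()
    ; step   = λ { μ B lt (e , (b , z , p , t , so) , d) → let i = μ 8 10 ; i< = subst (i <_) (sym e) lt in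
        μ 9 5 + i , refl , multiple≤M 4 (≤-trans (≤-trans (+-monoʳ-≤ (μ 9 5) (<⇒≤ i<)) (m≤m+n _ _)) (four (Sorted.K≤c so))) , μ 34 i , refl , refl ,
        e , (b , z , p , t , sort-beyond (m≤m+n _ _) (Sorted.ord< so _) so) , repeat-next i< d }
    ; exit   = λ μ (e , h , d) → h , subst (λ i → ∀ r → r < i → μ 34 (μ 9 5 + r) ≡ μ 34 r) (sym e) d
    } }

  Seats : (i : ℕ) (F SP ord X : ℕ → ℕ) → Set
  Seats i F SP ord X = (∀ x → X x < order) × ∀ r → r < i → X (r + r) ≡ F (ord r) × X (suc (r + r)) ≡ SP (ord r)

  private
    Filling : ℕ → Memory → Set
    Filling i μ = Bs μ × Tagged (μ 9 0) (μ 9 0) (μ 10) (μ 13) (μ 30) (μ 35) × Timing N (μ 31) (μ 32) × Sorted N (μ 9 5) (μ 9 0) (μ 10) (μ 34) ×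
                  (∀ r → r < μ 9 5 → μ 34 (μ 9 5 + r) ≡ μ 34 r) × μ 9 6 ≡ μ 9 5 + μ 9 5 × Seats i (μ 12) (μ 30) (μ 34) (μ 33)

    FillInv : ℕ → ℕ → Memory → Set
    FillInv T i μ = μ 9 6 ≡ T × Filling i μ

    seat-next : ∀ {i} F SP ord {X} → F (ord i) < order → SP (ord i) < order → Seats i F SP ord X →
                Seats (suc i) F SP ord (upd (upd X (i + i) (F (ord i))) (suc (i + i)) (SP (ord i)))
    seat-next {i} F SP ord {X} f< sp< (X< , seat) = upd< (upd X (i + i) (F (ord i))) (suc (i + i)) (SP (ord i)) sp< (upd< X (i + i) (F (ord i)) f< X<) ,
      below (λ r r< → let (p , q) = seat r r< ; l = +-mono-< r< r< ; l′ = ≤-trans (s≤s (≤-reflexive (sym (+-suc r r)))) (+-mono-≤ r< r<) in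
               trans (upd-other (upd X (i + i) (F (ord i))) (SP (ord i)) (>⇒≢ (m<n⇒m<1+n l))) (trans (upd-other X (F (ord i)) (>⇒≢ l)) p) ,
               trans (upd-other (upd X (i + i) (F (ord i))) (SP (ord i)) (>⇒≢ (s≤s l))) (trans (upd-other X (F (ord i)) (>⇒≢ l′)) q))
            (trans (upd-other (upd X (i + i) (F (ord i))) (SP (ord i)) 1+n≢n) (upd-same X (i + i) (F (ord i))) , upd-same (upd X (i + i) (F (ord i))) (suc (i + i)) (SP (ord i)))

    front : ∀ μ → Filling (μ 9 6) μ → μ 9 7 ≡ μ 9 6 + μ 9 6 → Fr μ
    front μ (b , p , t , so , d , K₂≡ , X< , seat) L≡ = record
      { obstacle = obstacle ; n≡ = n≡ ; original = original ; only = only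
      ; timed = λ v v< → Timing.started t v v< (s< v<) , Timing.ended t v v< (e< v<)
      ; ranking = record { ord< = Sorted.ord< so ; rising = Sorted.rising so ; onto = λ i i< → Sorted.onto so i i< (s< (Obs.V< obstacle i i<)) ; again = d }
      ; K≤N = Sorted.K≤c so ; K₂≡ = K₂≡ ; L≡ = L≡ ; X< = X<
      ; X-first = λ r r< → proj₁ (seat r r<)
      ; X-second = λ r j r< j< q → trans (proj₂ (seat r r<)) (trans (cong (μ 30) (sym q)) (Tagged.prev p j j<)) }
      where open Base b

  fill-triple : ⟨ Doubled ⟩ fill ⟨ Fr ⟩
  fill-triple = straight {Q = Filling 0} _ (λ { μ B ((b , z , p , t , so) , d) → μ 9 5 + μ 9 5 , refl ,
        multiple≤M 4 (≤-trans (m≤m+n _ _) (four (Sorted.K≤c so))) , b , p , t , so , d , refl ,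
        (λ x → ≤-<-trans (≤-reflexive (z x)) (order>0 (Base.obstacle b))) , λ _ () }) ▹
    loops {Q = λ μ → Filling (μ 9 6) μ} 10 (9 [ lit 6 ]) _ (λ μ₀ h → record
      { times  = μ₀ 9 6
      ; Inv    = FillInv (μ₀ 9 6)
      ; times≤ = λ B → B 9 6
      ; fixed  = λ _ _ (e , _) → e
      ; base   = refl , h
      ; step   = λ { μ B lt (e , b , p , t , so , d , k₂ , st) → let i = μ 8 10 ; i< = subst (i <_) (trans (sym e) k₂) lt
                                                                     le = ≤-trans (s≤s (≤-reflexive (sym (+-suc i i)))) (+-mono-≤ i< i<)
                                                                     le′ = multiple≤M 4 (≤-trans (≤-trans (n≤1+n _) le) (four (Sorted.K≤c so))) in
          i + i , refl , ≤-trans (n≤1+n _) le′ , μ 12 (μ 34 i) , refl , suc (i + i) , +-comm (i + i) 1 , le′ , μ 30 (μ 34 i) , refl ,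
          refl , e , b , p , t , so , d , k₂ , seat-next (μ 12) (μ 30) (μ 34) (NearlyComplete.F< A (Base.obstacle b) (Sorted.ord< so i)) (Tagged.SP< p _) st }
      ; exit   = λ { μ (e , b , p , t , so , d , k₂ , st) → b , p , t , so , d , k₂ , subst (λ i → Seats i (μ 12) (μ 30) (μ 34) (μ 33)) (sym e) st }
      }) ▹
    straight _ λ { μ B (b , p , t , so , d , k₂ , st) → μ 9 6 + μ 9 6 , refl ,
      multiple≤M 4 (≤-trans (≤-reflexive (cong (λ a → a + a) k₂)) (four (Sorted.K≤c so))) , front (μ [ 9 , 7 ↦ μ 9 6 + μ 9 6 ]) (b , p , t , so , d , k₂ , st) refl }

  sort-arcs : Program
  sort-arcs = marking ⍮ sweep ⍮ repeat ⍮ fill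

  sort-arcs-triple : ⟨ Started ⟩ sort-arcs ⟨ Fr ⟩
  sort-arcs-triple = marking-triple ▹ sweep-triple ▹ repeat-triple ▹ fill-triple

-- The whole program on a circular-arc model

module ArcAssembly {Γ : Graphᴺ} (A : Arcs Γ) (Wt : ℕ → Set) (M : ℕ) (64≤M : 64 ≤ M) (W : ℕ) (M≤W : M ≤ W) (room : 128 * Arcs.N A ≤ M)
  (N≡ : Arcs.N A ≡ Graphᴺ.order Γ + Graphᴺ.order Γ) where
  open Core Γ Wt M 64≤M W M≤W
  open Obstacles Γ
  open TreeSoundness Γ
  open Listing₂ A Wt M 64≤M W M≤W room
  open Sweeping A Wt M 64≤M W M≤W room N≡ using (Started; sort-arcs; sort-arcs-triple)
  open Assembly Γ Wt M 64≤M W M≤W using (core; core-triple)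
  open Trees Γ Wt M 64≤M W M≤W using (Out)
  open SecondPassing Γ Wt M 64≤M W M≤W using (Result)
  open NotCircularArc A using (not-circular-arc)
  module NoEdges = Trees Γ (λ _ → ⊥) M 64≤M W M≤W

  octahedron-tree : Tree
  octahedron-tree = essential₃ (0 ∷ 1 ∷ 2 ∷ []) (2 ∷ 2 ∷ 2 ∷ []) (3 ∷ 4 ∷ 5 ∷ []) (4 ∷ 5 ∷ 3 ∷ [])

  octahedron-facts : Facts
  octahedron-facts = (0 , 1 , adj) ∷ (0 , 2 , adj) ∷ (1 , 2 , adj) ∷ (3 , 0 , far) ∷ (4 , 1 , far) ∷ (5 , 2 , far) ∷
    (3 , 4 , adj) ∷ (3 , 5 , adj) ∷ (4 , 5 , adj) ∷ (3 , 1 , adj) ∷ (3 , 2 , adj) ∷ (4 , 0 , adj) ∷ (4 , 2 , adj) ∷ (5 , 0 , adj) ∷ (5 , 1 , adj) ∷ []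

  return-octahedron arc-program : Program
  return-octahedron = (8 [ lit 10 ]≔ (slot 38 ⊖ lit 1) ⍮ name-all ⍮ 9 [ lit 1 ]≔ lit 0 ⍮ 29 [ lit 0 ]≔ lit 0) ⍮ NoEdges.tree-program octahedron-tree
  arc-program = sort-arcs ⍮ seek octahedron-pairs ⍮ cond (slot 38 ≈ lit 0) (pairs-within 16 ⍮ core) return-octahedron

  private
    R : Memory → Set
    R μ = E (μ 25 0) (μ 25 1)

    joined : ∀ {k V Z F S} → Obs k V Z F S → ∀ {a b} → a < k → b < k → E (F a) (V b) → E (V a) (V b)
    joined O {a} {b} a< b< q = Obs.clique O a b a< b< λ { refl → proj₁ (NearlyComplete.F-far A O a<) q }

    facts : ∀ {k V Z F S} → Obs k V Z F S → ∀ {a b c} → a < k → b < k → c < k → Ranks.Octahedron A k V F a b c →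
            ∀ {v} → v 0 ≡ V a → v 1 ≡ V b → v 2 ≡ V c → v 3 ≡ F a → v 4 ≡ F b → v 5 ≡ F c → All (Holdsᶠ v) octahedron-facts
    facts {k} {V} {Z} {F} O {a} {b} {c} a< b< c< (Ranks.octahedron p₁ p₂ p₃ p₄ p₅ p₆ p₇ p₈ p₉) v₀ v₁ v₂ v₃ v₄ v₅ =
      at v₀ v₁ (joined O a< b< p₄) ∷ at v₀ v₂ (joined O a< c< p₅) ∷ at v₁ v₂ (joined O b< c< p₇) ∷
      apart v₃ v₀ a< ∷ apart v₄ v₁ b< ∷ apart v₅ v₂ c< ∷ at v₃ v₄ p₁ ∷ at v₃ v₅ p₂ ∷ at v₄ v₅ p₃ ∷
      at v₃ v₁ p₄ ∷ at v₃ v₂ p₅ ∷ at v₄ v₀ p₆ ∷ at v₄ v₂ p₇ ∷ at v₅ v₀ p₈ ∷ at v₅ v₁ p₉ ∷ []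
      where
      at : ∀ {x y x′ y′} → x ≡ x′ → y ≡ y′ → E x′ y′ → E x y
      at refl refl q = q
      apart : ∀ {x y i} → x ≡ F i → y ≡ V i → i < k → ¬ E x y × x ≢ y
      apart refl refl i< = NearlyComplete.F-far A O i<

  -- A single leaf asks no question, so it can be run with an empty list of edges and an empty `Wt`.
  -- The pair of names 0 and 1 to be left nonadjacent is chosen to be an edge, recorded by `R`, so
  -- the undecided outcome is contradictory.
  return-octahedron-triple : ⟨ (λ μ → Sought μ × μ 8 38 ≢ 0) ⟩ return-octahedron ⟨ Result ⟩
  return-octahedron-triple = straight {Q = NoEdges.Asked 6 6 ((0 , 1) ∷ []) R (λ _ _ _ r → r) octahedron-facts} _ asked ▹
    weaken (λ _ h → h) answered (NoEdges.tree-triple 6 6 ((0 , 1) ∷ []) R (λ _ _ _ r → r) octahedron-tree octahedron-facts tt)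
    where
    asked : ∀ μ → Bounded μ → Sought μ × μ 8 38 ≢ 0 → wp (8 [ lit 10 ]≔ (slot 38 ⊖ lit 1) ⍮ name-all ⍮ 9 [ lit 1 ]≔ lit 0 ⍮ 29 [ lit 0 ]≔ lit 0)
              (NoEdges.Asked 6 6 ((0 , 1) ∷ []) R (λ _ _ _ r → r) octahedron-facts) μ
    asked μ B ((fr , inj₁ (z , _)) , nz) = ⊥-elim (nz z)
    asked μ B ((fr , inj₂ (r , found , oct)) , _) = let V = μ 10 ; F = μ 12 ; ord = μ 34 in
        r , cong (_∸ 1) found , V (ord r) , refl , V (ord (2 + r)) , refl , V (ord (4 + r)) , refl , F (ord r) , refl , F (ord (2 + r)) , refl , F (ord (4 + r)) , refl ,
        joined O (ord< r) (ord< (2 + r)) (Ranks.Octahedron.fvᵃᵇ oct) , refl , record { sound = λ _ () ; complete = λ () } ,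
        facts O (ord< r) (ord< (2 + r)) (ord< (4 + r)) oct refl refl refl refl refl refl , λ a le lt → ⊥-elim (<⇒≱ lt le)
      where
      O = Front.obstacle fr
      ord< = Ranks.Ranking.ord< (Front.ranking fr)
    answered : ∀ μ → _ → Result μ
    answered μ (inj₁ (_ , inj₁ r)) = r
    answered μ (inj₁ (_ , inj₂ (F , _ , _ , f))) = ⊥-elim (not-circular-arc F (μ 2) f)
    answered μ (inj₂ (_ , r , n , _)) = ⊥-elim (n r)

  arc-program-triple : ⟨ Started ⟩ arc-program ⟨ Result ⟩
  arc-program-triple = sort-arcs-triple ▹ seek-octahedron-triple ▹ branch (slot 38 ≈ lit 0)
    (weaken none (λ _ h → h) (pairs-within-triple 16 ≤-refl) ▹ weaken all-listed essential core-triple)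
    return-octahedron-triple
    where
    none : ∀ μ → Sought μ × μ 8 38 ≡ 0 → FN μ
    none μ ((fr , inj₁ (_ , n)) , _) = fr , n
    none μ ((fr , inj₂ (r , f , _)) , z) = case trans (sym z) f of λ ()
    essential : ∀ μ → Out μ → Result μ
    essential μ (inj₁ r) = r
    essential μ (inj₂ (F , _ , _ , f)) = ⊥-elim (not-circular-arc F (μ 2) f)

-- The programs do not depend on the graph and the bounds with which their
-- parts are parameterised: they are taken at an empty graph.

module ListProgram (Γ : Graphᴺ) (Wt : ℕ → Set) (M : ℕ) (64≤M : 64 ≤ M) (W : ℕ) (M≤W : M ≤ W) where

  program : Program
  program = Loading.take-input Γ Wt M 64≤M W M≤W ⍮ Loading.list-edges Γ Wt M 64≤M W M≤W ⍮ Assembly.core Γ Wt M 64≤M W M≤W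

empty : Graphᴺ
empty = record { order = 0 ; E = λ _ _ → ⊥ ; E? = λ _ _ → no λ () ; E-sym = λ { {_} {_} () } ; E-irr = λ { {_} () } ; E< = λ { {_} {_} () } }

no-arcs : Arcs empty
no-arcs = record { N = 0 ; s = id ; e = id ; s< = λ { {_} () } ; e< = λ { {_} () } ; s≢e = λ { {_} () }
                 ; meets = λ { {_} {_} () } ; adjacent = λ { {_} {_} () } }

list-program take-input arc-program : Program
list-program = ListProgram.program empty (λ _ → ⊥) 64 ≤-refl 64 ≤-refl
take-input   = Loading.take-input empty (λ _ → ⊥) 64 ≤-refl 64 ≤-refl
arc-program  = ArcAssembly.arc-program no-arcs (λ _ → ⊥) 64 ≤-refl 64 ≤-refl z≤n refl

list-program≡ : ∀ Γ Wt M 64≤M W M≤W → ListProgram.program Γ Wt M 64≤M W M≤W ≡ list-program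
list-program≡ Γ Wt M 64≤M W M≤W = refl

take-input≡ : ∀ Γ Wt M 64≤M W M≤W → Loading.take-input Γ Wt M 64≤M W M≤W ≡ take-input
take-input≡ Γ Wt M 64≤M W M≤W = refl

arc-program≡ : ∀ {Γ} (A : Arcs Γ) Wt M 64≤M W M≤W room N≡ → ArcAssembly.arc-program A Wt M 64≤M W M≤W room N≡ ≡ arc-program
arc-program≡ A Wt M 64≤M W M≤W room N≡ = refl

abstract

  -- The successor makes one factor large enough for the words as well as for the steps. Being
  -- abstract, the factor keeps the price of the concrete programs from being unfolded.
  factor : Program → ℕ → ℕ
  factor p c = suc (price p) * c

  steps≤ : ∀ p c {M x} → suc M ≤ c * x → price p * suc M ≤ factor p c * x
  steps≤ p c {M} {x} enough = ≤-trans (≤-trans (*-monoʳ-≤ (price p) enough) (m≤n+m _ (c * x))) (≤-reflexive (sym (*-assoc (suc (price p)) c x)))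

  words≤ : ∀ p c {M x} → suc M ≤ c * x → M ≤ factor p c * x
  words≤ p c {M} {x} enough = ≤-trans (≤-trans (n≤1+n M) enough) (≤-trans (m≤m+n _ (price p * (c * x))) (≤-reflexive (sym (*-assoc (suc (price p)) c x))))

module _ {W M : ℕ} {input : List (List ℕ)} {Post : Memory → Set} where

  computes : ∀ {p p₀ Q} → p ≡ p₀ → Ok W Q p (price p * suc M) (load input) → price p₀ * suc M ≤ W → (∀ μ → Q μ → Post μ) → Computes p₀ input W Post
  computes refl (ok run t≤ post) le f = _ , _ , run , ≤-trans t≤ le , f _ post

  -- The triple for the second program may depend on the memory left by the first one: for arcs,
  -- `Wt` is the set of witnesses stored there.
  computes-after : ∀ {p p₀ q₀ Q} → p ≡ p₀ → Ok W Q p (price p * suc M) (load input) →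
                   (∀ μ → Q μ → Σ Program λ q → q ≡ q₀ × Ok W Post q (price q * suc M) μ) → price (p₀ ⍮ q₀) * suc M ≤ W → Computes (p₀ ⍮ q₀) input W Post
  computes-after {p} {q₀ = q₀} refl (ok run t≤ post) after le with after _ post
  ... | _ , refl , ok run′ t≤′ post′ = _ , _ , seq run run′ ,
        ≤-trans (+-mono-≤ t≤ t≤′) (≤-trans (≤-reflexive (sym (*-distribʳ-+ (suc M) (price p) (price q₀)))) le) , post′

-- Circular-arc models on the natural numbers

module ArcModels {n : ℕ} (G : Graph n) (𝓜 : ArcModel n) (model : 𝓜 IsModelOf G) where
  open ArcModel 𝓜
  open Graphᴺ (graphᴺ G) using (E)
  open Translation G using (to-E)
  open Inverse extreme using (to; from; strictlyInverseˡ; strictlyInverseʳ)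

  private
    at-side : Side → ℕ → ℕ
    at-side σ x with x <? n
    ... | yes p = toℕ (position (fromℕ< p) σ)
    ... | no _  = 0

    at-side≡ : ∀ σ v → at-side σ (toℕ v) ≡ toℕ (position v σ)
    at-side≡ σ v with toℕ v <? n
    ... | yes p = cong (λ v → toℕ (position v σ)) (fromℕ<-toℕ v p)
    ... | no n≮ = ⊥-elim (n≮ (toℕ<n v))

    vertex-at : ∀ (P : ℕ → Set) → (∀ v → P (toℕ v)) → ∀ {x} → x < n → P x
    vertex-at P h x< = subst P (toℕ-fromℕ< x<) (h (fromℕ< x<))

    position-at : ∀ (P : ℕ → Set) → (∀ c → P (toℕ c)) → ∀ {c} → c < 2 * n → P c
    position-at P h c< = subst P (toℕ-fromℕ< c<) (h (fromℕ< c<))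

    to-In : ∀ {v p} → Arc v p → In (at-side start (toℕ v)) (at-side end (toℕ v)) (toℕ p)
    to-In {v} {p} = subst₂ (λ a b → In a b (toℕ p)) (sym (at-side≡ start v)) (sym (at-side≡ end v))

    from-In : ∀ {v p} → In (at-side start (toℕ v)) (at-side end (toℕ v)) (toℕ p) → Arc v p
    from-In {v} {p} = subst₂ (λ a b → In a b (toℕ p)) (at-side≡ start v) (at-side≡ end v)

  arcs : Arcs (graphᴺ G)
  arcs = record
    { N = 2 * n ; s = at-side start ; e = at-side end
    ; s< = vertex-at (λ x → at-side start x < 2 * n) λ v → subst (_< 2 * n) (sym (at-side≡ start v)) (toℕ<n _)
    ; e< = vertex-at (λ x → at-side end x < 2 * n) λ v → subst (_< 2 * n) (sym (at-side≡ end v)) (toℕ<n _)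
    ; s≢e = vertex-at (λ x → at-side start x ≢ at-side end x) λ v q → case
        trans (sym (strictlyInverseˡ (v , start))) (trans (cong to (toℕ-injective (trans (sym (at-side≡ start v)) (trans q (at-side≡ end v))))) (strictlyInverseˡ (v , end))) of λ ()
    ; meets = λ { (u , v , refl , refl , a) → let (_ , p , pu , pv) = Equivalence.to (model u v) a in toℕ p , toℕ<n p , to-In pu , to-In pv }
    ; adjacent = λ {x} {y} x< y< → vertex-at
        (λ x → x ≢ y → (Σ ℕ λ p → p < 2 * n × In (at-side start x) (at-side end x) p × In (at-side start y) (at-side end y) p) → E x y)
        (λ u → vertex-at (λ y → toℕ u ≢ y → (Σ ℕ λ p → p < 2 * n × In (at-side start (toℕ u)) (at-side end (toℕ u)) p × In (at-side start y) (at-side end y) p) → E (toℕ u) y)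
          (λ v ne (p , p< , pu , pv) → to-E (Equivalence.from (model u v) ((λ q → ne (cong toℕ q)) , fromℕ< p< ,
             from-In (subst (In _ _) (sym (toℕ-fromℕ< p<)) pu) , from-In (subst (In _ _) (sym (toℕ-fromℕ< p<)) pv)))) y<) x<
    }

  private
    vx sd : ℕ → ℕ
    vx c = tabulate (toℕ ∘ proj₁ ∘ to) at c
    sd c = tabulate (encodeSide ∘ proj₂ ∘ to) at c

    vx≡ : ∀ c → vx (toℕ c) ≡ toℕ (proj₁ (to c))
    vx≡ = at-tabulate (toℕ ∘ proj₁ ∘ to)

    sd≡ : ∀ c → sd (toℕ c) ≡ encodeSide (proj₂ (to c))
    sd≡ = at-tabulate (encodeSide ∘ proj₂ ∘ to)

    vx-side : ∀ v σ → vx (at-side σ (toℕ v)) ≡ toℕ v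
    vx-side v σ = trans (cong vx (at-side≡ σ v)) (trans (vx≡ (position v σ)) (cong (toℕ ∘ proj₁) (strictlyInverseˡ (v , σ))))

    sd-side : ∀ v σ → sd (at-side σ (toℕ v)) ≡ encodeSide σ
    sd-side v σ = trans (cong sd (at-side≡ σ v)) (trans (sd≡ (position v σ)) (cong (encodeSide ∘ proj₂) (strictlyInverseˡ (v , σ))))

    side-vx : ∀ c → at-side (proj₂ (to c)) (vx (toℕ c)) ≡ toℕ c
    side-vx c = trans (cong (at-side (proj₂ (to c))) (vx≡ c)) (trans (at-side≡ _ _) (cong toℕ (strictlyInverseʳ c)))

  positions : Positions arcs vx sd
  positions = record
    { at-start = vertex-at (λ x → vx (at-side start x) ≡ x × sd (at-side start x) ≡ 0) λ v → vx-side v start , sd-side v start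
    ; at-end = vertex-at (λ x → vx (at-side end x) ≡ x × sd (at-side end x) ≢ 0) λ v → vx-side v end , λ q → case trans (sym (sd-side v end)) q of λ ()
    ; start-at = position-at (λ c → sd c ≡ 0 → at-side start (vx c) ≡ c) λ c z → subst (λ σ → at-side σ (vx (toℕ c)) ≡ toℕ c) (is-start (trans (sym (sd≡ c)) z)) (side-vx c)
    ; end-at = position-at (λ c → sd c ≢ 0 → at-side end (vx c) ≡ c) λ c nz → subst (λ σ → at-side σ (vx (toℕ c)) ≡ toℕ c) (is-end (nz ∘ trans (sd≡ c))) (side-vx c)
    }
    where
    is-start : ∀ {σ} → encodeSide σ ≡ 0 → σ ≡ start
    is-start {start} _ = refl
    is-end : ∀ {σ} → encodeSide σ ≢ 0 → σ ≡ end
    is-end {start} n = ⊥-elim (n refl)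
    is-end {end} _ = refl

  vx-bounded : ∀ {M} → n ≤ M → All (_≤ M) (tabulate (toℕ ∘ proj₁ ∘ to))
  vx-bounded n≤ = AllP.tabulate⁺ λ c → ≤-trans (<⇒≤ (toℕ<n _)) n≤

  sd-bounded : ∀ {M} → 1 ≤ M → All (_≤ M) (tabulate (encodeSide ∘ proj₂ ∘ to))
  sd-bounded 1≤ = AllP.tabulate⁺ λ c → ≤-trans (side≤1 (proj₂ (to c))) 1≤
    where
    side≤1 : ∀ σ → encodeSide σ ≤ 1
    side≤1 start = z≤n
    side≤1 end = ≤-refl

-- Bounds on the words and the two computations

module _ {n : ℕ} (G : Graph n) (𝒬 : Enumeration (Fin n)) (isObstacle : IsObstacleEnumIn G 𝒬) where
  open Enumeration 𝒬 using (k)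
  open EncodedEnum G 𝒬 isObstacle

  private
    1≤n : 1 ≤ n
    1≤n = ≤-trans (≤-trans (s≤s z≤n) (IsObstacleEnumIn.k≥3 isObstacle)) k≤n

    Found : Memory → Set
    Found μ = EssentialFound G μ ⊎ InducedFound (C 4 *ᵍ) G μ ⊎ InducedFound K⟨ 2 , 3 ⟩ G μ ⊎ InducedFound domino G μ ⊎ InducedFound G₃ G μ
            ⊎ InducedFound (complement (C 6)) G μ ⊎ InducedFound (complement (C 5 +ᵍ K 2)) G μ

    found : ∀ F {μ} → InducedFound (graph-of F) G μ → Found μ
    found isC₄*    h = inj₂ (inj₁ h)
    found isK₂₃    h = inj₂ (inj₂ (inj₁ h))
    found isDomino h = inj₂ (inj₂ (inj₂ (inj₁ h)))
    found isG₃     h = inj₂ (inj₂ (inj₂ (inj₂ (inj₁ h))))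
    found isC₆ᶜ    h = inj₂ (inj₂ (inj₂ (inj₂ (inj₂ (inj₁ h)))))
    found isC₅K₂ᶜ  h = inj₂ (inj₂ (inj₂ (inj₂ (inj₂ (inj₂ h)))))

  module _ (L : AdjacencyLists G) where
    private
      module L = Adjacency G L
      size-of-input = n + ∣E G ∣
      -- Room for the literals and for the rounds of `list-edges`, where each edge is counted in
      -- both directions.
      M = 64 + (n + (∣E G ∣ + ∣E G ∣))

      enough : suc M ≤ 67 * size-of-input
      -- 67 = 65 + 2: the input has size at least 1, which absorbs 64 + 1, and twice its size covers
      -- n plus twice the number of edges.
      enough = ≤-trans (+-mono-≤ (≤-trans (m≤m*n 65 size-of-input {{>-nonZero (≤-trans 1≤n (m≤m+n n _))}}) ≤-refl)
          (≤-trans (≤-reflexive (sym (+-assoc n _ _))) (+-mono-≤ ≤-refl (m≤n+m ∣E G ∣ n))))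
        (≤-reflexive (trans (cong (65 * size-of-input +_) (cong (size-of-input +_) (sym (+-identityʳ size-of-input)))) (sym (*-distribʳ-+ size-of-input 65 2))))

      κ = factor list-program 67
      M≤bound = words≤ list-program 67 {M} {size-of-input} enough
      module P = ListProgram (graphᴺ G) (λ _ → ⊤) M (m≤m+n 64 _) (κ * size-of-input) M≤bound
      module T = Loading (graphᴺ G) (λ _ → ⊤) M (m≤m+n 64 _) (κ * size-of-input) M≤bound
      open Trees (graphᴺ G) (λ _ → ⊤) M (m≤m+n 64 _) (κ * size-of-input) M≤bound using (Out)
      module Z = Assembly (graphᴺ G) (λ _ → ⊤) M (m≤m+n 64 _) (κ * size-of-input) M≤bound
      open Core (graphᴺ G) (λ _ → ⊤) M (m≤m+n 64 _) (κ * size-of-input) M≤bound using (Bounded; ⟨_⟩_⟨_⟩; _▹_)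

      input : List (List ℕ)
      input = encodeGraph L ++ encodeEnum 𝒬

      total≤M : n + L.total ≤ M
      total≤M = ≤-trans (+-monoʳ-≤ n L.total≤) (m≤n+m _ 64)

      n≤M : n ≤ M
      n≤M = ≤-trans (m≤m+n n _) total≤M

      input-bounded : Bounded (load input)
      input-bounded = load-bounded ((n≤M ∷ []) ∷ L.offsets-bounded (tabulate (AdjacencyLists.neighbours L)) 0 (≤-trans (m≤n+m _ n) total≤M) ∷
        AllP.map⁺ (All.universal (λ v → ≤-trans (<⇒≤ (toℕ<n v)) n≤M) _) ∷ bounded n≤M (s≤s (s≤s z≤n)))

      triple : ⟨ T.Given T.Part₁ ⟩ P.program ⟨ Out ⟩
      triple = T.take-input-triple T.Part₁ ▹ T.list-edges-triple tt ▹ Z.core-triple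

    lists-computed : Computes list-program input (κ * size-of-input) Found
    lists-computed = computes {M = M} {input = input} (list-program≡ (graphᴺ G) (λ _ → ⊤) M (m≤m+n 64 _) (κ * size-of-input) M≤bound)
      (triple (load input) input-bounded (refl , obstacle , L.Row.rows (λ _ → ⊤) M (m≤m+n 64 _) (κ * size-of-input) M≤bound total≤M))
      (steps≤ list-program 67 {M} {size-of-input} enough) answer
      where
      answer : ∀ μ → Bounded μ × Out μ → Found μ
      answer μ (_ , inj₁ (z , O , es)) = inj₁ (Output.essential-found G μ z O es)
      answer μ (_ , inj₂ (F , o , len , f)) = found F {μ} (Output.forbidden-found G F μ o len f)

  module _ (𝓜 : ArcModel n) (model : 𝓜 IsModelOf G) where
    open ArcModels G 𝓜 model

    private
      -- The circle has 2 n positions, so the second summand is what `room` asks for.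
      M = 64 + 128 * (2 * n)

      -- 321 = 65 + 256, where 65 n absorbs 64 + 1.
      enough : suc M ≤ 321 * n
      enough = ≤-trans (+-mono-≤ (m≤m*n 65 n {{>-nonZero 1≤n}}) (≤-reflexive (sym (*-assoc 128 2 n)))) (≤-reflexive (sym (*-distribʳ-+ n 65 256)))

      κ = factor (take-input ⍮ arc-program) 321
      M≤bound = words≤ (take-input ⍮ arc-program) 321 {M} {n} enough
      64≤M = m≤m+n 64 (128 * (2 * n))
      room : 128 * Arcs.N arcs ≤ M
      room = m≤n+m _ 64
      N≡ : Arcs.N arcs ≡ n + n
      N≡ = cong (n +_) (+-identityʳ n)

      input : List (List ℕ)
      input = encodeModel 𝓜 ++ encodeEnum 𝒬

      n≤M : n ≤ M
      n≤M = ≤-trans (m≤m+n n _) (≤-trans (m≤m+n (2 * n) _) room)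

      module T = Loading (graphᴺ G) (λ _ → ⊤) M 64≤M (κ * n) M≤bound
      open SecondPassing (graphᴺ G) (λ _ → ⊤) M 64≤M (κ * n) M≤bound using (framed; Result)
      open Core (graphᴺ G) (λ _ → ⊤) M 64≤M (κ * n) M≤bound using (Bounded; ⟨_⟩_⟨_⟩)
      open Obstacles (graphᴺ G) using (IsW)

      input-bounded : Bounded (load input)
      input-bounded = load-bounded ((n≤M ∷ []) ∷ vx-bounded n≤M ∷ sd-bounded (s≤s z≤n) ∷ bounded n≤M (s≤s (s≤s z≤n)))

      Blank : Memory → Set
      Blank μ = (∀ i → μ 33 i ≡ 0) × (∀ i → μ 34 i ≡ 0) × (∀ i → μ 30 i ≡ 0) × (∀ i → μ 35 i ≡ 0)

      taken : ⟨ (λ μ → T.Given (λ _ → Positions arcs) μ × Blank μ) ⟩ T.take-input ⟨ (λ μ → T.Loaded (λ _ → Positions arcs) μ × Blank μ) ⟩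
      taken = framed Blank (λ μ μ′ same (a , b , c , d) → (λ i → trans (same 33 tt i) (a i)) , (λ i → trans (same 34 tt i) (b i)) ,
        (λ i → trans (same 30 tt i) (c i)) , (λ i → trans (same 35 tt i) (d i))) (T.take-input-triple (λ _ → Positions arcs))

    arcs-computed : Computes (take-input ⍮ arc-program) input (κ * n) (EssentialFound G)
    arcs-computed = computes-after {M = M} {input = input} {Post = EssentialFound G} (take-input≡ (graphᴺ G) (λ _ → ⊤) M 64≤M (κ * n) M≤bound)
        (taken (load input) input-bounded ((refl , obstacle , positions) , (λ _ → refl) , (λ _ → refl) , (λ _ → refl) , (λ _ → refl)))
        rest (steps≤ (take-input ⍮ arc-program) 321 {M} {n} enough)
      where
      essential : ∀ {p c μ} → Ok (κ * n) (λ μ → Bounded μ × Result μ) p c μ → Ok (κ * n) (EssentialFound G) p c μ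
      essential (ok {final = μ} run t≤ (_ , flag , O , es)) = ok run t≤ (Output.essential-found G μ flag O es)
      rest : ∀ μ → Bounded μ × (T.Loaded (λ _ → Positions arcs) μ × Blank μ) → Σ Program λ q → q ≡ arc-program × Ok (κ * n) (EssentialFound G) q (price q * suc M) μ
      rest μ (B , (n≡ , O , ps) , z) = _ , arc-program≡ arcs Wt M 64≤M (κ * n) M≤bound room N≡ ,
          essential (ArcAssembly.arc-program-triple arcs Wt M 64≤M (κ * n) M≤bound room N≡ μ B (record { obstacle = O ; n≡ = n≡ ; original = id ; only = id ; positions = ps } , z))
        where
        Wt : ℕ → Set
        -- With the given witnesses themselves as `Wt`, both `original` and `only` are identities.
        Wt = IsW (μ 9 0) (μ 12) (μ 13)

theorem8 :
  (∃₂ λ (p : Program) (κ : ℕ) →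
     ∀ {n} (G : Graph n) (L : AdjacencyLists G) (𝒬 : Enumeration (Fin n)) →
     IsObstacleEnumIn G 𝒬 →
     Computes p (encodeGraph L ++ encodeEnum 𝒬) (κ * (n + ∣E G ∣))
       (λ μ → EssentialFound G μ
            ⊎ InducedFound (C 4 *ᵍ) G μ
            ⊎ InducedFound K⟨ 2 , 3 ⟩ G μ
            ⊎ InducedFound domino G μ
            ⊎ InducedFound G₃ G μ
            ⊎ InducedFound (complement (C 6)) G μ
            ⊎ InducedFound (complement (C 5 +ᵍ K 2)) G μ))
  ×
  (∃₂ λ (p : Program) (κ : ℕ) →
     ∀ {n} (G : Graph n) (M : ArcModel n) → M IsModelOf G →
     (𝒬 : Enumeration (Fin n)) → IsObstacleEnumIn G 𝒬 →
     Computes p (encodeModel M ++ encodeEnum 𝒬) (κ * n)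
       (λ μ → EssentialFound G μ))
theorem8 = (list-program , factor list-program 67 , λ G L 𝒬 O → lists-computed G 𝒬 O L) ,
           (take-input ⍮ arc-program , factor (take-input ⍮ arc-program) 321 , λ G M model 𝒬 O → arcs-computed G 𝒬 O M model)
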